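{- Let $\mathbb F$ be a finite field of odd order, let $Q=Q_{a,b}$ be a quadratic quasigroup upon $\mathbb F$, and let $\mathbb K$ be the least subfield of $\mathbb F$ containing $\{a,b\}$. Then $\operatorname{Aut}(Q)=\mathrm{A\Gamma^2L}_1(\mathbb F\mid\mathbb K)$, except in the following cases: (i) If $a=b$, then $\operatorname{Aut}(Q)\cong\operatorname{AGL}_k(\mathbb K)$, where $k=[\mathbb F:\mathbb K]$; the automorphisms of $Q$ are exactly the maps $x\mapsto\sigma(x)+\mu$ with $\mu\in\mathbb F$ and $\sigma:\mathbb F\to\mathbb F$ a $\mathbb K$-linear bijection. (ii) If $b=a^\gamma$ where $\gamma^2=|\mathbb K|$, then $\operatorname{Aut}(Q)=\mathrm{A\Gamma L}^{\mathrm{tw}}_1(\mathbb F\mid\mathbb K)$. (iii) If $|\mathbb F|=7$ and $\{a,b\}=\{3,5\}$, then $\operatorname{Aut}(Q)\cong\operatorname{PSL}_2(7)$.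
   Context: $\chi$ is the quadratic character of $\mathbb F$ ($\chi(0)=0$, $1$ on nonzero squares, $-1$ on nonsquares). For $a,b\in\mathbb F$ with $\chi(a)=\chi(b)\ne0$ and $\chi(1-a)=\chi(1-b)\ne0$, $Q_{a,b}$ is $(\mathbb F,*)$ with $x*y=x+a(y-x)$ if $\chi(y-x)\ge0$ and $x*y=x+b(y-x)$ if $\chi(y-x)=-1$. $\mathrm{A\Gamma L}_1(\mathbb F)$ is the group of maps $x\mapsto\lambda\alpha(x)+\mu$ with $\lambda\in\mathbb F^*$, $\mu\in\mathbb F$, $\alpha\in\operatorname{Aut}(\mathbb F)$; $\mathrm{A\Gamma L}_1(\mathbb F\mid\mathbb K)$ is its subgroup where $\alpha\in\operatorname{Gal}(\mathbb F\mid\mathbb K)$; $\mathrm{A\Gamma^2L}_1(\mathbb F)$ is its subgroup where $\chi(\lambda)=1$; and $\mathrm{A\Gamma^2L}_1(\mathbb F\mid\mathbb K)=\mathrm{A\Gamma^2L}_1(\mathbb F)\cap\mathrm{A\Gamma L}_1(\mathbb F\mid\mathbb K)$. If $\mathbb K$ has a subfield $\mathbb L$ with $[\mathbb K:\mathbb L]=2$, the twist $\mathrm{A\Gamma L}^{\mathrm{tw}}_1(\mathbb F\mid\mathbb K)$ consists of $\mathrm{A\Gamma^2L}_1(\mathbb F\mid\mathbb K)$ together with all maps $x\mapsto\lambda\alpha(x^\gamma)+\mu$ with $\chi(\lambda)=-1$, $\alpha\in\operatorname{Gal}(\mathbb F\mid\mathbb K)$, $\mu\in\mathbb F$, and $\gamma=|\mathbb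 L|$. -}

module Defs where

open import Level using (Level) renaming (suc to lsuc; zero to lzero)
open import Data.Nat as ℕ using (ℕ; zero; suc)
open import Data.Nat.DivMod using (_mod_)
open import Data.Fin as Fin using (Fin; toℕ)
import Data.Fin.Properties as FinP
open import Data.Integer using (ℤ; +_; -[1+_])
open import Data.Product using (Σ; ∃; _×_; _,_; proj₁; proj₂; Σ-syntax; ∃-syntax)
open import Data.Sum using (_⊎_)
open import Data.List using (List; length)
open import Data.List.Membership.Propositional using (_∈_)
open import Data.List.Relation.Unary.Unique.Propositional using (Unique)
open import Relation.Nullary using (¬_; Dec; yes; no)
import Relation.Nullary.Decidable as Dec
open import Relation.Binary.PropositionalEquality
open import Function using (_∘_; _↔_; Inverse; _⇔_)
open import Function.Definitions using (Bijective)
open import Algebra.Structures using (IsCommutativeRing)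

record FiniteField : Set₁ where
  infixl 6 _+_ _-_
  infixl 7 _*_
  field
    Carrier : Set
    _+_ _*_ : Carrier → Carrier → Carrier
    -_ : Carrier → Carrier
    0# 1# : Carrier
    isCommutativeRing : IsCommutativeRing _≡_ _+_ _*_ -_ 0# 1#
    0≢1 : ¬ (0# ≡ 1#)
    inverse : ∀ x → ¬ (x ≡ 0#) → ∃[ y ] (x * y ≡ 1#)
    size : ℕ
    enumeration : Carrier ↔ Fin size

  _-_ : Carrier → Carrier → Carrier
  x - y = x + (- y)

module _ (F : FiniteField) where
  open FiniteField F
  open Inverse enumeration using (to; from; inverseʳ)

  _≟F_ : (x y : Carrier) → Dec (x ≡ y)
  x ≟F y with to x Fin.≟ to y
  ... | yes e = yes (trans (sym (inverseʳ refl)) (trans (cong from e) (inverseʳ refl)))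
  ... | no ne = no (λ e → ne (cong to e))

  IsSquare : Carrier → Set
  IsSquare x = ∃[ y ] (y * y ≡ x)

  isSquare? : ∀ x → Dec (IsSquare x)
  isSquare? x = Dec.map′ (λ { (i , e) → from i , e })
                         (λ { (y , e) → to y , trans (cong₂ _*_ (inverseʳ refl) (inverseʳ refl)) e })
                         (FinP.any? (λ i → (from i * from i) ≟F x))

  χ : Carrier → ℤ
  χ x with x ≟F 0#
  ... | yes _ = + 0
  ... | no _ with isSquare? x
  ...   | yes _ = + 1
  ...   | no _ = -[1+ 0 ]

  _^F_ : Carrier → ℕ → Carrier
  x ^F zero = 1#
  x ^F suc n = x * (x ^F n)

  ι : ℕ → Carrier
  ι zero = 0#
  ι (suc n) = 1# + ι n

  pick : ℤ → Carrier → Carrier → Carrier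
  pick (+ _) a b = a
  pick -[1+ zero ] a b = b
  pick -[1+ suc _ ] a b = a

  qop : (a b : Carrier) → Carrier → Carrier → Carrier
  qop a b x y = x + pick (χ (y - x)) a b * (y - x)

  -- hypotheses on (a,b) making Q_{a,b} a quadratic quasigroup
  QuadraticParams : Carrier → Carrier → Set
  QuadraticParams a b =
    χ a ≡ χ b × ¬ (χ a ≡ + 0) × χ (1# - a) ≡ χ (1# - b) × ¬ (χ (1# - a) ≡ + 0)

  IsAut : (a b : Carrier) → (Carrier → Carrier) → Set
  IsAut a b f = Bijective _≡_ _≡_ f × (∀ x y → f (qop a b x y) ≡ qop a b (f x) (f y))

  IsFieldAut : (Carrier → Carrier) → Set
  IsFieldAut α = Bijective _≡_ _≡_ α
               × (∀ x y → α (x + y) ≡ α x + α y)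
               × (∀ x y → α (x * y) ≡ α x * α y)
               × α 1# ≡ 1#

  IsSubfield : (Carrier → Set) → Set
  IsSubfield S = S 0# × S 1#
               × (∀ x y → S x → S y → S (x + y))
               × (∀ x → S x → S (- x))
               × (∀ x y → S x → S y → S (x * y))
               × (∀ x y → S x → x * y ≡ 1# → S y)

  InK : (a b : Carrier) → Carrier → Set₁
  InK a b x = (S : Carrier → Set) → IsSubfield S → S a → S b → S x

  InGal : (a b : Carrier) → (Carrier → Carrier) → Set₁
  InGal a b α = IsFieldAut α × (∀ x → InK a b x → α x ≡ x)

  HasCard : ∀ {ℓ} → (Carrier → Set ℓ) → ℕ → Set ℓ
  HasCard P n = Σ (List Carrier) λ xs → Unique xs × length xs ≡ n
              × (∀ x → (P x → x ∈ xs) × (x ∈ xs → P x))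

  InAΓ²L : (a b : Carrier) → (Carrier → Carrier) → Set₁
  InAΓ²L a b f = Σ Carrier λ l → Σ Carrier λ μ → Σ (Carrier → Carrier) λ α →
    χ l ≡ + 1 × InGal a b α × (∀ x → f x ≡ l * α x + μ)

  -- membership of f in AΓL^tw_1(F | K), where γ = |L|, [K : L] = 2
  InTwist : (a b : Carrier) → ℕ → (Carrier → Carrier) → Set₁
  InTwist a b γ f = InAΓ²L a b f
    ⊎ (Σ Carrier λ l → Σ Carrier λ μ → Σ (Carrier → Carrier) λ α →
        χ l ≡ -[1+ 0 ] × InGal a b α × (∀ x → f x ≡ l * α (x ^F γ) + μ))

  IsKLinear : (a b : Carrier) → (Carrier → Carrier) → Set₁
  IsKLinear a b σ = (∀ x y → σ (x + y) ≡ σ x + σ y)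
                  × (∀ c x → InK a b c → σ (c * x) ≡ c * σ x)

  InAffK : (a b : Carrier) → (Carrier → Carrier) → Set₁
  InAffK a b f = Σ (Carrier → Carrier) λ σ → Σ Carrier λ μ →
    IsKLinear a b σ × Bijective _≡_ _≡_ σ × (∀ x → f x ≡ σ x + μ)

  TwistExponent : (a b : Carrier) → ℕ → Set₁
  TwistExponent a b γ = Σ ℕ λ n → HasCard (InK a b) n × γ ℕ.* γ ≡ n × b ≡ a ^F γ

  Exceptional7 : (a b : Carrier) → Set
  Exceptional7 a b = size ≡ 7 × ((a ≡ ι 3 × b ≡ ι 5) ⊎ (a ≡ ι 5 × b ≡ ι 3))

-- PSL_2(7), modelled as SL_2(ℤ/7) modulo ±I (a setoid)

F7 : Set
F7 = Fin 7

infixl 6 _⊕_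
infixl 7 _⊗_
_⊕_ _⊗_ : F7 → F7 → F7
x ⊕ y = (toℕ x ℕ.+ toℕ y) mod 7
x ⊗ y = (toℕ x ℕ.* toℕ y) mod 7

⊖_ : F7 → F7
⊖ x = (7 ℕ.∸ toℕ x) mod 7

record Mat2 : Set where
  constructor mat
  field m11 m12 m21 m22 : F7
open Mat2

_·_ : Mat2 → Mat2 → Mat2
A · B = mat (m11 A ⊗ m11 B ⊕ m12 A ⊗ m21 B) (m11 A ⊗ m12 B ⊕ m12 A ⊗ m22 B)
            (m21 A ⊗ m11 B ⊕ m22 A ⊗ m21 B) (m21 A ⊗ m12 B ⊕ m22 A ⊗ m22 B)

negM : Mat2 → Mat2
negM A = mat (⊖ m11 A) (⊖ m12 A) (⊖ m21 A) (⊖ m22 A)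

det : Mat2 → F7
det A = m11 A ⊗ m22 A ⊕ ⊖ (m12 A ⊗ m21 A)

SL₂7 : Set
SL₂7 = Σ Mat2 λ A → det A ≡ Fin.suc Fin.zero

_∼PSL_ : Mat2 → Mat2 → Set
A ∼PSL B = A ≡ B ⊎ A ≡ negM B

module _ (F : FiniteField) where
  open FiniteField F

  AutQ : Carrier → Carrier → Set
  AutQ a b = Σ (Carrier → Carrier) (IsAut F a b)

  _≐_ : (Carrier → Carrier) → (Carrier → Carrier) → Set
  f ≐ g = ∀ x → f x ≡ g x

  AutIsoPSL₂7 : Carrier → Carrier → Set
  AutIsoPSL₂7 a b = Σ (AutQ a b → SL₂7) λ φ →
      (∀ f g → proj₁ f ≐ proj₁ g → proj₁ (φ f) ∼PSL proj₁ (φ g))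
    × (∀ f g → proj₁ (φ f) ∼PSL proj₁ (φ g) → proj₁ f ≐ proj₁ g)
    × ((B : SL₂7) → Σ (AutQ a b) λ f → proj₁ (φ f) ∼PSL proj₁ B)
    × (∀ f g h → proj₁ h ≐ (proj₁ g ∘ proj₁ f) →
         proj₁ (φ h) ∼PSL (proj₁ (φ g) · proj₁ (φ f)))

-- The maps x ↦ l α(x) + μ are automorphisms when l is a square and the field automorphism α fixes a and b, and also when l is
-- a nonsquare and α interchanges them. Conversely, an automorphism f that preserves the quadratic character of differences has
-- this form by Carlitz's theorem. If f does not preserve it, then Aut(Q) is doubly transitive, because the affine maps with
-- square slope have only two orbits on pairs of points. Call the set of points fixed by the stabiliser of x and y the line
-- through x and y. If the line through 0 and 1 contains 2, then f is affine over the prime field, and then f preserves or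
-- reverses the character; reversal means that α interchanges a and b, so that α is the involution of K over its fixed field L,
-- which on K is x ↦ x^|L|. Otherwise ab = a + b = 1 with a and −1 nonsquares, and Q is a Netto triple system. For 7 ≠ 0 in F it
-- is not doubly transitive: a 2-subgroup maximal among those fixing more than three points would act on its fixed points in a
-- way that forces a Pasch configuration which the system does not contain. For 7 = 0 the Pasch configurations through x and y
-- single out the F₇-line through x and y, so f is affine again, unless |F| = 7 and Q is the Fano plane.
module Submission where

open import Defs
open import Algebra.Bundles using (CommutativeRing)
import Algebra.Properties.CommutativeMonoid.Sum as MonoidSum
import Algebra.Solver.Ring as RingSolver
open import Algebra.Solver.Ring.AlmostCommutativeRing using (AlmostCommutativeRing; fromCommutativeRing; _-Raw-AlmostCommutative⟶_)
open import Data.Bool using (Bool; true; false; _∧_; _xor_; if_then_else_; not; _∨_; T)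
import Data.Bool.Properties as Boolₚ
open import Data.Empty using (⊥; ⊥-elim)
open import Data.Fin as Fin using (Fin; toℕ; zero; suc; finToFun; funToFin)
open import Data.Fin.Patterns using (0F; 1F; 2F; 3F; 4F; 5F; 6F)
open import Data.Fin.Permutation using (Permutation; permutation)
import Data.Fin.Properties as Finₚ
open import Data.Fin.Subset as Subset using (Subset; ∣_∣)
import Data.Fin.Subset.Properties as Subsetₚ
open import Data.Integer as ℤ using (ℤ; +_; -[1+_])
import Data.Integer.Properties as ℤₚ
open import Data.List using (List; []; _∷_; map; length; filter; _++_; allFin; cartesianProduct)
open import Data.List.Membership.Propositional using (_∈_; find; lose)
open import Data.List.Membership.Propositional.Properties using (∈-map⁺; ∈-map⁻; ∈-filter⁺; ∈-filter⁻; ∈-++⁺ˡ; ∈-++⁺ʳ; ∈-++⁻; ∈-allFin; ∈-cartesianProduct⁺; ∈-cartesianProduct⁻)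
open import Data.List.Membership.Propositional.Properties.WithK using (unique∧set⇒bag)
open import Data.List.Properties using (length-map; length-++; length-tabulate)
open import Data.List.Relation.Binary.BagAndSetEquality using (∼bag⇒↭)
open import Data.List.Relation.Binary.Permutation.Propositional as Perm using (_↭_)
open import Data.List.Relation.Binary.Permutation.Propositional.Properties using (↭-length)
open import Data.List.Relation.Unary.All as All using (All; []; _∷_)
open import Data.List.Relation.Unary.AllPairs using ([]; _∷_)
open import Data.List.Relation.Unary.Any using (here; there; any?; Any)
open import Data.List.Relation.Unary.Unique.Propositional using (Unique)
import Data.List.Relation.Unary.Unique.Propositional.Properties as Uniqueₚ
open import Data.Maybe using (Maybe; just; nothing)
open import Data.Nat as ℕ using (ℕ; zero; suc; _≤_; _<_; z≤n; s≤s; _∸_)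
open import Data.Nat.DivMod using (_%_; _/_; m≡m%n+[m/n]*n; m%n<n; _mod_)
import Data.Nat.Properties as ℕₚ
import Data.Nat.Tactic.RingSolver as ℕSolver
open import Data.Product using (Σ; ∃; _×_; _,_; proj₁; proj₂; ∃-syntax; Σ-syntax)
open import Data.Sum using (_⊎_; inj₁; inj₂)
open import Data.Unit using (⊤; tt)
open import Data.Vec using (tabulate)
open import Data.Vec.Properties using (lookup∘tabulate; lookup⇒[]=; []=⇒lookup)
open import Function using (_∘_; Inverse; mk⇔; id; _⇔_)
open import Function.Definitions using (Bijective)
open import Level using (0ℓ)
open import Relation.Binary.Definitions using (tri<; tri≈; tri>)
open import Relation.Binary.PropositionalEquality hiding ([_])
open import Relation.Nullary using (¬_; Dec; yes; no; does)
open import Relation.Nullary.Decidable using (_×-dec_; _⊎-dec_; ¬?; dec-true; dec-false; from-yes; decidable-stable)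
import Relation.Nullary.Decidable as Dec

-- Carlitz's theorem is obtained from the character sum 2 Σ x χ(x - u) χ(x - v) = -(u + v). A
-- character-preserving f may be substituted for x, u and v, which leaves the characters alone;
-- writing χ(x - u) as (x - u)^m, with m = (|F| - 1)/2, turns the result into a comparison of
-- coefficients. Multiplication by a nonsquare is an isomorphism between Q_{a,b} and Q_{b,a}. Hence
-- the line through 0 and a nonsquare in one behaves like the line through 0 and 1 in the other, and
-- the argument about 2 has to be run for both. Double transitivity supplies automorphisms that
-- exchange two given points. A 2-subgroup fixing two points therefore has even index, and so lies
-- with index 2 in a larger one. This is what produces an involution on a fixed-point set. Two
-- obstacles come from the way K enters. Membership in K quantifies over all subfields, so K is also
-- generated inductively and its decidability is assumed only under a negation. A twist exponent
-- only satisfies γ² = |K|; that x ↦ x^γ is additive has to be extracted from this.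

-- Arithmetic in a finite field.

module Arith (F : FiniteField) where
  open FiniteField F public
  infix 4 _≟_
  infixr 8 _^_

  _≟_ : (x y : Carrier) → Dec (x ≡ y)
  _≟_ = _≟F_ F

  _^_ : Carrier → ℕ → Carrier
  _^_ = _^F_ F

  nat : ℕ → Carrier
  nat = ι F

  ring : CommutativeRing 0ℓ 0ℓ
  ring = record { isCommutativeRing = isCommutativeRing }

  open CommutativeRing ring public
    using (+-assoc; +-comm; +-identityˡ; +-identityʳ; -‿inverseˡ; -‿inverseʳ;
           *-assoc; *-comm; *-identityˡ; *-identityʳ; distribˡ; distribʳ; zeroˡ; zeroʳ)
  open import Algebra.Properties.Ring (CommutativeRing.ring ring) public
    using (-‿distribˡ-*; -‿distribʳ-*; -‿+-comm; -‿involutive; -0#≈0#; +-cancelˡ; +-cancelʳ)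

  acr : AlmostCommutativeRing 0ℓ 0ℓ
  acr = fromCommutativeRing ring

  -- Unlike nat 1, this makes the numeral 1 reduce to 1#.
  num : ℕ → Carrier
  num zero = 0#
  num (suc zero) = 1#
  num (suc (suc n)) = 1# + num (suc n)

  opaque
    num≡nat : ∀ n → num n ≡ nat n
    num≡nat zero = refl
    num≡nat (suc zero) = sym (+-identityʳ 1#)
    num≡nat (suc (suc n)) = cong (λ z → 1# + z) (num≡nat (suc n))

  ⟦_⟧ℤ : ℤ → Carrier
  ⟦ + n ⟧ℤ = num n
  ⟦ -[1+ n ] ⟧ℤ = - num (suc n)

  opaque
    nat-+ : ∀ m n → nat (m ℕ.+ n) ≡ nat m + nat n
    nat-+ zero n = sym (+-identityˡ _)
    nat-+ (suc m) n = trans (cong (λ z → 1# + z) (nat-+ m n)) (sym (+-assoc _ _ _))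

    nat-* : ∀ m n → nat (m ℕ.* n) ≡ nat m * nat n
    nat-* zero n = sym (zeroˡ _)
    nat-* (suc m) n = trans (nat-+ n (m ℕ.* n))
      (trans (cong₂ _+_ (sym (*-identityˡ _)) (nat-* m n)) (sym (distribʳ _ _ _)))

  private
    num-suc : ∀ n → num (suc n) ≡ 1# + num n
    num-suc zero = sym (+-identityʳ 1#)
    num-suc (suc n) = refl

    num-+ : ∀ m n → num (m ℕ.+ n) ≡ num m + num n
    num-+ m n = trans (num≡nat (m ℕ.+ n)) (trans (nat-+ m n) (cong₂ _+_ (sym (num≡nat m)) (sym (num≡nat n))))

    num-* : ∀ m n → num (m ℕ.* n) ≡ num m * num n
    num-* m n = trans (num≡nat (m ℕ.* n)) (trans (nat-* m n) (cong₂ _*_ (sym (num≡nat m)) (sym (num≡nat n))))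

    cancel-1 : ∀ x y → (1# + x) - (1# + y) ≡ x - y
    cancel-1 x y = trans (cong (λ z → (1# + x) + z) (sym (-‿+-comm 1# y)))
      (trans (cong (_+ (- 1# + - y)) (+-comm 1# x))
      (trans (+-assoc x 1# _) (cong (λ z → x + z)
      (trans (sym (+-assoc 1# _ _)) (trans (cong (_+ - y) (-‿inverseʳ 1#)) (+-identityˡ _))))))

    ⊖-homo : ∀ m n → ⟦ m ℤ.⊖ n ⟧ℤ ≡ num m - num n
    ⊖-homo m zero = sym (trans (cong (λ z → num m + z) -0#≈0#) (+-identityʳ _))
    ⊖-homo zero (suc n) = sym (+-identityˡ _)
    ⊖-homo (suc m) (suc n) = trans (cong ⟦_⟧ℤ (ℤₚ.[1+m]⊖[1+n]≡m⊖n m n))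
      (trans (⊖-homo m n) (trans (sym (cancel-1 _ _)) (cong₂ _-_ (sym (num-suc m)) (sym (num-suc n)))))

    neg-homo : ∀ i → ⟦ ℤ.- i ⟧ℤ ≡ - ⟦ i ⟧ℤ
    neg-homo (+ zero) = sym -0#≈0#
    neg-homo (+ suc n) = refl
    neg-homo -[1+ n ] = sym (-‿involutive _)

    +-homo : ∀ i j → ⟦ i ℤ.+ j ⟧ℤ ≡ ⟦ i ⟧ℤ + ⟦ j ⟧ℤ
    +-homo (+ m) (+ n) = num-+ m n
    +-homo (+ m) -[1+ n ] = ⊖-homo m (suc n)
    +-homo -[1+ m ] (+ n) = trans (⊖-homo n (suc m)) (+-comm _ _)
    +-homo -[1+ m ] -[1+ n ] = trans
      (cong -_ (trans (cong (λ k → num (suc k)) (sym (ℕₚ.+-suc m n))) (num-+ (suc m) (suc n))))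
      (sym (-‿+-comm _ _))

    *-homo : ∀ i j → ⟦ i ℤ.* j ⟧ℤ ≡ ⟦ i ⟧ℤ * ⟦ j ⟧ℤ
    *-homo (+ m) (+ n) = trans (cong ⟦_⟧ℤ (ℤₚ.+◃n≡+n (m ℕ.* n))) (num-* m n)
    *-homo (+ m) -[1+ n ] = trans (cong ⟦_⟧ℤ (ℤₚ.-◃n≡-n (m ℕ.* suc n)))
      (trans (neg-homo (+ (m ℕ.* suc n))) (trans (cong -_ (num-* m (suc n))) (-‿distribʳ-* _ _)))
    *-homo -[1+ m ] (+ n) = trans (cong ⟦_⟧ℤ (ℤₚ.-◃n≡-n (suc m ℕ.* n)))
      (trans (neg-homo (+ (suc m ℕ.* n))) (trans (cong -_ (num-* (suc m) n)) (-‿distribˡ-* _ _)))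
    *-homo -[1+ m ] -[1+ n ] = trans (num-* (suc m) (suc n))
      (sym (trans (sym (-‿distribˡ-* _ _)) (trans (cong -_ (sym (-‿distribʳ-* _ _))) (-‿involutive _))))

  morphism : ℤ.+-*-rawRing -Raw-AlmostCommutative⟶ acr
  morphism = record { ⟦_⟧ = ⟦_⟧ℤ ; +-homo = +-homo ; *-homo = *-homo ; -‿homo = neg-homo
                    ; 0-homo = refl ; 1-homo = refl }

  private
    coeff≟ : ∀ i j → Maybe (⟦ i ⟧ℤ ≡ ⟦ j ⟧ℤ)
    coeff≟ i j with i ℤₚ.≟ j
    ... | yes e = just (cong ⟦_⟧ℤ e)
    ... | no _ = nothing

  open RingSolver ℤ.+-*-rawRing acr morphism coeff≟ public
    using (Polynomial; solve; _:=_; con; _:+_; _:*_; _:-_; :-_)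

  opaque
    x-y≡0⇒x≡y : ∀ {x y} → x - y ≡ 0# → x ≡ y
    x-y≡0⇒x≡y {x} {y} e = trans (solve 2 (λ x y → x := (x :- y) :+ y) refl x y)
      (trans (cong (_+ y) e) (+-identityˡ y))

    x≡y⇒x-y≡0 : ∀ {x y} → x ≡ y → x - y ≡ 0#
    x≡y⇒x-y≡0 {x} refl = -‿inverseʳ x

    x≢y⇒x-y≢0 : ∀ {x y} → ¬ x ≡ y → ¬ x - y ≡ 0#
    x≢y⇒x-y≢0 ne e = ne (x-y≡0⇒x≡y e)

    xy≡0⇒x≡0⊎y≡0 : ∀ x y → x * y ≡ 0# → x ≡ 0# ⊎ y ≡ 0#
    xy≡0⇒x≡0⊎y≡0 x y e with x ≟ 0#
    ... | yes p = inj₁ p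
    ... | no np with inverse x np
    ...   | (z , xz) = inj₂ (trans (sym (*-identityˡ y)) (trans (cong (_* y) (sym xz))
            (trans (solve 3 (λ x y z → (x :* z) :* y := z :* (x :* y)) refl x y z)
            (trans (cong (z *_) e) (zeroʳ z)))))

    xy≢0 : ∀ {x y} → ¬ x ≡ 0# → ¬ y ≡ 0# → ¬ x * y ≡ 0#
    xy≢0 {x} {y} nx ny e with xy≡0⇒x≡0⊎y≡0 x y e
    ... | inj₁ p = nx p
    ... | inj₂ p = ny p

    *-cancelˡ : ∀ {x y z} → ¬ x ≡ 0# → x * y ≡ x * z → y ≡ z
    *-cancelˡ {x} {y} {z} nx e with xy≡0⇒x≡0⊎y≡0 x (y - z)
      (trans (solve 3 (λ x y z → x :* (y :- z) := x :* y :- x :* z) refl x y z) (x≡y⇒x-y≡0 e))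
    ... | inj₁ p = ⊥-elim (nx p)
    ... | inj₂ p = x-y≡0⇒x≡y p

    1≢0 : ¬ 1# ≡ 0#
    1≢0 e = 0≢1 (sym e)

    -- Totalised by inv 0 = 0.
    inv : Carrier → Carrier
    inv x with x ≟ 0#
    ... | yes _ = 0#
    ... | no np = proj₁ (inverse x np)

    inv-right : ∀ {x} → ¬ x ≡ 0# → x * inv x ≡ 1#
    inv-right {x} nx with x ≟ 0#
    ... | yes p = ⊥-elim (nx p)
    ... | no np = proj₂ (inverse x np)

    inv-left : ∀ {x} → ¬ x ≡ 0# → inv x * x ≡ 1#
    inv-left nx = trans (*-comm _ _) (inv-right nx)

    inv-0 : inv 0# ≡ 0#
    inv-0 with 0# ≟ 0#
    ... | yes _ = refl
    ... | no np = ⊥-elim (np refl)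

    xy≡1⇒x≢0 : ∀ {x y} → x * y ≡ 1# → ¬ x ≡ 0#
    xy≡1⇒x≢0 {x} {y} e p = 1≢0 (trans (sym e) (trans (cong (_* y) p) (zeroˡ y)))

    inv≢0 : ∀ {x} → ¬ x ≡ 0# → ¬ inv x ≡ 0#
    inv≢0 nx = xy≡1⇒x≢0 (inv-left nx)

    inv-unique : ∀ {x y} → x * y ≡ 1# → inv x ≡ y
    inv-unique e = *-cancelˡ (xy≡1⇒x≢0 e) (trans (inv-right (xy≡1⇒x≢0 e)) (sym e))

    inv-inv : ∀ x → inv (inv x) ≡ x
    inv-inv x with x ≟ 0#
    ... | yes refl = inv-0
    ... | no np = inv-unique (trans (*-comm _ _) (proj₂ (inverse x np)))

    -x≡0⇒x≡0 : ∀ {x} → - x ≡ 0# → x ≡ 0#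
    -x≡0⇒x≡0 {x} e = trans (sym (-‿involutive x)) (trans (cong -_ e) -0#≈0#)

    ^-+ : ∀ x m n → x ^ (m ℕ.+ n) ≡ x ^ m * x ^ n
    ^-+ x zero n = sym (*-identityˡ _)
    ^-+ x (suc m) n = trans (cong (x *_) (^-+ x m n)) (sym (*-assoc _ _ _))

    ^-* : ∀ x m n → x ^ (m ℕ.* n) ≡ (x ^ n) ^ m
    ^-* x zero n = refl
    ^-* x (suc m) n = trans (^-+ x n (m ℕ.* n)) (cong (x ^ n *_) (^-* x m n))

    *-^ : ∀ x y n → (x * y) ^ n ≡ x ^ n * y ^ n
    *-^ x y zero = sym (*-identityˡ _)
    *-^ x y (suc n) = trans (cong ((x * y) *_) (*-^ x y n))
      (solve 4 (λ x y u v → (x :* y) :* (u :* v) := (x :* u) :* (y :* v)) refl x y (x ^ n) (y ^ n))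

    1^ : ∀ n → 1# ^ n ≡ 1#
    1^ zero = refl
    1^ (suc n) = trans (*-identityˡ _) (1^ n)

    0^suc : ∀ n → 0# ^ suc n ≡ 0#
    0^suc n = zeroˡ _

    ^≢0 : ∀ {x} n → ¬ x ≡ 0# → ¬ x ^ n ≡ 0#
    ^≢0 zero nx = 1≢0
    ^≢0 (suc n) nx = xy≢0 nx (^≢0 n nx)

    x^n≡0⇒x≡0 : ∀ {x} n → x ^ n ≡ 0# → x ≡ 0#
    x^n≡0⇒x≡0 {x} n e with x ≟ 0#
    ... | yes p = p
    ... | no np = ⊥-elim (^≢0 n np e)

    x²≡y²⇒x≡y⊎x≡-y : ∀ x y → x * x ≡ y * y → x ≡ y ⊎ x ≡ - y
    x²≡y²⇒x≡y⊎x≡-y x y e with xy≡0⇒x≡0⊎y≡0 (x - y) (x + y)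
      (trans (solve 2 (λ x y → (x :- y) :* (x :+ y) := x :* x :- y :* y) refl x y) (x≡y⇒x-y≡0 e))
    ... | inj₁ p = inj₁ (x-y≡0⇒x≡y p)
    ... | inj₂ p = inj₂ (x-y≡0⇒x≡y (trans (cong (λ z → x + z) (-‿involutive y)) p))

-- Finite counting: orbits, sums, products and roots of polynomials.

unique-↭ : ∀ {A : Set} {xs ys : List A} → Unique xs → Unique ys →
  (∀ {x} → x ∈ xs → x ∈ ys) → (∀ {x} → x ∈ ys → x ∈ xs) → xs ↭ ys
unique-↭ ux uy f g = ∼bag⇒↭ (unique∧set⇒bag ux uy (mk⇔ f g))

iter : ∀ {A : Set} → (A → A) → ℕ → A → A
iter f zero x = x
iter f (suc n) x = f (iter f n x)

iter-+ : ∀ {A : Set} (f : A → A) m n x → iter f (m ℕ.+ n) x ≡ iter f m (iter f n x)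
iter-+ f zero n x = refl
iter-+ f (suc m) n x = cong f (iter-+ f m n x)

iter-injective : ∀ {A : Set} {f : A → A} → (∀ {x y} → f x ≡ f y → x ≡ y) →
  ∀ n {x y} → iter f n x ≡ iter f n y → x ≡ y
iter-injective inj zero e = e
iter-injective inj (suc n) e = iter-injective inj n (inj e)

module Counting (F : FiniteField) where
  open Arith F
  open Inverse enumeration using (to; from; inverseˡ; inverseʳ)

  opaque
    from-to : ∀ x → from (to x) ≡ x
    from-to x = inverseʳ refl

    to-from : ∀ i → to (from i) ≡ i
    to-from i = inverseˡ refl

    to-injective : ∀ {x y} → to x ≡ to y → x ≡ y
    to-injective {x} {y} e = trans (sym (from-to x)) (trans (cong from e) (from-to y))

    -- Every orbit of an injection of a finite set is a cycle. This stands in for inverse maps: what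
    -- is closed under f is closed under its inverse.
    iter-returns : ∀ {f : Carrier → Carrier} → (∀ {x y} → f x ≡ f y → x ≡ y) →
      ∀ x → ∃[ k ] iter f (suc k) x ≡ x
    iter-returns {f} inj x with Finₚ.pigeonhole (ℕₚ.n<1+n size) (λ i → to (iter f (toℕ i) x))
    ... | (i , j , i<j , e) with ℕₚ.m≤n⇒∃[o]m+o≡n i<j
    ...   | (k , ek) = k , iter-injective inj (toℕ i)
            (trans (sym (iter-+ f (toℕ i) (suc k) x))
            (trans (cong (λ n → iter f n x) (trans (ℕₚ.+-suc (toℕ i) k) ek)) (sym (to-injective e))))

    injective⇒surjective : ∀ {f : Carrier → Carrier} → (∀ {x y} → f x ≡ f y → x ≡ y) →
      ∀ y → ∃[ x ] f x ≡ y
    injective⇒surjective {f} inj y = iter f (proj₁ (iter-returns inj y)) y , proj₂ (iter-returns inj y)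

    injective⇒bijective : ∀ {f : Carrier → Carrier} → (∀ {x y} → f x ≡ f y → x ≡ y) →
      Bijective _≡_ _≡_ f
    injective⇒bijective inj = inj , λ y → proj₁ (injective⇒surjective inj y) ,
      λ { refl → proj₂ (injective⇒surjective inj y) }

  elems : List Carrier
  elems = map from (allFin size)

  opaque
    elems-unique : Unique elems
    elems-unique = Uniqueₚ.map⁺ (λ {i} {j} e → trans (sym (to-from i)) (trans (cong to e) (to-from j)))
      (Uniqueₚ.allFin⁺ size)

    ∈-elems : ∀ x → x ∈ elems
    ∈-elems x = subst (_∈ elems) (from-to x) (∈-map⁺ from (∈-allFin (to x)))

    length-elems : length elems ≡ size
    length-elems = trans (length-map from (allFin size)) (length-tabulate (λ i → i))

  sumL prodL : (Carrier → Carrier) → List Carrier → Carrier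
  sumL g [] = 0#
  sumL g (x ∷ xs) = g x + sumL g xs
  prodL g [] = 1#
  prodL g (x ∷ xs) = g x * prodL g xs

  opaque
    sumL-cong : ∀ {g h} xs → (∀ x → g x ≡ h x) → sumL g xs ≡ sumL h xs
    sumL-cong [] e = refl
    sumL-cong (x ∷ xs) e = cong₂ _+_ (e x) (sumL-cong xs e)

    sumL-+ : ∀ g h xs → sumL (λ x → g x + h x) xs ≡ sumL g xs + sumL h xs
    sumL-+ g h [] = sym (+-identityˡ _)
    sumL-+ g h (x ∷ xs) = trans (cong (λ z → (g x + h x) + z) (sumL-+ g h xs))
      (solve 4 (λ a b c d → (a :+ b) :+ (c :+ d) := (a :+ c) :+ (b :+ d)) refl (g x) (h x) (sumL g xs) (sumL h xs))

    sumL-* : ∀ c g xs → sumL (λ x → c * g x) xs ≡ c * sumL g xs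
    sumL-* c g [] = sym (zeroʳ c)
    sumL-* c g (x ∷ xs) = trans (cong (λ z → c * g x + z) (sumL-* c g xs)) (sym (distribˡ _ _ _))

    sumL-↭ : ∀ g {xs ys} → xs ↭ ys → sumL g xs ≡ sumL g ys
    sumL-↭ g Perm.refl = refl
    sumL-↭ g (Perm.prep x p) = cong (λ z → g x + z) (sumL-↭ g p)
    sumL-↭ g (Perm.swap {xs} {ys} x y p) = trans (cong (λ z → g x + (g y + z)) (sumL-↭ g p))
      (solve 3 (λ a b c → a :+ (b :+ c) := b :+ (a :+ c)) refl (g x) (g y) (sumL g ys))
    sumL-↭ g (Perm.trans p q) = trans (sumL-↭ g p) (sumL-↭ g q)

    sumL-map : ∀ g (h : Carrier → Carrier) xs → sumL g (map h xs) ≡ sumL (g ∘ h) xs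
    sumL-map g h [] = refl
    sumL-map g h (x ∷ xs) = cong (λ z → g (h x) + z) (sumL-map g h xs)

    sumL-const : ∀ c xs → sumL (λ _ → c) xs ≡ nat (length xs) * c
    sumL-const c [] = sym (zeroˡ c)
    sumL-const c (x ∷ xs) = trans (cong (λ z → c + z) (sumL-const c xs))
      (trans (cong (λ z → z + nat (length xs) * c) (sym (*-identityˡ c))) (sym (distribʳ _ _ _)))

    prodL-↭ : ∀ g {xs ys} → xs ↭ ys → prodL g xs ≡ prodL g ys
    prodL-↭ g Perm.refl = refl
    prodL-↭ g (Perm.prep x p) = cong (g x *_) (prodL-↭ g p)
    prodL-↭ g (Perm.swap {xs} {ys} x y p) = trans (cong (λ z → g x * (g y * z)) (prodL-↭ g p))
      (solve 3 (λ a b c → a :* (b :* c) := b :* (a :* c)) refl (g x) (g y) (prodL g ys))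
    prodL-↭ g (Perm.trans p q) = trans (prodL-↭ g p) (prodL-↭ g q)

    prodL-scale : ∀ c xs → prodL (λ x → x) (map (c *_) xs) ≡ c ^ length xs * prodL (λ x → x) xs
    prodL-scale c [] = sym (*-identityˡ _)
    prodL-scale c (x ∷ xs) = trans (cong ((c * x) *_) (prodL-scale c xs))
      (solve 4 (λ c x u v → (c :* x) :* (u :* v) := (c :* u) :* (x :* v)) refl c x (c ^ length xs) (prodL (λ x → x) xs))

    prodL≢0 : ∀ xs → (∀ x → x ∈ xs → ¬ x ≡ 0#) → ¬ prodL (λ x → x) xs ≡ 0#
    prodL≢0 [] h = 1≢0
    prodL≢0 (x ∷ xs) h = xy≢0 (h x (here refl)) (prodL≢0 xs (λ y m → h y (there m)))

  ∑ : (Carrier → Carrier) → Carrier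
  ∑ g = sumL g elems

  opaque
    ∑-cong : ∀ {g h} → (∀ x → g x ≡ h x) → ∑ g ≡ ∑ h
    ∑-cong = sumL-cong elems

    ∑-bij : ∀ {f} → Bijective _≡_ _≡_ f → ∀ g → ∑ (g ∘ f) ≡ ∑ g
    ∑-bij {f} (inj , surj) g = trans (sym (sumL-map g f elems)) (sumL-↭ g
      (unique-↭ (Uniqueₚ.map⁺ inj elems-unique) elems-unique (λ {x} _ → ∈-elems x)
        (λ {x} _ → subst (_∈ map f elems) (proj₂ (surj x) refl) (∈-map⁺ f (∈-elems _)))))

    ∑-sub : ∀ {f} → (∀ {x y} → f x ≡ f y → x ≡ y) → ∀ g → ∑ (g ∘ f) ≡ ∑ g
    ∑-sub inj = ∑-bij (injective⇒bijective inj)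

    -- Translation by 1 permutes F, so Σ x = Σ (1 + x) = |F|·1 + Σ x.
    nat-size : nat size ≡ 0#
    nat-size = +-cancelʳ (∑ (λ x → x)) _ _ (trans
      (trans (cong (_+ ∑ (λ x → x)) (trans (sym (*-identityʳ _)) (trans (cong (λ n → nat n * 1#) (sym length-elems))
        (sym (sumL-const 1# elems)))))
      (trans (sym (sumL-+ (λ _ → 1#) (λ x → x) elems)) (∑-sub (λ {x} {y} e → +-cancelˡ 1# x y e) (λ x → x))))
      (sym (+-identityˡ _)))

    -- Multiplication by x permutes `ys`; compare the products. Stated for a list so as to serve the
    -- units of F and those of a subfield alike.
    fermat-list : ∀ ys → Unique ys → (∀ y → y ∈ ys → ¬ y ≡ 0#) → ∀ {x} → ¬ x ≡ 0# →
      (∀ y → y ∈ ys → x * y ∈ ys) → (∀ y → y ∈ ys → inv x * y ∈ ys) → x ^ length ys ≡ 1#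
    fermat-list ys uy nz {x} nx cl cl⁻ = *-cancelˡ (prodL≢0 ys nz)
      (trans (*-comm _ _) (trans (sym (prodL-scale x ys))
      (trans (prodL-↭ (λ z → z) (unique-↭ (Uniqueₚ.map⁺ (*-cancelˡ nx) uy) uy to′ from′)) (sym (*-identityʳ _)))))
      where
      to′ : ∀ {y} → y ∈ map (x *_) ys → y ∈ ys
      to′ m with ∈-map⁻ (x *_) m
      ... | (z , z∈ , refl) = cl z z∈
      from′ : ∀ {y} → y ∈ ys → y ∈ map (x *_) ys
      from′ {y} m = subst (_∈ map (x *_) ys)
        (trans (sym (*-assoc _ _ _)) (trans (cong (_* y) (inv-right nx)) (*-identityˡ y)))
        (∈-map⁺ (x *_) (cl⁻ y m))

  -- Horner form of a polynomial of degree below n. The coefficients form an infinite sequence, so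
  -- that shifting and adding them involves no bounds.
  poly : (ℕ → Carrier) → ℕ → Carrier → Carrier
  poly c zero x = 0#
  poly c (suc n) x = c 0 + x * poly (c ∘ suc) n x

  opaque
    poly-cong : ∀ {c d} n x → (∀ i → c i ≡ d i) → poly c n x ≡ poly d n x
    poly-cong zero x e = refl
    poly-cong (suc n) x e = cong₂ _+_ (e 0) (cong (x *_) (poly-cong n x (e ∘ suc)))

    poly-0 : ∀ {c} n x → (∀ i → i < n → c i ≡ 0#) → poly c n x ≡ 0#
    poly-0 zero x e = refl
    poly-0 (suc n) x e = trans (cong₂ _+_ (e 0 (s≤s z≤n)) (trans (cong (x *_) (poly-0 n x (λ i l → e (suc i) (s≤s l)))) (zeroʳ x)))
      (+-identityˡ _)

    poly-+ : ∀ c d n x → poly (λ i → c i + d i) n x ≡ poly c n x + poly d n x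
    poly-+ c d zero x = sym (+-identityˡ _)
    poly-+ c d (suc n) x = trans (cong (λ z → c 0 + d 0 + x * z) (poly-+ (c ∘ suc) (d ∘ suc) n x))
      (solve 5 (λ a b x u v → a :+ b :+ x :* (u :+ v) := (a :+ x :* u) :+ (b :+ x :* v)) refl (c 0) (d 0) x _ _)

    poly-* : ∀ k c n x → poly (λ i → k * c i) n x ≡ k * poly c n x
    poly-* k c zero x = sym (zeroʳ k)
    poly-* k c (suc n) x = trans (cong (λ z → k * c 0 + x * z) (poly-* k (c ∘ suc) n x))
      (solve 4 (λ k a x u → k :* a :+ x :* (k :* u) := k :* (a :+ x :* u)) refl k (c 0) x _)

  private
    -- Synthetic division: the coefficients of (c(x) - c(r)) / (x - r).
    quot : (ℕ → Carrier) → ℕ → Carrier → ℕ → Carrier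
    quot c zero r i = 0#
    quot c (suc n) r zero = poly (c ∘ suc) n r
    quot c (suc n) r (suc i) = quot (c ∘ suc) n r i

    quot-spec : ∀ c n r x → poly c (suc n) x - poly c (suc n) r ≡ (x - r) * poly (quot c (suc n) r) n x
    quot-spec c zero r x = solve 3 (λ a x r → (a :+ x :* con (+ 0)) :- (a :+ r :* con (+ 0)) := (x :- r) :* con (+ 0)) refl (c 0) x r
    quot-spec c (suc n) r x = trans
      (solve 5 (λ a x r u v → (a :+ x :* u) :- (a :+ r :* v) := (x :- r) :* v :+ x :* (u :- v)) refl (c 0) x r p′x p′r)
      (trans (cong (λ z → (x - r) * p′r + x * z) (quot-spec (c ∘ suc) n r x))
      (solve 4 (λ x r v w → (x :- r) :* v :+ x :* ((x :- r) :* w) := (x :- r) :* (v :+ x :* w)) refl x r p′r _))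
      where
      p′x = poly (c ∘ suc) (suc n) x
      p′r = poly (c ∘ suc) (suc n) r

    quot-0 : ∀ c n r → (∀ i → i < n → quot c (suc n) r i ≡ 0#) → ∀ i → i < n → c (suc i) ≡ 0#
    quot-0 c (suc n) r h zero l = trans (sym (+-identityʳ _)) (trans (cong (λ z → c 1 + z)
      (sym (trans (cong (r *_) (poly-0 n r (quot-0 (c ∘ suc) n r (λ i l → h (suc i) (s≤s l))))) (zeroʳ r)))) (h 0 (s≤s z≤n)))
    quot-0 c (suc n) r h (suc i) (s≤s l) = quot-0 (c ∘ suc) n r (λ i l → h (suc i) (s≤s l)) i l

  opaque
    -- After division by x - r the quotient has the remaining roots, and the coefficients of c are
    -- recovered from it. Applied to all of F this is comparison of coefficients for polynomial
    -- functions.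
    roots-bound : ∀ rs → Unique rs → ∀ c n → n ≤ length rs → (∀ r → r ∈ rs → poly c n r ≡ 0#) →
      ∀ i → i < n → c i ≡ 0#
    roots-bound [] u c zero _ h i ()
    roots-bound (r ∷ rs) u c zero _ h i ()
    roots-bound (r ∷ rs) (r∉ ∷ u) c (suc n) (s≤s l) h = go
      where
      q0 : ∀ i → i < n → quot c (suc n) r i ≡ 0#
      q0 = roots-bound rs u (quot c (suc n) r) n l (λ x x∈ → root x x∈)
        where
        root : ∀ x → x ∈ rs → poly (quot c (suc n) r) n x ≡ 0#
        root x x∈ with xy≡0⇒x≡0⊎y≡0 (x - r) _ (trans (sym (quot-spec c n r x))
          (x≡y⇒x-y≡0 (trans (h x (there x∈)) (sym (h r (here refl))))))
        ... | inj₁ p = ⊥-elim (All.lookup r∉ x∈ (sym (x-y≡0⇒x≡y p)))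
        ... | inj₂ p = p
      cs0 : ∀ i → i < n → c (suc i) ≡ 0#
      cs0 = quot-0 c n r q0
      go : ∀ i → i < suc n → c i ≡ 0#
      go zero _ = trans (sym (+-identityʳ _)) (trans (cong (λ z → c 0 + z)
        (sym (trans (cong (r *_) (poly-0 n r cs0)) (zeroʳ r)))) (h r (here refl)))
      go (suc i) (s≤s l) = cs0 i l

-- The quadratic character as a power map.

module Signs (F : FiniteField) (odd : FiniteField.size F % 2 ≡ 1) where
  open Arith F public
  open Counting F public
  open Inverse enumeration using (to; from)

  two : Carrier
  two = 1# + 1#

  opaque
    -- |F|·1 vanishes by `nat-size`, but for |F| odd and 2 = 0 it would equal 1.
    two≢0 : ¬ two ≡ 0#
    two≢0 e = 1≢0 (trans (sym (trans (cong nat (m≡m%n+[m/n]*n size 2)) (trans (cong (λ r → nat (r ℕ.+ size / 2 ℕ.* 2)) odd)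
      (trans (cong (λ z → 1# + z) (trans (nat-* (size / 2) 2) (trans (cong (λ z → nat (size / 2) * (1# + z)) (+-identityʳ 1#))
        (trans (cong (nat (size / 2) *_) e) (zeroʳ _))))) (+-identityʳ 1#))))) nat-size)

  ½ : Carrier
  ½ = inv two

  opaque
    two*½ : two * ½ ≡ 1#
    two*½ = inv-right two≢0

    x+x≡two*x : ∀ x → x + x ≡ two * x
    x+x≡two*x x = sym (trans (distribʳ x 1# 1#) (cong₂ _+_ (*-identityˡ x) (*-identityˡ x)))

    ½+½ : ∀ x → ½ * x + ½ * x ≡ x
    ½+½ x = trans (x+x≡two*x _) (trans (sym (*-assoc _ _ _)) (trans (cong (_* x) two*½) (*-identityˡ x)))

    two*-cancel : ∀ {x y} → x + x ≡ y + y → x ≡ y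
    two*-cancel {x} {y} e = *-cancelˡ two≢0 (trans (sym (x+x≡two*x x)) (trans e (x+x≡two*x y)))

    x≢-x : ∀ {x} → ¬ x ≡ 0# → ¬ x ≡ - x
    x≢-x {x} nx e with xy≡0⇒x≡0⊎y≡0 two x (trans (sym (x+x≡two*x x)) (trans (cong (λ z → x + z) e) (-‿inverseʳ x)))
    ... | inj₁ p = two≢0 p
    ... | inj₂ p = nx p

    1≢-1 : ¬ 1# ≡ - 1#
    1≢-1 = x≢-x 1≢0

  private
    <-? : ∀ y → Dec (toℕ (to y) < toℕ (to (- y)))
    <-? y = toℕ (to y) ℕₚ.<? toℕ (to (- y))

  -- One element of each pair {y, -y} with y ≠ 0, the one enumerated first. Its length m = (|F| -
  -- 1)/2 is the exponent in Euler's criterion.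
  halfSystem : List Carrier
  halfSystem = filter <-? elems

  opaque
    m : ℕ
    m = length halfSystem

    m-def : m ≡ length halfSystem
    m-def = refl

  private
    negHalf : List Carrier
    negHalf = map -_ halfSystem

    half-spec : ∀ {y} → y ∈ halfSystem → toℕ (to y) < toℕ (to (- y))
    half-spec y∈ = proj₂ (∈-filter⁻ <-? {xs = elems} y∈)

    half-unique : Unique halfSystem
    half-unique = Uniqueₚ.filter⁺ <-? elems-unique

    -inj : ∀ {x y} → - x ≡ - y → x ≡ y
    -inj {x} {y} e = trans (sym (-‿involutive x)) (trans (cong -_ e) (-‿involutive y))

    half≢0 : ∀ {y} → y ∈ halfSystem → ¬ y ≡ 0#
    half≢0 y∈ refl = ℕₚ.<-irrefl (cong (toℕ ∘ to) (sym -0#≈0#)) (half-spec y∈)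

    disjoint : ∀ {y} → y ∈ halfSystem → y ∈ negHalf → ⊥
    disjoint y∈ y∈′ with ∈-map⁻ -_ y∈′
    ... | (z , z∈ , refl) = ℕₚ.<-asym (half-spec z∈)
          (subst (λ w → toℕ (to (- z)) < toℕ (to w)) (-‿involutive z) (half-spec y∈))

  units : List Carrier
  units = halfSystem ++ negHalf

  opaque
    units-unique : Unique units
    units-unique = Uniqueₚ.++⁺ half-unique (Uniqueₚ.map⁺ -inj half-unique) (λ { (p , q) → disjoint p q })

    ∈-units : ∀ {y} → ¬ y ≡ 0# → y ∈ units
    ∈-units {y} ny with ℕₚ.<-cmp (toℕ (to y)) (toℕ (to (- y)))
    ... | tri< l _ _ = ∈-++⁺ˡ (∈-filter⁺ <-? (∈-elems y) l)
    ... | tri≈ _ e _ = ⊥-elim (x≢-x ny (to-injective (Finₚ.toℕ-injective e)))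
    ... | tri> _ _ g = ∈-++⁺ʳ halfSystem (subst (_∈ negHalf) (-‿involutive y)
          (∈-map⁺ -_ (∈-filter⁺ <-? (∈-elems (- y)) (subst (λ w → toℕ (to (- y)) < toℕ (to w)) (sym (-‿involutive y)) g))))

    units≢0 : ∀ y → y ∈ units → ¬ y ≡ 0#
    units≢0 y y∈ e with ∈-++⁻ halfSystem y∈
    ... | inj₁ p = half≢0 p e
    ... | inj₂ p with ∈-map⁻ -_ p
    ...   | (z , z∈ , refl) = half≢0 z∈ (-x≡0⇒x≡0 e)

    length-units : length units ≡ m ℕ.+ m
    length-units = trans (length-++ halfSystem) (cong₂ ℕ._+_ (sym m-def) (trans (length-map -_ halfSystem) (sym m-def)))

    elems-↭ : elems ↭ 0# ∷ units
    elems-↭ = unique-↭ elems-unique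
      (All.tabulate (λ {y} y∈ e → units≢0 y y∈ (sym e)) ∷ units-unique) (λ {x} _ → split x) (λ {x} _ → ∈-elems x)
      where
      split : ∀ x → x ∈ 0# ∷ units
      split x with x ≟ 0#
      ... | yes e = here e
      ... | no ne = there (∈-units ne)

    size≡1+2m : size ≡ suc (m ℕ.+ m)
    size≡1+2m = trans (sym length-elems) (trans (↭-length elems-↭) (cong suc length-units))

    fermat : ∀ {x} → ¬ x ≡ 0# → x ^ (m ℕ.+ m) ≡ 1#
    fermat {x} nx = trans (cong (x ^_) (sym length-units)) (fermat-list units units-unique units≢0 nx
      (λ y y∈ → ∈-units (xy≢0 nx (units≢0 y y∈))) (λ y y∈ → ∈-units (xy≢0 (inv≢0 nx) (units≢0 y y∈))))

    x^size≡x : ∀ x → x ^ size ≡ x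
    x^size≡x x = trans (cong (x ^_) size≡1+2m) (lem (x ≟ 0#))
      where
      lem : Dec (x ≡ 0#) → x * x ^ (m ℕ.+ m) ≡ x
      lem (yes refl) = zeroˡ _
      lem (no nx) = trans (cong (x *_) (fermat nx)) (*-identityʳ x)

    m≢0 : ∃[ k ] m ≡ suc k
    m≢0 = lem m refl
      where
      empty : ∀ {x : Carrier} {xs} → x ∈ xs → ¬ length xs ≡ 0
      empty (here _) ()
      empty (there _) ()
      lem : ∀ n → m ≡ n → ∃[ k ] m ≡ suc k
      lem zero e = ⊥-elim (empty (∈-units 1≢0) (trans length-units (cong (λ k → k ℕ.+ k) e)))
      lem (suc k) e = k , e

  -- `δ n` serves as the coefficient sequence of the monomial xⁿ.
  δ : ℕ → ℕ → Carrier
  δ zero zero = 1#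
  δ zero (suc i) = 0#
  δ (suc n) zero = 0#
  δ (suc n) (suc i) = δ n i

  opaque
    poly-δ : ∀ n k x → n < k → poly (δ n) k x ≡ x ^ n
    poly-δ zero (suc k) x _ = trans (cong (λ z → 1# + z) (trans (cong (x *_) (poly-0 k x (λ _ _ → refl))) (zeroʳ x))) (+-identityʳ 1#)
    poly-δ (suc n) (suc k) x (s≤s l) = trans (+-identityˡ _) (cong (x *_) (poly-δ n k x l))

    δ-diag : ∀ n → δ n n ≡ 1#
    δ-diag zero = refl
    δ-diag (suc n) = δ-diag n

    -- `c` represents x^(n+1) - 1; more than n + 1 roots would force its leading coefficient 1 to
    -- vanish.
    few-roots-of-unity : ∀ n rs → Unique rs → suc n < length rs → ¬ (∀ r → r ∈ rs → r ^ suc n ≡ 1#)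
    few-roots-of-unity n rs u l h = 1≢0 (trans (sym (δ-diag n)) (trans (sym (trans (cong (λ z → δ n n + z)
      (zeroʳ (- 1#))) (+-identityʳ _)))
      (roots-bound rs u c (suc (suc n)) l root (suc n) (ℕₚ.n<1+n (suc n)))))
      where
      c : ℕ → Carrier
      c i = δ (suc n) i + (- 1#) * δ 0 i
      root : ∀ r → r ∈ rs → poly c (suc (suc n)) r ≡ 0#
      root r r∈ = trans (poly-+ (δ (suc n)) (λ i → (- 1#) * δ 0 i) (suc (suc n)) r) (trans (cong₂ _+_ (poly-δ (suc n) (suc (suc n)) r ℕₚ.≤-refl)
        (trans (poly-* (- 1#) (δ 0) (suc (suc n)) r) (cong (- 1# *_) (poly-δ 0 (suc (suc n)) r (s≤s z≤n)))))
        (trans (cong (λ z → z + (- 1#) * 1#) (h r r∈)) (trans (cong (λ z → 1# + z) (*-identityʳ _)) (-‿inverseʳ 1#))))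

  -- Euler's criterion makes this the quadratic character with values in F.
  opaque
    X : Carrier → Carrier
    X x = x ^ m

    X-def : ∀ x → X x ≡ x ^ m
    X-def x = refl

  S N : Carrier → Set
  S x = X x ≡ 1#
  N x = X x ≡ - 1#

  opaque
    X-* : ∀ x y → X (x * y) ≡ X x * X y
    X-* x y = trans (X-def _) (trans (*-^ x y m) (sym (cong₂ _*_ (X-def x) (X-def y))))

    X-0 : X 0# ≡ 0#
    X-0 = trans (X-def 0#) (trans (cong (0# ^_) (proj₂ m≢0)) (0^suc (proj₁ m≢0)))

    X² : ∀ {x} → ¬ x ≡ 0# → X x * X x ≡ 1#
    X² {x} nx = trans (cong₂ _*_ (X-def x) (X-def x)) (trans (sym (^-+ x m m)) (fermat nx))

    S⊎N : ∀ {x} → ¬ x ≡ 0# → S x ⊎ N x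
    S⊎N nx = x²≡y²⇒x≡y⊎x≡-y _ 1# (trans (X² nx) (sym (*-identityˡ 1#)))

    S≢N : ∀ {x} → S x → N x → ⊥
    S≢N s n = 1≢-1 (trans (sym s) n)

    S≢0 : ∀ {x} → S x → ¬ x ≡ 0#
    S≢0 s refl = 0≢1 (trans (sym X-0) s)

    N≢0 : ∀ {x} → N x → ¬ x ≡ 0#
    N≢0 n refl = 1≢0 (-x≡0⇒x≡0 (trans (sym n) X-0))

    -1*-1 : (- 1#) * (- 1#) ≡ 1#
    -1*-1 = solve 0 ((:- con (+ 1)) :* (:- con (+ 1)) := con (+ 1)) refl

    S-1 : S 1#
    S-1 = trans (X-def 1#) (1^ m)

    SS : ∀ {x y} → S x → S y → S (x * y)
    SS {x} {y} p q = trans (X-* x y) (trans (cong₂ _*_ p q) (*-identityˡ _))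

    SN : ∀ {x y} → S x → N y → N (x * y)
    SN {x} {y} p q = trans (X-* x y) (trans (cong₂ _*_ p q) (*-identityˡ _))

    NS : ∀ {x y} → N x → S y → N (x * y)
    NS {x} {y} p q = trans (X-* x y) (trans (cong₂ _*_ p q) (*-identityʳ _))

    NN : ∀ {x y} → N x → N y → S (x * y)
    NN {x} {y} p q = trans (X-* x y) (trans (cong₂ _*_ p q) -1*-1)

    S-sq : ∀ {x} → ¬ x ≡ 0# → S (x * x)
    S-sq {x} nx = trans (X-* x x) (X² nx)

    S-inv : ∀ {x} → S x → S (inv x)
    S-inv {x} s = trans (sym (*-identityˡ _)) (trans (cong (_* X (inv x)) (sym s)) (trans (sym (X-* x (inv x)))
      (trans (cong X (inv-right (S≢0 s))) S-1)))

    N-inv : ∀ {x} → N x → N (inv x)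
    N-inv {x} n with S⊎N (inv≢0 (N≢0 n))
    ... | inj₁ s = ⊥-elim (S≢N S-1 (subst N (inv-right (N≢0 n)) (NS n s)))
    ... | inj₂ n′ = n′

    -- Otherwise all 2m units would be roots of x^m = 1.
    nonsquare : ∃[ ν ] N ν
    nonsquare with any? (λ y → X y ≟ - 1#) units
    ... | yes p = proj₁ (find p) , proj₂ (proj₂ (find p))
    ... | no np with m≢0
    ...   | (k , ek) = ⊥-elim (few-roots-of-unity k units units-unique
            (subst (suc k <_) (sym (trans length-units (cong (λ n → n ℕ.+ n) ek))) (s≤s (ℕₚ.m<m+n k (s≤s z≤n))))
            (λ r r∈ → allS r r∈))
      where
      allS : ∀ r → r ∈ units → r ^ suc k ≡ 1#
      allS r r∈ with S⊎N (units≢0 r r∈)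
      ... | inj₁ s = trans (cong (r ^_) (sym ek)) (trans (sym (X-def r)) s)
      ... | inj₂ n = ⊥-elim (np (lose r∈ n))

    -- The squares of the half system are m distinct roots of x^m = 1; a nonsquare root would be one
    -- too many.
    S⇒IsSquare : ∀ {x} → S x → IsSquare F x
    S⇒IsSquare {x} s with isSquare? F x
    ... | yes p = p
    ... | no np = ⊥-elim (contra m≢0)
      where
      sqs : List Carrier
      sqs = map (λ y → y * y) halfSystem
      uniq : ∀ {ys} → (∀ {y} → y ∈ ys → y ∈ halfSystem) → Unique ys → Unique (map (λ y → y * y) ys)
      uniq {[]} h [] = []
      uniq {y ∷ ys} h (y∉ ∷ u) = All.tabulate lem ∷ uniq (h ∘ there) u
        where
        lem : ∀ {z} → z ∈ map (λ y → y * y) ys → ¬ y * y ≡ z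
        lem z∈ e with ∈-map⁻ (λ y → y * y) z∈
        ... | (w , w∈ , refl) with x²≡y²⇒x≡y⊎x≡-y y w e
        ...   | inj₁ refl = All.lookup y∉ w∈ refl
        ...   | inj₂ refl = disjoint (h (here refl)) (∈-map⁺ -_ (h (there w∈)))
      contra : ∃[ k ] m ≡ suc k → ⊥
      contra (k , ek) = few-roots-of-unity k (x ∷ sqs)
        (All.tabulate (λ z∈ e → np (proj₁ (∈-map⁻ _ z∈) , trans (sym (proj₂ (proj₂ (∈-map⁻ _ z∈)))) (sym e))) ∷ uniq (λ z → z) half-unique)
        (s≤s (ℕₚ.≤-reflexive (trans (sym ek) (trans m-def (sym (length-map _ halfSystem))))))
        (λ r r∈ → trans (cong (r ^_) (sym ek)) (trans (sym (X-def r)) (root r r∈)))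
        where
        root : ∀ r → r ∈ x ∷ sqs → S r
        root r (here refl) = s
        root r (there r∈) with ∈-map⁻ (λ y → y * y) r∈
        ... | (y , y∈ , refl) = S-sq (half≢0 y∈)

    IsSquare⇒S : ∀ {x} → ¬ x ≡ 0# → IsSquare F x → S x
    IsSquare⇒S nx (y , refl) = S-sq (λ { refl → nx (zeroˡ _) })

    χ-0 : χ F 0# ≡ + 0
    χ-0 with _≟F_ F 0# 0#
    ... | yes _ = refl
    ... | no np = ⊥-elim (np refl)

    χ-S : ∀ {x} → S x → χ F x ≡ + 1
    χ-S {x} s with _≟F_ F x 0#
    ... | yes e = ⊥-elim (S≢0 s e)
    ... | no _ with isSquare? F x
    ...   | yes _ = refl
    ...   | no np = ⊥-elim (np (S⇒IsSquare s))

    χ-N : ∀ {x} → N x → χ F x ≡ -[1+ 0 ]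
    χ-N {x} n with _≟F_ F x 0#
    ... | yes e = ⊥-elim (N≢0 n e)
    ... | no nx with isSquare? F x
    ...   | yes p = ⊥-elim (S≢N (IsSquare⇒S nx p) n)
    ...   | no _ = refl

  data SignOf (x : Carrier) : Set where
    zer : x ≡ 0# → SignOf x
    pos : S x → SignOf x
    neg : N x → SignOf x

  opaque
    sign : ∀ x → SignOf x
    sign x with x ≟ 0#
    ... | yes e = zer e
    ... | no ne with S⊎N ne
    ...   | inj₁ s = pos s
    ...   | inj₂ n = neg n

    χ⇒S : ∀ {x} → χ F x ≡ + 1 → S x
    χ⇒S {x} e with sign x
    ... | pos s = s
    ... | zer refl with trans (sym χ-0) e
    ...   | ()
    χ⇒S {x} e | neg n with trans (sym (χ-N n)) e
    ...   | ()

    χ⇒N : ∀ {x} → χ F x ≡ -[1+ 0 ] → N x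
    χ⇒N {x} e with sign x
    ... | neg n = n
    ... | zer refl with trans (sym χ-0) e
    ...   | ()
    χ⇒N {x} e | pos s with trans (sym (χ-S s)) e
    ...   | ()

    χ≢0⇒≢0 : ∀ {x} → ¬ χ F x ≡ + 0 → ¬ x ≡ 0#
    χ≢0⇒≢0 h refl = h χ-0

    χ≡⇒X≡ : ∀ {x y} → χ F x ≡ χ F y → X x ≡ X y
    χ≡⇒X≡ {x} {y} e with sign x
    ... | pos s = trans s (sym (χ⇒S (trans (sym e) (χ-S s))))
    ... | neg n = trans n (sym (χ⇒N (trans (sym e) (χ-N n))))
    ... | zer refl with sign y
    ...   | zer refl = refl
    ...   | pos s with trans (sym χ-0) (trans e (χ-S s))
    ...     | ()
    χ≡⇒X≡ {x} {y} e | zer refl | neg n with trans (sym χ-0) (trans e (χ-N n))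
    ...     | ()

    qop-S : ∀ a b {x y} → S (y - x) → qop F a b x y ≡ x + a * (y - x)
    qop-S a b {x} {y} s = cong (λ c → x + pick F c a b * (y - x)) (χ-S s)

    qop-N : ∀ a b {x y} → N (y - x) → qop F a b x y ≡ x + b * (y - x)
    qop-N a b {x} {y} n = cong (λ c → x + pick F c a b * (y - x)) (χ-N n)

    qop-refl : ∀ a b x → qop F a b x x ≡ x
    qop-refl a b x = trans (cong (λ z → x + pick F (χ F (x - x)) a b * z) (-‿inverseʳ x))
      (trans (cong (λ z → x + z) (zeroʳ _)) (+-identityʳ x))

  -- An opaque copy of qop: unfolding χ during unification is prohibitively expensive.
  opaque
    op : Carrier → Carrier → Carrier → Carrier → Carrier
    op = qop F

    op-S : ∀ a b {x y} → S (y - x) → op a b x y ≡ x + a * (y - x)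
    op-S = qop-S

    op-N : ∀ a b {x y} → N (y - x) → op a b x y ≡ x + b * (y - x)
    op-N = qop-N

    op-refl : ∀ a b x → op a b x x ≡ x
    op-refl = qop-refl

  -- On a finite set injectivity already is bijectivity; the operation is the opaque one.
  Aut : Carrier → Carrier → (Carrier → Carrier) → Set
  Aut a b g = (∀ {x y} → g x ≡ g y → x ≡ y) × (∀ x y → g (op a b x y) ≡ op a b (g x) (g y))

  opaque
    unfolding op

    Aut⇒IsAut : ∀ {a b g} → Aut a b g → IsAut F a b g
    Aut⇒IsAut (inj , hom) = injective⇒bijective inj , hom

    IsAut⇒Aut : ∀ {a b g} → IsAut F a b g → Aut a b g
    IsAut⇒Aut ((inj , _) , hom) = inj , hom

-- Binomial coefficients.

bin : ℕ → ℕ → ℕ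
bin n zero = 1
bin zero (suc k) = 0
bin (suc n) (suc k) = bin n k ℕ.+ bin n (suc k)

bin-> : ∀ n k → n < k → bin n k ≡ 0
bin-> zero (suc k) _ = refl
bin-> (suc n) (suc k) (s≤s l) = cong₂ ℕ._+_ (bin-> n k l) (bin-> n (suc k) (ℕₚ.m<n⇒m<1+n l))

bin-diag : ∀ n → bin n n ≡ 1
bin-diag zero = refl
bin-diag (suc n) = cong₂ ℕ._+_ (bin-diag n) (bin-> n (suc n) (ℕₚ.n<1+n n))

bin-sym : ∀ i j → bin (i ℕ.+ j) i ≡ bin (i ℕ.+ j) j
bin-sym zero j = sym (bin-diag j)
bin-sym (suc i) zero = trans (cong (λ n → bin (suc n) (suc i)) (ℕₚ.+-identityʳ i)) (bin-diag (suc i))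
bin-sym (suc i) (suc j) = trans (cong₂ ℕ._+_ (bin-sym i (suc j))
  (trans (cong (λ n → bin n (suc i)) (ℕₚ.+-suc i j)) (trans (bin-sym (suc i) j) (cong (λ n → bin n j) (sym (ℕₚ.+-suc i j))))))
  (ℕₚ.+-comm (bin (i ℕ.+ suc j) (suc j)) _)

-- Both sides count the chains I ⊆ J in an n-set with |I| = i and |J| = i + j.
bin-chain : ∀ n i j → bin n (i ℕ.+ j) ℕ.* bin (i ℕ.+ j) i ≡ bin n i ℕ.* bin (n ∸ i) j
bin-chain n zero j = ℕₚ.*-comm (bin n j) 1
bin-chain zero (suc i) j = refl
bin-chain (suc n) (suc i) j = begin
  (p ℕ.+ r) ℕ.* (q ℕ.+ s)              ≡⟨ expand p q r s ⟩
  p ℕ.* q ℕ.+ (p ℕ.* s ℕ.+ r ℕ.* (q ℕ.+ s)) ≡⟨ cong₂ ℕ._+_ (bin-chain n i j) (rest j) ⟩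
  u ℕ.* bin (n ∸ i) j ℕ.+ w ℕ.* bin (n ∸ i) j ≡⟨ sym (ℕₚ.*-distribʳ-+ (bin (n ∸ i) j) u w) ⟩
  (u ℕ.+ w) ℕ.* bin (n ∸ i) j ∎
  where
  open ≡-Reasoning
  p = bin n (i ℕ.+ j)
  r = bin n (suc (i ℕ.+ j))
  q = bin (i ℕ.+ j) i
  s = bin (i ℕ.+ j) (suc i)
  u = bin n i
  w = bin n (suc i)
  expand : ∀ p q r s → (p ℕ.+ r) ℕ.* (q ℕ.+ s) ≡ p ℕ.* q ℕ.+ (p ℕ.* s ℕ.+ r ℕ.* (q ℕ.+ s))
  expand = ℕSolver.solve-∀
  pascal : ∀ j → bin n (suc i) ℕ.* bin (n ∸ suc i) j ℕ.+ bin n (suc i) ℕ.* bin (n ∸ suc i) (suc j)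
           ≡ bin n (suc i) ℕ.* bin (n ∸ i) (suc j)
  pascal j with suc i ℕₚ.≤? n
  ... | yes l = trans (sym (ℕₚ.*-distribˡ-+ (bin n (suc i)) (bin (n ∸ suc i) j) _))
                  (cong (λ k → bin n (suc i) ℕ.* bin k (suc j)) (sym (ℕₚ.+-∸-assoc 1 l)))
  ... | no nl rewrite bin-> n (suc i) (ℕₚ.≰⇒> nl) = refl
  rest : ∀ j → bin n (i ℕ.+ j) ℕ.* bin (i ℕ.+ j) (suc i) ℕ.+ bin n (suc (i ℕ.+ j)) ℕ.* bin (suc (i ℕ.+ j)) (suc i)
         ≡ bin n (suc i) ℕ.* bin (n ∸ i) j
  rest zero = trans (cong₂ ℕ._+_
      (trans (cong (bin n (i ℕ.+ 0) ℕ.*_) (bin-> (i ℕ.+ 0) (suc i) (s≤s (ℕₚ.≤-reflexive (ℕₚ.+-identityʳ i))))) (ℕₚ.*-zeroʳ (bin n (i ℕ.+ 0))))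
      (bin-chain n (suc i) 0)) refl
  rest (suc j) = trans (cong₂ ℕ._+_
      (trans (cong (λ k → bin n k ℕ.* bin k (suc i)) (ℕₚ.+-suc i j)) (bin-chain n (suc i) j))
      (bin-chain n (suc i) (suc j))) (pascal j)

-- Carlitz's theorem on maps that preserve the quadratic character.

module Carlitz (F : FiniteField) (odd : FiniteField.size F % 2 ≡ 1) where
  open Signs F odd

  nbin : ℕ → ℕ → Carrier
  nbin n i = nat (bin n i)

  -- The coefficients of (x + u) c(u) as a polynomial in u.
  timesLinear : Carrier → (ℕ → Carrier) → ℕ → Carrier
  timesLinear x c zero = x * c 0
  timesLinear x c (suc i) = x * c (suc i) + c i

  opaque
    poly-cong-< : ∀ {c d} n x → (∀ i → i < n → c i ≡ d i) → poly c n x ≡ poly d n x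
    poly-cong-< zero x e = refl
    poly-cong-< (suc n) x e = cong₂ _+_ (e 0 (s≤s z≤n)) (cong (x *_) (poly-cong-< n x (λ i l → e (suc i) (s≤s l))))

    poly-snoc : ∀ c n x → poly c (suc n) x ≡ poly c n x + c n * x ^ n
    poly-snoc c zero x = solve 2 (λ a x → a :+ x :* con (+ 0) := con (+ 0) :+ a :* con (+ 1)) refl (c 0) x
    poly-snoc c (suc n) x = trans (cong (λ z → c 0 + x * z) (poly-snoc (c ∘ suc) n x))
      (solve 5 (λ a x p b y → a :+ x :* (p :+ b :* y) := (a :+ x :* p) :+ b :* (x :* y)) refl (c 0) x (poly (c ∘ suc) n x) (c (suc n)) (x ^ n))

    poly-at-0 : ∀ c n → poly c (suc n) 0# ≡ c 0
    poly-at-0 c n = trans (cong (λ z → c 0 + z) (zeroˡ _)) (+-identityʳ _)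

    poly-linear-factor : ∀ c n x u → c (suc n) ≡ 0# → (x + u) * poly c (suc n) u ≡
      poly (timesLinear x c) (suc (suc n)) u
    poly-linear-factor c n x u e = sym (trans (cong (λ z → x * c 0 + u * z)
      (trans (poly-+ (λ i → x * c (suc i)) c (suc n) u) (cong (_+ poly c (suc n) u) (poly-* x (c ∘ suc) (suc n) u))))
      (trans (cong (λ z → x * c 0 + u * (x * z + poly c (suc n) u)) (trans (poly-snoc (c ∘ suc) n u)
        (trans (cong (λ z → poly (c ∘ suc) n u + z * u ^ n) e) (trans (cong (λ z → poly (c ∘ suc) n u + z) (zeroˡ _)) (+-identityʳ _)))))
      (solve 4 (λ x a u p → x :* a :+ u :* (x :* p :+ (a :+ u :* p)) := (x :+ u) :* (a :+ u :* p)) refl x (c 0) u (poly (c ∘ suc) n u))))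

    binomial : ∀ n x u → (x + u) ^ n ≡ poly (λ i → nbin n i * x ^ (n ∸ i)) (suc n) u
    binomial zero x u = solve 1 (λ u → con (+ 1) := (con (+ 1) :+ con (+ 0)) :* con (+ 1) :+ u :* con (+ 0)) refl u
    binomial (suc n) x u = trans (cong ((x + u) *_) (binomial n x u))
      (trans (poly-linear-factor c n x u (trans (cong (λ k → nat k * x ^ (n ∸ suc n)) (bin-> n (suc n) (ℕₚ.n<1+n n))) (zeroˡ _)))
      (poly-cong (suc (suc n)) u coeff))
      where
      c : ℕ → Carrier
      c i = nbin n i * x ^ (n ∸ i)
      coeff : ∀ i → timesLinear x c i ≡ nbin (suc n) i * x ^ (suc n ∸ i)
      coeff zero = solve 2 (λ x y → x :* ((con (+ 1) :+ con (+ 0)) :* y) := (con (+ 1) :+ con (+ 0)) :* (x :* y)) refl x (x ^ n)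
      coeff (suc i) with suc i ℕₚ.≤? n
      ... | yes l = trans (solve 5 (λ x p y q z → x :* (p :* y) :+ q :* z := p :* (x :* y) :+ q :* z) refl x (nbin n (suc i)) (x ^ (n ∸ suc i)) (nbin n i) (x ^ (n ∸ i)))
            (trans (cong (λ k → nbin n (suc i) * x ^ k + nbin n i * x ^ (n ∸ i)) (sym (ℕₚ.+-∸-assoc 1 l)))
            (trans (solve 3 (λ p q z → p :* z :+ q :* z := (q :+ p) :* z) refl (nbin n (suc i)) (nbin n i) (x ^ (n ∸ i)))
            (cong (_* x ^ (n ∸ i)) (sym (nat-+ (bin n i) (bin n (suc i)))))))
      ... | no nl = trans (cong (λ k → x * (nat k * x ^ (n ∸ suc i)) + nbin n i * x ^ (n ∸ i)) z)
            (trans (solve 4 (λ x y q z → x :* (con (+ 0) :* y) :+ q :* z := (q :+ con (+ 0)) :* z) refl x (x ^ (n ∸ suc i)) (nbin n i) (x ^ (n ∸ i)))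
            (cong (_* x ^ (n ∸ i)) (trans (cong (λ k → nbin n i + nat k) (sym z)) (sym (nat-+ (bin n i) (bin n (suc i)))))))
        where
        z : bin n (suc i) ≡ 0
        z = bin-> n (suc i) (ℕₚ.≰⇒> nl)

    δ-off : ∀ n i → ¬ n ≡ i → δ n i ≡ 0#
    δ-off zero zero ne = ⊥-elim (ne refl)
    δ-off zero (suc i) ne = refl
    δ-off (suc n) zero ne = refl
    δ-off (suc n) (suc i) ne = δ-off n i (ne ∘ cong suc)

    -- The mixed terms of the binomial expansion drop out. The weight c is kept because what becomes
    -- known is the vanishing of each product of a coefficient of f with an inner binomial
    -- coefficient.
    binomial-collapse : ∀ c n → (∀ i j → suc i ℕ.+ suc j ≡ suc n → c * nbin (suc n) (suc i) ≡ 0#) →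
      ∀ x y → c * (x + y) ^ suc n ≡ c * (x ^ suc n + y ^ suc n)
    binomial-collapse c n h x y = trans (cong (c *_) (binomial (suc n) x y)) (trans (sym (poly-* c (λ i → nbin (suc n) i * x ^ (suc n ∸ i)) (suc (suc n)) y))
      (trans (poly-cong-< (suc (suc n)) y coeff) (trans (poly-+ (λ i → (c * x ^ suc n) * δ 0 i) (λ i → c * δ (suc n) i) (suc (suc n)) y)
      (trans (cong₂ _+_ (poly-* (c * x ^ suc n) (δ 0) (suc (suc n)) y) (poly-* c (δ (suc n)) (suc (suc n)) y))
      (trans (cong₂ (λ u v → c * x ^ suc n * u + c * v) (poly-δ 0 (suc (suc n)) y (s≤s z≤n)) (poly-δ (suc n) (suc (suc n)) y ℕₚ.≤-refl))
      (solve 3 (λ c u v → (c :* u) :* con (+ 1) :+ c :* v := c :* (u :+ v)) refl c (x ^ suc n) (y ^ suc n)))))))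
      where
      coeff : ∀ i → i < suc (suc n) → c * (nbin (suc n) i * x ^ (suc n ∸ i)) ≡ (c * x ^ suc n) * δ 0 i + c * δ (suc n) i
      coeff zero _ = solve 2 (λ c u → c :* ((con (+ 1) :+ con (+ 0)) :* u) := c :* u :* con (+ 1) :+ c :* con (+ 0)) refl c (x ^ suc n)
      coeff (suc i) (s≤s (s≤s l)) with n ℕₚ.≟ i
      ... | yes refl = trans (cong₂ (λ k e → c * (nat k * x ^ e)) (bin-diag (suc n)) (ℕₚ.n∸n≡0 n))
            (trans (solve 2 (λ c u → c :* ((con (+ 1) :+ con (+ 0)) :* con (+ 1)) := u :* con (+ 0) :+ c :* con (+ 1)) refl c (c * x ^ suc n))
            (cong (λ z → c * x ^ suc n * 0# + c * z) (sym (δ-diag n))))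
      ... | no ne with ℕₚ.m≤n⇒∃[o]m+o≡n (ℕₚ.≤∧≢⇒< l (ne ∘ sym))
      ...   | (k , ek) = trans (sym (*-assoc _ _ _)) (trans (cong (_* x ^ (n ∸ i)) (h i k (cong suc (trans (ℕₚ.+-suc i k) ek))))
            (trans (zeroˡ _) (trans (solve 2 (λ c u → con (+ 0) := u :* con (+ 0) :+ c :* con (+ 0)) refl c (c * x ^ suc n))
            (cong (λ z → c * x ^ suc n * 0# + c * z) (sym (δ-off n i ne))))))

    poly-additive : ∀ c n → c 0 ≡ 0# → (∀ i x y → suc i < n → c (suc i) * (x + y) ^ suc i ≡ c (suc i) * (x ^ suc i + y ^ suc i)) →
      ∀ x y → poly c n (x + y) ≡ poly c n x + poly c n y
    poly-additive c zero c0 h x y = sym (+-identityˡ _)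
    poly-additive c (suc n) c0 h x y = trans (poly-snoc c n (x + y)) (trans (cong₂ _+_
      (poly-additive c n c0 (λ i x y l → h i x y (ℕₚ.m<n⇒m<1+n l)) x y) (top n h))
      (trans (solve 4 (λ a b u v → (a :+ b) :+ (u :+ v) := (a :+ u) :+ (b :+ v)) refl _ _ _ _)
      (sym (cong₂ _+_ (poly-snoc c n x) (poly-snoc c n y)))))
      where
      top : ∀ n → (∀ i x y → suc i < suc n → c (suc i) * (x + y) ^ suc i ≡ c (suc i) * (x ^ suc i + y ^ suc i)) →
        c n * (x + y) ^ n ≡ c n * x ^ n + c n * y ^ n
      top zero _ = trans (cong (_* 1#) c0) (trans (zeroˡ _) (sym (trans (cong₂ _+_ (trans (cong (_* 1#) c0) (zeroˡ _)) (trans (cong (_* 1#) c0) (zeroˡ _))) (+-identityˡ _))))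
      top (suc n) h = trans (h n x y ℕₚ.≤-refl) (distribˡ _ _ _)

    ∑-poly : ∀ (g : Carrier → ℕ → Carrier) n u → ∑ (λ x → poly (g x) n u) ≡ poly (λ i → ∑ (λ x → g x i)) n u
    ∑-poly g zero u = trans (sumL-const 0# elems) (zeroʳ _)
    ∑-poly g (suc n) u = trans (sumL-+ (λ x → g x 0) (λ x → u * poly (g x ∘ suc) n u) elems)
      (cong (λ z → ∑ (λ x → g x 0) + z) (trans (sumL-* u (λ x → poly (g x ∘ suc) n u) elems) (cong (u *_) (∑-poly (λ x → g x ∘ suc) n u))))

    ∑-single : ∀ g → (∀ x → ¬ x ≡ 0# → g x ≡ 0#) → ∑ g ≡ g 0#
    ∑-single g h = trans (sumL-↭ g elems-↭) (trans (cong (λ z → g 0# + z) (zeros units units≢0)) (+-identityʳ _))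
      where
      zeros : ∀ xs → (∀ x → x ∈ xs → ¬ x ≡ 0#) → sumL g xs ≡ 0#
      zeros [] _ = refl
      zeros (x ∷ xs) nz = trans (cong₂ _+_ (h x (nz x (here refl))) (zeros xs (λ y y∈ → nz y (there y∈)))) (+-identityˡ _)

    ∑-id : ∑ (λ x → x) ≡ 0#
    ∑-id = trans (solve 1 (λ s → s := (con (+ 1) :+ con (+ 1)) :* s :- s) refl (∑ (λ x → x)))
      (x≡y⇒x-y≡0 (trans (sym (sumL-* two (λ x → x) elems)) (∑-sub (*-cancelˡ two≢0) (λ x → x))))

    -- Scaling by a nonsquare permutes F and negates the sum.
    ∑-X : ∑ X ≡ 0#
    ∑-X with ∑ X ≟ 0#
    ... | yes e = e
    ... | no ne = ⊥-elim (x≢-x ne (trans (sym (∑-sub (*-cancelˡ (N≢0 n)) X)) (trans (∑-cong (λ x → trans (X-* ν x) (cong (_* X x) n)))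
          (trans (sumL-* (- 1#) X elems) (solve 1 (λ s → (:- con (+ 1)) :* s := :- s) refl (∑ X))))))
      where
      ν : Carrier
      ν = proj₁ nonsquare
      n : N ν
      n = proj₂ nonsquare

    X-inv : ∀ x → X (inv x) ≡ X x
    X-inv x with x ≟ 0#
    ... | yes refl = cong X inv-0
    ... | no nx = *-cancelˡ (λ e → 1≢0 (trans (sym (X² nx)) (trans (cong (_* X x) e) (zeroˡ _))))
          (trans (sym (X-* x (inv x))) (trans (cong X (inv-right nx)) (trans S-1 (sym (X² nx)))))

    X-1*X-1 : X (- 1#) * X (- 1#) ≡ 1#
    X-1*X-1 = X² (λ e → 1≢0 (-x≡0⇒x≡0 e))

  -- The indicator function of 0. It corrects at 0 the identities in which the square of X y is
  -- replaced by 1.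
  indicator₀ : Carrier → Carrier
  indicator₀ x = 1# - X x * X x

  -- The Jacobi sums to which the substitution in `moment` leads when u ≠ v.
  J₀ J₁ : Carrier
  J₀ = ∑ (λ y → X y * X (y - 1#))
  J₁ = ∑ (λ y → y * (X y * X (y - 1#)))

  opaque
    indicator-off : ∀ x → ¬ x ≡ 0# → indicator₀ x ≡ 0#
    indicator-off x nx = x≡y⇒x-y≡0 (sym (X² nx))

    indicator-at : indicator₀ 0# ≡ 1#
    indicator-at = trans (cong (λ z → 1# - z * z) X-0) (solve 0 (con (+ 1) :- con (+ 0) :* con (+ 0) := con (+ 1)) refl)

    -- For y ≠ 0 the summand is X(y⁻¹) X(y - 1) = X(1 - y⁻¹). The map y ↦ 1 - y⁻¹, with 0 ↦ 1,
    -- permutes F, so the sum over all y would be 0; the term X(1) for y = 0 is in excess.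
    J₀≡-1 : J₀ ≡ - 1#
    J₀≡-1 = trans (∑-cong step) (trans (sumL-+ (λ y → X (1# - inv y)) (λ y → - 1# * indicator₀ y) elems)
      (trans (cong₂ _+_ (trans (∑-sub {λ y → 1# - inv y} inj X) ∑-X)
        (trans (sumL-* (- 1#) indicator₀ elems) (cong (- 1# *_) (trans (∑-single indicator₀ indicator-off) indicator-at))))
      (solve 0 (con (+ 0) :+ (:- con (+ 1)) :* con (+ 1) := :- con (+ 1)) refl)))
      where
      inj : ∀ {x y} → 1# - inv x ≡ 1# - inv y → x ≡ y
      inj {x} {y} e = trans (sym (inv-inv x)) (trans (cong inv (trans (sym (-‿involutive _))
        (trans (cong -_ (+-cancelˡ 1# _ _ e)) (-‿involutive _)))) (inv-inv y))
      step : ∀ y → X y * X (y - 1#) ≡ X (1# - inv y) + - 1# * indicator₀ y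
      step y with y ≟ 0#
      ... | yes refl = trans (cong (_* X (0# - 1#)) X-0) (trans (zeroˡ _) (sym (trans (cong₂ (λ u v → u + - 1# * v)
              (trans (cong X (trans (cong (λ z → 1# - z) inv-0) (solve 0 (con (+ 1) :- con (+ 0) := con (+ 1)) refl))) S-1) indicator-at)
              (solve 0 (con (+ 1) :+ (:- con (+ 1)) :* con (+ 1) := con (+ 0)) refl))))
      ... | no ny = trans (cong₂ _*_ (sym (X-inv y)) refl) (trans (sym (X-* (inv y) (y - 1#)))
              (trans (cong X (trans (solve 2 (λ y i → i :* (y :- con (+ 1)) := y :* i :- i) refl y (inv y)) (cong (λ z → z - inv y) (inv-right ny))))
              (sym (trans (cong (λ z → X (1# - inv y) + - 1# * z) (indicator-off y ny)) (solve 1 (λ u → u :+ (:- con (+ 1)) :* con (+ 0) := u) refl _)))))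

    -- Under y ↦ 1 - y the weight X(y) X(y - 1) is invariant, since X(-1)² = 1, and the factor y
    -- becomes 1 - y.
    J₁+J₁≡J₀ : J₁ + J₁ ≡ J₀
    J₁+J₁≡J₀ = trans (cong (_+ J₁) (sym (∑-sub {λ y → 1# - y} inj (λ y → y * (X y * X (y - 1#))))))
      (trans (sym (sumL-+ (λ y → (1# - y) * (X (1# - y) * X (1# - y - 1#))) (λ y → y * (X y * X (y - 1#))) elems)) (∑-cong step))
      where
      inj : ∀ {x y} → 1# - x ≡ 1# - y → x ≡ y
      inj {x} {y} e = trans (sym (-‿involutive _)) (trans (cong -_ (+-cancelˡ 1# _ _ e)) (-‿involutive _))
      step : ∀ y → (1# - y) * (X (1# - y) * X (1# - y - 1#)) + y * (X y * X (y - 1#)) ≡ X y * X (y - 1#)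
      step y = trans (cong (λ z → (1# - y) * z + y * (X y * X (y - 1#)))
        (trans (cong₂ _*_ (trans (cong X (solve 1 (λ y → con (+ 1) :- y := (:- con (+ 1)) :* (y :- con (+ 1))) refl y)) (X-* _ _))
                          (trans (cong X (solve 1 (λ y → con (+ 1) :- y :- con (+ 1) := (:- con (+ 1)) :* y) refl y)) (X-* _ _)))
        (trans (solve 3 (λ k u v → (k :* u) :* (k :* v) := (k :* k) :* (v :* u)) refl (X (- 1#)) (X (y - 1#)) (X y))
        (trans (cong (_* (X y * X (y - 1#))) X-1*X-1) (*-identityˡ _)))))
        (solve 2 (λ y p → (con (+ 1) :- y) :* p :+ y :* p := p) refl y (X y * X (y - 1#)))

    -- Substituting x = u + (v - u) y reduces the sum to J₀ and J₁.
    moment : ∀ u v → two * ∑ (λ x → x * (X (x - u) * X (x - v))) ≡ - (u + v)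
    moment u v with u ≟ v
    ... | yes refl = trans (cong (two *_) (trans (sym (∑-sub {λ y → y + u} (λ {x} {y} e → +-cancelʳ u x y e) (λ x → x * (X (x - u) * X (x - u)))))
          (trans (∑-cong step) (trans (sumL-+ (λ y → y + u) (λ y → - 1# * ((y + u) * indicator₀ y)) elems)
          (trans (cong₂ _+_ (trans (sumL-+ (λ y → y) (λ _ → u) elems) (cong₂ _+_ ∑-id (trans (sumL-const u elems)
              (trans (cong (λ k → nat k * u) length-elems) (cong (_* u) nat-size)))))
            (trans (sumL-* (- 1#) (λ y → (y + u) * indicator₀ y) elems) (cong (- 1# *_) (trans (∑-single (λ y → (y + u) * indicator₀ y)
              (λ y ny → trans (cong ((y + u) *_) (indicator-off y ny)) (zeroʳ _))) (cong ((0# + u) *_) indicator-at))))) refl)))))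
          (solve 1 (λ u → (con (+ 2)) :* (con (+ 0) :+ con (+ 0) :* u :+ (:- con (+ 1)) :* ((con (+ 0) :+ u) :* con (+ 1))) := :- (u :+ u)) refl u)
      where
      step : ∀ y → (y + u) * (X (y + u - u) * X (y + u - u)) ≡ (y + u) + - 1# * ((y + u) * indicator₀ y)
      step y = trans (cong (λ z → (y + u) * (X z * X z)) (solve 2 (λ y u → y :+ u :- u := y) refl y u))
        (solve 2 (λ w s → w :* s := w :+ (:- con (+ 1)) :* (w :* (con (+ 1) :- s))) refl (y + u) (X y * X y))
    ... | no ne = trans (cong (two *_) (trans (sym (∑-sub {λ y → u + (v - u) * y} inj (λ x → x * (X (x - u) * X (x - v)))))
          (trans (∑-cong step) (trans (sumL-+ (λ y → u * (X y * X (y - 1#))) (λ y → (v - u) * (y * (X y * X (y - 1#)))) elems)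
          (cong₂ _+_ (sumL-* u (λ y → X y * X (y - 1#)) elems) (sumL-* (v - u) (λ y → y * (X y * X (y - 1#))) elems))))))
          (trans (solve 4 (λ u w i j → con (+ 2) :* (u :* i :+ w :* j) := con (+ 2) :* (u :* i) :+ w :* (j :+ j)) refl u (v - u) J₀ J₁)
          (trans (cong₂ (λ p q → two * (u * p) + (v - u) * q) J₀≡-1 (trans J₁+J₁≡J₀ J₀≡-1))
          (solve 2 (λ u v → con (+ 2) :* (u :* (:- con (+ 1))) :+ (v :- u) :* (:- con (+ 1)) := :- (u :+ v)) refl u v)))
      where
      w≢0 : ¬ v - u ≡ 0#
      w≢0 = x≢y⇒x-y≢0 (ne ∘ sym)
      inj : ∀ {x y} → u + (v - u) * x ≡ u + (v - u) * y → x ≡ y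
      inj e = *-cancelˡ w≢0 (+-cancelˡ u _ _ e)
      step : ∀ y → (u + (v - u) * y) * (X (u + (v - u) * y - u) * X (u + (v - u) * y - v)) ≡
        u * (X y * X (y - 1#)) + (v - u) * (y * (X y * X (y - 1#)))
      step y = trans (cong ((u + (v - u) * y) *_) (trans (cong₂ _*_
          (trans (cong X (solve 3 (λ u w y → u :+ w :* y :- u := w :* y) refl u (v - u) y)) (X-* _ _))
          (trans (cong X (solve 3 (λ u v y → u :+ (v :- u) :* y :- v := (v :- u) :* (y :- con (+ 1))) refl u v y)) (X-* _ _)))
          (trans (solve 3 (λ w p q → (w :* p) :* (w :* q) := (w :* w) :* (p :* q)) refl (X (v - u)) (X y) (X (y - 1#)))
          (trans (cong (_* (X y * X (y - 1#))) (X² w≢0)) (*-identityˡ _)))))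
        (solve 4 (λ u w y p → (u :+ w :* y) :* p := u :* p :+ w :* (y :* p)) refl u (v - u) y (X y * X (y - 1#)))

  module Preserving (f : Carrier → Carrier) (f0 : f 0# ≡ 0#) (pres : ∀ x y → X (f x - f y) ≡ X (x - y)) where
    opaque
      injective : ∀ {x y} → f x ≡ f y → x ≡ y
      injective {x} {y} e with sign (x - y)
      ... | zer z = x-y≡0⇒x≡y z
      ... | pos s = ⊥-elim (0≢1 (trans (sym X-0) (trans (cong X (sym (x≡y⇒x-y≡0 e))) (trans (pres x y) s))))
      ... | neg n = ⊥-elim (1≢0 (-x≡0⇒x≡0 (sym (trans (sym X-0) (trans (cong X (sym (x≡y⇒x-y≡0 e))) (trans (pres x y) n))))))

      -- Put f x, f u, f v for x, u, v in `moment`: the characters do not change, so f enters only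
      -- linearly.
      moment-f : ∀ u v → two * ∑ (λ x → f x * (X (x - u) * X (x - v))) ≡ - (f u + f v)
      moment-f u v = trans (cong (two *_) (trans (∑-cong (λ x → cong (f x *_) (sym (cong₂ _*_ (pres x u) (pres x v)))))
        (∑-sub injective (λ y → y * (X (y - f u) * X (y - f v)))))) (moment (f u) (f v))

    κ : ℕ → Carrier
    κ i = nbin m i * (- 1#) ^ i

    coeffs : Carrier → ℕ → Carrier
    coeffs x i = κ i * x ^ (m ∸ i)

    -- The coefficient of uⁱvʲ in the sum of f(x) X(x - u) X(x - v). Up to the factor κᵢκⱼ it
    -- depends on i + j alone (`A-moment`).
    A : ℕ → ℕ → Carrier
    A i j = ∑ (λ x → f x * (coeffs x i * coeffs x j))

    M : ℕ → Carrier
    M s = ∑ (λ x → f x * x ^ (m ℕ.+ m ∸ s))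

    opaque
      poly-reflect : ∀ c n u → poly c n (- u) ≡ poly (λ i → c i * (- 1#) ^ i) n u
      poly-reflect c zero u = refl
      poly-reflect c (suc n) u = cong₂ _+_ (sym (*-identityʳ _)) (trans (cong (- u *_) (poly-reflect (c ∘ suc) n u))
        (trans (solve 2 (λ u p → (:- u) :* p := u :* ((:- con (+ 1)) :* p)) refl u _)
        (cong (u *_) (trans (sym (poly-* (- 1#) (λ i → c (suc i) * (- 1#) ^ i) n u))
          (poly-cong n u (λ i → solve 2 (λ c k → (:- con (+ 1)) :* (c :* k) := c :* ((:- con (+ 1)) :* k)) refl (c (suc i)) ((- 1#) ^ i)))))))

      X-expand : ∀ x u → X (x - u) ≡ poly (coeffs x) (suc m) u
      X-expand x u = trans (X-def _) (trans (binomial m x (- u)) (trans (poly-reflect (λ i → nbin m i * x ^ (m ∸ i)) (suc m) u)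
        (poly-cong (suc m) u (λ i → solve 3 (λ b p k → (b :* p) :* k := (b :* k) :* p) refl (nbin m i) (x ^ (m ∸ i)) ((- 1#) ^ i)))))

      expand : ∀ u v → ∑ (λ x → f x * (X (x - u) * X (x - v))) ≡ poly (λ i → poly (A i) (suc m) v) (suc m) u
      expand u v = trans (∑-cong step) (trans (∑-poly (λ x i → poly (λ j → f x * (coeffs x i * coeffs x j)) (suc m) v) (suc m) u)
        (poly-cong (suc m) u (λ i → ∑-poly (λ x j → f x * (coeffs x i * coeffs x j)) (suc m) v)))
        where
        step : ∀ x → f x * (X (x - u) * X (x - v)) ≡ poly (λ i → poly (λ j → f x * (coeffs x i * coeffs x j)) (suc m) v) (suc m) u
        step x = trans (cong₂ (λ p q → f x * (p * q)) (X-expand x u) (X-expand x v))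
          (trans (solve 3 (λ f p q → f :* (p :* q) := (f :* q) :* p) refl (f x) (poly (coeffs x) (suc m) u) (poly (coeffs x) (suc m) v))
          (trans (sym (poly-* (f x * poly (coeffs x) (suc m) v) (coeffs x) (suc m) u)) (poly-cong (suc m) u (λ i →
            trans (solve 3 (λ f q c → (f :* q) :* c := (f :* c) :* q) refl (f x) (poly (coeffs x) (suc m) v) (coeffs x i))
            (trans (sym (poly-* (f x * coeffs x i) (coeffs x) (suc m) v)) (poly-cong (suc m) v (λ j → *-assoc (f x) (coeffs x i) (coeffs x j))))))))

      -- Setting v = 0 writes f as a polynomial of degree at most m.
      at-0 : ∀ u → two * poly (λ i → A i 0) (suc m) u ≡ - f u
      at-0 u = trans (cong (two *_) (trans (poly-cong (suc m) u (λ i → sym (poly-at-0 (A i) m))) (sym (expand u 0#))))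
        (trans (moment-f u 0#) (cong -_ (trans (cong (λ z → f u + z) f0) (+-identityʳ _))))

      suc-m≤size : suc m ≤ length elems
      suc-m≤size = ℕₚ.≤-trans (s≤s (ℕₚ.m≤m+n m m)) (ℕₚ.≤-reflexive (trans (sym size≡1+2m) (sym length-elems)))

      -- The right side -(f u + f v) has no mixed terms: subtracting the case v = 0 leaves the
      -- constant -f v, so every coefficient of positive degree in u cancels. `A-0` then compares
      -- coefficients in v.
      A-row : ∀ i → suc i < suc m → ∀ v → poly (A (suc i)) (suc m) v ≡ A (suc i) 0
      A-row i l v = *-cancelˡ two≢0 (x-y≡0⇒x≡y (trans (solve 3 (λ p q z → con (+ 2) :* p :- con (+ 2) :* q := con (+ 2) :* (p :+ (:- con (+ 1)) :* q) :+ z :* con (+ 0)) refl (poly (A (suc i)) (suc m) v) (A (suc i) 0) (f v))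
          (roots-bound elems elems-unique c (suc m) suc-m≤size (λ u _ → root u) (suc i) l)))
        where
        c : ℕ → Carrier
        c i = two * (poly (A i) (suc m) v + - 1# * A i 0) + f v * δ 0 i
        root : ∀ u → poly c (suc m) u ≡ 0#
        root u = trans (poly-+ (λ i → two * (poly (A i) (suc m) v + - 1# * A i 0)) (λ i → f v * δ 0 i) (suc m) u)
          (trans (cong₂ _+_ (trans (poly-* two (λ i → poly (A i) (suc m) v + - 1# * A i 0) (suc m) u)
              (cong (two *_) (trans (poly-+ (λ i → poly (A i) (suc m) v) (λ i → - 1# * A i 0) (suc m) u)
                (cong₂ _+_ (sym (expand u v)) (poly-* (- 1#) (λ i → A i 0) (suc m) u)))))
            (trans (poly-* (f v) (δ 0) (suc m) u) (cong (f v *_) (poly-δ 0 (suc m) u (s≤s z≤n)))))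
          (trans (solve 4 (λ t p q z → t :* (p :+ (:- con (+ 1)) :* q) :+ z :* con (+ 1) := t :* p :- t :* q :+ z) refl two (∑ (λ x → f x * (X (x - u) * X (x - v)))) (poly (λ i → A i 0) (suc m) u) (f v))
          (trans (cong₂ (λ p q → p - q + f v) (moment-f u v) (at-0 u))
          (solve 2 (λ u v → (:- (u :+ v)) :- (:- u) :+ v := con (+ 0)) refl (f u) (f v)))))

      A-0 : ∀ i j → suc i < suc m → suc j < suc m → A (suc i) (suc j) ≡ 0#
      A-0 i j l l′ = trans (solve 2 (λ p q → p := p :+ ((:- con (+ 1)) :* q) :* con (+ 0)) refl (A (suc i) (suc j)) (A (suc i) 0))
        (roots-bound elems elems-unique c (suc m) suc-m≤size (λ v _ → root v) (suc j) l′)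
        where
        c : ℕ → Carrier
        c j = A (suc i) j + (- 1# * A (suc i) 0) * δ 0 j
        root : ∀ v → poly c (suc m) v ≡ 0#
        root v = trans (poly-+ (A (suc i)) (λ j → (- 1# * A (suc i) 0) * δ 0 j) (suc m) v)
          (trans (cong₂ _+_ (A-row i l v) (trans (poly-* (- 1# * A (suc i) 0) (δ 0) (suc m) v) (cong (- 1# * A (suc i) 0 *_) (poly-δ 0 (suc m) v (s≤s z≤n)))))
          (solve 1 (λ p → p :+ ((:- con (+ 1)) :* p) :* con (+ 1) := con (+ 0)) refl (A (suc i) 0)))

      A-moment : ∀ i j → i ≤ m → j ≤ m → A i j ≡ (κ i * κ j) * M (i ℕ.+ j)
      A-moment i j l l′ = trans (∑-cong (λ x → trans
          (solve 5 (λ f k p k′ p′ → f :* ((k :* p) :* (k′ :* p′)) := (k :* k′) :* (f :* (p :* p′))) refl (f x) (κ i) (x ^ (m ∸ i)) (κ j) (x ^ (m ∸ j)))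
          (cong (λ z → (κ i * κ j) * (f x * z)) (trans (sym (^-+ x (m ∸ i) (m ∸ j))) (cong (x ^_) arith)))))
        (sumL-* (κ i * κ j) (λ x → f x * x ^ (m ℕ.+ m ∸ (i ℕ.+ j))) elems)
        where
        arith : (m ∸ i) ℕ.+ (m ∸ j) ≡ m ℕ.+ m ∸ (i ℕ.+ j)
        arith = trans (sym (ℕₚ.m+n∸n≡m _ (i ℕ.+ j))) (cong (_∸ (i ℕ.+ j))
          (trans (shuffle (m ∸ i) (m ∸ j) i j) (cong₂ ℕ._+_ (ℕₚ.m∸n+n≡m l) (ℕₚ.m∸n+n≡m l′))))
          where
          shuffle : ∀ a b i j → (a ℕ.+ b) ℕ.+ (i ℕ.+ j) ≡ (a ℕ.+ i) ℕ.+ (b ℕ.+ j)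
          shuffle = ℕSolver.solve-∀

      κ-0⇒ : ∀ i → κ i ≡ 0# → nbin m i ≡ 0#
      κ-0⇒ i e with xy≡0⇒x≡0⊎y≡0 _ _ e
      ... | inj₁ p = p
      ... | inj₂ p = ⊥-elim (^≢0 i (λ e → 1≢0 (-x≡0⇒x≡0 e)) p)

      κκM-0 : ∀ i j → 0 < i → 0 < j → i ≤ m → j ≤ m → κ i * κ j ≡ 0# ⊎ M (i ℕ.+ j) ≡ 0#
      κκM-0 (suc i) (suc j) _ _ l l′ = xy≡0⇒x≡0⊎y≡0 _ _ (trans (sym (A-moment (suc i) (suc j) l l′)) (A-0 i j (s≤s l) (s≤s l′)))

      nbin-chain : ∀ i j → nbin m i ≡ 0# → nbin m (i ℕ.+ j) * nbin (i ℕ.+ j) i ≡ 0#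
      nbin-chain i j e = trans (sym (nat-* (bin m (i ℕ.+ j)) (bin (i ℕ.+ j) i))) (trans (cong nat (bin-chain m i j))
        (trans (nat-* (bin m i) (bin (m ∸ i) j)) (trans (cong (_* nbin (m ∸ i) j) e) (zeroˡ _))))

      nbin-vanish : ∀ i j → κ i ≡ 0# ⊎ κ j ≡ 0# → nbin m (i ℕ.+ j) * nbin (i ℕ.+ j) i ≡ 0#
      nbin-vanish i j (inj₁ p) = nbin-chain i j (κ-0⇒ i p)
      nbin-vanish i j (inj₂ p) = trans (cong (λ k → nbin m (i ℕ.+ j) * nat k) (bin-sym i j))
        (trans (cong (λ k → nbin m k * nbin k j) (ℕₚ.+-comm i j)) (nbin-chain j i (κ-0⇒ j p)))

      -- By `A-0` either M s or κᵢκⱼ is 0. The first kills A s 0. In the second case C(m,i) or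
      -- C(m,j) vanishes, hence so does C(m,s) C(s,i) = C(m,i) C(m-i,j), and C(m,s) is a factor of A
      -- s 0. So only additive powers contribute to f.
      vanish : ∀ i j s → i ℕ.+ j ≡ s → 0 < i → 0 < j → s ≤ m → A s 0 * nbin s i ≡ 0#
      vanish i j s refl i>0 j>0 l = trans (cong (_* nbin s i) (A-moment s 0 l z≤n))
        (trans (cong (λ k → (κ s * κ 0) * M k * nbin s i) (ℕₚ.+-identityʳ s)) (cases (κκM-0 i j i>0 j>0
          (ℕₚ.≤-trans (ℕₚ.m≤m+n i j) l) (ℕₚ.≤-trans (ℕₚ.m≤n+m j i) l))))
        where
        cases : κ i * κ j ≡ 0# ⊎ M s ≡ 0# → (κ s * κ 0) * M s * nbin s i ≡ 0#
        cases (inj₂ e) = trans (cong (λ z → (κ s * κ 0) * z * nbin s i) e) (trans (cong (_* nbin s i) (zeroʳ _)) (zeroˡ _))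
        cases (inj₁ e) = trans (solve 5 (λ b k c M n → ((b :* k) :* c) :* M :* n := (b :* n) :* (k :* c :* M)) refl (nbin m s) ((- 1#) ^ s) (κ 0) (M s) (nbin s i))
          (trans (cong (_* ((- 1#) ^ s * κ 0 * M s)) (nbin-vanish i j (xy≡0⇒x≡0⊎y≡0 _ _ e))) (zeroˡ _))

      additive : ∀ x y → f (x + y) ≡ f x + f y
      additive x y = *-cancelˡ -1≢0 (trans (step (x + y)) (trans (poly-additive c (suc m) c0 collapse x y)
        (trans (sym (cong₂ _+_ (step x) (step y))) (sym (distribˡ _ _ _)))))
        where
        -1≢0 : ¬ - 1# ≡ 0#
        -1≢0 e = 1≢0 (-x≡0⇒x≡0 e)
        c : ℕ → Carrier
        c i = two * A i 0
        step : ∀ u → - 1# * f u ≡ poly c (suc m) u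
        step u = trans (solve 1 (λ z → (:- con (+ 1)) :* z := :- z) refl (f u)) (trans (sym (at-0 u)) (sym (poly-* two (λ i → A i 0) (suc m) u)))
        c0 : c 0 ≡ 0#
        c0 = trans (sym (poly-at-0 c m)) (trans (sym (step 0#)) (trans (cong (- 1# *_) f0) (zeroʳ _)))
        collapse : ∀ i x y → suc i < suc m → c (suc i) * (x + y) ^ suc i ≡ c (suc i) * (x ^ suc i + y ^ suc i)
        collapse i x y (s≤s l) = binomial-collapse (c (suc i)) i (λ p q e → trans (*-assoc _ _ _) (trans (cong (two *_)
          (vanish (suc p) (suc q) (suc i) e (s≤s z≤n) (s≤s z≤n) l)) (zeroʳ _))) x y

  -- A map preserving X and fixing 0 and 1 is additive, and so is its conjugate by inversion; Hua's identity then makes it multiplicative.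
  module Unital (f : Carrier → Carrier) (f0 : f 0# ≡ 0#) (f1 : f 1# ≡ 1#) (pres : ∀ x y → X (f x - f y) ≡ X (x - y)) where
    open Preserving f f0 pres using (injective; additive)

    ψ : Carrier → Carrier
    ψ x = inv (f (inv x))

    opaque
      f≢0 : ∀ {x} → ¬ x ≡ 0# → ¬ f x ≡ 0#
      f≢0 nx e = nx (injective (trans e (sym f0)))

      X-f : ∀ x → X (f x) ≡ X x
      X-f x = trans (cong X (solve 1 (λ z → z := z :- con (+ 0)) refl (f x))) (trans (cong (λ z → X (f x - z)) (sym f0)) (trans (pres x 0#)
        (cong X (solve 1 (λ z → z :- con (+ 0) := z) refl x))))

      ψ0 : ψ 0# ≡ 0#
      ψ0 = trans (cong (inv ∘ f) inv-0) (trans (cong inv f0) inv-0)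

      X-ψ : ∀ x → X (ψ x) ≡ X x
      X-ψ x = trans (X-inv _) (trans (X-f _) (X-inv x))

      inv-diff : ∀ {p q} → ¬ p ≡ 0# → ¬ q ≡ 0# → inv p - inv q ≡ (q - p) * (inv p * inv q)
      inv-diff {p} {q} np nq = sym (trans (solve 4 (λ p q i j → (q :- p) :* (i :* j) := (q :* j) :* i :- (p :* i) :* j) refl p q (inv p) (inv q))
        (cong₂ _-_ (trans (cong (_* inv p) (inv-right nq)) (*-identityˡ _)) (trans (cong (_* inv q) (inv-right np)) (*-identityˡ _))))

      -- From p⁻¹ - q⁻¹ = (q - p) p⁻¹q⁻¹, used before and after applying f. It makes `Preserving`
      -- available for ψ.
      ψ-pres : ∀ x y → X (ψ x - ψ y) ≡ X (x - y)
      ψ-pres x y with x ≟ 0# | y ≟ 0#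
      ... | yes refl | _ = trans (cong (λ z → X (z - ψ y)) ψ0) (trans (cong X (lem (ψ y))) (trans (X-* _ _) (trans (cong (X (- 1#) *_) (X-ψ y))
              (trans (sym (X-* _ _)) (cong X (sym (lem y)))))))
        where
        lem : ∀ z → 0# - z ≡ - 1# * z
        lem = solve 1 (λ z → con (+ 0) :- z := (:- con (+ 1)) :* z) refl
      ... | no _ | yes refl = trans (cong (λ z → X (ψ x - z)) ψ0) (trans (cong X (lem (ψ x))) (trans (X-ψ x) (cong X (sym (lem x)))))
        where
        lem : ∀ z → z - 0# ≡ z
        lem = solve 1 (λ z → z :- con (+ 0) := z) refl
      ... | no nx | no ny = trans (cong X (inv-diff (f≢0 (inv≢0 nx)) (f≢0 (inv≢0 ny))))
            (trans (trans (X-* _ _) (cong₂ _*_ (pres _ _) (trans (X-* _ _) (cong₂ _*_ (X-ψ x) (X-ψ y)))))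
            (trans (cong (_* (X x * X y)) (trans (cong X (inv-diff ny nx)) (trans (X-* _ _) (cong (X (x - y) *_) (trans (X-* _ _) (cong₂ _*_ (X-inv y) (X-inv x)))))))
            (trans (solve 3 (λ d p q → (d :* (q :* p)) :* (p :* q) := d :* ((p :* p) :* (q :* q))) refl (X (x - y)) (X x) (X y))
            (trans (cong₂ (λ p q → X (x - y) * (p * q)) (X² nx) (X² ny)) (solve 1 (λ d → d :* (con (+ 1) :* con (+ 1)) := d) refl _)))))

    module Ψ = Preserving ψ ψ0 ψ-pres

    opaque
      neg-f : ∀ x → f (- x) ≡ - f x
      neg-f x = trans (solve 2 (λ p q → p := (q :+ p) :- q) refl (f (- x)) (f x)) (trans (cong (λ z → z - f x) (trans (sym (additive x (- x))) (trans (cong f (-‿inverseʳ x)) f0)))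
        (+-identityˡ _))

      -- Let y = x(1 - x), so that y⁻¹ = x⁻¹ + (1 - x)⁻¹. Additivity of ψ gives f y = f x (1 - f x),
      -- additivity of f gives f y = f x - f(x²).
      square : ∀ x → f (x * x) ≡ f x * f x
      square x with x ≟ 0# | x ≟ 1#
      ... | yes refl | _ = trans (cong f (zeroˡ _)) (trans f0 (sym (trans (cong (_* f 0#) f0) (zeroˡ _))))
      ... | no _ | yes refl = trans (cong f (*-identityˡ _)) (trans f1 (sym (trans (cong₂ _*_ f1 f1) (*-identityˡ _))))
      ... | no nx | no n1 = trans (solve 2 (λ p q → p := q :- (q :- p)) refl (f (x * x)) (f x))
            (trans (cong (λ z → f x - z) (trans (sym fx-x²) fy≡)) (solve 1 (λ p → p :- p :* (con (+ 1) :- p) := p :* p) refl (f x)))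
        where
        y : Carrier
        y = x * (1# - x)
        1-x≢0 : ¬ 1# - x ≡ 0#
        1-x≢0 = x≢y⇒x-y≢0 (n1 ∘ sym)
        f1-x : f (1# - x) ≡ 1# - f x
        f1-x = trans (additive 1# (- x)) (cong₂ _+_ f1 (neg-f x))
        fx-x² : f y ≡ f x - f (x * x)
        fx-x² = trans (cong f (solve 1 (λ x → x :* (con (+ 1) :- x) := x :+ (:- (x :* x))) refl x)) (trans (additive _ _) (cong (λ z → f x + z) (neg-f _)))
        hua : ∀ {z} → ¬ z ≡ 0# → ¬ 1# - z ≡ 0# → inv (z * (1# - z)) ≡ inv z + inv (1# - z)
        hua {z} nz nz′ = inv-unique (trans (solve 3 (λ z i j → (z :* (con (+ 1) :- z)) :* (i :+ j) := (con (+ 1) :- z) :* (z :* i) :+ z :* ((con (+ 1) :- z) :* j)) refl z (inv z) (inv (1# - z)))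
          (trans (cong₂ (λ p q → (1# - z) * p + z * q) (inv-right nz) (inv-right nz′)) (solve 1 (λ z → (con (+ 1) :- z) :* con (+ 1) :+ z :* con (+ 1) := con (+ 1)) refl z)))
        ψ-inv : ∀ z → ψ (inv z) ≡ inv (f z)
        ψ-inv z = cong (inv ∘ f) (inv-inv z)
        fy≡ : f y ≡ f x * (1# - f x)
        fy≡ = trans (sym (inv-inv _)) (trans (cong inv (trans (sym (ψ-inv y)) (trans (cong ψ (hua nx 1-x≢0)) (trans (Ψ.additive _ _)
          (trans (cong₂ _+_ (ψ-inv x) (trans (ψ-inv _) (cong inv f1-x))) (sym (hua (f≢0 nx) (subst (λ z → ¬ z ≡ 0#) f1-x (f≢0 1-x≢0)))))))))
          (inv-inv _))

      -- Polarisation: 2xy = (x + y)² - x² - y².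
      multiplicative : ∀ x y → f (x * y) ≡ f x * f y
      multiplicative x y = two*-cancel (trans (sym (additive _ _)) (trans (cong f (solve 2 (λ x y → x :* y :+ x :* y := (x :+ y) :* (x :+ y) :+ (:- (x :* x :+ y :* y))) refl x y))
        (trans (additive _ _) (trans (cong₂ _+_ (trans (square (x + y)) (cong₂ _*_ (additive x y) (additive x y))) (trans (neg-f _) (cong -_ (trans (additive _ _) (cong₂ _+_ (square x) (square y))))))
        (solve 2 (λ p q → (p :+ q) :* (p :+ q) :+ (:- (p :* p :+ q :* q)) := p :* q :+ p :* q) refl (f x) (f y))))))

      isFieldAut : IsFieldAut F f
      isFieldAut = injective⇒bijective injective , additive , multiplicative , f1

  opaque
    carlitz : ∀ (f : Carrier → Carrier) → (∀ x y → X (f x - f y) ≡ X (x - y)) →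
      Σ Carrier λ l → Σ Carrier λ μ → Σ (Carrier → Carrier) λ α → S l × IsFieldAut F α × (∀ x → f x ≡ l * α x + μ)
    carlitz f pres = l , f 0# , α , Sl , Unital.isFieldAut α α0 α1 α-pres , spec
      where
      l : Carrier
      l = f 1# - f 0#
      α : Carrier → Carrier
      α x = inv l * (f x - f 0#)
      Sl : S l
      Sl = trans (pres 1# 0#) (trans (cong X (solve 0 (con (+ 1) :- con (+ 0) := con (+ 1)) refl)) S-1)
      α0 : α 0# ≡ 0#
      α0 = trans (cong (inv l *_) (-‿inverseʳ _)) (zeroʳ _)
      α1 : α 1# ≡ 1#
      α1 = inv-left (S≢0 Sl)
      α-pres : ∀ x y → X (α x - α y) ≡ X (x - y)
      α-pres x y = trans (cong X (solve 4 (λ i p q r → i :* (p :- r) :- i :* (q :- r) := i :* (p :- q)) refl (inv l) (f x) (f y) (f 0#)))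
        (trans (X-* _ _) (trans (cong₂ _*_ (S-inv Sl) (pres x y)) (*-identityˡ _)))
      spec : ∀ x → f x ≡ l * α x + f 0#
      spec x = sym (trans (cong (_+ f 0#) (trans (sym (*-assoc _ _ _)) (trans (cong (_* (f x - f 0#)) (inv-right (S≢0 Sl))) (*-identityˡ _))))
        (solve 2 (λ p q → (p :- q) :+ q := p) refl (f x) (f 0#)))

-- Automorphisms of Q_{a,b}, double transitivity and lines.

module Quasi (F : FiniteField) (odd : FiniteField.size F % 2 ≡ 1) where
  open Signs F odd

  opaque
    op-view : ∀ a b x y → (op a b x y ≡ x + a * (y - x) × (y ≡ x ⊎ S (y - x))) ⊎ (op a b x y ≡ x + b * (y - x) × N (y - x))
    op-view a b x y with sign (y - x)
    ... | zer e = inj₁ (trans (cong (op a b x) (x-y≡0⇒x≡y e)) (trans (op-refl a b x) (sym (trans (cong (λ z → x + a * z) e) (solve 2 (λ x a → x :+ a :* con (+ 0) := x) refl x a)))) , inj₁ (x-y≡0⇒x≡y e))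
    ... | pos s = inj₁ (op-S a b s , inj₂ s)
    ... | neg n = inj₂ (op-N a b n , n)

    op-affine : ∀ a b {s} μ x y → S s → op a b (s * x + μ) (s * y + μ) ≡ s * op a b x y + μ
    op-affine a b {s} μ x y Ss with sign (y - x)
    ... | zer e = trans (cong (λ z → op a b (s * x + μ) (s * z + μ)) (x-y≡0⇒x≡y e)) (trans (op-refl a b _) (cong (λ z → s * z + μ)
          (sym (trans (cong (op a b x) (x-y≡0⇒x≡y e)) (op-refl a b x)))))
    ... | pos p = trans (op-S a b (subst S (sym diff) (SS Ss p))) (trans (cong (λ z → s * x + μ + a * z) diff)
          (trans (solve 5 (λ s x μ a d → s :* x :+ μ :+ a :* (s :* d) := s :* (x :+ a :* d) :+ μ) refl s x μ a (y - x)) (cong (λ z → s * z + μ) (sym (op-S a b p)))))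
      where
      diff : (s * y + μ) - (s * x + μ) ≡ s * (y - x)
      diff = solve 4 (λ s x y μ → (s :* y :+ μ) :- (s :* x :+ μ) := s :* (y :- x)) refl s x y μ
    ... | neg p = trans (op-N a b (subst N (sym diff) (SN Ss p))) (trans (cong (λ z → s * x + μ + b * z) diff)
          (trans (solve 5 (λ s x μ a d → s :* x :+ μ :+ a :* (s :* d) := s :* (x :+ a :* d) :+ μ) refl s x μ b (y - x)) (cong (λ z → s * z + μ) (sym (op-N a b p)))))
      where
      diff : (s * y + μ) - (s * x + μ) ≡ s * (y - x)
      diff = solve 4 (λ s x y μ → (s :* y :+ μ) :- (s :* x :+ μ) := s :* (y :- x)) refl s x y μ

    -- A nonsquare factor interchanges the two branches, so it is an isomorphism from Q_{b,a} to
    -- Q_{a,b}. It transfers results about a to b, and later yields the reversing automorphisms.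
    op-twist : ∀ a b {ν} x y → N ν → op a b (ν * x) (ν * y) ≡ ν * op b a x y
    op-twist a b {ν} x y Nν with sign (y - x)
    ... | zer e = trans (cong (λ z → op a b (ν * x) (ν * z)) (x-y≡0⇒x≡y e)) (trans (op-refl a b _) (cong (ν *_)
          (sym (trans (cong (op b a x) (x-y≡0⇒x≡y e)) (op-refl b a x)))))
    ... | pos p = trans (op-N a b (subst N (sym diff) (NS Nν p))) (trans (cong (λ z → ν * x + b * z) diff)
          (trans (solve 4 (λ s x a d → s :* x :+ a :* (s :* d) := s :* (x :+ a :* d)) refl ν x b (y - x)) (cong (ν *_) (sym (op-S b a p)))))
      where
      diff : ν * y - ν * x ≡ ν * (y - x)
      diff = solve 3 (λ s x y → s :* y :- s :* x := s :* (y :- x)) refl ν x y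
    ... | neg p = trans (op-S a b (subst S (sym diff) (NN Nν p))) (trans (cong (λ z → ν * x + a * z) diff)
          (trans (solve 4 (λ s x a d → s :* x :+ a :* (s :* d) := s :* (x :+ a :* d)) refl ν x a (y - x)) (cong (ν *_) (sym (op-N b a p)))))
      where
      diff : ν * y - ν * x ≡ ν * (y - x)
      diff = solve 3 (λ s x y → s :* y :- s :* x := s :* (y :- x)) refl ν x y

    aut-injective : ∀ {a b g} → Aut a b g → ∀ {x y} → g x ≡ g y → x ≡ y
    aut-injective (inj , _) = inj

    mkAut : ∀ {a b g} → (∀ {x y} → g x ≡ g y → x ≡ y) → (∀ x y → g (op a b x y) ≡ op a b (g x) (g y)) → Aut a b g
    mkAut inj hom = inj , hom

    affine-injective : ∀ {s μ} → ¬ s ≡ 0# → ∀ {x y} → s * x + μ ≡ s * y + μ → x ≡ y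
    affine-injective ns e = *-cancelˡ ns (+-cancelʳ _ _ _ e)

    affine-aut : ∀ a b {s} μ → S s → Aut a b (λ z → s * z + μ)
    affine-aut a b μ Ss = mkAut (affine-injective (S≢0 Ss)) (λ x y → sym (op-affine a b μ x y Ss))

    ∘-aut : ∀ {a b g h} → Aut a b g → Aut a b h → Aut a b (g ∘ h)
    ∘-aut {g = g} ig ih = mkAut (aut-injective ih ∘ aut-injective ig) (λ x y → trans (cong g (proj₂ ih x y)) (proj₂ ig _ _))

    id-aut : ∀ {a b} → Aut a b (λ z → z)
    id-aut = mkAut (λ e → e) (λ _ _ → refl)

  inverseOf : ∀ {a b g} → Aut a b g → Carrier → Carrier
  inverseOf (inj , _) y = proj₁ (injective⇒surjective inj y)

  opaque
    inverse-right : ∀ {a b g} (ig : Aut a b g) y → g (inverseOf ig y) ≡ y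
    inverse-right (inj , _) y = proj₂ (injective⇒surjective inj y)

    inverse-left : ∀ {a b g} (ig : Aut a b g) x → inverseOf ig (g x) ≡ x
    inverse-left ig x = aut-injective ig (inverse-right ig _)

    inverse-aut : ∀ {a b g} (ig : Aut a b g) → Aut a b (inverseOf ig)
    inverse-aut {a} {b} {g} ig = mkAut (λ {x} {y} e → trans (sym (inverse-right ig x)) (trans (cong g e) (inverse-right ig y)))
      (λ x y → aut-injective ig (trans (inverse-right ig _) (sym (trans (proj₂ ig _ _) (cong₂ (op a b) (inverse-right ig x) (inverse-right ig y))))))

    ν-conj-cancel : ∀ {ν} → ¬ ν ≡ 0# → ∀ z → ν * (inv ν * z) ≡ z
    ν-conj-cancel nν z = trans (sym (*-assoc _ _ _)) (trans (cong (_* z) (inv-right nν)) (*-identityˡ z))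

    ν-conj-cancel′ : ∀ {ν} → ¬ ν ≡ 0# → ∀ z → inv ν * (ν * z) ≡ z
    ν-conj-cancel′ nν z = trans (sym (*-assoc _ _ _)) (trans (cong (_* z) (inv-left nν)) (*-identityˡ z))

    twist-aut : ∀ {a b g ν} → N ν → Aut a b g → Aut b a (λ z → inv ν * g (ν * z))
    twist-aut {a} {b} {g} {ν} Nν ig = mkAut (*-cancelˡ (N≢0 Nν) ∘ aut-injective ig ∘ *-cancelˡ (inv≢0 (N≢0 Nν)))
      (λ x y → trans (cong (λ z → inv ν * g z) (sym (op-twist a b x y Nν))) (trans (cong (inv ν *_) (proj₂ ig _ _)) (sym (op-twist b a _ _ (N-inv Nν)))))

    ratio-S : ∀ {p q} → ¬ p ≡ 0# → X q ≡ X p → S (q * inv p)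
    ratio-S {p} {q} np e = trans (X-* _ _) (trans (cong (_* X (inv p)) e) (trans (sym (X-* _ _)) (trans (cong X (inv-right np)) S-1)))

    hom-pair : ∀ {x y x′ y′} → ¬ x ≡ y → X (y′ - x′) ≡ X (y - x) →
      Σ[ s ∈ Carrier ] Σ[ μ ∈ Carrier ] S s × s * x + μ ≡ x′ × s * y + μ ≡ y′
    hom-pair {x} {y} {x′} {y′} ne e = s , x′ - s * x , ratio-S nd e , solve 3 (λ s x x′ → s :* x :+ (x′ :- s :* x) := x′) refl s x x′ ,
      trans (solve 4 (λ s x y x′ → s :* y :+ (x′ :- s :* x) := s :* (y :- x) :+ x′) refl s x y x′)
      (trans (cong (_+ x′) (trans (*-assoc _ _ _) (trans (cong ((y′ - x′) *_) (inv-left nd)) (*-identityʳ _)))) (solve 2 (λ p q → (p :- q) :+ q := p) refl y′ x′))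
      where
      nd : ¬ y - x ≡ 0#
      nd = x≢y⇒x-y≢0 (ne ∘ sym)
      s : Carrier
      s = (y′ - x′) * inv (y - x)

  TwoTransitive : Carrier → Carrier → Set
  TwoTransitive a b = ∀ x y x′ y′ → ¬ x ≡ y → ¬ x′ ≡ y′ → Σ[ g ∈ (Carrier → Carrier) ] Aut a b g × g x ≡ x′ × g y ≡ y′

  opaque
    X≢⇒- : ∀ {p q} → ¬ p ≡ 0# → ¬ q ≡ 0# → ¬ X p ≡ X q → X p ≡ - X q
    X≢⇒- {p} {q} np nq ne with x²≡y²⇒x≡y⊎x≡-y (X p) (X q) (trans (X² np) (sym (X² nq)))
    ... | inj₁ e = ⊥-elim (ne e)
    ... | inj₂ e = e

    -- Affine maps of square slope join any two pairs whose differences have the same character. A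
    -- change of character is made by f if the pair x₀, y₀ has the character of x, y, and by its
    -- inverse otherwise.
    flip⇒twoTransitive : ∀ {a b f} → Aut a b f → ∀ x₀ y₀ → ¬ X (f y₀ - f x₀) ≡ X (y₀ - x₀) → TwoTransitive a b
    flip⇒twoTransitive {a} {b} {f} af x₀ y₀ flip x y x′ y′ ne ne′ = cases (X (y′ - x′) ≟ X (y - x)) (X (y₀ - x₀) ≟ X (y - x))
      where
      d≢0 : ¬ y - x ≡ 0#
      d≢0 = x≢y⇒x-y≢0 (ne ∘ sym)
      d′≢0 : ¬ y′ - x′ ≡ 0#
      d′≢0 = x≢y⇒x-y≢0 (ne′ ∘ sym)
      ne₀ : ¬ x₀ ≡ y₀
      ne₀ refl = flip (cong X (trans (-‿inverseʳ _) (sym (-‿inverseʳ _))))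
      d₀≢0 : ¬ y₀ - x₀ ≡ 0#
      d₀≢0 = x≢y⇒x-y≢0 (ne₀ ∘ sym)
      nef : ¬ f x₀ ≡ f y₀
      nef e = ne₀ (aut-injective af e)
      df≢0 : ¬ f y₀ - f x₀ ≡ 0#
      df≢0 = x≢y⇒x-y≢0 (nef ∘ sym)
      flip′ : X (f y₀ - f x₀) ≡ - X (y₀ - x₀)
      flip′ = X≢⇒- df≢0 d₀≢0 flip
      cases : Dec (X (y′ - x′) ≡ X (y - x)) → Dec (X (y₀ - x₀) ≡ X (y - x)) → Σ[ g ∈ (Carrier → Carrier) ] Aut a b g × g x ≡ x′ × g y ≡ y′
      cases (yes e) _ with hom-pair ne e
      ... | (s , μ , Ss , ex , ey) = _ , affine-aut a b μ Ss , ex , ey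
      cases (no n) (yes e₀) with hom-pair ne e₀ | hom-pair nef (trans (X≢⇒- d′≢0 d≢0 n) (trans (cong -_ (sym e₀)) (sym flip′)))
      ... | (s , μ , Ss , ex , ey) | (s′ , μ′ , Ss′ , ex′ , ey′) = _ , ∘-aut (affine-aut a b μ′ Ss′) (∘-aut af (affine-aut a b μ Ss)) ,
            trans (cong (λ z → s′ * f z + μ′) ex) ex′ , trans (cong (λ z → s′ * f z + μ′) ey) ey′
      cases (no n) (no n₀) with hom-pair ne (trans flip′ (trans (cong -_ (X≢⇒- d₀≢0 d≢0 n₀)) (-‿involutive _)))
                              | hom-pair ne₀ (trans (X≢⇒- d′≢0 d≢0 n) (sym (X≢⇒- d₀≢0 d≢0 n₀)))
      ... | (s , μ , Ss , ex , ey) | (s′ , μ′ , Ss′ , ex′ , ey′) = _ , ∘-aut (affine-aut a b μ′ Ss′) (∘-aut (inverse-aut af) (affine-aut a b μ Ss)) ,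
            trans (cong (λ z → s′ * z + μ′) (trans (cong (inverseOf af) ex) (inverse-left af x₀))) ex′ ,
            trans (cong (λ z → s′ * z + μ′) (trans (cong (inverseOf af) ey) (inverse-left af y₀))) ey′

    twist-twoTransitive : ∀ {a b} → TwoTransitive a b → TwoTransitive b a
    twist-twoTransitive 2-trans x y x′ y′ ne ne′ with 2-trans (ν * x) (ν * y) (ν * x′) (ν * y′) (ne ∘ *-cancelˡ nν) (ne′ ∘ *-cancelˡ nν)
      where
      ν : Carrier
      ν = proj₁ nonsquare
      nν : ¬ ν ≡ 0#
      nν = N≢0 (proj₂ nonsquare)
    ... | (g , ig , ex , ey) = _ , twist-aut (proj₂ nonsquare) ig ,
      trans (cong (inv (proj₁ nonsquare) *_) ex) (ν-conj-cancel′ (N≢0 (proj₂ nonsquare)) x′) ,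
      trans (cong (inv (proj₁ nonsquare) *_) ey) (ν-conj-cancel′ (N≢0 (proj₂ nonsquare)) y′)

  Line : (a b x y z : Carrier) → Set
  Line a b x y z = ∀ g → Aut a b g → g x ≡ x → g y ≡ y → g z ≡ z

  module Lines (a b : Carrier) where
    private
      _∗_ : Carrier → Carrier → Carrier
      _∗_ = op a b

    opaque
      line-l : ∀ {x y} → Line a b x y x
      line-l g ig ex ey = ex

      line-r : ∀ {x y} → Line a b x y y
      line-r g ig ex ey = ey

      line-op : ∀ {x y u v} → Line a b x y u → Line a b x y v → Line a b x y (u ∗ v)
      line-op lu lv g ig ex ey = trans (proj₂ ig _ _) (cong₂ _∗_ (lu g ig ex ey) (lv g ig ex ey))

      line-trans : ∀ {x y u v w} → Line a b x y u → Line a b x y v → Line a b u v w → Line a b x y w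
      line-trans lu lv lw g ig ex ey = lw g ig (lu g ig ex ey) (lv g ig ex ey)

      line-agree : ∀ {x y z g h} → Aut a b g → Aut a b h → g x ≡ h x → g y ≡ h y → Line a b x y z → g z ≡ h z
      line-agree {x} {y} {z} {g} {h} ig ih ex ey lz = trans (sym (inverse-right ih (g z))) (cong h (lz _ (∘-aut (inverse-aut ih) ig)
        (trans (cong (inverseOf ih) ex) (inverse-left ih x)) (trans (cong (inverseOf ih) ey) (inverse-left ih y))))

      line-image : ∀ {x y z f} → Aut a b f → Line a b x y z → Line a b (f x) (f y) (f z)
      line-image {x} {y} {z} {f} af lz g ig ex ey = line-agree {x = x} {y = y} (∘-aut ig af) af ex ey lz

      -- An automorphism g taking x, y to u, v maps the line of x, y to that of u, v, which is
      -- contained in it. So g acts on the line of x, y, and w is the g-image of a point of its own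
      -- orbit.
      line-change : TwoTransitive a b → ∀ {x y u v w} → ¬ x ≡ y → ¬ u ≡ v → Line a b x y u → Line a b x y v → Line a b x y w → Line a b u v w
      line-change 2-trans {x} {y} {u} {v} {w} ne ne′ lu lv lw with 2-trans x y u v ne ne′
      ... | (g , ig , refl , refl) = subst (Line a b u v) (proj₂ ret) (image (orbit (proj₁ ret)))
        where
        ret : ∃[ k ] iter g (suc k) w ≡ w
        ret = iter-returns (aut-injective ig) w
        image : ∀ {z} → Line a b x y z → Line a b u v (g z)
        image = line-image ig
        orbit : ∀ k → Line a b x y (iter g k w)
        orbit zero = lw
        orbit (suc k) = line-trans lu lv (image (orbit k))

    module _ (2-trans : TwoTransitive a b) where
      private
        L : Carrier → Set
        L = Line a b 0# 1#

      opaque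
        -- Multiplication by r takes the line through 0 and u to the line through 0 and ru, and both
        -- coincide with L.
        scale-closed : ∀ {r u z} → S r → L u → ¬ u ≡ 0# → L (r * u) → L z → L (r * z)
        scale-closed {r} {u} {z} Sr lu nu lru lz = line-trans line-l lru (subst₂ (λ p q → Line a b p q (r * z)) (eq0) (eqr u)
          (subst (Line a b _ _) (eqr z) (line-image (affine-aut a b 0# Sr) (line-change 2-trans 0≢1 (nu ∘ sym) line-l lu lz))))
          where
          eqr : ∀ w → r * w + 0# ≡ r * w
          eqr w = +-identityʳ _
          eq0 : r * 0# + 0# ≡ 0#
          eq0 = trans (+-identityʳ _) (zeroʳ r)

        affine-closed : ∀ {r c} → S r → ¬ c ≡ r + c → L c → L (r + c) → ∀ {z} → L z → L (r * z + c)
        affine-closed {r} {c} Sr ne lc lrc {z} lz = line-trans lc lrc (subst₂ (λ p q → Line a b p q (r * z + c))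
          (solve 2 (λ r c → r :* con (+ 0) :+ c := c) refl r c) (solve 2 (λ r c → r :* con (+ 1) :+ c := r :+ c) refl r c)
          (line-image (affine-aut a b c Sr) lz))

        affine-closed⁻ : ∀ {r c} → S r → ¬ c ≡ r + c → L c → L (r + c) → ∀ {z} → L z → L (inv r * z + - (inv r * c))
        affine-closed⁻ {r} {c} Sr ne lc lrc {z} lz = subst₂ (λ p q → Line a b p q (inv r * z + - (inv r * c)))
          (-‿inverseʳ _) (trans (solve 3 (λ i r c → i :* (r :+ c) :+ (:- (i :* c)) := i :* r) refl (inv r) r c) (inv-left (S≢0 Sr)))
          (line-image (affine-aut a b (- (inv r * c)) (S-inv Sr)) (line-change 2-trans 0≢1 ne lc lrc lz))

      Period : Carrier → Set
      Period μ = ∀ z → L z → L (z + μ)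

      opaque
        period-neg : ∀ {μ} → Period μ → Period (- μ)
        period-neg {μ} t z lz = subst L eq (orbit k)
          where
          ret : ∃[ k ] iter (_+ μ) (suc k) z ≡ z
          ret = iter-returns (λ {x} {y} e → +-cancelʳ μ x y e) z
          k : ℕ
          k = proj₁ ret
          orbit : ∀ k → L (iter (_+ μ) k z)
          orbit zero = lz
          orbit (suc k) = t _ (orbit k)
          eq : iter (_+ μ) k z ≡ z + - μ
          eq = trans (solve 2 (λ p q → p := (p :+ q) :+ (:- q)) refl (iter (_+ μ) k z) μ) (cong (_+ - μ) (proj₂ ret))

        period-scale : ∀ {r u μ} → S r → L u → ¬ u ≡ 0# → L (r * u) → Period μ → Period (r * μ)
        period-scale {r} {u} {μ} Sr lu nu lru t z lz = subst L (trans (solve 4 (λ r i z μ → r :* (i :* z :+ μ) := (r :* i) :* z :+ r :* μ) refl r (inv r) z μ)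
            (cong (_+ r * μ) (trans (cong (_* z) (inv-right nr)) (*-identityˡ z))))
          (scale-closed Sr lu nu lru (t _ (scale-closed (S-inv Sr) lru (xy≢0 nr nu) (subst L (sym (ν-conj-cancel′ nr u)) lu) lz)))
          where
          nr : ¬ r ≡ 0#
          nr = S≢0 Sr

        period-1⇒two : Period 1# → L two
        period-1⇒two t = t _ line-r

        -- The commutator of z ↦ sz and z ↦ rz + c, both of which preserve L, is the translation by
        -- (s - 1)c.
        shift : ∀ {s r c} → L s → S s → S r → ¬ c ≡ r + c → L c → L (r + c) → Period ((s - 1#) * c)
        shift {s} {r} {c} ls Ss Sr ne lc lrc z lz = subst L eq
          (scale-closed Ss line-r 1≢0 (subst L (sym (*-identityʳ s)) ls)
          (affine-closed Sr ne lc lrc (scale-closed (S-inv Ss) ls (S≢0 Ss) (subst L (sym (inv-left (S≢0 Ss))) line-r) (affine-closed⁻ Sr ne lc lrc lz))))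
          where
          eq : s * (r * (inv s * (inv r * z + - (inv r * c))) + c) ≡ z + (s - 1#) * c
          eq = trans (solve 6 (λ s r i j z c → s :* (r :* (i :* (j :* z :+ (:- (j :* c)))) :+ c) := (s :* i) :* (r :* j) :* (z :- c) :+ s :* c) refl s r (inv s) (inv r) z c)
            (trans (cong₂ (λ p q → p * q * (z - c) + s * c) (inv-right (S≢0 Ss)) (inv-right (S≢0 Sr)))
            (solve 3 (λ s z c → con (+ 1) :* con (+ 1) :* (z :- c) :+ s :* c := z :+ (s :- con (+ 1)) :* c) refl s z c))

        -- It suffices that 1 is a period. If μ is a square, scale L by μ⁻¹. Otherwise run through
        -- the orbit of 0 under φ; each t in it is a period until 1 is found to be one. If 1 + t is
        -- a square, scaling by it makes φ t a period. If 1 + t is a nonsquare, scaling by (1 + t)/μ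
        -- makes 1 + t a period, hence also 1. If 1 + t = 0, then -1 is a period; this must happen
        -- in the end, as the orbit returns to 0.
        translation⇒two : ∀ {μ} → ¬ μ ≡ 0# → Period μ → L two
        translation⇒two {μ} nμ t = period-1⇒two (cases (S⊎N nμ))
          where
          lμ : L μ
          lμ = subst L (+-identityˡ μ) (t _ line-l)
          φ : Carrier → Carrier
          φ t = μ * (1# + t)
          φ-inj : ∀ {x y} → φ x ≡ φ y → x ≡ y
          φ-inj e = +-cancelˡ 1# _ _ (*-cancelˡ nμ e)
          period-1 : ∀ {t} → Period t → 1# + t ≡ 0# → Period 1#
          period-1 {t} Tt e = λ z lz → subst (λ w → L (z + w)) (trans (solve 1 (λ t → :- t := con (+ 1) :- (con (+ 1) :+ t)) refl t)
            (trans (cong (λ w → 1# - w) e) (solve 0 (con (+ 1) :- con (+ 0) := con (+ 1)) refl))) (period-neg Tt z lz)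
          orbit : N μ → ∀ k → Period (iter φ k 0#) ⊎ Period 1#
          orbit Nμ zero = inj₁ (λ z lz → subst L (sym (+-identityʳ z)) lz)
          orbit Nμ (suc k) with orbit Nμ k
          ... | inj₂ p = inj₂ p
          ... | inj₁ Tt = go (sign (1# + iter φ k 0#))
            where
            tk : Carrier
            tk = iter φ k 0#
            l1t : L (1# + tk)
            l1t = Tt _ line-r
            go : SignOf (1# + tk) → Period (φ tk) ⊎ Period 1#
            go (zer e) = inj₂ (period-1 Tt e)
            go (pos s) = inj₁ (λ z lz → subst (λ w → L (z + w)) (*-comm _ _) (period-scale s line-r 1≢0 (subst L (sym (*-identityʳ _)) l1t) t z lz))
            go (neg n) = inj₂ (λ z lz → subst L (solve 2 (λ z t → (z :+ (con (+ 1) :+ t)) :+ (:- t) := z :+ con (+ 1)) refl z tk)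
              (period-neg Tt _ (subst (λ w → L (z + w)) req (period-scale (NN n (N-inv Nμ)) lμ nμ (subst L (sym req) l1t) t z lz))))
              where
              req : (1# + tk) * inv μ * μ ≡ 1# + tk
              req = trans (*-assoc _ _ _) (trans (cong ((1# + tk) *_) (inv-left nμ)) (*-identityʳ _))
          cases : S μ ⊎ N μ → Period 1#
          cases (inj₁ s) = λ z lz → subst (λ w → L (z + w)) (inv-left nμ) (period-scale (S-inv s) lμ nμ (subst L (sym (inv-left nμ)) line-r) t z lz)
          cases (inj₂ n) with iter-returns φ-inj 0#
          ... | (k , e) with orbit n k
          ...   | inj₂ p = p
          ...   | inj₁ Tt with xy≡0⇒x≡0⊎y≡0 μ _ e
          ...     | inj₁ z = ⊥-elim (nμ z)
          ...     | inj₂ z = period-1 Tt z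

        line-op01 : L a
        line-op01 = subst L (trans (op-S a b (subst S (sym 1-0) S-1)) (trans (cong (λ z → 0# + a * z) 1-0) (solve 1 (λ a → con (+ 0) :+ a :* con (+ 1) := a) refl a))) (line-op line-l line-r)
          where
          1-0 : 1# - 0# ≡ 1#
          1-0 = solve 0 (con (+ 1) :- con (+ 0) := con (+ 1)) refl

        -- `shift` asks for a map z ↦ rz + c with r a square, c ≠ 0, and c, r + c on L. The pairs 1,
        -- 0 and 1, a and a, 1 have the slopes -1, a - 1 and 1 - a, one of which is a square.
        square⇒two : ¬ a ≡ 0# → ¬ a ≡ 1# → ∀ {s} → L s → S s → ¬ s ≡ 1# → L two
        square⇒two a≢0 a≢1 {s} ls Ss s≢1 = cases (S⊎N {x = - 1#} (λ e → 1≢0 (-x≡0⇒x≡0 e))) (S⊎N (x≢y⇒x-y≢0 a≢1))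
          where
          finish : ∀ {r c} → S r → ¬ c ≡ 0# → L c → L (r + c) → L two
          finish {r} {c} Sr nc lc lrc = translation⇒two (xy≢0 (x≢y⇒x-y≢0 s≢1) nc) (shift ls Ss Sr
            (λ e → S≢0 Sr (+-cancelʳ c r 0# (trans (sym e) (sym (+-identityˡ c))))) lc lrc)
          cases : S (- 1#) ⊎ N (- 1#) → S (a - 1#) ⊎ N (a - 1#) → L two
          cases (inj₁ p) _ = finish p 1≢0 line-r (subst L (sym (-‿inverseˡ 1#)) line-l)
          cases (inj₂ n) (inj₁ p) = finish p 1≢0 line-r (subst L (solve 1 (λ a → a := (a :- con (+ 1)) :+ con (+ 1)) refl a) line-op01)
          cases (inj₂ n) (inj₂ n′) = finish (subst S (solve 1 (λ a → (:- con (+ 1)) :* (a :- con (+ 1)) := con (+ 1) :- a) refl a) (NN n n′)) a≢0 line-op01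
            (subst L (solve 1 (λ a → con (+ 1) := (con (+ 1) :- a) :+ a) refl a) line-r)

        -- The alternative is the case in which the operation is that of a Steiner triple system.
        two⊎netto : ¬ a ≡ 0# → ¬ a ≡ 1# → ¬ b ≡ 0# → ¬ b ≡ 1# → X a ≡ X b → L two ⊎ (a * b ≡ 1# × a + b ≡ 1# × N a × N (- 1#))
        two⊎netto a≢0 a≢1 b≢0 b≢1 ab = cases (S⊎N a≢0)
          where
          by : ∀ {s} → L s → S s → ¬ s ≡ 1# → L two ⊎ (a * b ≡ 1# × a + b ≡ 1# × N a × N (- 1#))
          by ls Ss n = inj₁ (square⇒two a≢0 a≢1 ls Ss n)
          1-c≢1 : ∀ {c} → ¬ c ≡ 0# → ¬ 1# - c ≡ 1#
          1-c≢1 {c} nc e = nc (trans (solve 1 (λ c → c := con (+ 1) :- (con (+ 1) :- c)) refl c) (x≡y⇒x-y≡0 (sym e)))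
          -0# : ∀ x → x - 0# ≡ x
          -0# = solve 1 (λ x → x :- con (+ 0) := x) refl
          0-1 : 0# - 1# ≡ - 1#
          0-1 = solve 0 (con (+ 0) :- con (+ 1) := :- con (+ 1)) refl
          cases : S a ⊎ N a → L two ⊎ (a * b ≡ 1# × a + b ≡ 1# × N a × N (- 1#))
          cases (inj₁ Sa) = by line-op01 Sa a≢1
          -- Now 0 ∗ a = ab is a square on L.
          cases (inj₂ Na) with a * b ≟ 1#
          ... | no ab≢1 = by (subst L (trans (op-N a b (subst N (sym (-0# a)) Na)) (trans (cong (λ z → 0# + b * z) (-0# a)) (solve 2 (λ a b → con (+ 0) :+ b :* a := a :* b) refl a b)))
                (line-op line-l line-op01)) (NN Na (trans (sym ab) Na)) ab≢1
          ... | yes ab≡1 = cases′ (S⊎N {x = - 1#} (λ e → 1≢0 (-x≡0⇒x≡0 e)))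
            where
            ratio : ∀ {c} → L (1# - c) → N (1# - c) → ¬ (1# - c) * inv a ≡ 1# → L two ⊎ (a * b ≡ 1# × a + b ≡ 1# × N a × N (- 1#))
            ratio {c} lc Nc ne = by (subst L (*-identityʳ _) (scale-closed r line-op01 a≢0 (subst L (sym eq) lc) line-r)) r ne
              where
              r : S ((1# - c) * inv a)
              r = NN Nc (N-inv Na)
              eq : (1# - c) * inv a * a ≡ 1# - c
              eq = trans (*-assoc _ _ _) (trans (cong ((1# - c) *_) (inv-left a≢0)) (*-identityʳ _))
            ratio≡1 : ∀ {c} → (1# - c) * inv a ≡ 1# → 1# - c ≡ a
            ratio≡1 {c} e = trans (sym (*-identityʳ _)) (trans (cong ((1# - c) *_) (sym (inv-left a≢0))) (trans (sym (*-assoc _ _ _)) (trans (cong (_* a) e) (*-identityˡ a))))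
            -- 1 ∗ 0 = 1 - c, where c is a or b according to the character of -1. If 1 - c is a
            -- nonsquare, scaling by (1 - c)/a takes a to 1 - c, both on L, so this square ratio is
            -- on L too; it helps unless 1 - c = a.
            viaC : ∀ c → ¬ c ≡ 0# → ¬ c ≡ 1# → L (1# - c) → (1# - c ≡ a → L two ⊎ (a * b ≡ 1# × a + b ≡ 1# × N a × N (- 1#))) →
              L two ⊎ (a * b ≡ 1# × a + b ≡ 1# × N a × N (- 1#))
            viaC c nc nc1 lc k with sign (1# - c)
            ... | zer e = ⊥-elim (nc1 (sym (x-y≡0⇒x≡y e)))
            ... | pos s = by lc s (1-c≢1 nc)
            ... | neg n with (1# - c) * inv a ≟ 1#
            ...   | no ne = ratio {c} lc n ne
            ...   | yes e = k (ratio≡1 {c} e)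
            cases′ : S (- 1#) ⊎ N (- 1#) → L two ⊎ (a * b ≡ 1# × a + b ≡ 1# × N a × N (- 1#))
            cases′ (inj₁ p) = viaC a a≢0 a≢1 (subst L (trans (op-S a b (subst S (sym 0-1) p)) (solve 1 (λ a → con (+ 1) :+ a :* (con (+ 0) :- con (+ 1)) := con (+ 1) :- a) refl a))
                (line-op line-r line-l))
              -- Here 1 - a = a, so a ∗ 0 = a - ab = a - 1 = -a. Scaling by -1 then puts the square
              -- -1 on L.
              (λ e → by (subst L (*-identityʳ _) (scale-closed p line-op01 a≢0 (subst L (op-a0 e) (line-op line-op01 line-l)) line-r)) p (1≢-1 ∘ sym))
              where
              0-a : 0# - a ≡ - 1# * a
              0-a = solve 1 (λ a → con (+ 0) :- a := (:- con (+ 1)) :* a) refl a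
              op-a0 : 1# - a ≡ a → a ∗ 0# ≡ - 1# * a
              op-a0 e = trans (op-N a b (subst N (sym 0-a) (SN p Na))) (trans (solve 2 (λ a b → a :+ b :* (con (+ 0) :- a) := a :- a :* b) refl a b)
                (trans (cong (λ z → a - z) ab≡1) (trans (solve 1 (λ a → a :- con (+ 1) := (:- con (+ 1)) :* (con (+ 1) :- a)) refl a) (cong (- 1# *_) e))))
            cases′ (inj₂ n) = viaC b b≢0 b≢1 (subst L (trans (op-N a b (subst N (sym 0-1) n)) (solve 1 (λ a → con (+ 1) :+ a :* (con (+ 0) :- con (+ 1)) := con (+ 1) :- a) refl b))
                (line-op line-r line-l))
              (λ e → inj₂ (ab≡1 , trans (cong (_+ b) (sym e)) (solve 1 (λ b → (con (+ 1) :- b) :+ b := con (+ 1)) refl b) , Na , n))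

  -- Conjugating a translation by f gives an automorphism moving f(iμ) to f((i+1)μ); as the order of F is odd, two consecutive
  -- differences f((i+1)μ) - f(iμ) have the same sign, so it agrees with an affine map there, and that map must be a translation.
  module Midpoint {a b : Carrier} {f : Carrier → Carrier} (af : Aut a b f) (two∈ : ∀ μ → ¬ μ ≡ 0# → Line a b 0# μ (μ + μ))
    (μ : Carrier) (nμ : ¬ μ ≡ 0#) where
    open Lines a b

    w : ℕ → Carrier
    w zero = 0#
    w (suc i) = μ + w i

    u : ℕ → Carrier
    u i = f (w i)

    d : ℕ → Carrier
    d i = u (suc i) - u i

    opaque
      w-nat : ∀ i → w i ≡ nat i * μ
      w-nat zero = sym (zeroˡ μ)
      w-nat (suc i) = trans (cong (λ z → μ + z) (w-nat i)) (solve 2 (λ n μ → μ :+ n :* μ := (con (+ 1) :+ n) :* μ) refl (nat i) μ)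
      w-+ : ∀ i j → w (i ℕ.+ j) ≡ w i + w j
      w-+ i j = trans (w-nat (i ℕ.+ j)) (trans (cong (_* μ) (nat-+ i j)) (trans (distribʳ _ _ _) (sym (cong₂ _+_ (w-nat i) (w-nat j)))))
      w-size : w size ≡ 0#
      w-size = trans (w-nat size) (trans (cong (_* μ) nat-size) (zeroˡ μ))
      u-period : ∀ i → u (i ℕ.+ size) ≡ u i
      u-period i = cong f (trans (w-+ i size) (trans (cong (λ z → w i + z) w-size) (+-identityʳ _)))
      d≢0 : ∀ i → ¬ d i ≡ 0#
      d≢0 i e = nμ (+-cancelʳ (w i) μ 0# (trans (aut-injective af (x-y≡0⇒x≡y e)) (sym (+-identityˡ _))))
      step : ∀ i → Line a b (w i) (w (suc i)) (w (suc (suc i)))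
      step i = subst₂ (λ p q → Line a b p q (w (suc (suc i)))) (trans (cong (_+ w i) (zeroʳ 1#)) (+-identityˡ _)) (cong (_+ w i) (*-identityˡ μ))
        (subst (Line a b _ _) (trans (cong (_+ w i) (*-identityˡ _)) (+-assoc _ _ _)) (line-image (affine-aut a b (w i) S-1) (two∈ μ nμ)))
      ahead : ∀ i k → Line a b (w i) (w (suc i)) (w (k ℕ.+ i)) × Line a b (w i) (w (suc i)) (w (suc (k ℕ.+ i)))
      ahead i zero = line-l , line-r
      ahead i (suc k) with ahead i k
      ... | (p , q) = q , line-trans p q (step (k ℕ.+ i))
      -- If no two consecutive characters agree, they alternate, and agreement at distance n + 1
      -- makes n odd. Over a full period n + 1 = |F| is odd.
      same : ∀ n i → X (d (n ℕ.+ suc i)) ≡ X (d i) → (∃[ j ] X (d (suc j)) ≡ X (d j)) ⊎ (∃[ k ] n ≡ suc (k ℕ.+ k))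
      same zero i e = inj₁ (i , e)
      same (suc zero) i e = inj₂ (0 , refl)
      same (suc (suc n)) i e with X (d (suc i)) ≟ X (d i) | X (d (suc (suc i))) ≟ X (d (suc i))
      ... | yes p | _ = inj₁ (i , p)
      ... | no _ | yes q = inj₁ (suc i , q)
      ... | no p | no q with same n (suc (suc i)) (trans (cong (λ k → X (d k)) (trans (ℕₚ.+-suc n (suc (suc i))) (cong suc (ℕₚ.+-suc n (suc i)))))
            (trans e (trans (sym (-‿involutive _)) (trans (cong -_ (sym (X≢⇒- (d≢0 (suc i)) (d≢0 i) p))) (sym (X≢⇒- (d≢0 (suc (suc i))) (d≢0 (suc i)) q))))))
      ...   | inj₁ r = inj₁ r
      ...   | inj₂ (k , refl) = inj₂ (suc k , cong (λ z → suc (suc z)) (sym (ℕₚ.+-suc k k)))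
      odd-contra : ∀ k → ¬ m ℕ.+ m ≡ suc (k ℕ.+ k)
      odd-contra k e = lem m k e
        where
        lem : ∀ p q → ¬ p ℕ.+ p ≡ suc (q ℕ.+ q)
        lem zero q ()
        lem (suc p) zero e with trans (sym (ℕₚ.+-suc p p)) (ℕₚ.suc-injective e)
        ... | ()
        lem (suc p) (suc q) e = lem p q (ℕₚ.suc-injective (trans (sym (ℕₚ.+-suc p p)) (trans (ℕₚ.suc-injective e) (cong suc (ℕₚ.+-suc q q)))))
      consecutive : ∃[ j ] X (d (suc j)) ≡ X (d j)
      consecutive with same (m ℕ.+ m) 0 (cong X (cong₂ _-_ (trans (cong (λ k → u (suc k)) (trans (ℕₚ.+-suc (m ℕ.+ m) 0) (trans (cong suc (ℕₚ.+-identityʳ (m ℕ.+ m))) (sym size≡1+2m)))) (u-period 1))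
                                     (trans (cong u (trans (ℕₚ.+-suc (m ℕ.+ m) 0) (trans (cong suc (ℕₚ.+-identityʳ (m ℕ.+ m))) (sym size≡1+2m)))) (u-period 0))))
      ... | inj₁ r = r
      ... | inj₂ (k , e) = ⊥-elim (odd-contra k e)
      i₀ : ℕ
      i₀ = proj₁ consecutive
      ne₀ : ¬ u i₀ ≡ u (suc i₀)
      ne₀ e = d≢0 i₀ (x≡y⇒x-y≡0 (sym e))
      hp : Σ[ s ∈ Carrier ] Σ[ μ′ ∈ Carrier ] S s × s * u i₀ + μ′ ≡ u (suc i₀) × s * u (suc i₀) + μ′ ≡ u (suc (suc i₀))
      hp = hom-pair ne₀ (proj₂ consecutive)
      s : Carrier
      s = proj₁ hp
      c : Carrier
      c = proj₁ (proj₂ hp)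
      Ss : S s
      Ss = proj₁ (proj₂ (proj₂ hp))
      h : Carrier → Carrier
      h z = s * z + c
      shift-aut : Aut a b (λ z → 1# * z + μ)
      shift-aut = affine-aut a b μ S-1
      sh : ∀ i → 1# * w i + μ ≡ w (suc i)
      sh i = solve 2 (λ x μ → con (+ 1) :* x :+ μ := μ :+ x) refl (w i) μ
      -- `h` after f and f after the translation by μ agree at `w i₀` and the next point, hence on
      -- the line through them, which contains all later points of the progression.
      agree : ∀ k → h (u (k ℕ.+ i₀)) ≡ u (suc (k ℕ.+ i₀))
      agree k = trans (line-agree {w i₀} {w (suc i₀)} (∘-aut (affine-aut a b c Ss) af) (∘-aut af shift-aut)
        (trans (proj₁ (proj₂ (proj₂ (proj₂ hp)))) (cong f (sym (sh i₀)))) (trans (proj₂ (proj₂ (proj₂ (proj₂ hp)))) (cong f (sym (sh (suc i₀)))))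
        (proj₁ (ahead i₀ k))) (cong f (sh (k ℕ.+ i₀)))
      d-geometric : ∀ k → d (k ℕ.+ i₀) ≡ s ^ k * d i₀
      d-geometric zero = sym (*-identityˡ _)
      d-geometric (suc k) = trans (cong₂ _-_ (sym (agree (suc k))) (sym (agree k)))
        (trans (solve 4 (λ s p q c → (s :* p :+ c) :- (s :* q :+ c) := s :* (p :- q)) refl s (u (suc (k ℕ.+ i₀))) (u (k ℕ.+ i₀)) c)
        (trans (cong (s *_) (d-geometric k)) (sym (*-assoc _ _ _))))
      -- The differences have period |F| and ratio s, so s^|F| = 1, whereas s^|F| = s.
      s≡1 : s ≡ 1#
      s≡1 = *-cancelˡ (d≢0 i₀) (trans (*-comm _ _) (trans (cong (_* d i₀) (sym (x^size≡x s))) (trans (sym (d-geometric size))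
        (trans (cong₂ _-_ (trans (cong (λ k → u (suc k)) (ℕₚ.+-comm size i₀)) (u-period (suc i₀))) (trans (cong u (ℕₚ.+-comm size i₀)) (u-period i₀))) (sym (*-identityʳ _))))))
      d-const : ∀ k → d (k ℕ.+ i₀) ≡ d i₀
      d-const k = trans (d-geometric k) (trans (cong (λ z → z ^ k * d i₀) s≡1) (trans (cong (_* d i₀) (1^ k)) (*-identityˡ _)))
      d-period : ∀ i k → d (i ℕ.+ k ℕ.* size) ≡ d i
      d-period i zero = cong d (ℕₚ.+-identityʳ i)
      d-period i (suc k) = trans (cong d (trans (cong (i ℕ.+_) (ℕₚ.+-comm size (k ℕ.* size))) (sym (ℕₚ.+-assoc i (k ℕ.* size) size))))
        (trans (cong₂ _-_ (u-period (suc (i ℕ.+ k ℕ.* size))) (u-period (i ℕ.+ k ℕ.* size))) (d-period i k))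
      size-suc : ∃[ k ] size ≡ suc k
      size-suc = m ℕ.+ m , size≡1+2m
      d≡ : ∀ i → d i ≡ d i₀
      d≡ i = trans (sym (d-period i i₀)) (trans (cong d (trans (cong (λ k → i ℕ.+ i₀ ℕ.* k) (proj₂ size-suc))
        (trans (cong (i ℕ.+_) (trans (ℕₚ.*-suc i₀ (proj₁ size-suc)) (ℕₚ.+-comm i₀ _))) (sym (ℕₚ.+-assoc i _ i₀))))) (d-const (i ℕ.+ i₀ ℕ.* proj₁ size-suc)))
      lemma : u 1 + u 1 ≡ u 2 + u 0
      lemma = trans (solve 3 (λ p q r → q :+ q := (q :- r) :+ (q :+ r)) refl (u 2) (u 1) (u 0)) (trans (cong (_+ (u 1 + u 0)) (trans (d≡ 0) (sym (d≡ 1))))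
        (solve 3 (λ p q r → (p :- q) :+ (q :+ r) := p :+ r) refl (u 2) (u 1) (u 0)))

  opaque
    midpoint : ∀ {a b f} → Aut a b f → (∀ μ → ¬ μ ≡ 0# → Line a b 0# μ (μ + μ)) → ∀ μ → f (μ + μ) + f 0# ≡ f μ + f μ
    midpoint {a} {b} {f} af two∈ μ with μ ≟ 0#
    ... | yes refl = cong (λ z → f z + f 0#) (+-identityˡ 0#)
    ... | no nμ = trans (cong (λ z → f z + f 0#) (solve 1 (λ μ → μ :+ μ := μ :+ (μ :+ con (+ 0))) refl μ))
          (trans (sym (Midpoint.lemma af two∈ μ nμ)) (cong₂ _+_ (cong f (+-identityʳ μ)) (cong f (+-identityʳ μ))))

-- Affine automorphisms preserve or reverse the character.

module Dichotomy (F : FiniteField) (odd : FiniteField.size F % 2 ≡ 1) where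
  open Signs F odd
  open Quasi F odd

  Preserves Reverses : (Carrier → Carrier) → Set
  Preserves f = ∀ x y → X (f x - f y) ≡ X (x - y)
  Reverses f = ∀ x y → X (f x - f y) ≡ - X (x - y)

  Additive : (Carrier → Carrier) → Set
  Additive f = ∀ x y → f (x + y) ≡ f x + f y

  opaque
    -- A square μ scales the line through 0 and 1. Conjugation by a nonsquare μ turns the claim into
    -- the one for the line through 0 and 1 in Q_{b,a}; hence the two hypotheses.
    lines-closed : ∀ {a b} → Line a b 0# 1# two → Line b a 0# 1# two → ∀ μ → ¬ μ ≡ 0# → Line a b 0# μ (μ + μ)
    lines-closed {a} {b} l l′ μ nμ with S⊎N nμ
    ... | inj₁ s = subst₂ (λ p q → Line a b p q (μ + μ)) (solve 1 (λ μ → μ :* con (+ 0) :+ con (+ 0) := con (+ 0)) refl μ)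
          (solve 1 (λ μ → μ :* con (+ 1) :+ con (+ 0) := μ) refl μ) (subst (Line a b _ _) (solve 1 (λ μ → μ :* con (+ 2) :+ con (+ 0) := μ :+ μ) refl μ)
          (Lines.line-image a b (affine-aut a b 0# s) l))
    ... | inj₂ n = λ g ig e0 eμ → trans (cong g (solve 1 (λ μ → μ :+ μ := μ :* con (+ 2)) refl μ)) (trans (sym (ν-conj-cancel nμ _))
          (trans (cong (μ *_) (l′ _ (twist-aut n ig)
            (trans (cong (λ z → inv μ * g z) (zeroʳ μ)) (trans (cong (inv μ *_) e0) (zeroʳ _)))
            (trans (cong (λ z → inv μ * g z) (*-identityʳ μ)) (trans (cong (inv μ *_) eμ) (inv-left nμ)))))
          (solve 1 (λ μ → μ :* con (+ 2) := μ :+ μ) refl μ)))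

    -- Both sides equal 2 f((x + y)/2): one is the midpoint rule for 0 and x + y, the other that for
    -- x and y, translated to 0.
    aut-additive : ∀ {a b f} → Aut a b f → (∀ μ → ¬ μ ≡ 0# → Line a b 0# μ (μ + μ)) → ∀ x y → f (x + y) + f 0# ≡ f x + f y
    aut-additive {a} {b} {f} af two∈ x y = trans (trans (cong (λ z → f z + f 0#) (sym (½+½ (x + y)))) (midpoint af two∈ (½ * (x + y))))
      (sym (trans (+-comm _ _) (trans (cong₂ (λ p q → f p + f q) (sym eq-y) (sym eq-x)) (trans (midpoint (∘-aut af (affine-aut a b x S-1)) two∈ (½ * (y - x)))
      (cong₂ _+_ (cong f eq-m) (cong f eq-m))))))
      where
      eq-x : 1# * 0# + x ≡ x
      eq-x = solve 1 (λ x → con (+ 1) :* con (+ 0) :+ x := x) refl x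
      eq-y : 1# * (½ * (y - x) + ½ * (y - x)) + x ≡ y
      eq-y = trans (cong (λ z → 1# * z + x) (½+½ (y - x))) (solve 2 (λ x y → con (+ 1) :* (y :- x) :+ x := y) refl x y)
      eq-m : 1# * (½ * (y - x)) + x ≡ ½ * (x + y)
      eq-m = trans (cong (λ z → 1# * (½ * (y - x)) + z) (sym (½+½ x))) (solve 3 (λ h x y → con (+ 1) :* (h :* (y :- x)) :+ (h :* x :+ h :* x) := h :* (x :+ y)) refl ½ x y)

  module AdditiveMap {f : Carrier → Carrier} (inj : ∀ {x y} → f x ≡ f y → x ≡ y) (add : Additive f) where
    -- For c, d in {a, b} these sets cover F, because f(0 ∗ x) = 0 ∗ f(x). Each is a subgroup closed
    -- under halving, and two of them with exactly one index in common meet in 0.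
    R : Carrier → Carrier → Carrier → Set
    R c d x = f (c * x) ≡ d * f x

    opaque
      f0 : f 0# ≡ 0#
      f0 = +-cancelˡ (f 0#) _ _ (trans (sym (add 0# 0#)) (trans (cong f (+-identityˡ 0#)) (sym (+-identityʳ _))))

      f-neg : ∀ x → f (- x) ≡ - f x
      f-neg x = +-cancelˡ (f x) _ _ (trans (sym (add x (- x))) (trans (cong f (-‿inverseʳ x)) (trans f0 (sym (-‿inverseʳ _)))))

      f≢0 : ∀ {x} → ¬ x ≡ 0# → ¬ f x ≡ 0#
      f≢0 nx e = nx (inj (trans e (sym f0)))

      R-add : ∀ {c d x y} → R c d x → R c d y → R c d (x + y)
      R-add {c} {d} {x} {y} p q = trans (cong f (distribˡ c x y)) (trans (add _ _) (trans (cong₂ _+_ p q) (trans (sym (distribˡ d _ _)) (cong (d *_) (sym (add x y))))))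

      R-neg : ∀ {c d x} → R c d x → R c d (- x)
      R-neg {c} {d} {x} p = trans (cong f (sym (-‿distribʳ-* c x))) (trans (f-neg _) (trans (cong -_ p) (trans (-‿distribʳ-* d _) (cong (d *_) (sym (f-neg x))))))

      R-half : ∀ {c d x} → R c d (x + x) → R c d x
      R-half {c} {d} {x} p = two*-cancel (trans (sym (add _ _)) (trans (cong f (sym (distribˡ c x x))) (trans p (trans (cong (d *_) (add x x)) (distribˡ d _ _)))))

      R-value : ∀ {c d d′ x} → ¬ d ≡ d′ → ¬ x ≡ 0# → R c d x → R c d′ x → ⊥
      R-value {x = x} ne nx p q = ne (*-cancelˡ (f≢0 nx) (trans (*-comm _ _) (trans (sym p) (trans q (*-comm _ _)))))

      R-scalar : ∀ {c c′ d x} → ¬ c ≡ c′ → R c d x → R c′ d x → x ≡ 0#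
      R-scalar {c} {c′} {d} {x} ne p q with x ≟ 0#
      ... | yes e = e
      ... | no nx = ⊥-elim (ne (*-cancelˡ nx (trans (*-comm _ _) (trans (inj (trans p (sym q))) (*-comm _ _)))))

    module Cover {c c′ d d′ : Carrier} (c≢ : ¬ c ≡ c′) (d≢ : ¬ d ≡ d′)
      (cover : ∀ x → ¬ x ≡ 0# → (R c d x ⊎ R c d′ x) ⊎ (R c′ d x ⊎ R c′ d′ x)) where
      opaque
        sum≢0 : ∀ {u v} → R c d u → R c d′ v → ¬ u ≡ 0# → ¬ u + v ≡ 0#
        sum≢0 {u} {v} ru rv nu e = R-value d≢ nu ru (subst (R c d′) (sym (trans (solve 2 (λ u v → u := (u :+ v) :+ (:- v)) refl u v) (trans (cong (_+ - v) e) (+-identityˡ _)))) (R-neg rv))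

        mixed : ∀ {u v} → R c d u → R c d′ v → ¬ u ≡ 0# → ¬ v ≡ 0# → R c′ d (u + v) ⊎ R c′ d′ (u + v)
        mixed {u} {v} ru rv nu nv with cover (u + v) (sum≢0 ru rv nu)
        ... | inj₂ r = r
        ... | inj₁ (inj₁ r) = ⊥-elim (R-value d≢ nv (subst (R c d) (solve 2 (λ u v → (u :+ v) :+ (:- u) := v) refl u v) (R-add r (R-neg ru))) rv)
        ... | inj₁ (inj₂ r) = ⊥-elim (R-value d≢ nu ru (subst (R c d′) (solve 2 (λ u v → (u :+ v) :+ (:- v) := u) refl u v) (R-add r (R-neg rv))))

        -- If u + v and u - v were both in R c′ d, so would be u, which is in R c d; if both were in
        -- R c′ d′, so would be v, which is in R c d′.
        opposite : ∀ {u v} → R c d u → R c d′ v → ¬ u ≡ 0# → ¬ v ≡ 0# →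
          (R c′ d (u + v) × R c′ d′ (u + - v)) ⊎ (R c′ d′ (u + v) × R c′ d (u + - v))
        opposite {u} {v} ru rv nu nv with mixed ru rv nu nv | mixed ru (R-neg rv) nu (nv ∘ -x≡0⇒x≡0)
        ... | inj₁ p | inj₂ q = inj₁ (p , q)
        ... | inj₂ p | inj₁ q = inj₂ (p , q)
        ... | inj₁ p | inj₁ q = ⊥-elim (nu (R-scalar c≢ ru (R-half (subst (R c′ d) (solve 2 (λ u v → (u :+ v) :+ (u :+ (:- v)) := u :+ u) refl u v) (R-add p q)))))
        ... | inj₂ p | inj₂ q = ⊥-elim (nv (R-scalar c≢ rv (R-half (subst (R c′ d′) (solve 2 (λ u v → (u :+ v) :+ (:- (u :+ (:- v))) := v :+ v) refl u v) (R-add p (R-neg q))))))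

        -- By `opposite` exactly one of u + v and u - v lies in R c′ d, and likewise for u′. If the
        -- signs agree, u - u′ lies in R c d and in R c′ d, hence is 0; if not, the same holds of u
        -- + u′.
        unique-± : ∀ {u u′ v} → R c d u → R c d u′ → R c d′ v → ¬ u ≡ 0# → ¬ u′ ≡ 0# → ¬ v ≡ 0# → u′ ≡ u ⊎ u′ ≡ - u
        unique-± {u} {u′} {v} ru ru′ rv nu nu′ nv with opposite ru rv nu nv | opposite ru′ rv nu′ nv
        ... | inj₁ (p , q) | inj₁ (p′ , q′) = inj₁ (sym (x-y≡0⇒x≡y (R-scalar c≢ (R-add ru (R-neg ru′)) (subst (R c′ d) (solve 3 (λ u u′ v → (u :+ v) :+ (:- (u′ :+ v)) := u :- u′) refl u u′ v) (R-add p (R-neg p′))))))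
        ... | inj₂ (p , q) | inj₂ (p′ , q′) = inj₁ (sym (x-y≡0⇒x≡y (R-scalar c≢ (R-add ru (R-neg ru′)) (subst (R c′ d) (solve 3 (λ u u′ v → (u :+ (:- v)) :+ (:- (u′ :+ (:- v))) := u :- u′) refl u u′ v) (R-add q (R-neg q′))))))
        ... | inj₁ (p , q) | inj₂ (p′ , q′) = inj₂ (x-y≡0⇒x≡y (trans (solve 2 (λ u u′ → u′ :- (:- u) := u :+ u′) refl u u′) (R-scalar c≢ (R-add ru ru′) (subst (R c′ d) (solve 3 (λ u u′ v → (u :+ v) :+ (u′ :+ (:- v)) := u :+ u′) refl u u′ v) (R-add p q′)))))
        ... | inj₂ (p , q) | inj₁ (p′ , q′) = inj₂ (x-y≡0⇒x≡y (trans (solve 2 (λ u u′ → u′ :- (:- u) := u :+ u′) refl u u′) (R-scalar c≢ (R-add ru ru′) (subst (R c′ d) (solve 3 (λ u u′ v → (u :+ (:- v)) :+ (u′ :+ v) := u :+ u′) refl u u′ v) (R-add q p′)))))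

  -- If f sends some square to a square and some square to a nonsquare, then F is the sum of two lines of order 3 on which f acts by
  -- scalars with different signs; writing a s₁ in terms of s₁ and s₂ shows that the two scalars agree.
  module Mixed {a b : Carrier} (a≢b : ¬ a ≡ b) {f : Carrier → Carrier} (af : Aut a b f) (add : Additive f) where
    open AdditiveMap (aut-injective af) add

    opaque
      op-0S : ∀ {a b x} → S x → op a b 0# x ≡ a * x
      op-0S {a} {b} {x} s = trans (op-S a b (subst S (solve 1 (λ x → x := x :- con (+ 0)) refl x) s)) (solve 2 (λ a x → con (+ 0) :+ a :* (x :- con (+ 0)) := a :* x) refl a x)

      op-0N : ∀ {a b x} → N x → op a b 0# x ≡ b * x
      op-0N {a} {b} {x} s = trans (op-N a b (subst N (solve 1 (λ x → x := x :- con (+ 0)) refl x) s)) (solve 2 (λ a x → con (+ 0) :+ a :* (x :- con (+ 0)) := a :* x) refl b x)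

      hom0 : ∀ x → f (op a b 0# x) ≡ op a b 0# (f x)
      hom0 x = trans (proj₂ af 0# x) (cong (λ z → op a b z (f x)) f0)

      SS-R : ∀ {x} → S x → S (f x) → R a a x
      SS-R {x} s s′ = trans (cong f (sym (op-0S s))) (trans (hom0 x) (op-0S s′))

      SN-R : ∀ {x} → S x → N (f x) → R a b x
      SN-R {x} s s′ = trans (cong f (sym (op-0S s))) (trans (hom0 x) (op-0N s′))

      cover : ∀ x → ¬ x ≡ 0# → (R a a x ⊎ R a b x) ⊎ (R b a x ⊎ R b b x)
      cover x nx with S⊎N nx | S⊎N (f≢0 nx)
      ... | inj₁ s | inj₁ s′ = inj₁ (inj₁ (SS-R s s′))
      ... | inj₁ s | inj₂ s′ = inj₁ (inj₂ (SN-R s s′))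
      ... | inj₂ s | inj₁ s′ = inj₂ (inj₁ (trans (cong f (sym (op-0N s))) (trans (hom0 x) (op-0S s′))))
      ... | inj₂ s | inj₂ s′ = inj₂ (inj₂ (trans (cong f (sym (op-0N s))) (trans (hom0 x) (op-0N s′))))

      swap-⊎ : ∀ {A B : Set} → A ⊎ B → B ⊎ A
      swap-⊎ (inj₁ x) = inj₂ x
      swap-⊎ (inj₂ x) = inj₁ x

      cover′ : ∀ x → ¬ x ≡ 0# → (R a b x ⊎ R a a x) ⊎ (R b b x ⊎ R b a x)
      cover′ x nx with cover x nx
      ... | inj₁ p = inj₁ (swap-⊎ p)
      ... | inj₂ p = inj₂ (swap-⊎ p)

    module Cab = Cover a≢b a≢b cover
    module Cab′ = Cover a≢b (a≢b ∘ sym) cover′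
    module Cba = Cover (a≢b ∘ sym) a≢b (λ x nx → swap-⊎ (cover x nx))
    module Cba′ = Cover (a≢b ∘ sym) (a≢b ∘ sym) (λ x nx → swap-⊎ (cover′ x nx))

    Combination : Carrier → Carrier → Carrier → Set
    Combination s₁ s₂ z = Σ[ e₁ ∈ Carrier ] Σ[ e₂ ∈ Carrier ] (e₂ ≡ 0# → e₁ ≡ 0# ⊎ e₁ ≡ 1# ⊎ e₁ ≡ - 1#) × z ≡ e₁ * s₁ + e₂ * s₂ × f z ≡ e₁ * f s₁ + e₂ * f s₂

    opaque
      comb : ∀ s₁ s₂ {x z} e₁ e₂ → (e₂ ≡ 0# → e₁ ≡ 0# ⊎ e₁ ≡ 1# ⊎ e₁ ≡ - 1#) → x ≡ e₁ * s₁ + e₂ * s₂ → f x ≡ e₁ * f s₁ + e₂ * f s₂ → z ≡ x ⊎ z ≡ - x →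
        Combination s₁ s₂ z
      comb s₁ s₂ e₁ e₂ h ex efx (inj₁ refl) = e₁ , e₂ , h , ex , efx
      comb s₁ s₂ {x} e₁ e₂ h ex efx (inj₂ refl) = - e₁ , - e₂ , (λ e → flip-sign (h (-x≡0⇒x≡0 e))) ,
        trans (cong -_ ex) (neg-comb e₁ e₂ s₁ s₂) , trans (f-neg x) (trans (cong -_ efx) (neg-comb e₁ e₂ (f s₁) (f s₂)))
        where
        neg-comb : ∀ e e′ s s′ → - (e * s + e′ * s′) ≡ - e * s + - e′ * s′
        neg-comb = solve 4 (λ e e′ s s′ → :- (e :* s :+ e′ :* s′) := (:- e) :* s :+ (:- e′) :* s′) refl
        flip-sign : ∀ {e} → e ≡ 0# ⊎ e ≡ 1# ⊎ e ≡ - 1# → - e ≡ 0# ⊎ - e ≡ 1# ⊎ - e ≡ - 1#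
        flip-sign (inj₁ refl) = inj₁ -0#≈0#
        flip-sign (inj₂ (inj₁ refl)) = inj₂ (inj₂ refl)
        flip-sign (inj₂ (inj₂ refl)) = inj₂ (inj₁ (-‿involutive 1#))

      combination : ∀ {s₁ s₂} → R a a s₁ → R a b s₂ → ¬ s₁ ≡ 0# → ¬ s₂ ≡ 0# → ∀ z → ¬ z ≡ 0# → Combination s₁ s₂ z
      combination {s₁} {s₂} r₁ r₂ n₁ n₂ z nz = go (cover z nz) (Cab.opposite r₁ r₂ n₁ n₂)
        where
        lin : ∀ p q → p + q ≡ 1# * p + 1# * q
        lin = solve 2 (λ p q → p :+ q := con (+ 1) :* p :+ con (+ 1) :* q) refl
        lin′ : ∀ p q → p + - q ≡ 1# * p + - 1# * q
        lin′ = solve 2 (λ p q → p :+ (:- q) := con (+ 1) :* p :+ (:- con (+ 1)) :* q) refl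
        only₁ : ∀ p q → p ≡ 1# * p + 0# * q
        only₁ = solve 2 (λ p q → p := con (+ 1) :* p :+ con (+ 0) :* q) refl
        only₂ : ∀ p q → q ≡ 0# * p + 1# * q
        only₂ = solve 2 (λ p q → q := con (+ 0) :* p :+ con (+ 1) :* q) refl
        -1≢0 : ¬ - 1# ≡ 0#
        -1≢0 e = 1≢0 (-x≡0⇒x≡0 e)
        ns : ¬ s₁ + s₂ ≡ 0#
        ns = Cab.sum≢0 r₁ r₂ n₁
        nd : ¬ s₁ + - s₂ ≡ 0#
        nd = Cab.sum≢0 r₁ (R-neg r₂) n₁
        by-sum : z ≡ s₁ + s₂ ⊎ z ≡ - (s₁ + s₂) → Combination s₁ s₂ z
        by-sum = comb s₁ s₂ 1# 1# (λ e → ⊥-elim (1≢0 e)) (lin s₁ s₂) (trans (add s₁ s₂) (lin (f s₁) (f s₂)))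
        by-diff : z ≡ s₁ + - s₂ ⊎ z ≡ - (s₁ + - s₂) → Combination s₁ s₂ z
        by-diff = comb s₁ s₂ 1# (- 1#) (λ e → ⊥-elim (-1≢0 e)) (lin′ s₁ s₂) (trans (add s₁ (- s₂)) (trans (cong (λ w → f s₁ + w) (f-neg s₂)) (lin′ (f s₁) (f s₂))))
        go : (R a a z ⊎ R a b z) ⊎ (R b a z ⊎ R b b z) → (R b a (s₁ + s₂) × R b b (s₁ + - s₂)) ⊎ (R b b (s₁ + s₂) × R b a (s₁ + - s₂)) → Combination s₁ s₂ z
        go (inj₁ (inj₁ r)) _ = comb s₁ s₂ 1# 0# (λ _ → inj₂ (inj₁ refl)) (only₁ s₁ s₂) (only₁ (f s₁) (f s₂)) (Cab.unique-± r₁ r r₂ n₁ nz n₂)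
        go (inj₁ (inj₂ r)) _ = comb s₁ s₂ 0# 1# (λ e → ⊥-elim (1≢0 e)) (only₂ s₁ s₂) (only₂ (f s₁) (f s₂)) (Cab′.unique-± r₂ r r₁ n₂ nz n₁)
        go (inj₂ (inj₁ r)) (inj₁ (p , q)) = by-sum (Cba.unique-± p r q ns nz nd)
        go (inj₂ (inj₂ r)) (inj₁ (p , q)) = by-diff (Cba′.unique-± q r p nd nz ns)
        go (inj₂ (inj₁ r)) (inj₂ (p , q)) = by-diff (Cba.unique-± q r p nd nz ns)
        go (inj₂ (inj₂ r)) (inj₂ (p , q)) = by-sum (Cba′.unique-± p r q ns nz nd)

      contradiction : ¬ a ≡ 0# → ¬ a ≡ 1# → ∀ {s₁ s₂} → S s₁ → S (f s₁) → S s₂ → N (f s₂) → ⊥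
      contradiction a≢0 a≢1 {s₁} {s₂} S₁ Sf₁ S₂ Nf₂ = go (combination r₁ r₂ (S≢0 S₁) (S≢0 S₂) (a * s₁) (xy≢0 a≢0 (S≢0 S₁)))
        where
        r₁ : R a a s₁
        r₁ = SS-R S₁ Sf₁
        r₂ : R a b s₂
        r₂ = SN-R S₂ Nf₂
        move : ∀ {p q e₁ e₂} → a * p ≡ e₁ * p + e₂ * q → (a - e₁) * p ≡ e₂ * q
        move {p} {q} {e₁} {e₂} e = trans (solve 3 (λ a p e → (a :- e) :* p := a :* p :- e :* p) refl a p e₁) (trans (cong (λ z → z - e₁ * p) e)
          (solve 2 (λ u v → u :+ v :- u := v) refl (e₁ * p) (e₂ * q)))
        go : Combination s₁ s₂ (a * s₁) → ⊥
        go (e₁ , e₂ , h , ez , efz) with e₂ ≟ 0#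
        -- (a - e₁) s₁ = e₂ s₂ and (a - e₁) f s₁ = e₂ f s₂. As s₁ and s₂ are squares, a - e₁ and e₂
        -- have the same character; then so have f s₁ and f s₂.
        ... | no ne = 1≢-1 (trans (sym Sf₁) (trans (*-cancelˡ nk (trans (sym (X-* k (f s₁))) (trans (cong X kf) (trans (X-* e₂ (f s₂)) (cong (_* X (f s₂)) (sym Xk)))))) Nf₂))
          where
          k : Carrier
          k = a - e₁
          ks : k * s₁ ≡ e₂ * s₂
          ks = move ez
          kf : k * f s₁ ≡ e₂ * f s₂
          kf = move (trans (sym r₁) efz)
          Xk : X k ≡ X e₂
          Xk = trans (sym (*-identityʳ _)) (trans (cong (X k *_) (sym S₁)) (trans (sym (X-* k s₁)) (trans (cong X ks) (trans (X-* e₂ s₂) (trans (cong (X e₂ *_) S₂) (*-identityʳ _))))))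
          nk : ¬ X k ≡ 0#
          nk e = 1≢0 (trans (sym (X² ne)) (trans (cong (_* X e₂) (trans (sym Xk) e)) (zeroˡ _)))
        ... | yes refl = scalar (h refl) a≡e₁
          where
          a≡e₁ : a ≡ e₁
          a≡e₁ = *-cancelˡ (S≢0 S₁) (trans (*-comm _ _) (trans ez (solve 3 (λ e s t → e :* s :+ con (+ 0) :* t := s :* e) refl e₁ s₁ s₂)))
          scalar : e₁ ≡ 0# ⊎ e₁ ≡ 1# ⊎ e₁ ≡ - 1# → a ≡ e₁ → ⊥
          scalar (inj₁ z) e = a≢0 (trans e z)
          scalar (inj₂ (inj₁ z)) e = a≢1 (trans e z)
          -- For a = -1 every additive map satisfies R a a, against R a b at s₂.
          scalar (inj₂ (inj₂ z)) e = R-value a≢b (S≢0 S₂) neg-R r₂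
            where
            -1* : ∀ x → - x ≡ - 1# * x
            -1* = solve 1 (λ x → :- x := (:- con (+ 1)) :* x) refl
            a≡-1 : a ≡ - 1#
            a≡-1 = trans e z
            neg-R : R a a s₂
            neg-R = trans (cong f (trans (cong (_* s₂) a≡-1) (sym (-1* s₂)))) (trans (f-neg s₂) (trans (-1* (f s₂)) (cong (_* f s₂) (sym a≡-1))))

  opaque
    -- f permutes the squares: a nonsquare with square image would have only squares further on in
    -- its orbit, yet the orbit returns to it.
    squares⇒preserves : ∀ {f} → (∀ {x y} → f x ≡ f y → x ≡ y) → Additive f → (∀ x → S x → S (f x)) → Preserves f
    squares⇒preserves {f} inj add h x y = trans (cong X (trans (cong (λ z → f x + z) (sym (f-neg y))) (sym (add x (- y))))) (go (x - y))
      where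
      open AdditiveMap inj add
      orbit : ∀ k {z} → S z → S (iter f k z)
      orbit zero s = s
      orbit (suc k) s = h _ (orbit k s)
      go : ∀ d → X (f d) ≡ X d
      go d with sign d
      ... | zer refl = cong X f0
      ... | pos s = trans (h d s) (sym s)
      ... | neg n with S⊎N (f≢0 (N≢0 n))
      ...   | inj₂ n′ = trans n′ (sym n)
      ...   | inj₁ s with iter-returns inj d
      ...     | (k , e) = ⊥-elim (S≢N (subst S (trans (sym (iter-+ f k 1 d)) (trans (cong (λ n → iter f n d) (ℕₚ.+-comm k 1)) e)) (orbit k s)) n)

    -- `Mixed` excludes that f behaves differently on different squares. If it sends all of them to
    -- nonsquares, a nonsquare multiple of f preserves the character.
    preserves⊎reverses-additive : ∀ {a b f} → ¬ a ≡ b → ¬ a ≡ 0# → ¬ a ≡ 1# → Aut a b f → Additive f → Preserves f ⊎ Reverses f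
    preserves⊎reverses-additive {a} {b} {f} a≢b a≢0 a≢1 af add = go
      (any? (λ x → (X x ≟ 1#) ×-dec (X (f x) ≟ 1#)) elems) (any? (λ x → (X x ≟ 1#) ×-dec (X (f x) ≟ - 1#)) elems)
      where
      open AdditiveMap (aut-injective af) add
      go : Dec (Any (λ x → S x × S (f x)) elems) → Dec (Any (λ x → S x × N (f x)) elems) → Preserves f ⊎ Reverses f
      go (yes p) (yes q) with find p | find q
      ... | (s₁ , _ , S₁ , Sf₁) | (s₂ , _ , S₂ , Nf₂) = ⊥-elim (Mixed.contradiction a≢b af add a≢0 a≢1 S₁ Sf₁ S₂ Nf₂)
      go _ (no q) = inj₁ (squares⇒preserves (aut-injective af) add h)
        where
        h : ∀ x → S x → S (f x)
        h x s with S⊎N (f≢0 (S≢0 s))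
        ... | inj₁ s′ = s′
        ... | inj₂ n = ⊥-elim (q (lose (∈-elems x) (s , n)))
      go (no p) _ = inj₂ (λ x y → trans (sym (trans (cong (_* X (f x - f y)) -Xν) (trans (solve 1 (λ z → (:- (:- con (+ 1))) :* z := z) refl _) refl)))
          (trans (solve 2 (λ u z → (:- u) :* z := :- (u :* z)) refl (X ν) (X (f x - f y))) (cong -_ (trans (sym (X-* ν _)) (trans (cong X (solve 3 (λ n p q → n :* (p :- q) := n :* p :- n :* q) refl ν (f x) (f y)))
            (squares⇒preserves inj′ add′ h x y))))))
        where
        ν : Carrier
        ν = proj₁ nonsquare
        Nν : N ν
        Nν = proj₂ nonsquare
        -Xν : - X ν ≡ - - 1#
        -Xν = cong -_ Nν
        inj′ : ∀ {x y} → ν * f x ≡ ν * f y → x ≡ y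
        inj′ e = aut-injective af (*-cancelˡ (N≢0 Nν) e)
        add′ : Additive (λ x → ν * f x)
        add′ x y = trans (cong (ν *_) (add x y)) (distribˡ _ _ _)
        h : ∀ x → S x → S (ν * f x)
        h x s with S⊎N (f≢0 (S≢0 s))
        ... | inj₁ s′ = ⊥-elim (p (lose (∈-elems x) (s , s′)))
        ... | inj₂ n = NN Nν n

    normalise : ∀ {a b f} → Aut a b f → Aut a b (λ x → 1# * f x + - f 0#)
    normalise {a} {b} {f} af = ∘-aut (affine-aut a b (- f 0#) S-1) af

    preserves⊎reverses : ∀ {a b f} → ¬ a ≡ b → ¬ a ≡ 0# → ¬ a ≡ 1# → Aut a b f → (∀ x y → f (x + y) + f 0# ≡ f x + f y) → Preserves f ⊎ Reverses f
    preserves⊎reverses {a} {b} {f} a≢b a≢0 a≢1 af aff with preserves⊎reverses-additive a≢b a≢0 a≢1 (normalise af) add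
      where
      add : Additive (λ x → 1# * f x + - f 0#)
      add x y = trans (solve 2 (λ p z → con (+ 1) :* p :+ (:- z) := (p :+ z) :+ (:- z) :+ (:- z)) refl (f (x + y)) (f 0#)) (trans (cong (λ w → w + - f 0# + - f 0#) (aff x y))
        (solve 3 (λ p q z → (p :+ q) :+ (:- z) :+ (:- z) := (con (+ 1) :* p :+ (:- z)) :+ (con (+ 1) :* q :+ (:- z))) refl (f x) (f y) (f 0#)))
    ... | inj₁ h = inj₁ (λ x y → trans (cong X (diff x y)) (h x y))
      where
      diff : ∀ x y → f x - f y ≡ (1# * f x + - f 0#) - (1# * f y + - f 0#)
      diff x y = solve 3 (λ p q z → p :- q := (con (+ 1) :* p :+ (:- z)) :- (con (+ 1) :* q :+ (:- z))) refl (f x) (f y) (f 0#)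
    ... | inj₂ h = inj₂ (λ x y → trans (cong X (diff x y)) (h x y))
      where
      diff : ∀ x y → f x - f y ≡ (1# * f x + - f 0#) - (1# * f y + - f 0#)
      diff x y = solve 3 (λ p q z → p :- q := (con (+ 1) :* p :+ (:- z)) :- (con (+ 1) :* q :+ (:- z))) refl (f x) (f y) (f 0#)

-- Counting modulo 2 and 2-subgroups of permutation groups.

open MonoidSum (CommutativeRing.+-commutativeMonoid Boolₚ.xor-∧-commutativeRing) using (sum; sum-cong-≗; ∑-distrib-+; sum-permute)

does⇒ : ∀ {P : Set} (d : Dec P) → does d ≡ true → P
does⇒ (yes p) _ = p

isLt isEq isGt : ∀ {n} (i j : Fin n) → Bool
isLt i j with Finₚ.<-cmp i j
... | tri< _ _ _ = true
... | _ = false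
isEq i j with Finₚ.<-cmp i j
... | tri≈ _ _ _ = true
... | _ = false
isGt i j with Finₚ.<-cmp i j
... | tri> _ _ _ = true
... | _ = false

isLt-swap : ∀ {n} (i j : Fin n) → isLt j i ≡ isGt i j
isLt-swap i j with Finₚ.<-cmp i j | Finₚ.<-cmp j i
... | tri< l _ _ | tri< l′ _ _ = ⊥-elim (Finₚ.<-asym l l′)
... | tri< _ _ _ | tri≈ _ _ _ = refl
... | tri< _ _ _ | tri> _ _ _ = refl
... | tri≈ _ e _ | tri< _ ne _ = ⊥-elim (ne (sym e))
... | tri≈ _ _ _ | tri≈ _ _ _ = refl
... | tri≈ _ _ _ | tri> _ _ _ = refl
... | tri> _ _ _ | tri< _ _ _ = refl
... | tri> _ ne _ | tri≈ _ e _ = ⊥-elim (ne (sym e))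
... | tri> _ _ g | tri> _ _ g′ = ⊥-elim (Finₚ.<-asym g g′)

isEq-≟ : ∀ {n} (i j : Fin n) → isEq i j ≡ does (j Fin.≟ i)
isEq-≟ i j with Finₚ.<-cmp i j
... | tri< _ ne _ = sym (dec-false (j Fin.≟ i) (ne ∘ sym))
... | tri≈ _ e _ = sym (dec-true (j Fin.≟ i) (sym e))
... | tri> _ ne _ = sym (dec-false (j Fin.≟ i) (ne ∘ sym))

isCmp : ∀ {n} (i j : Fin n) → true ≡ isEq i j xor (isLt i j xor isGt i j)
isCmp i j with Finₚ.<-cmp i j
... | tri< _ _ _ = refl
... | tri≈ _ _ _ = refl
... | tri> _ _ _ = refl

opaque
  -- `sum` is the cardinality modulo 2. The involution exchanges the i in p that lie below σ i with
  -- those that lie above, so these two classes cancel and the fixed points remain.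
  parity-involution : ∀ {n} (p : Fin n → Bool) (σ : Fin n → Fin n) → (∀ i → p i ≡ true → p (σ i) ≡ true) →
    (∀ i → p i ≡ true → σ (σ i) ≡ i) → sum p ≡ sum (λ i → p i ∧ does (σ i Fin.≟ i))
  parity-involution {n} p σ cl inv = trans (sum-cong-≗ split) (trans (∑-distrib-+ fx (λ i → lt i xor gt i))
    (trans (cong (sum fx xor_) (trans (∑-distrib-+ lt gt) (trans (cong (sum lt xor_) (sym reindex)) (Boolₚ.xor-same (sum lt)))))
    (trans (Boolₚ.xor-identityʳ _) (sum-cong-≗ (λ i → cong (p i ∧_) (isEq-≟ i (σ i)))))))
    where
    fx lt gt : Fin n → Bool
    fx i = p i ∧ isEq i (σ i)
    lt i = p i ∧ isLt i (σ i)
    gt i = p i ∧ isGt i (σ i)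
    split : ∀ i → p i ≡ fx i xor (lt i xor gt i)
    split i with p i
    ... | false = refl
    ... | true = isCmp i (σ i)
    -- Extended by the identity outside p, σ permutes all indices.
    σ′ : Fin n → Fin n
    σ′ i = if p i then σ i else i
    σ′-true : ∀ i → p i ≡ true → σ′ i ≡ σ i
    σ′-true i e rewrite e = refl
    σ′-false : ∀ i → p i ≡ false → σ′ i ≡ i
    σ′-false i e rewrite e = refl
    σ′-inv : ∀ i → σ′ (σ′ i) ≡ i
    σ′-inv i with p i in e
    ... | true = trans (σ′-true (σ i) (cl i e)) (inv i e)
    ... | false = σ′-false i e
    π : Permutation n n
    π = permutation σ′ σ′ σ′-inv σ′-inv
    lt-σ′ : ∀ i → lt (σ′ i) ≡ gt i
    lt-σ′ i with p i in e
    ... | true = trans (cong₂ (λ b j → b ∧ isLt (σ i) j) (cl i e) (inv i e)) (isLt-swap i (σ i))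
    ... | false = cong (_∧ isLt i (σ i)) e
    reindex : sum lt ≡ sum gt
    reindex = trans (sum-permute lt π) (sum-cong-≗ lt-σ′)

  parity-single : ∀ {n} (i₀ : Fin n) → sum (λ i → does (i Fin.≟ i₀)) ≡ true
  parity-single {suc n} zero = cong (true xor_) (zeros n (λ i → does (suc i Fin.≟ zero)) (λ _ → refl))
    where
    zeros : ∀ n (q : Fin n → Bool) → (∀ i → q i ≡ false) → sum q ≡ false
    zeros zero q h = refl
    zeros (suc n) q h = cong₂ _xor_ (h zero) (zeros n (q ∘ suc) (h ∘ suc))
  parity-single {suc n} (suc i₀) = trans (sum-cong-≗ {n} {λ i → does (suc i Fin.≟ suc i₀)} {λ i → does (i Fin.≟ i₀)} (λ i → eq i (i Fin.≟ i₀))) (parity-single i₀)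
    where
    eq : ∀ i → Dec (i ≡ i₀) → does (suc i Fin.≟ suc i₀) ≡ does (i Fin.≟ i₀)
    eq i (yes e) = trans (dec-true (suc i Fin.≟ suc i₀) (cong suc e)) (sym (dec-true (i Fin.≟ i₀) e))
    eq i (no ne) = trans (dec-false (suc i Fin.≟ suc i₀) (ne ∘ Finₚ.suc-injective)) (sym (dec-false (i Fin.≟ i₀) ne))

  even⇒another : ∀ {n} (p : Fin n → Bool) i₀ → sum p ≡ false → p i₀ ≡ true → ∃[ i ] ¬ i ≡ i₀ × p i ≡ true
  even⇒another p i₀ ev e₀ with Finₚ.any? (λ i → ¬? (i Fin.≟ i₀) ×-dec (p i Boolₚ.≟ true))
  ... | yes r = r
  ... | no none = ⊥-elim (true≢false (trans (sym (parity-single i₀)) (trans (sym (sum-cong-≗ same)) ev)))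
    where
    true≢false : ¬ true ≡ false
    true≢false ()
    same : ∀ i → p i ≡ does (i Fin.≟ i₀)
    same i with i Fin.≟ i₀
    ... | yes refl = e₀
    ... | no ne = Boolₚ.¬-not (λ e → none (i , ne , e))

least : ∀ {n} {P : Fin n → Set} → (∀ i → Dec (P i)) → ∃ P → Σ[ i ∈ Fin n ] P i × (∀ j → P j → i Fin.≤ j)
least {suc n} {P} P? (i , p) with P? zero
... | yes p₀ = zero , p₀ , λ _ _ → z≤n
... | no np with i
...   | zero = ⊥-elim (np p)
...   | suc j with least (P? ∘ suc) (j , p)
...     | (k , q , h) = suc k , q , λ { zero r → ⊥-elim (np r) ; (suc l) r → s≤s (h l r) }

-- 2-subgroups of a group of permutations of a finite set, given by a chain of generators.
module TwoSubgroups {C : Set} {n : ℕ} (to : C → Fin n) (from : Fin n → C) (from-to : ∀ x → from (to x) ≡ x) (to-from : ∀ i → to (from i) ≡ i)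
  (A : (C → C) → Set) (A? : ∀ f → Dec (A f)) (A-resp : ∀ {f g} → (∀ x → f x ≡ g x) → A f → A g)
  (A-id : A id) (A-∘ : ∀ {f g} → A f → A g → A (f ∘ g))
  (A-inv : ∀ {f} → A f → Σ[ f′ ∈ (C → C) ] A f′ × (∀ x → f (f′ x) ≡ x) × (∀ x → f′ (f x) ≡ x)) where

  record G : Set where
    constructor mk
    field
      fn inv : C → C
      fn-A : A fn
      inv-A : A inv
      fn-inv : ∀ x → fn (inv x) ≡ x
      inv-fn : ∀ x → inv (fn x) ≡ x
  open G

  ε : G
  ε = mk id id A-id A-id (λ _ → refl) (λ _ → refl)

  infixl 7 _⊙_
  _⊙_ : G → G → G
  g ⊙ h = mk (fn g ∘ fn h) (inv h ∘ inv g) (A-∘ (fn-A g) (fn-A h)) (A-∘ (inv-A h) (inv-A g))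
    (λ x → trans (cong (fn g) (fn-inv h _)) (fn-inv g x)) (λ x → trans (cong (inv h) (inv-fn g _)) (inv-fn h x))

  _⁻¹ : G → G
  g ⁻¹ = mk (inv g) (fn g) (inv-A g) (fn-A g) (inv-fn g) (fn-inv g)

  fromA : ∀ f → A f → G
  fromA f af with A-inv af
  ... | (f′ , af′ , l , r) = mk f f′ af af′ l r

  -- If N is the group of `gs`, that of `g ∷ gs` is N ∪ g⁻¹N. Under `Valid` g normalises N and g²
  -- lies in N, so this is a group in which N has index at most 2.
  Mem : List G → (C → C) → Set
  Mem [] f = ∀ x → f x ≡ x
  Mem (g ∷ gs) f = Mem gs f ⊎ Mem gs (fn g ∘ f)

  Normal : List G → G → Set
  Normal gs g = ∀ h → Mem gs h → Mem gs (inv g ∘ h ∘ fn g)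

  Valid : List G → Set
  Valid [] = ⊤
  Valid (g ∷ gs) = Valid gs × Mem gs (fn g ∘ fn g) × Normal gs g

  ≡? : (x y : C) → Dec (x ≡ y)
  ≡? x y = Dec.map′ (λ e → trans (sym (from-to x)) (trans (cong from e) (from-to y))) (cong to) (to x Fin.≟ to y)

  all-C? : ∀ {P : C → Set} → (∀ x → Dec (P x)) → Dec (∀ x → P x)
  all-C? {P} P? = Dec.map′ (λ h x → subst P (from-to x) (h (to x))) (λ h i → h (from i)) (Finₚ.all? (λ i → P? (from i)))

  Mem? : ∀ gs f → Dec (Mem gs f)
  Mem? [] f = all-C? (λ x → ≡? (f x) x)
  Mem? (g ∷ gs) f = Mem? gs f ⊎-dec Mem? gs (fn g ∘ f)

  opaque
    mem-resp : ∀ gs {f f′} → (∀ x → f x ≡ f′ x) → Mem gs f → Mem gs f′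
    mem-resp [] e m x = trans (sym (e x)) (m x)
    mem-resp (g ∷ gs) e (inj₁ m) = inj₁ (mem-resp gs e m)
    mem-resp (g ∷ gs) e (inj₂ m) = inj₂ (mem-resp gs (λ x → cong (fn g) (e x)) m)

    mem-id : ∀ gs → Mem gs id
    mem-id [] x = refl
    mem-id (g ∷ gs) = inj₁ (mem-id gs)

    mutual
      mem-∘ : ∀ gs → Valid gs → ∀ {f f′} → Mem gs f → Mem gs f′ → Mem gs (f ∘ f′)
      mem-∘ [] v {f} m m′ x = trans (cong f (m′ x)) (m x)
      mem-∘ (g ∷ gs) (v , sq , nm) (inj₁ m) (inj₁ m′) = inj₁ (mem-∘ gs v m m′)
      mem-∘ (g ∷ gs) (v , sq , nm) (inj₂ m) (inj₁ m′) = inj₂ (mem-∘ gs v m m′)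
      mem-∘ (g ∷ gs) (v , sq , nm) {f} {f′} (inj₁ m) (inj₂ m′) = inj₂ (mem-resp gs
        (λ x → cong (fn g) (trans (fn-inv g _) (cong f (trans (fn-inv g _) (inv-fn g (f′ x))))))
        (mem-∘ gs v sq (mem-∘ gs v (nm f m) (mem-∘ gs v (sq⁻¹ g gs v sq) m′))))
      mem-∘ (g ∷ gs) (v , sq , nm) {f} {f′} (inj₂ m) (inj₂ m′) = inj₁ (mem-resp gs
        (λ x → trans (inv-fn g _) (cong f (trans (fn-inv g _) (inv-fn g _))))
        (mem-∘ gs v (nm (fn g ∘ f) m) (mem-∘ gs v (sq⁻¹ g gs v sq) m′)))

      sq⁻¹ : ∀ g gs → Valid gs → Mem gs (fn g ∘ fn g) → Mem gs (inv g ∘ inv g)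
      sq⁻¹ g gs v sq = mem-inv gs v sq (λ x → trans (cong (fn g) (fn-inv g _)) (fn-inv g x))

      mem-inv : ∀ gs → Valid gs → ∀ {f f′} → Mem gs f → (∀ x → f (f′ x) ≡ x) → Mem gs f′
      mem-inv [] v {f} {f′} m e x = trans (sym (m (f′ x))) (e x)
      mem-inv (g ∷ gs) v (inj₁ m) e = inj₁ (mem-inv gs (proj₁ v) m e)
      mem-inv (g ∷ gs) (v , sq , nm) {f} {f′} (inj₂ m) e = inj₂ (mem-resp gs
        (λ x → cong (fn g) (trans (fn-inv g _) (cong f′ (inv-fn g x))))
        (mem-∘ gs v sq (nm (f′ ∘ inv g) (mem-inv gs v m (λ x → trans (cong (fn g) (e (inv g x))) (fn-inv g x))))))

    mem-A : ∀ gs {f} → Mem gs f → A f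
    mem-A [] m = A-resp (λ x → sym (m x)) A-id
    mem-A (g ∷ gs) (inj₁ m) = mem-A gs m
    mem-A (g ∷ gs) (inj₂ m) = A-resp (λ x → inv-fn g _) (A-∘ (inv-A g) (mem-A gs m))

  M : ℕ
  M = n ℕ.^ n

  -- Maps are numbered so that a coset has a least representative and sets of cosets can be counted
  -- with `sum`.
  code : (C → C) → Fin M
  code f = funToFin (to ∘ f ∘ from)

  decode : Fin M → C → C
  decode i = from ∘ finToFun i ∘ to

  opaque
    decode-code : ∀ f x → decode (code f) x ≡ f x
    decode-code f x = trans (cong from (Finₚ.finToFun-funToFin (to ∘ f ∘ from) (to x))) (trans (from-to _) (cong f (from-to x)))

  module Cosets (gs : List G) (v : Valid gs) where
    -- Membership of k in the left coset gN, where N is the group of `gs`.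
    _∼_ : G → (C → C) → Set
    g ∼ k = Mem gs (inv g ∘ k)

    opaque
      rep-search : ∀ g → Σ[ i ∈ Fin M ] g ∼ decode i × (∀ j → g ∼ decode j → i Fin.≤ j)
      rep-search g = least (λ i → Mem? gs (inv g ∘ decode i))
        (code (fn g) , mem-resp gs (λ x → sym (trans (cong (inv g) (decode-code (fn g) x)) (inv-fn g x))) (mem-id gs))

      ∼-trans : ∀ g h {k} → g ∼ fn h → h ∼ k → g ∼ k
      ∼-trans g h m m′ = mem-resp gs (λ x → cong (inv g) (fn-inv h _)) (mem-∘ gs v m m′)

      ∼-sym : ∀ g h → g ∼ fn h → h ∼ fn g
      ∼-sym g h m = mem-inv gs v m (λ x → trans (cong (inv g) (fn-inv h _)) (inv-fn g x))

      ∼-refl : ∀ g → g ∼ fn g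
      ∼-refl g = mem-resp gs (λ x → sym (inv-fn g x)) (mem-id gs)

      ∼-left : ∀ s g {k} → g ∼ k → (s ⊙ g) ∼ (fn s ∘ k)
      ∼-left s g m = mem-resp gs (λ x → cong (inv g) (sym (inv-fn s _))) m

    rep : G → Fin M
    rep g = proj₁ (rep-search g)

    opaque
      rep-∼ : ∀ g → g ∼ decode (rep g)
      rep-∼ g = proj₁ (proj₂ (rep-search g))

      rep-cong : ∀ g h → g ∼ fn h → rep g ≡ rep h
      rep-cong g h m = Finₚ.≤-antisym (proj₂ (proj₂ (rep-search g)) _ (∼-trans g h m (rep-∼ h)))
        (proj₂ (proj₂ (rep-search h)) _ (∼-trans h g (∼-sym g h m) (rep-∼ g)))

      decode-A : ∀ g → A (decode (rep g))
      decode-A g = A-resp (λ x → fn-inv g _) (A-∘ (fn-A g) (mem-A gs (rep-∼ g)))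

    IsRep : Fin M → Set
    IsRep i = Σ[ af ∈ A (decode i) ] rep (fromA (decode i) af) ≡ i

    elem : ∀ {i} → IsRep i → G
    elem {i} (af , _) = fromA (decode i) af

    opaque
      unfolding rep-search
      fn-fromA : ∀ f af x → fn (fromA f af) x ≡ f x
      fn-fromA f af x with A-inv af
      ... | (f′ , af′ , l , r) = refl

    opaque
      fromA-∼ : ∀ g (af : A (decode (rep g))) → g ∼ fn (fromA (decode (rep g)) af)
      fromA-∼ g af = mem-resp gs (λ x → cong (inv g) (sym (fn-fromA _ af x))) (rep-∼ g)

      isRep-rep : ∀ g → IsRep (rep g)
      isRep-rep g = decode-A g , sym (rep-cong g (fromA (decode (rep g)) (decode-A g)) (fromA-∼ g (decode-A g)))

      isRep? : ∀ i → Dec (IsRep i)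
      isRep? i with A? (decode i)
      ... | no na = no (λ { (af , _) → na af })
      ... | yes af with rep (fromA (decode i) af) Fin.≟ i
      ...   | yes e = yes (af , e)
      ...   | no ne = no (λ { (af′ , e) → ne (trans (rep-cong (fromA (decode i) af) (fromA (decode i) af′)
                (mem-resp gs (λ x → trans (sym (inv-fn (fromA (decode i) af) x)) (cong (inv (fromA (decode i) af))
                  (trans (fn-fromA _ af x) (sym (fn-fromA _ af′ x))))) (mem-id gs))) e) })

      elem-∼ : ∀ g (r : IsRep (rep g)) → g ∼ fn (elem r)
      elem-∼ g (af , _) = fromA-∼ g af

      rep-elem : ∀ {i} (r : IsRep i) → rep (elem r) ≡ i
      rep-elem (af , e) = e

    lift : (G → G) → Fin M → Fin M
    lift s i with isRep? i
    ... | yes r = rep (s (elem r))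
    ... | no _ = i

    opaque
      lift-rep : ∀ s {i} → IsRep i → Σ[ r ∈ IsRep i ] lift s i ≡ rep (s (elem r))
      lift-rep s {i} r with isRep? i
      ... | yes r′ = r′ , refl
      ... | no nr = ⊥-elim (nr r)

    -- The cosets fixed under left multiplication by the generators in `ss`, and so, by
    -- `fixedBy-mem`, by all members of a valid chain.
    FixedBy : List G → Fin M → Set
    FixedBy [] i = IsRep i
    FixedBy (s ∷ ss) i = FixedBy ss i × lift (s ⊙_) i ≡ i

    fixedBy? : ∀ ss i → Dec (FixedBy ss i)
    fixedBy? [] i = isRep? i
    fixedBy? (s ∷ ss) i = fixedBy? ss i ×-dec (lift (s ⊙_) i Fin.≟ i)

    opaque
      fixedBy-rep : ∀ ss {i} → FixedBy ss i → IsRep i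
      fixedBy-rep [] r = r
      fixedBy-rep (s ∷ ss) (p , _) = fixedBy-rep ss p

      lift-elem : ∀ s {i} (r : IsRep i) → lift (s ⊙_) i ≡ rep (s ⊙ elem r)
      lift-elem s {i} r with lift-rep (s ⊙_) r
      ... | (r′ , e) = trans e (rep-cong (s ⊙ elem r′) (s ⊙ elem r) (∼-left s (elem r′) (same r′ r)))
        where
        same : ∀ (r′ r : IsRep i) → elem r′ ∼ fn (elem r)
        same (af , _) (af′ , _) = mem-resp gs (λ x → trans (sym (inv-fn (fromA (decode i) af) x)) (cong (inv (fromA (decode i) af))
          (trans (fn-fromA _ af x) (sym (fn-fromA _ af′ x))))) (mem-id gs)

      fixedBy-mem : ∀ ss → Valid ss → ∀ {i} → (fx : FixedBy ss i) → ∀ s → Mem ss (fn s) → rep (s ⊙ elem (fixedBy-rep ss fx)) ≡ i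
      fixedBy-mem [] v′ fx s m = trans (rep-cong (s ⊙ elem fx) (elem fx) (mem-resp gs (λ x → sym (trans (cong (inv (elem fx)) (trans (sym (cong (inv s) (m _))) (inv-fn s _))) (inv-fn (elem fx) x))) (mem-id gs))) (rep-elem fx)
      fixedBy-mem (g ∷ ss) (v′ , sq , nm) (fx , e) s (inj₁ m) = fixedBy-mem ss v′ fx s m
      fixedBy-mem (g ∷ ss) (v′ , sq , nm) {i} (fx , e) s (inj₂ m) = trans (rep-cong (s ⊙ x) (g ⁻¹ ⊙ x)
          (∼-trans (s ⊙ x) (g ⁻¹ ⊙ (g ⊙ s ⊙ x)) (mem-resp gs (λ y → sym (trans (cong (inv x ∘ inv s) (inv-fn g _)) (trans (cong (inv x) (inv-fn s _)) (inv-fn x y)))) (mem-id gs))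
            (∼-left (g ⁻¹) (g ⊙ s ⊙ x) gsx∼x)))
          (trans (sym (rep-cong x (g ⁻¹ ⊙ x) x∼g⁻¹x)) (rep-elem r))
        where
        r : IsRep i
        r = fixedBy-rep ss fx
        x : G
        x = elem r
        repeq⇒∼ : ∀ y z → rep y ≡ rep z → y ∼ fn z
        repeq⇒∼ y z eq = ∼-trans y (elem (isRep-rep y)) (elem-∼ y (isRep-rep y))
          (∼-sym z (elem (isRep-rep y)) (mem-resp gs (λ w → cong (inv z) (trans (cong (λ k → decode k w) (sym eq)) (sym (fn-fromA _ (decode-A y) w)))) (rep-∼ z)))
        gsx∼x : (g ⊙ s ⊙ x) ∼ fn x
        gsx∼x = repeq⇒∼ (g ⊙ s ⊙ x) x (trans (fixedBy-mem ss v′ fx (g ⊙ s) m) (sym (rep-elem r)))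
        x∼g⁻¹x : x ∼ (inv g ∘ fn x)
        x∼g⁻¹x = ∼-trans x (g ⁻¹ ⊙ (g ⊙ x)) (mem-resp gs (λ y → sym (trans (cong (inv x) (inv-fn g _)) (inv-fn x y))) (mem-id gs))
          (∼-left (g ⁻¹) (g ⊙ x) (repeq⇒∼ (g ⊙ x) x (trans (sym (lift-elem g r)) (trans e (sym (rep-elem r))))))

      rep≡⇒∼ : ∀ y z → rep y ≡ rep z → y ∼ fn z
      rep≡⇒∼ y z eq = ∼-trans y (elem (isRep-rep y)) (elem-∼ y (isRep-rep y))
          (∼-sym z (elem (isRep-rep y)) (mem-resp gs (λ w → cong (inv z) (trans (cong (λ k → decode k w) (sym eq)) (sym (fn-fromA _ (decode-A y) w)))) (rep-∼ z)))

      mem-fixes : ∀ ss → Valid ss → ∀ {i} (r : IsRep i) → (∀ s → Mem ss (fn s) → rep (s ⊙ elem r) ≡ i) → FixedBy ss i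
      mem-fixes [] _ r h = r
      mem-fixes (g ∷ ss) (v′ , sq , nm) r h = mem-fixes ss v′ r (λ s m → h s (inj₁ m)) , trans (lift-elem g r) (h g (inj₂ sq))

      -- As g normalises the group of `ss`, it permutes the cosets fixed by that group; its square
      -- lies in the group and hence acts trivially on them.
      fixedBy-step : ∀ g ss → Valid (g ∷ ss) → ∀ i → FixedBy ss i → FixedBy ss (lift (g ⊙_) i) × lift (g ⊙_) (lift (g ⊙_) i) ≡ i
      fixedBy-step g ss (v′ , sq , nm) i fx = subst (FixedBy ss) (sym li) (mem-fixes ss v′ r′ fixed) ,
        trans (cong (lift (g ⊙_)) li) (trans (lift-elem g r′) (trans (rep-cong (g ⊙ elem r′) (g ⊙ (g ⊙ x)) (∼-left g (elem r′) (∼-sym (g ⊙ x) (elem r′) (elem-∼ (g ⊙ x) r′))))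
          (trans (rep-cong (g ⊙ (g ⊙ x)) (g ⊙ g ⊙ x) (∼-refl (g ⊙ (g ⊙ x)))) (fixedBy-mem ss v′ fx (g ⊙ g) sq))))
        where
        r : IsRep i
        r = fixedBy-rep ss fx
        x : G
        x = elem r
        r′ : IsRep (rep (g ⊙ x))
        r′ = isRep-rep (g ⊙ x)
        li : lift (g ⊙_) i ≡ rep (g ⊙ x)
        li = lift-elem g r
        fixed : ∀ s → Mem ss (fn s) → rep (s ⊙ elem r′) ≡ rep (g ⊙ x)
        fixed s m = trans (rep-cong (s ⊙ elem r′) (s ⊙ (g ⊙ x)) (∼-left s (elem r′) (∼-sym (g ⊙ x) (elem r′) (elem-∼ (g ⊙ x) r′))))
          (trans (rep-cong (s ⊙ (g ⊙ x)) (g ⊙ (g ⁻¹ ⊙ s ⊙ g ⊙ x)) (mem-resp gs (λ y → sym (trans (cong (inv x ∘ inv g ∘ inv s) (fn-inv g _)) (trans (cong (inv x ∘ inv g) (inv-fn s _)) (trans (cong (inv x) (inv-fn g _)) (inv-fn x y))))) (mem-id gs)))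
          (rep-cong (g ⊙ (g ⁻¹ ⊙ s ⊙ g ⊙ x)) (g ⊙ x) (∼-left g (g ⁻¹ ⊙ s ⊙ g ⊙ x) (rep≡⇒∼ (g ⁻¹ ⊙ s ⊙ g ⊙ x) x (trans (fixedBy-mem ss v′ fx (g ⁻¹ ⊙ s ⊙ g) (nm (fn s) m)) (sym (rep-elem r)))))))

      -- Each generator is an involution on the cosets fixed by those after it in the list, so the
      -- parity of the number of fixed cosets never changes.
      fixedBy-even : ∀ ss → Valid ss → sum (λ i → does (isRep? i)) ≡ false → sum (λ i → does (fixedBy? ss i)) ≡ false
      fixedBy-even [] v′ ev = ev
      fixedBy-even (g ∷ ss) v′ ev = trans (sym (parity-involution (λ i → does (fixedBy? ss i)) (lift (g ⊙_))
        (λ i e → dec-true (fixedBy? ss _) (proj₁ (fixedBy-step g ss v′ i (does⇒ (fixedBy? ss i) e))))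
        (λ i e → proj₂ (fixedBy-step g ss v′ i (does⇒ (fixedBy? ss i) e))))) (fixedBy-even ss (proj₁ v′) ev)

      -- NxN = xN means that x⁻¹Nx is contained in N. So the fixed cosets make up the quotient of
      -- the normaliser of N by N.
      normalises : ∀ {i} (fx : FixedBy gs i) → Normal gs (elem (fixedBy-rep gs fx))
      normalises {i} fx h m = mem-resp gs (λ y → cong (inv x) (fn-fromA h (mem-A gs m) (fn x y)))
        (rep≡⇒∼ x (fromA h (mem-A gs m) ⊙ x) (trans (rep-elem r) (sym (fixedBy-mem gs v fx (fromA h (mem-A gs m)) (mem-resp gs (λ y → sym (fn-fromA h (mem-A gs m) y)) m)))))
        where
        r : IsRep i
        r = fixedBy-rep gs fx
        x : G
        x = elem r

      -- Conjugation by g permutes the finite group Mem gs, so the inverse conjugation preserves it as well.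
      normal-inv : ∀ g → Normal gs g → Normal gs (g ⁻¹)
      normal-inv g nm h m = mem-resp gs conj-power (conj k h m)
        where
        pigeon : ∃[ k ] (∀ x → iter (fn g) (suc k) x ≡ x)
        pigeon with Finₚ.pigeonhole (ℕₚ.n<1+n M) (λ i → code (iter (fn g) (toℕ i)))
        ... | (i , j , i<j , e) with ℕₚ.m≤n⇒∃[o]m+o≡n i<j
        ...   | (k , ek) = k , λ x → iter-injective (λ {a} {b} e → trans (sym (inv-fn g a)) (trans (cong (inv g) e) (inv-fn g b))) (toℕ i)
                (trans (sym (iter-+ (fn g) (toℕ i) (suc k) x)) (trans (cong (λ l → iter (fn g) l x) (trans (ℕₚ.+-suc (toℕ i) k) ek))
                (trans (sym (decode-code (iter (fn g) (toℕ j)) x)) (trans (cong (λ c → decode c x) (sym e)) (decode-code (iter (fn g) (toℕ i)) x)))))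
        k : ℕ
        k = proj₁ pigeon
        conj : ∀ k h → Mem gs h → Mem gs (iter (inv g) k ∘ h ∘ iter (fn g) k)
        conj zero h m = m
        conj (suc k) h m = mem-resp gs (λ x → cong (inv g ∘ iter (inv g) k ∘ h) (sym (comm k x))) (conj′ k)
          where
          comm : ∀ k x → fn g (iter (fn g) k x) ≡ iter (fn g) k (fn g x)
          comm zero x = refl
          comm (suc k) x = cong (fn g) (comm k x)
          conj′ : ∀ k → Mem gs (inv g ∘ iter (inv g) k ∘ h ∘ iter (fn g) k ∘ fn g)
          conj′ k = nm _ (conj k h m)
        inv≡power : ∀ x → inv g x ≡ iter (fn g) k x
        inv≡power x = trans (cong (inv g) (sym (proj₂ pigeon x))) (inv-fn g _)
        power-inv : ∀ k x → iter (inv g) k (iter (fn g) k x) ≡ x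
        power-inv zero x = refl
        power-inv (suc k) x = trans (cong (inv g) (trans (cong (iter (inv g) k) (sym (lem k x))) (power-inv′ k x))) (inv-fn g x)
          where
          lem : ∀ k x → iter (fn g) k (fn g x) ≡ fn g (iter (fn g) k x)
          lem zero x = refl
          lem (suc k) x = cong (fn g) (lem k x)
          power-inv′ : ∀ k x → iter (inv g) k (iter (fn g) k (fn g x)) ≡ fn g x
          power-inv′ k x = power-inv k (fn g x)
        conj-power : ∀ x → iter (inv g) k (h (iter (fn g) k x)) ≡ fn g (h (inv g x))
        conj-power x = trans (cong (λ z → iter (inv g) k (h z)) (sym (inv≡power x)))
          (trans (cong (iter (inv g) k) (sym (trans (sym (inv≡power (fn g (h (inv g x))))) (inv-fn g _)))) (power-inv k _))

      lift-inv : ∀ {i} (r : IsRep i) → lift _⁻¹ i ≡ rep (elem r ⁻¹)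
      lift-inv {i} r with lift-rep _⁻¹ r
      ... | (r′ , e) = trans e (rep-cong (elem r′ ⁻¹) (elem r ⁻¹) (mem-resp gs (λ x → sym (same r′ r x)) (mem-id gs)))
        where
        same : ∀ (r′ r : IsRep i) x → fn (elem r′) (inv (elem r) x) ≡ x
        same (af , _) (af′ , _) x = trans (fn-fromA _ af _) (trans (sym (fn-fromA _ af′ _)) (fn-inv (fromA (decode i) af′) x))

      inversion-step : ∀ i → FixedBy gs i → FixedBy gs (lift _⁻¹ i) × lift _⁻¹ (lift _⁻¹ i) ≡ i
      inversion-step i fx = subst (FixedBy gs) (sym (lift-inv r)) (mem-fixes gs v r′ fixed) ,
        trans (cong (lift _⁻¹) (lift-inv r)) (trans (lift-inv r′) (trans (rep-cong (e ⁻¹) x back) (rep-elem r)))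
        where
        r : IsRep i
        r = fixedBy-rep gs fx
        x : G
        x = elem r
        nm : Normal gs x
        nm = normalises fx
        r′ : IsRep (rep (x ⁻¹))
        r′ = isRep-rep (x ⁻¹)
        e : G
        e = elem r′
        back : Mem gs (fn e ∘ fn x)
        back = mem-resp gs (λ y → inv-fn x _) (nm (fn x ∘ fn e) (elem-∼ (x ⁻¹) r′))
        fixed : ∀ s → Mem gs (fn s) → rep (s ⊙ e) ≡ rep (x ⁻¹)
        fixed s m = trans (rep-cong (s ⊙ e) (s ⊙ x ⁻¹) (∼-left s e (∼-sym (x ⁻¹) e (elem-∼ (x ⁻¹) r′))))
          (rep-cong (s ⊙ x ⁻¹) (x ⁻¹) (normal-inv x nm (inv s) (mem-inv gs v m (fn-inv s))))

    module _ (x y : C) (x≢y : ¬ x ≡ y) (fixes : ∀ h → Mem gs h → h x ≡ x × h y ≡ y) (sw : C → C → G)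
      (sw-l : ∀ u v → ¬ u ≡ v → fn (sw u v) u ≡ v) (sw-r : ∀ u v → ¬ u ≡ v → fn (sw u v) v ≡ u)
      (sw-inv : ∀ u v → ¬ u ≡ v → ∀ z → fn (sw v u) (fn (sw u v) z) ≡ z) where

      -- The group N fixes x and y, so the points gx and gy depend only on the coset gN; Φ exchanges
      -- them. It is an involution of the cosets without fixed points, whence N has even index.
      Φ : G → G
      Φ g = sw (fn g x) (fn g y) ⊙ g

      opaque
        fn≢ : ∀ g → ¬ fn g x ≡ fn g y
        fn≢ g e = x≢y (trans (sym (inv-fn g x)) (trans (cong (inv g) e) (inv-fn g y)))

        ∼-x : ∀ g h → g ∼ fn h → fn h x ≡ fn g x
        ∼-x g h m = trans (sym (fn-inv g _)) (cong (fn g) (proj₁ (fixes _ m)))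

        ∼-y : ∀ g h → g ∼ fn h → fn h y ≡ fn g y
        ∼-y g h m = trans (sym (fn-inv g _)) (cong (fn g) (proj₂ (fixes _ m)))

        Φ-involutive : ∀ g h → Φ g ∼ fn h → g ∼ fn (Φ h)
        Φ-involutive g h m = mem-resp gs lem m
          where
          u v′ : C
          u = fn g x
          v′ = fn g y
          hx : fn h x ≡ v′
          hx = trans (∼-x (Φ g) h m) (sw-l u v′ (fn≢ g))
          hy : fn h y ≡ u
          hy = trans (∼-y (Φ g) h m) (sw-r u v′ (fn≢ g))
          lem : ∀ z → inv (Φ g) (fn h z) ≡ inv g (fn (Φ h) z)
          lem z = trans (sym (inv-fn g _)) (cong (inv g) (trans (sym (sw-inv u v′ (fn≢ g) _)) (trans (cong (fn (sw v′ u)) (fn-inv (Φ g) (fn h z)))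
            (cong₂ (λ p q → fn (sw p q) (fn h z)) (sym hx) (sym hy)))))

        reps-even : sum (λ i → does (isRep? i)) ≡ false
        reps-even = trans (parity-involution (λ i → does (isRep? i)) (lift Φ) cl inv′) (none (λ i → does (isRep? i) ∧ does (lift Φ i Fin.≟ i)) nofix)
          where
          cl : ∀ i → does (isRep? i) ≡ true → does (isRep? (lift Φ i)) ≡ true
          cl i e with lift-rep Φ (does⇒ (isRep? i) e)
          ... | (r , eq) = dec-true (isRep? _) (subst IsRep (sym eq) (isRep-rep _))
          inv′ : ∀ i → does (isRep? i) ≡ true → lift Φ (lift Φ i) ≡ i
          inv′ i e with lift-rep Φ (does⇒ (isRep? i) e)
          ... | (r , eq) with lift-rep Φ (isRep-rep (Φ (elem r)))
          ...   | (r₂ , eq₂) = trans (cong (lift Φ) eq) (trans eq₂ (trans (sym (rep-cong (elem r) (Φ (elem r₂)) (Φ-involutive (elem r) (elem r₂) (elem-∼ (Φ (elem r)) r₂)))) (rep-elem r)))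
          nofix : ∀ i → does (isRep? i) ∧ does (lift Φ i Fin.≟ i) ≡ false
          nofix i with isRep? i in eqr
          ... | no _ = refl
          ... | yes r₀ = dec-false (rep (Φ (elem r₀)) Fin.≟ i) contra
            where
            contra : ¬ rep (Φ (elem r₀)) ≡ i
            contra e = fn≢ (elem r₀) (trans (∼-x (Φ (elem r₀)) (elem r₀) m) (sw-l _ _ (fn≢ (elem r₀))))
              where
              m : Φ (elem r₀) ∼ fn (elem r₀)
              m = rep≡⇒∼ (Φ (elem r₀)) (elem r₀) (trans e (sym (rep-elem r₀)))
          none : ∀ {k} (q : Fin k → Bool) → (∀ i → q i ≡ false) → sum q ≡ false
          none {zero} q h = refl
          none {suc k} q h = cong₂ _xor_ (h zero) (none (q ∘ suc) (h ∘ suc))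

        -- As the index is even, so is the number of cosets fixed by N, that is, the order of the
        -- normaliser modulo N. Inversion there fixes the trivial coset, hence another one, and its
        -- elements have their squares in N. This is the inductive step in Sylow's theorem.
        extension : Σ[ g ∈ G ] ¬ Mem gs (fn g) × Mem gs (fn g ∘ fn g) × Normal gs g
        extension with even⇒another (λ i → does (fixedBy? gs i) ∧ does (lift _⁻¹ i Fin.≟ i)) (rep ε)
            (trans (sym (parity-involution (λ i → does (fixedBy? gs i)) (lift _⁻¹)
              (λ i e → dec-true (fixedBy? gs _) (proj₁ (inversion-step i (does⇒ (fixedBy? gs i) e))))
              (λ i e → proj₂ (inversion-step i (does⇒ (fixedBy? gs i) e))))) (fixedBy-even gs v reps-even))
            (cong₂ _∧_ (dec-true (fixedBy? gs _) (mem-fixes gs v rε fixed)) (dec-true (lift _⁻¹ (rep ε) Fin.≟ rep ε) (trans (lift-inv rε)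
              (rep-cong (elem rε ⁻¹) ε (elem-∼ ε rε)))))
          where
          rε : IsRep (rep ε)
          rε = isRep-rep ε
          fixed : ∀ s → Mem gs (fn s) → rep (s ⊙ elem rε) ≡ rep ε
          fixed s m = trans (rep-cong (s ⊙ elem rε) (s ⊙ ε) (∼-left s (elem rε) (∼-sym ε (elem rε) (elem-∼ ε rε)))) (rep-cong (s ⊙ ε) ε (mem-inv gs v m (fn-inv s)))
        ... | (i , ne , e) = g , (λ m → ne (trans (sym (rep-elem r)) (sym (rep-cong ε g m)))) ,
            rep≡⇒∼ (g ⁻¹) g (trans (sym (lift-inv r)) (trans (does⇒ (lift _⁻¹ i Fin.≟ i) (Boolₚ.∧-conicalʳ (does (fixedBy? gs i)) _ e)) (sym (rep-elem r)))) , normalises fx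
          where
          fx : FixedBy gs i
          fx = does⇒ (fixedBy? gs i) (Boolₚ.∧-conicalˡ _ _ e)
          r : IsRep i
          r = fixedBy-rep gs fx
          g : G
          g = elem r

  members : List G → Subset M
  members gs = tabulate (λ i → does (Mem? gs (decode i)))

  opaque
    ∈-members⁺ : ∀ gs i → Mem gs (decode i) → i Subset.∈ members gs
    ∈-members⁺ gs i m = lookup⇒[]= i _ (trans (lookup∘tabulate _ i) (dec-true (Mem? gs (decode i)) m))

    ∈-members⁻ : ∀ gs i → i Subset.∈ members gs → Mem gs (decode i)
    ∈-members⁻ gs i m = does⇒ (Mem? gs (decode i)) (trans (sym (lookup∘tabulate _ i)) ([]=⇒lookup m))

    members-grow : ∀ g gs → Mem gs (fn g ∘ fn g) → ¬ Mem gs (fn g) → ∣ members gs ∣ ℕ.< ∣ members (g ∷ gs) ∣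
    members-grow g gs sq nm = Subsetₚ.p⊂q⇒∣p∣<∣q∣ ((λ {i} m → ∈-members⁺ (g ∷ gs) i (inj₁ (∈-members⁻ gs i m))) ,
      code (fn g) , ∈-members⁺ (g ∷ gs) _ (mem-resp (g ∷ gs) (λ x → sym (decode-code (fn g) x)) (inj₂ sq)) ,
      λ m → nm (mem-resp gs (decode-code (fn g)) (∈-members⁻ gs _ m)))

    -- Every extension adds a member, and there are at most M of them, so Q has to fail at some
    -- step. The counter k bounds the steps left.
    last-with : ∀ {Q : List G → Set} → (∀ gs → Dec (Q gs)) → Q [] →
      (∀ gs → Valid gs → Q gs → Σ[ g ∈ G ] ¬ Mem gs (fn g) × Mem gs (fn g ∘ fn g) × Normal gs g) →
      Σ[ gs ∈ List G ] Σ[ g ∈ G ] Valid gs × Q gs × ¬ Q (g ∷ gs) × Mem gs (fn g ∘ fn g) × Normal gs g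
    last-with {Q} Q? q₀ ext = go M [] tt q₀ (ℕₚ.m≤m+n M _)
      where
      go : ∀ k gs → Valid gs → Q gs → M ℕ.≤ k ℕ.+ ∣ members gs ∣ →
        Σ[ gs ∈ List G ] Σ[ g ∈ G ] Valid gs × Q gs × ¬ Q (g ∷ gs) × Mem gs (fn g ∘ fn g) × Normal gs g
      go k gs v q l with ext gs v q
      ... | (g , nm , sq , nr) with Q? (g ∷ gs)
      ...   | no nq = gs , g , v , q , nq , sq , nr
      go zero gs v q l | (g , nm , sq , nr) | yes q′ = ⊥-elim (ℕₚ.<⇒≱ (ℕₚ.≤-trans (members-grow g gs sq nm) (Subsetₚ.∣p∣≤n (members (g ∷ gs)))) l)
      go (suc k) gs v q l | (g , nm , sq , nr) | yes q′ = go k (g ∷ gs) (v , sq , nr) q′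
        (ℕₚ.≤-trans l (ℕₚ.≤-trans (ℕₚ.≤-reflexive (sym (ℕₚ.+-suc k _))) (ℕₚ.+-monoʳ-≤ k (members-grow g gs sq nm))))

-- Netto triple systems outside characteristic 7.

-- For these parameters the operation is that of the Netto triple system.
module Netto (F : FiniteField) (odd : FiniteField.size F % 2 ≡ 1) (a b : FiniteField.Carrier F) where
  open Signs F odd
  open Quasi F odd

  module Steiner (a≢b : ¬ a ≡ b) (ab≡1 : a * b ≡ 1#) (a+b≡1 : a + b ≡ 1#) (Na : N a) (N-1 : N (- 1#)) where
    infixl 7 _∗_
    _∗_ : Carrier → Carrier → Carrier
    _∗_ = op a b

    opaque
      b≡1-a : b ≡ 1# - a
      b≡1-a = trans (solve 2 (λ a b → b := (a :+ b) :- a) refl a b) (cong (λ z → z - a) a+b≡1)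

      Nb : N b
      Nb with S⊎N {b} (λ e → 1≢0 (trans (sym ab≡1) (trans (cong (a *_) e) (zeroʳ a))))
      ... | inj₂ n = n
      ... | inj₁ s = ⊥-elim (S≢N S-1 (subst N ab≡1 (NS Na s)))

      -- Since ab = a + b = 1, a and b are the roots of x² - x + 1, the primitive sixth roots of
      -- unity.
      rel : a * a ≡ a - 1#
      rel = trans (solve 1 (λ a → a :* a := a :- a :* (con (+ 1) :- a)) refl a) (cong (λ z → a - z) (trans (cong (a *_) (sym b≡1-a)) ab≡1))

      -- M and C are cofactors that put p - q into the ideal generated by l - r and a² - a + 1; the
      -- ring solver checks the certificate.
      mod-rel : ∀ {p q M l r C} → p - q ≡ M * (l - r) + C * (a * a - (a - 1#)) → l ≡ r → p ≡ q
      mod-rel {M = M} {C = C} e h = x-y≡0⇒x≡y (trans e (trans (cong₂ (λ u v → M * u + C * v) (x≡y⇒x-y≡0 h) (x≡y⇒x-y≡0 rel))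
        (solve 2 (λ M C → M :* con (+ 0) :+ C :* con (+ 0) := con (+ 0)) refl M C)))

      nz1 : ¬ num 1 ≡ 0#
      nz1 = 1≢0

      nz4 : ¬ num 4 ≡ 0#
      nz4 e = xy≢0 two≢0 two≢0 (trans (solve 0 (con (+ 2) :* con (+ 2) := con (+ 4)) refl) e)

      s≢0 : ¬ num 2 * a - 1# ≡ 0#
      s≢0 e = a≢b (x-y≡0⇒x≡y (trans (cong (λ z → a - z) b≡1-a) (trans (solve 1 (λ a → a :- (con (+ 1) :- a) := con (+ 2) :* a :- con (+ 1)) refl a) e)))

      -- (2a - 1)² = -3, and 2a - 1 = a - b is not 0.
      nz3 : ¬ num 3 ≡ 0#
      nz3 e = xy≢0 s≢0 s≢0 (mod-rel {r = 0#} (solve 1 (λ a → (con (+ 2) :* a :- con (+ 1)) :* (con (+ 2) :* a :- con (+ 1)) :- con (+ 0) := (:- con (+ 1)) :* (con (+ 3) :- con (+ 0)) :+ con (+ 4) :* (a :* a :- (a :- con (+ 1)))) refl a) e)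

      nz9 : ¬ num 9 ≡ 0#
      nz9 e = xy≢0 nz3 nz3 (trans (solve 0 (con (+ 3) :* con (+ 3) := con (+ 9)) refl) e)

      nz12 : ¬ num 12 ≡ 0#
      nz12 e = xy≢0 nz3 nz4 (trans (solve 0 (con (+ 3) :* con (+ 4) := con (+ 12)) refl) e)

      nz27 : ¬ num 27 ≡ 0#
      nz27 e = xy≢0 nz3 nz9 (trans (solve 0 (con (+ 3) :* con (+ 9) := con (+ 27)) refl) e)

      -- x - y and y - x have opposite characters, and b = 1 - a reconciles the two branches. With
      -- `∗-invol` this makes the sets {x, y, x ∗ y} the blocks of a Steiner triple system.
      ∗-comm : ∀ x y → x ∗ y ≡ y ∗ x
      ∗-comm x y with sign (y - x)
      ... | zer e = cong₂ _∗_ (sym (x-y≡0⇒x≡y e)) (x-y≡0⇒x≡y e)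
      ... | pos s = trans (op-S a b s) (sym (trans (op-N a b (subst N (solve 2 (λ x y → (:- con (+ 1)) :* (y :- x) := x :- y) refl x y) (NS N-1 s)))
            (trans (cong (λ c → y + c * (x - y)) b≡1-a) (solve 3 (λ a x y → y :+ (con (+ 1) :- a) :* (x :- y) := x :+ a :* (y :- x)) refl a x y))))
      ... | neg n = trans (op-N a b n) (trans (trans (cong (λ c → x + c * (y - x)) b≡1-a) (solve 3 (λ a x y → x :+ (con (+ 1) :- a) :* (y :- x) := y :+ a :* (x :- y)) refl a x y))
            (sym (op-S a b (subst S (solve 2 (λ x y → (:- con (+ 1)) :* (y :- x) := x :- y) refl x y) (NN N-1 n)))))

      ∗-invol : ∀ x y → x ∗ (x ∗ y) ≡ y
      ∗-invol x y with sign (y - x)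
      ... | zer e = trans (cong (λ z → x ∗ (x ∗ z)) (x-y≡0⇒x≡y e)) (trans (cong (x ∗_) (op-refl a b x)) (trans (op-refl a b x) (sym (x-y≡0⇒x≡y e))))
      ... | pos s = trans (cong (x ∗_) (op-S a b s)) (trans (op-N a b (subst N (sym d) (NS Na s))) (trans (cong (λ z → x + b * z) d)
            (trans (solve 4 (λ a b x y → x :+ b :* (a :* (y :- x)) := x :+ (a :* b) :* (y :- x)) refl a b x y) (trans (cong (λ z → x + z * (y - x)) ab≡1) (solve 2 (λ x y → x :+ con (+ 1) :* (y :- x) := y) refl x y)))))
        where
        d : x + a * (y - x) - x ≡ a * (y - x)
        d = solve 3 (λ a x y → x :+ a :* (y :- x) :- x := a :* (y :- x)) refl a x y
      ... | neg n = trans (cong (x ∗_) (op-N a b n)) (trans (op-S a b (subst S (sym d) (NN Nb n))) (trans (cong (λ z → x + a * z) d)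
            (trans (solve 4 (λ a b x y → x :+ a :* (b :* (y :- x)) := x :+ (a :* b) :* (y :- x)) refl a b x y) (trans (cong (λ z → x + z * (y - x)) ab≡1) (solve 2 (λ x y → x :+ con (+ 1) :* (y :- x) := y) refl x y)))))
        where
        d : x + b * (y - x) - x ≡ b * (y - x)
        d = solve 3 (λ a x y → x :+ a :* (y :- x) :- x := a :* (y :- x)) refl b x y

      ∗-cancel : ∀ x {y z} → x ∗ y ≡ x ∗ z → y ≡ z
      ∗-cancel x {y} {z} e = trans (sym (∗-invol x y)) (trans (cong (x ∗_) e) (∗-invol x z))

      ∗-move : ∀ {x y z} → x ∗ y ≡ z → y ≡ x ∗ z
      ∗-move {x} {y} e = trans (sym (∗-invol x y)) (cong (x ∗_) e)

      x∗y≢x : ∀ {x y} → ¬ x ≡ y → ¬ x ∗ y ≡ x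
      x∗y≢x {x} {y} ne e = ne (sym (trans (∗-move e) (op-refl a b x)))

      0∗1 : 0# ∗ 1# ≡ a
      0∗1 = trans (op-S a b (subst S (solve 0 (con (+ 1) := con (+ 1) :- con (+ 0)) refl) S-1)) (solve 1 (λ a → con (+ 0) :+ a :* (con (+ 1) :- con (+ 0)) := a) refl a)

    # : ∀ {n} → ℕ → Polynomial n
    # k = con (+ k)

    :rel : ∀ {n} → Polynomial n → Polynomial n
    :rel a = a :* a :- (a :- # 1)

    :L : ∀ {n} → Polynomial n → Polynomial n → Polynomial n → Polynomial n
    :L t c x = c :+ t :* (x :- c)

    -- The two branches of c ∗ x, with b eliminated so that everything is polynomial in a.
    L : Carrier → Carrier → Bool → Carrier
    L c x true = c + a * (x - c)
    L c x false = c + (1# - a) * (x - c)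

    Sg : Bool → Carrier → Set
    Sg true = S
    Sg false = N

    s : Carrier
    s = num 2 * a - 1#

    -- `Aset` lists the values of 3z that survive in `pasch-case`, `Iset` those of them that survive
    -- in `centre-case`. Which choices of branches have consistent signs depends on the character
    -- `ss` of s = 2a - 1, a square root of -3.
    Aset Iset : Bool → List Carrier
    Aset true = (num 2 - a) ∷ (num 2 * a - 1#) ∷ (1# - num 2 * a) ∷ (1# + a) ∷ []
    Aset false = (num 2 + num 2 * a) ∷ (1# + a) ∷ (num 2 - a) ∷ (num 4 - num 2 * a) ∷ []
    Iset true = (num 2 * a - 1#) ∷ (1# + a) ∷ []
    Iset false = (1# + a) ∷ (num 2 - a) ∷ []

    opaque
      op-L : ∀ c x → ¬ x ≡ c → Σ[ σ ∈ Bool ] Sg σ (x - c) × c ∗ x ≡ L c x σ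
      op-L c x ne with S⊎N (x≢y⇒x-y≢0 ne)
      ... | inj₁ p = true , p , op-S a b p
      ... | inj₂ p = false , p , trans (op-N a b p) (cong (λ w → c + w * (x - c)) b≡1-a)

      -- Both 9 and T² are squares. In the case analysis e is a difference whose character is
      -- prescribed and u is s, as or 1, up to squares the only values that occur.
      sgn : ∀ {e u T} → ¬ T ≡ 0# → num 3 * num 3 * e ≡ u * (T * T) → X e ≡ X u
      sgn {e} {u} {T} nT eq = trans (sym (*-identityˡ _)) (trans (cong (_* X e) (sym (S-sq nz3))) (trans (sym (X-* _ _)) (trans (cong X eq)
        (trans (X-* _ _) (trans (cong (X u *_) (S-sq nT)) (*-identityʳ _))))))

      sgn-s : ∀ ss {e T} → ¬ T ≡ 0# → num 3 * num 3 * e ≡ s * (T * T) → Sg ss s → Sg ss e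
      sgn-s true nT eq h = trans (sgn nT eq) h
      sgn-s false nT eq h = trans (sgn nT eq) h

      sgn-as : ∀ ss {e T} → ¬ T ≡ 0# → num 3 * num 3 * e ≡ a * s * (T * T) → Sg ss s → Sg (not ss) e
      sgn-as true nT eq h = trans (sgn nT eq) (NS Na h)
      sgn-as false nT eq h = trans (sgn nT eq) (NN Na h)

      sgn-1 : ∀ {e T} → ¬ T ≡ 0# → num 3 * num 3 * e ≡ 1# * (T * T) → S e
      sgn-1 nT eq = trans (sgn nT eq) S-1

    -- In the next two lemmas each choice of signs turns the hypothesis into a linear equation for z over ℤ[a].
    opaque
      pasch-case : ∀ ss σ₁ σ₂ σ₃ σ₄ z → Sg ss s → Sg σ₁ (z - 1#) → Sg σ₂ (L 1# z σ₁ - 0#) → Sg σ₃ (z - 0#) → Sg σ₄ (L 0# z σ₃ - 1#) →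
        L 0# (L 1# z σ₁) σ₂ ≡ L 1# (L 0# z σ₃) σ₄ → num 3 * z ∈ Aset ss
      pasch-case ss true true true true z hs h₁ h₂ h₃ h₄ e =
        ⊥-elim (nz1 (mod-rel (solve 2 (λ a z → # 1 :- # 0 := (# 1 :+ :- # 1 :* a) :* (:L a (# 0) (:L a (# 1) z) :- :L a (# 1) (:L a (# 0) z)) :+ (# 2 :+ :- # 1 :* a) :* :rel a) refl a z) e))
      pasch-case true true true true false z hs h₁ h₂ h₃ h₄ e =
        ⊥-elim (S≢N h₁ (sgn-as true (λ e → nz3 (mod-rel (solve 2 (λ a z → # 3 :- # 0 := (:- # 2 :+ # 1 :* a) :* (:- # 1 :+ :- # 1 :* a :- # 0) :+ # 1 :* :rel a) refl a z) e))
          (mod-rel (solve 2 (λ a z → # 3 :* # 3 :* (z :- # 1) :- a :* (# 2 :* a :- # 1) :* ((:- # 1 :+ :- # 1 :* a) :* (:- # 1 :+ :- # 1 :* a)) := (:- # 3 :+ :- # 3 :* a) :* (:L a (# 0) (:L a (# 1) z) :- :L (# 1 :- a) (# 1) (:L a (# 0) z)) :+ (:- # 9 :+ # 9 :* z :+ :- # 8 :* a :+ # 6 :* a :* z :+ :- # 2 :* a :* a) :* :rel a) refl a z) e) hs))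
      pasch-case false true true true false z hs h₁ h₂ h₃ h₄ e =
        there (there (here (mod-rel (solve 2 (λ a z → # 3 :* z :- (# 2 :- a) := (:- # 1 :+ :- # 1 :* a) :* (:L a (# 0) (:L a (# 1) z) :- :L (# 1 :- a) (# 1) (:L a (# 0) z)) :+ (:- # 2 :+ # 3 :* z :+ :- # 1 :* a :+ # 2 :* a :* z) :* :rel a) refl a z) e)))
      pasch-case true true true false true z hs h₁ h₂ h₃ h₄ e =
        there (here (mod-rel (solve 2 (λ a z → # 3 :* z :- (# 2 :* a :- # 1) := (:- # 1 :+ :- # 1 :* a) :* (:L a (# 0) (:L a (# 1) z) :- :L a (# 1) (:L (# 1 :- a) (# 0) z)) :+ (# 3 :* z :+ :- # 1 :* a :+ # 2 :* a :* z) :* :rel a) refl a z) e))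
      pasch-case false true true false true z hs h₁ h₂ h₃ h₄ e =
        ⊥-elim (S≢N h₂ (sgn-s false (λ e → nz3 (mod-rel (solve 2 (λ a z → # 3 :- # 0 := (# 1 :+ :- # 2 :* a) :* (:- # 1 :+ # 2 :* a :- # 0) :+ # 4 :* :rel a) refl a z) e))
          (mod-rel (solve 2 (λ a z → # 3 :* # 3 :* (:L a (# 1) z :- # 0) :- (# 2 :* a :- # 1) :* ((:- # 1 :+ # 2 :* a) :* (:- # 1 :+ # 2 :* a)) := (# 3 :+ :- # 6 :* a) :* (:L a (# 0) (:L a (# 1) z) :- :L a (# 1) (:L (# 1 :- a) (# 0) z)) :+ (# 13 :+ :- # 14 :* a :+ # 12 :* a :* z) :* :rel a) refl a z) e) hs))
      pasch-case true true true false false z hs h₁ h₂ h₃ h₄ e =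
        ⊥-elim (S≢N h₂ (sgn-as true (λ e → nz3 (mod-rel (solve 2 (λ a z → # 3 :- # 0 := (# 1 :+ :- # 2 :* a) :* (:- # 1 :+ # 2 :* a :- # 0) :+ # 4 :* :rel a) refl a z) e))
          (mod-rel (solve 2 (λ a z → # 3 :* # 3 :* (:L a (# 1) z :- # 0) :- a :* (# 2 :* a :- # 1) :* ((:- # 1 :+ # 2 :* a) :* (:- # 1 :+ # 2 :* a)) := (# 6 :+ :- # 3 :* a) :* (:L a (# 0) (:L a (# 1) z) :- :L (# 1 :- a) (# 1) (:L (# 1 :- a) (# 0) z)) :+ (# 9 :+ # 6 :* z :+ # 1 :* a :+ :- # 8 :* a :* a) :* :rel a) refl a z) e) hs))
      pasch-case false true true false false z hs h₁ h₂ h₃ h₄ e =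
        ⊥-elim (S≢N h₁ (sgn-s false (λ e → nz3 (mod-rel (solve 2 (λ a z → # 3 :- # 0 := (:- # 2 :+ # 1 :* a) :* (:- # 1 :+ :- # 1 :* a :- # 0) :+ # 1 :* :rel a) refl a z) e))
          (mod-rel (solve 2 (λ a z → # 3 :* # 3 :* (z :- # 1) :- (# 2 :* a :- # 1) :* ((:- # 1 :+ :- # 1 :* a) :* (:- # 1 :+ :- # 1 :* a)) := (# 3 :+ :- # 6 :* a) :* (:L a (# 0) (:L a (# 1) z) :- :L (# 1 :- a) (# 1) (:L (# 1 :- a) (# 0) z)) :+ (:- # 8 :+ # 12 :* z :+ :- # 8 :* a) :* :rel a) refl a z) e) hs))
      pasch-case true true false true true z hs h₁ h₂ h₃ h₄ e =
        there (there (there (here (mod-rel (solve 2 (λ a z → # 3 :* z :- (# 1 :+ a) := (# 1 :+ # 1 :* a) :* (:L (# 1 :- a) (# 0) (:L a (# 1) z) :- :L a (# 1) (:L a (# 0) z)) :+ (:- # 1 :+ # 3 :* z :+ :- # 1 :* a :+ # 2 :* a :* z) :* :rel a) refl a z) e))))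
      pasch-case false true false true true z hs h₁ h₂ h₃ h₄ e =
        ⊥-elim (S≢N h₁ (sgn-s false (λ e → nz3 (mod-rel (solve 2 (λ a z → # 3 :- # 0 := (:- # 2 :+ # 1 :* a) :* (:- # 1 :+ :- # 1 :* a :- # 0) :+ # 1 :* :rel a) refl a z) e))
          (mod-rel (solve 2 (λ a z → # 3 :* # 3 :* (z :- # 1) :- (# 2 :* a :- # 1) :* ((:- # 1 :+ :- # 1 :* a) :* (:- # 1 :+ :- # 1 :* a)) := (# 3 :+ # 3 :* a) :* (:L (# 1 :- a) (# 0) (:L a (# 1) z) :- :L a (# 1) (:L a (# 0) z)) :+ (:- # 8 :+ # 9 :* z :+ :- # 5 :* a :+ # 6 :* a :* z) :* :rel a) refl a z) e) hs))
      pasch-case ss true false true false z hs h₁ h₂ h₃ h₄ e =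
        ⊥-elim (nz4 (mod-rel (solve 2 (λ a z → # 4 :- # 0 := (:- # 2 :+ # 2 :* a) :* (:L (# 1 :- a) (# 0) (:L a (# 1) z) :- :L (# 1 :- a) (# 1) (:L a (# 0) z)) :+ (# 6 :+ :- # 2 :* a) :* :rel a) refl a z) e))
      pasch-case ss true false false true z hs h₁ h₂ h₃ h₄ e =
        ⊥-elim (nz1 (mod-rel (solve 2 (λ a z → # 1 :- # 0 := :- # 1 :* (:L (# 1 :- a) (# 0) (:L a (# 1) z) :- :L a (# 1) (:L (# 1 :- a) (# 0) z)) :+ # 1 :* :rel a) refl a z) e))
      pasch-case true true false false false z hs h₁ h₂ h₃ h₄ e =
        ⊥-elim (S≢N h₁ (sgn-as true (λ e → nz3 (mod-rel (solve 2 (λ a z → # 3 :- # 0 := (:- # 1 :+ :- # 1 :* a) :* (:- # 2 :+ # 1 :* a :- # 0) :+ # 1 :* :rel a) refl a z) e))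
          (mod-rel (solve 2 (λ a z → # 3 :* # 3 :* (z :- # 1) :- a :* (# 2 :* a :- # 1) :* ((:- # 2 :+ # 1 :* a) :* (:- # 2 :+ # 1 :* a)) := (# 6 :+ :- # 3 :* a) :* (:L (# 1 :- a) (# 0) (:L a (# 1) z) :- :L (# 1 :- a) (# 1) (:L (# 1 :- a) (# 0) z)) :+ (:- # 15 :+ # 15 :* z :+ # 10 :* a :+ :- # 6 :* a :* z :+ :- # 2 :* a :* a) :* :rel a) refl a z) e) hs))
      pasch-case false true false false false z hs h₁ h₂ h₃ h₄ e =
        here (mod-rel (solve 2 (λ a z → # 3 :* z :- (# 2 :+ # 2 :* a) := (# 2 :+ :- # 1 :* a) :* (:L (# 1 :- a) (# 0) (:L a (# 1) z) :- :L (# 1 :- a) (# 1) (:L (# 1 :- a) (# 0) z)) :+ (:- # 4 :+ # 5 :* z :+ # 1 :* a :+ :- # 2 :* a :* z) :* :rel a) refl a z) e)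
      pasch-case true false true true true z hs h₁ h₂ h₃ h₄ e =
        ⊥-elim (S≢N (sgn-s true (λ e → nz3 (mod-rel (solve 2 (λ a z → # 3 :- # 0 := (# 1 :+ :- # 2 :* a) :* (:- # 1 :+ # 2 :* a :- # 0) :+ # 4 :* :rel a) refl a z) e))
          (mod-rel (solve 2 (λ a z → # 3 :* # 3 :* (z :- # 1) :- (# 2 :* a :- # 1) :* ((:- # 1 :+ # 2 :* a) :* (:- # 1 :+ # 2 :* a)) := (# 3 :+ # 3 :* a) :* (:L a (# 0) (:L (# 1 :- a) (# 1) z) :- :L a (# 1) (:L a (# 0) z)) :+ (:- # 5 :+ # 9 :* z :+ :- # 11 :* a :+ # 6 :* a :* z) :* :rel a) refl a z) e) hs) h₁)
      pasch-case false false true true true z hs h₁ h₂ h₃ h₄ e =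
        there (there (there (here (mod-rel (solve 2 (λ a z → # 3 :* z :- (# 4 :- # 2 :* a) := (# 1 :+ # 1 :* a) :* (:L a (# 0) (:L (# 1 :- a) (# 1) z) :- :L a (# 1) (:L a (# 0) z)) :+ (:- # 3 :+ # 3 :* z :+ :- # 1 :* a :+ # 2 :* a :* z) :* :rel a) refl a z) e))))
      pasch-case ss false true true false z hs h₁ h₂ h₃ h₄ e =
        ⊥-elim (nz1 (mod-rel (solve 2 (λ a z → # 1 :- # 0 := :- # 1 :* (:L a (# 0) (:L (# 1 :- a) (# 1) z) :- :L (# 1 :- a) (# 1) (:L a (# 0) z)) :+ # 1 :* :rel a) refl a z) e))
      pasch-case ss false true false true z hs h₁ h₂ h₃ h₄ e =
        ⊥-elim (nz4 (mod-rel (solve 2 (λ a z → # 4 :- # 0 := :- # 2 :* a :* (:L a (# 0) (:L (# 1 :- a) (# 1) z) :- :L a (# 1) (:L (# 1 :- a) (# 0) z)) :+ (# 4 :+ # 2 :* a) :* :rel a) refl a z) e))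
      pasch-case true false true false false z hs h₁ h₂ h₃ h₄ e =
        here (mod-rel (solve 2 (λ a z → # 3 :* z :- (# 2 :- a) := (# 2 :+ :- # 1 :* a) :* (:L a (# 0) (:L (# 1 :- a) (# 1) z) :- :L (# 1 :- a) (# 1) (:L (# 1 :- a) (# 0) z)) :+ (:- # 2 :+ # 5 :* z :+ # 1 :* a :+ :- # 2 :* a :* z) :* :rel a) refl a z) e)
      pasch-case false false true false false z hs h₁ h₂ h₃ h₄ e =
        ⊥-elim (S≢N (sgn-as false (λ e → nz3 (mod-rel (solve 2 (λ a z → # 3 :- # 0 := (:- # 2 :+ # 1 :* a) :* (:- # 1 :+ :- # 1 :* a :- # 0) :+ # 1 :* :rel a) refl a z) e))
          (mod-rel (solve 2 (λ a z → # 3 :* # 3 :* (z :- # 1) :- a :* (# 2 :* a :- # 1) :* ((:- # 1 :+ :- # 1 :* a) :* (:- # 1 :+ :- # 1 :* a)) := (# 6 :+ :- # 3 :* a) :* (:L a (# 0) (:L (# 1 :- a) (# 1) z) :- :L (# 1 :- a) (# 1) (:L (# 1 :- a) (# 0) z)) :+ (:- # 9 :+ # 15 :* z :+ :- # 2 :* a :+ :- # 6 :* a :* z :+ :- # 2 :* a :* a) :* :rel a) refl a z) e) hs) h₁)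
      pasch-case true false false true true z hs h₁ h₂ h₃ h₄ e =
        ⊥-elim (S≢N (sgn-s true (λ e → nz3 (mod-rel (solve 2 (λ a z → # 3 :- # 0 := (:- # 1 :+ :- # 1 :* a) :* (:- # 2 :+ # 1 :* a :- # 0) :+ # 1 :* :rel a) refl a z) e))
          (mod-rel (solve 2 (λ a z → # 3 :* # 3 :* (:L (# 1 :- a) (# 1) z :- # 0) :- (# 2 :* a :- # 1) :* ((:- # 2 :+ # 1 :* a) :* (:- # 2 :+ # 1 :* a)) := (# 3 :+ # 3 :* a) :* (:L (# 1 :- a) (# 0) (:L (# 1 :- a) (# 1) z) :- :L a (# 1) (:L a (# 0) z)) :+ (# 7 :+ # 6 :* z :+ # 1 :* a) :* :rel a) refl a z) e) hs) h₂)
      pasch-case false false false true true z hs h₁ h₂ h₃ h₄ e =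
        ⊥-elim (S≢N (sgn-as false (λ e → nz3 (mod-rel (solve 2 (λ a z → # 3 :- # 0 := (:- # 2 :+ # 1 :* a) :* (:- # 1 :+ :- # 1 :* a :- # 0) :+ # 1 :* :rel a) refl a z) e))
          (mod-rel (solve 2 (λ a z → # 3 :* # 3 :* (z :- # 1) :- a :* (# 2 :* a :- # 1) :* ((:- # 1 :+ :- # 1 :* a) :* (:- # 1 :+ :- # 1 :* a)) := (:- # 3 :+ # 6 :* a) :* (:L (# 1 :- a) (# 0) (:L (# 1 :- a) (# 1) z) :- :L a (# 1) (:L a (# 0) z)) :+ (:- # 12 :+ # 12 :* z :+ # 1 :* a :+ :- # 2 :* a :* a) :* :rel a) refl a z) e) hs) h₁)
      pasch-case true false false true false z hs h₁ h₂ h₃ h₄ e =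
        there (there (here (mod-rel (solve 2 (λ a z → # 3 :* z :- (# 1 :- # 2 :* a) := (:- # 2 :+ # 1 :* a) :* (:L (# 1 :- a) (# 0) (:L (# 1 :- a) (# 1) z) :- :L (# 1 :- a) (# 1) (:L a (# 0) z)) :+ (:- # 1 :+ # 5 :* z :+ # 1 :* a :+ :- # 2 :* a :* z) :* :rel a) refl a z) e)))
      pasch-case false false false true false z hs h₁ h₂ h₃ h₄ e =
        ⊥-elim (S≢N (sgn-as false (λ e → nz3 (mod-rel (solve 2 (λ a z → # 3 :- # 0 := (:- # 1 :+ :- # 1 :* a) :* (:- # 2 :+ # 1 :* a :- # 0) :+ # 1 :* :rel a) refl a z) e))
          (mod-rel (solve 2 (λ a z → # 3 :* # 3 :* (:L (# 1 :- a) (# 1) z :- # 0) :- a :* (# 2 :* a :- # 1) :* ((:- # 2 :+ # 1 :* a) :* (:- # 2 :+ # 1 :* a)) := (:- # 3 :+ # 6 :* a) :* (:L (# 1 :- a) (# 0) (:L (# 1 :- a) (# 1) z) :- :L (# 1 :- a) (# 1) (:L a (# 0) z)) :+ (# 12 :* z :+ # 13 :* a :+ :- # 12 :* a :* z :+ :- # 2 :* a :* a) :* :rel a) refl a z) e) hs) h₂)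
      pasch-case true false false false true z hs h₁ h₂ h₃ h₄ e =
        ⊥-elim (S≢N (sgn-s true (λ e → nz3 (mod-rel (solve 2 (λ a z → # 3 :- # 0 := (:- # 2 :+ # 1 :* a) :* (:- # 1 :+ :- # 1 :* a :- # 0) :+ # 1 :* :rel a) refl a z) e))
          (mod-rel (solve 2 (λ a z → # 3 :* # 3 :* (z :- # 1) :- (# 2 :* a :- # 1) :* ((:- # 1 :+ :- # 1 :* a) :* (:- # 1 :+ :- # 1 :* a)) := (:- # 6 :+ # 3 :* a) :* (:L (# 1 :- a) (# 0) (:L (# 1 :- a) (# 1) z) :- :L a (# 1) (:L (# 1 :- a) (# 0) z)) :+ (:- # 14 :+ # 15 :* z :+ # 1 :* a :+ :- # 6 :* a :* z) :* :rel a) refl a z) e) hs) h₁)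
      pasch-case false false false false true z hs h₁ h₂ h₃ h₄ e =
        there (here (mod-rel (solve 2 (λ a z → # 3 :* z :- (# 1 :+ a) := (:- # 2 :+ # 1 :* a) :* (:L (# 1 :- a) (# 0) (:L (# 1 :- a) (# 1) z) :- :L a (# 1) (:L (# 1 :- a) (# 0) z)) :+ (:- # 3 :+ # 5 :* z :+ # 1 :* a :+ :- # 2 :* a :* z) :* :rel a) refl a z) e))
      pasch-case ss false false false false z hs h₁ h₂ h₃ h₄ e =
        ⊥-elim (nz1 (mod-rel (solve 2 (λ a z → # 1 :- # 0 := # 1 :* a :* (:L (# 1 :- a) (# 0) (:L (# 1 :- a) (# 1) z) :- :L (# 1 :- a) (# 1) (:L (# 1 :- a) (# 0) z)) :+ (# 1 :+ # 1 :* a) :* :rel a) refl a z) e))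

    opaque
      mitre-case : ∀ σ₁ σ₂ σ₃ σ₄ z → ¬ z ≡ 0# → ¬ z ≡ 1# → ¬ z ≡ a → Sg σ₁ (z - 0#) → Sg σ₂ (L 0# z σ₁ - 1#) →
        Sg σ₃ (L 1# (L 0# z σ₁) σ₂ - 0#) → Sg σ₄ (z - a) → L 0# (L 1# (L 0# z σ₁) σ₂) σ₃ ≡ L a z σ₄ → ⊥
      mitre-case true true true true z n₀ n₁ nₐ h₁ h₂ h₃ h₄ e =
        n₀ (*-cancelˡ nz3 (mod-rel (solve 2 (λ a z → # 3 :* z :- # 3 :* # 0 := (:- # 2 :+ # 1 :* a) :* (:L a (# 0) (:L a (# 1) (:L a (# 0) z)) :- :L a a z) :+ (# 3 :* z :+ # 1 :* a :* z :+ :- # 1 :* a :* a :* z) :* :rel a) refl a z) e))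
      mitre-case true true true false z n₀ n₁ nₐ h₁ h₂ h₃ h₄ e =
        n₁ (*-cancelˡ nz3 (mod-rel (solve 2 (λ a z → # 3 :* z :- # 3 :* # 1 := (:- # 1 :+ :- # 1 :* a) :* (:L a (# 0) (:L a (# 1) (:L a (# 0) z)) :- :L (# 1 :- a) a z) :+ (:- # 3 :+ # 2 :* z :+ :- # 2 :* a :+ # 2 :* a :* z :+ # 1 :* a :* a :* z) :* :rel a) refl a z) e))
      mitre-case true true false true z n₀ n₁ nₐ h₁ h₂ h₃ h₄ e =
        nz3 (mod-rel (solve 2 (λ a z → # 3 :- # 0 := (:- # 2 :+ # 1 :* a) :* (:L (# 1 :- a) (# 0) (:L a (# 1) (:L a (# 0) z)) :- :L a a z) :+ (# 5 :+ :- # 2 :* a :+ :- # 2 :* a :* z :+ # 1 :* a :* a :* z) :* :rel a) refl a z) e)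
      mitre-case true true false false z n₀ n₁ nₐ h₁ h₂ h₃ h₄ e =
        n₁ (*-cancelˡ nz3 (mod-rel (solve 2 (λ a z → # 3 :* z :- # 3 :* # 1 := (# 1 :+ :- # 2 :* a) :* (:L (# 1 :- a) (# 0) (:L a (# 1) (:L a (# 0) z)) :- :L (# 1 :- a) a z) :+ (:- # 4 :+ # 4 :* z :+ # 1 :* a :* z :+ :- # 2 :* a :* a :* z) :* :rel a) refl a z) e))
      mitre-case true false true true z n₀ n₁ nₐ h₁ h₂ h₃ h₄ e =
        nz3 (mod-rel (solve 2 (λ a z → # 3 :- # 0 := (:- # 1 :+ :- # 1 :* a) :* (:L a (# 0) (:L (# 1 :- a) (# 1) (:L a (# 0) z)) :- :L a a z) :+ (# 3 :+ # 2 :* a :+ :- # 1 :* a :* z :+ :- # 1 :* a :* a :* z) :* :rel a) refl a z) e)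
      mitre-case true false true false z n₀ n₁ nₐ h₁ h₂ h₃ h₄ e =
        n₀ (*-cancelˡ nz3 (mod-rel (solve 2 (λ a z → # 3 :* z :- # 3 :* # 0 := (# 1 :+ :- # 2 :* a) :* (:L a (# 0) (:L (# 1 :- a) (# 1) (:L a (# 0) z)) :- :L (# 1 :- a) a z) :+ (# 4 :* z :+ # 1 :* a :* z :+ :- # 2 :* a :* a :* z) :* :rel a) refl a z) e))
      mitre-case true false false true z n₀ n₁ nₐ h₁ h₂ h₃ h₄ e =
        n₀ (*-cancelˡ nz3 (mod-rel (solve 2 (λ a z → # 3 :* z :- # 3 :* # 0 := (:- # 1 :+ # 2 :* a) :* (:L (# 1 :- a) (# 0) (:L (# 1 :- a) (# 1) (:L a (# 0) z)) :- :L a a z) :+ (# 3 :* z :+ # 3 :* a :* z :+ :- # 2 :* a :* a :* z) :* :rel a) refl a z) e))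
      mitre-case true false false false z n₀ n₁ nₐ h₁ h₂ h₃ h₄ e =
        nz3 (mod-rel (solve 2 (λ a z → # 3 :- # 0 := (# 1 :+ # 1 :* a) :* (:L (# 1 :- a) (# 0) (:L (# 1 :- a) (# 1) (:L a (# 0) z)) :- :L (# 1 :- a) a z) :+ (# 3 :+ # 1 :* z :+ # 2 :* a :+ :- # 1 :* a :* a :* z) :* :rel a) refl a z) e)
      mitre-case false true true true z n₀ n₁ nₐ h₁ h₂ h₃ h₄ e =
        -- On this branch z - a is a times (0 ∗ z) - 1, so the two characters are opposite whatever
        -- z is.
        S≢N h₄ (subst N (sym (mod-rel (solve 2 (λ a z → z :- a :- a :* (:L (# 1 :- a) (# 0) z :- # 1) := # 0 :* (# 0 :- # 0) :+ # 1 :* z :* :rel a) refl a z) refl)) (NS Na h₂))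
      mitre-case false true true false z n₀ n₁ nₐ h₁ h₂ h₃ h₄ e =
        nₐ (*-cancelˡ nz3 (mod-rel (solve 2 (λ a z → # 3 :* z :- # 3 :* a := (# 1 :+ :- # 2 :* a) :* (:L a (# 0) (:L a (# 1) (:L (# 1 :- a) (# 0) z)) :- :L (# 1 :- a) a z) :+ (# 4 :* z :+ :- # 4 :* a :+ # 1 :* a :* z :+ :- # 2 :* a :* a :* z) :* :rel a) refl a z) e))
      mitre-case false true false true z n₀ n₁ nₐ h₁ h₂ h₃ h₄ e =
        S≢N (sgn-1 (λ e → nz9 (mod-rel (solve 2 (λ a z → # 9 :- # 0 := (:- # 3 :+ # 3 :* a) :* (# 0 :+ :- # 3 :* a :- # 0) :+ # 9 :* :rel a) refl a z) e))
          (mod-rel (solve 2 (λ a z → # 3 :* # 3 :* (z :- # 0) :- # 1 :* ((# 0 :+ :- # 3 :* a) :* (# 0 :+ :- # 3 :* a)) := (:- # 3 :+ # 6 :* a) :* (:L (# 1 :- a) (# 0) (:L a (# 1) (:L (# 1 :- a) (# 0) z)) :- :L a a z) :+ (# 3 :+ # 9 :* z :+ :- # 12 :* a :+ # 9 :* a :* z :+ :- # 6 :* a :* a :* z) :* :rel a) refl a z) e)) h₁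
      mitre-case false true false false z n₀ n₁ nₐ h₁ h₂ h₃ h₄ e =
        nz3 (mod-rel (solve 2 (λ a z → # 3 :- # 0 := (:- # 1 :+ # 2 :* a) :* (:L (# 1 :- a) (# 0) (:L a (# 1) (:L (# 1 :- a) (# 0) z)) :- :L (# 1 :- a) a z) :+ (# 4 :+ :- # 1 :* z :+ # 3 :* a :* z :+ :- # 2 :* a :* a :* z) :* :rel a) refl a z) e)
      mitre-case false false true true z n₀ n₁ nₐ h₁ h₂ h₃ h₄ e =
        nₐ (*-cancelˡ nz3 (mod-rel (solve 2 (λ a z → # 3 :* z :- # 3 :* a := (:- # 1 :+ # 2 :* a) :* (:L a (# 0) (:L (# 1 :- a) (# 1) (:L (# 1 :- a) (# 0) z)) :- :L a a z) :+ (# 3 :* z :+ :- # 4 :* a :+ # 3 :* a :* z :+ :- # 2 :* a :* a :* z) :* :rel a) refl a z) e))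
      mitre-case false false true false z n₀ n₁ nₐ h₁ h₂ h₃ h₄ e =
        S≢N (subst S (sym (mod-rel (solve 2 (λ a z → z :- a :- a :* (:L (# 1 :- a) (# 0) z :- # 1) := # 0 :* (# 0 :- # 0) :+ # 1 :* z :* :rel a) refl a z) refl)) (NN Na h₂)) h₄
      mitre-case false false false true z n₀ n₁ nₐ h₁ h₂ h₃ h₄ e =
        n₀ (*-cancelˡ nz3 (mod-rel (solve 2 (λ a z → # 3 :* z :- # 3 :* # 0 := (:- # 2 :+ # 1 :* a) :* (:L (# 1 :- a) (# 0) (:L (# 1 :- a) (# 1) (:L (# 1 :- a) (# 0) z)) :- :L a a z) :+ (# 5 :* z :+ :- # 4 :* a :* z :+ # 1 :* a :* a :* z) :* :rel a) refl a z) e))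
      mitre-case false false false false z n₀ n₁ nₐ h₁ h₂ h₃ h₄ e =
        n₁ (*-cancelˡ nz3 (mod-rel (solve 2 (λ a z → # 3 :* z :- # 3 :* # 1 := (:- # 1 :+ :- # 1 :* a) :* (:L (# 1 :- a) (# 0) (:L (# 1 :- a) (# 1) (:L (# 1 :- a) (# 0) z)) :- :L (# 1 :- a) a z) :+ (:- # 3 :+ # 3 :* z :+ :- # 2 :* a :+ # 1 :* a :* z :+ :- # 1 :* a :* a :* z) :* :rel a) refl a z) e))

    opaque
      -- The equation says that 0, 1, z, 0 ∗ z, 1 ∗ z and the common value carry the four blocks of
      -- a Pasch configuration. At most four z are possible for the pair 0, 1.
      pasch01 : ∀ ss → Sg ss s → ∀ z → ¬ z ≡ 0# → ¬ z ≡ 1# → ¬ z ≡ a → 0# ∗ (1# ∗ z) ≡ 1# ∗ (0# ∗ z) → num 3 * z ∈ Aset ss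
      pasch01 ss hs z n₀ n₁ nₐ e with op-L 1# z n₁ | op-L 0# z n₀
      ... | (σ₁ , h₁ , e₁) | (σ₃ , h₃ , e₃) with op-L 0# (L 1# z σ₁) nv | op-L 1# (L 0# z σ₃) nu
        where
        nv : ¬ L 1# z σ₁ ≡ 0#
        nv q = nₐ (trans (∗-move (trans e₁ q)) (trans (∗-comm 1# 0#) 0∗1))
        nu : ¬ L 0# z σ₃ ≡ 1#
        nu q = nₐ (trans (∗-move (trans e₃ q)) 0∗1)
      ... | (σ₂ , h₂ , e₂) | (σ₄ , h₄ , e₄) = pasch-case ss σ₁ σ₂ σ₃ σ₄ z hs h₁ h₂ h₃ h₄
            (trans (sym e₂) (trans (cong (0# ∗_) (sym e₁)) (trans e (trans (cong (1# ∗_) e₃) e₄))))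

      -- The forbidden configuration is the mitre centred at 0: three blocks through 0, and two
      -- disjoint ones that the reflection in 0 would exchange, {1, 0 ∗ z, 1 ∗ (0 ∗ z)} and {a, z, a
      -- ∗ z}.
      mitre01 : ∀ z → ¬ z ≡ 0# → ¬ z ≡ 1# → ¬ z ≡ a → ¬ 0# ∗ (1# ∗ (0# ∗ z)) ≡ a ∗ z
      mitre01 z n₀ n₁ nₐ e with op-L 0# z n₀ | op-L a z nₐ
      ... | (σ₁ , h₁ , e₁) | (σ₄ , h₄ , e₄) with op-L 1# (L 0# z σ₁) nu
        where
        nu : ¬ L 0# z σ₁ ≡ 1#
        nu q = nₐ (trans (∗-move (trans e₁ q)) 0∗1)
      ... | (σ₂ , h₂ , e₂) with op-L 0# (L 1# (L 0# z σ₁) σ₂) nv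
        where
        nv : ¬ L 1# (L 0# z σ₁) σ₂ ≡ 0#
        nv q = n₁ (trans (∗-move (trans e₁ (trans (∗-move (trans e₂ q)) (trans (∗-comm 1# 0#) refl)))) (∗-invol 0# 1#))
      ... | (σ₃ , h₃ , e₃) = mitre-case σ₁ σ₂ σ₃ σ₄ z n₀ n₁ nₐ h₁ h₂ h₃ h₄
            (trans (sym e₃) (trans (cong (0# ∗_) (trans (sym e₂) (cong (1# ∗_) (sym e₁)))) (trans e e₄)))

    module Coordinates {x y : Carrier} (Sd : S (y - x)) where
      h : Carrier → Carrier
      h z = (y - x) * z + x

      coord : Carrier → Carrier
      coord z = inv (y - x) * (z - x)

      opaque
        h-aut : Aut a b h
        h-aut = affine-aut a b x Sd

        h-hom : ∀ u v → h (u ∗ v) ≡ h u ∗ h v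
        h-hom = proj₂ h-aut

        h-coord : ∀ z → h (coord z) ≡ z
        h-coord z = trans (cong (_+ x) (ν-conj-cancel (S≢0 Sd) (z - x))) (solve 2 (λ z x → (z :- x) :+ x := z) refl z x)

        coord-injective : ∀ {u v} → coord u ≡ coord v → u ≡ v
        coord-injective {u} {v} e = trans (sym (h-coord u)) (trans (cong h e) (h-coord v))

        h-0 : h 0# ≡ x
        h-0 = solve 2 (λ d x → d :* con (+ 0) :+ x := x) refl (y - x) x

        h-1 : h 1# ≡ y
        h-1 = solve 2 (λ y x → (y :- x) :* con (+ 1) :+ x := y) refl y x

        h-a : h a ≡ x ∗ y
        h-a = trans (cong h (sym 0∗1)) (trans (h-hom 0# 1#) (cong₂ _∗_ h-0 h-1))

        h-inj : ∀ {u v} → h u ≡ h v → u ≡ v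
        h-inj = aut-injective h-aut

        h≢ : ∀ {z p q} → h p ≡ q → ¬ z ≡ q → ¬ coord z ≡ p
        h≢ {z} e ne c = ne (trans (sym (h-coord z)) (trans (cong h c) e))

        h∗ : ∀ {p q u v} → h p ≡ u → h q ≡ v → h (p ∗ q) ≡ u ∗ v
        h∗ e e′ = trans (h-hom _ _) (cong₂ _∗_ e e′)

    -- Short for noncollinear: z is off the block of x and y.
    NC : Carrier → Carrier → Carrier → Set
    NC x y z = ¬ z ≡ x × ¬ z ≡ y × ¬ z ≡ x ∗ y

    opaque
      mitre-S : ∀ {x y z} → S (y - x) → NC x y z → ¬ x ∗ (y ∗ (x ∗ z)) ≡ (x ∗ y) ∗ z
      mitre-S {x} {y} {z} Sd (nx , ny , nxy) e = mitre01 (coord z) (h≢ h-0 nx) (h≢ h-1 ny) (h≢ h-a nxy)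
        (h-inj (trans (h∗ h-0 (h∗ h-1 (h∗ h-0 (h-coord z)))) (trans e (sym (h∗ h-a (h-coord z))))))
        where open Coordinates Sd

      -- Coordinates with x at 0 and y at 1 require y - x to be a square. If it is not, the third
      -- point of the block replaces y.
      out : ∀ {x y} → N (y - x) → S (x ∗ y - x)
      out {x} {y} n = subst S (sym (trans (cong (λ w → w - x) (op-N a b n)) (solve 3 (λ b x y → x :+ b :* (y :- x) :- x := b :* (y :- x)) refl b x y))) (NN Nb n)

      mitre : ∀ {x y z} → ¬ x ≡ y → NC x y z → ¬ x ∗ (y ∗ (x ∗ z)) ≡ (x ∗ y) ∗ z
      mitre {x} {y} {z} ne (nx , ny , nxy) e with S⊎N (x≢y⇒x-y≢0 (ne ∘ sym))
      ... | inj₁ p = mitre-S p (nx , ny , nxy) e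
      ... | inj₂ n = mitre-S (out n) (nc₁ , (λ q → ny (∗-cancel x q)) , (λ q → nxy (∗-move (trans q (∗-invol x y)))))
            (trans (cong (λ w → x ∗ ((x ∗ y) ∗ w)) (∗-invol x z)) (trans (cong (x ∗_) (sym e)) (trans (∗-invol x _) (cong (_∗ (x ∗ z)) (sym (∗-invol x y))))))
        where
        nc₁ : ¬ x ∗ z ≡ x
        nc₁ q = nx (trans (∗-move q) (op-refl a b x))

    module NotSeven (nz7 : ¬ num 7 ≡ 0#) (ss : Bool) (hs : Sg ss s) where
      opaque
        nz21 : ¬ num 21 ≡ 0#
        nz21 e = xy≢0 nz3 nz7 (trans (solve 0 (con (+ 3) :* con (+ 7) := con (+ 21)) refl) e)

        -- The second condition is the first one carried round by `ρ`. The discarded combinations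
        -- would make a number vanish whose prime factors are 2, 3 and 7; this is where 7 ≠ 0
        -- enters.
        centre-case : ∀ ss z → num 3 * z ∈ Aset ss → a * a * (num 3 * z) + num 3 ∈ Aset ss → num 3 * z ∈ Iset ss
        centre-case true z (here e₁) (here e₂) =
          ⊥-elim (nz9 (mod-rel (solve 2 (λ a z → # 9 :- # 0 := (# 3 :+ :- # 3 :* a) :* (a :* a :* (# 2 :- a) :+ # 3 :- (# 2 :- a)) :+ (# 6 :+ # 6 :* a :+ :- # 3 :* a :* a) :* :rel a) refl a z) (trans (cong (λ w → a * a * w + num 3) (sym e₁)) e₂)))
        centre-case true z (here e₁) (there (here e₂)) =
          ⊥-elim (nz9 (mod-rel (solve 2 (λ a z → # 9 :- # 0 := # 3 :* (a :* a :* (# 2 :- a) :+ # 3 :- (# 2 :* a :- # 1)) :+ (:- # 3 :+ # 3 :* a) :* :rel a) refl a z) (trans (cong (λ w → a * a * w + num 3) (sym e₁)) e₂)))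
        centre-case true z (here e₁) (there (there (here e₂))) =
          ⊥-elim (nz21 (mod-rel (solve 2 (λ a z → # 21 :- # 0 := (# 5 :+ :- # 4 :* a) :* (a :* a :* (# 2 :- a) :+ # 3 :- (# 1 :- # 2 :* a)) :+ (# 11 :+ # 9 :* a :+ :- # 4 :* a :* a) :* :rel a) refl a z) (trans (cong (λ w → a * a * w + num 3) (sym e₁)) e₂)))
        centre-case true z (here e₁) (there (there (there (here e₂)))) =
          ⊥-elim (nz3 (mod-rel (solve 2 (λ a z → # 3 :- # 0 := (# 2 :+ :- # 1 :* a) :* (a :* a :* (# 2 :- a) :+ # 3 :- (# 1 :+ a)) :+ (:- # 1 :+ # 3 :* a :+ :- # 1 :* a :* a) :* :rel a) refl a z) (trans (cong (λ w → a * a * w + num 3) (sym e₁)) e₂)))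
        centre-case true z (there (here e₁)) _ = here e₁
        centre-case true z (there (there (here e₁))) (here e₂) =
          ⊥-elim (nz12 (mod-rel (solve 2 (λ a z → # 12 :- # 0 := (# 4 :+ :- # 2 :* a) :* (a :* a :* (# 1 :- # 2 :* a) :+ # 3 :- (# 2 :- a)) :+ (# 8 :+ # 6 :* a :+ :- # 4 :* a :* a) :* :rel a) refl a z) (trans (cong (λ w → a * a * w + num 3) (sym e₁)) e₂)))
        centre-case true z (there (there (here e₁))) (there (here e₂)) =
          ⊥-elim (nz21 (mod-rel (solve 2 (λ a z → # 21 :- # 0 := (# 4 :+ # 1 :* a) :* (a :* a :* (# 1 :- # 2 :* a) :+ # 3 :- (# 2 :* a :- # 1)) :+ (# 5 :+ # 9 :* a :+ # 2 :* a :* a) :* :rel a) refl a z) (trans (cong (λ w → a * a * w + num 3) (sym e₁)) e₂)))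
        centre-case true z (there (there (here e₁))) (there (there (here e₂))) =
          ⊥-elim (nz27 (mod-rel (solve 2 (λ a z → # 27 :- # 0 := (# 6 :+ :- # 3 :* a) :* (a :* a :* (# 1 :- # 2 :* a) :+ # 3 :- (# 1 :- # 2 :* a)) :+ (# 15 :+ # 9 :* a :+ :- # 6 :* a :* a) :* :rel a) refl a z) (trans (cong (λ w → a * a * w + num 3) (sym e₁)) e₂)))
        centre-case true z (there (there (here e₁))) (there (there (there (here e₂)))) =
          ⊥-elim (nz9 (mod-rel (solve 2 (λ a z → # 9 :- # 0 := # 3 :* (a :* a :* (# 1 :- # 2 :* a) :+ # 3 :- (# 1 :+ a)) :+ (# 3 :+ # 6 :* a) :* :rel a) refl a z) (trans (cong (λ w → a * a * w + num 3) (sym e₁)) e₂)))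
        centre-case true z (there (there (there (here e₁)))) _ = there (here e₁)
        centre-case false z (here e₁) (here e₂) =
          ⊥-elim (nz9 (mod-rel (solve 2 (λ a z → # 9 :- # 0 := :- # 3 :* (a :* a :* (# 2 :+ # 2 :* a) :+ # 3 :- (# 2 :+ # 2 :* a)) :+ (# 12 :+ # 6 :* a) :* :rel a) refl a z) (trans (cong (λ w → a * a * w + num 3) (sym e₁)) e₂)))
        centre-case false z (here e₁) (there (here e₂)) =
          ⊥-elim (nz3 (mod-rel (solve 2 (λ a z → # 3 :- # 0 := (:- # 1 :+ :- # 1 :* a) :* (a :* a :* (# 2 :+ # 2 :* a) :+ # 3 :- (# 1 :+ a)) :+ (# 5 :+ # 6 :* a :+ # 2 :* a :* a) :* :rel a) refl a z) (trans (cong (λ w → a * a * w + num 3) (sym e₁)) e₂)))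
        centre-case false z (here e₁) (there (there (here e₂))) =
          ⊥-elim (nz9 (mod-rel (solve 2 (λ a z → # 9 :- # 0 := :- # 3 :* a :* (a :* a :* (# 2 :+ # 2 :* a) :+ # 3 :- (# 2 :- a)) :+ (# 9 :+ # 12 :* a :+ # 6 :* a :* a) :* :rel a) refl a z) (trans (cong (λ w → a * a * w + num 3) (sym e₁)) e₂)))
        centre-case false z (here e₁) (there (there (there (here e₂)))) =
          ⊥-elim (nz21 (mod-rel (solve 2 (λ a z → # 21 :- # 0 := (:- # 1 :+ :- # 4 :* a) :* (a :* a :* (# 2 :+ # 2 :* a) :+ # 3 :- (# 4 :- # 2 :* a)) :+ (# 20 :+ # 18 :* a :+ # 8 :* a :* a) :* :rel a) refl a z) (trans (cong (λ w → a * a * w + num 3) (sym e₁)) e₂)))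
        centre-case false z (there (here e₁)) _ = here e₁
        centre-case false z (there (there (here e₁))) _ = there (here e₁)
        centre-case false z (there (there (there (here e₁)))) (here e₂) =
          ⊥-elim (nz3 (mod-rel (solve 2 (λ a z → # 3 :- # 0 := (# 1 :+ :- # 2 :* a) :* (a :* a :* (# 4 :- # 2 :* a) :+ # 3 :- (# 2 :+ # 2 :* a)) :+ (# 2 :+ # 6 :* a :+ :- # 4 :* a :* a) :* :rel a) refl a z) (trans (cong (λ w → a * a * w + num 3) (sym e₁)) e₂)))
        centre-case false z (there (there (there (here e₁)))) (there (here e₂)) =
          ⊥-elim (nz9 (mod-rel (solve 2 (λ a z → # 9 :- # 0 := (# 3 :+ :- # 3 :* a) :* (a :* a :* (# 4 :- # 2 :* a) :+ # 3 :- (# 1 :+ a)) :+ (# 3 :+ # 12 :* a :+ :- # 6 :* a :* a) :* :rel a) refl a z) (trans (cong (λ w → a * a * w + num 3) (sym e₁)) e₂)))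
        centre-case false z (there (there (there (here e₁)))) (there (there (here e₂))) =
          ⊥-elim (nz21 (mod-rel (solve 2 (λ a z → # 21 :- # 0 := (# 4 :+ :- # 5 :* a) :* (a :* a :* (# 4 :- # 2 :* a) :+ # 3 :- (# 2 :- a)) :+ (# 17 :+ # 18 :* a :+ :- # 10 :* a :* a) :* :rel a) refl a z) (trans (cong (λ w → a * a * w + num 3) (sym e₁)) e₂)))
        centre-case false z (there (there (there (here e₁)))) (there (there (there (here e₂)))) =
          ⊥-elim (nz27 (mod-rel (solve 2 (λ a z → # 27 :- # 0 := (# 3 :+ :- # 6 :* a) :* (a :* a :* (# 4 :- # 2 :* a) :+ # 3 :- (# 4 :- # 2 :* a)) :+ (# 30 :+ # 18 :* a :+ :- # 12 :* a :* a) :* :rel a) refl a z) (trans (cong (λ w → a * a * w + num 3) (sym e₁)) e₂)))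

      -- The rotation 0 ↦ 1 ↦ a ↦ 0 of a block, affine with square slope a².
      ρ : Carrier → Carrier
      ρ z = a * a * z + 1#

      opaque
        ρ-aut : Aut a b ρ
        ρ-aut = affine-aut a b 1# (NN Na Na)

        ρ-0 : ρ 0# ≡ 1#
        ρ-0 = solve 1 (λ a → a :* a :* con (+ 0) :+ con (+ 1) := con (+ 1)) refl a

        ρ-1 : ρ 1# ≡ a
        ρ-1 = mod-rel {M = 0#} {l = 0#} {r = 0#} (solve 1 (λ a → a :* a :* con (+ 1) :+ con (+ 1) :- a := con (+ 0) :* (con (+ 0) :- con (+ 0)) :+ con (+ 1) :* (a :* a :- (a :- con (+ 1)))) refl a) refl

        ρ-a : ρ a ≡ 0#
        ρ-a = mod-rel {M = 0#} {l = 0#} {r = 0#} (solve 1 (λ a → a :* a :* a :+ con (+ 1) :- con (+ 0) := con (+ 0) :* (con (+ 0) :- con (+ 0)) :+ (a :+ con (+ 1)) :* (a :* a :- (a :- con (+ 1)))) refl a) refl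

        -- `ρ` takes a, 0 to 0, 1, so `pasch01` applies to ρ z as well as to z.
        centre01 : ∀ z → ¬ z ≡ 0# → ¬ z ≡ 1# → ¬ z ≡ a → 0# ∗ (1# ∗ z) ≡ 1# ∗ (0# ∗ z) → 0# ∗ (a ∗ z) ≡ a ∗ (0# ∗ z) → num 3 * z ∈ Iset ss
        centre01 z n₀ n₁ nₐ e e′ = centre-case ss z (pasch01 ss hs z n₀ n₁ nₐ e)
          (subst (_∈ Aset ss) (solve 2 (λ a z → con (+ 3) :* (a :* a :* z :+ con (+ 1)) := a :* a :* (con (+ 3) :* z) :+ con (+ 3)) refl a z)
            (pasch01 ss hs (ρ z) (λ q → nₐ (ρ-inj (trans q (sym ρ-a)))) (λ q → n₀ (ρ-inj (trans q (sym ρ-0)))) (λ q → n₁ (ρ-inj (trans q (sym ρ-1))))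
              (trans (sym (ρ∗ ρ-a (ρ∗ ρ-0 refl))) (trans (cong ρ (sym e′)) (ρ∗ ρ-0 (ρ∗ ρ-a refl))))))
          where
          ρ-inj : ∀ {u v} → ρ u ≡ ρ v → u ≡ v
          ρ-inj = aut-injective ρ-aut
          ρ∗ : ∀ {p q u v} → ρ p ≡ u → ρ q ≡ v → ρ (p ∗ q) ≡ u ∗ v
          ρ∗ q q′ = trans (proj₂ ρ-aut _ _) (cong₂ _∗_ q q′)

        centre : ∀ {c v y} (Sd : S (v - c)) → NC c v y → c ∗ (v ∗ y) ≡ v ∗ (c ∗ y) → c ∗ ((c ∗ v) ∗ y) ≡ (c ∗ v) ∗ (c ∗ y) →
          num 3 * Coordinates.coord Sd y ∈ Iset ss
        centre {c} {v} {y} Sd (n₀ , n₁ , nₐ) e e′ = centre01 (coord y) (h≢ h-0 n₀) (h≢ h-1 n₁) (h≢ h-a nₐ)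
          (h-inj (trans (h∗ h-0 (h∗ h-1 (h-coord y))) (trans e (sym (h∗ h-1 (h∗ h-0 (h-coord y)))))))
          (h-inj (trans (h∗ h-0 (h∗ h-a (h-coord y))) (trans e′ (sym (h∗ h-a (h∗ h-0 (h-coord y)))))))
          where open Coordinates Sd

        pigeon : ∀ {x y z : Carrier} ss → x ∈ Iset ss → y ∈ Iset ss → z ∈ Iset ss → x ≡ y ⊎ x ≡ z ⊎ y ≡ z
        pigeon true (here p) (here q) _ = inj₁ (trans p (sym q))
        pigeon true (here p) (there (here q)) (here r) = inj₂ (inj₁ (trans p (sym r)))
        pigeon true (here p) (there (here q)) (there (here r)) = inj₂ (inj₂ (trans q (sym r)))
        pigeon true (there (here p)) (here q) (here r) = inj₂ (inj₂ (trans q (sym r)))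
        pigeon true (there (here p)) (here q) (there (here r)) = inj₂ (inj₁ (trans p (sym r)))
        pigeon true (there (here p)) (there (here q)) _ = inj₁ (trans p (sym q))
        pigeon false (here p) (here q) _ = inj₁ (trans p (sym q))
        pigeon false (here p) (there (here q)) (here r) = inj₂ (inj₁ (trans p (sym r)))
        pigeon false (here p) (there (here q)) (there (here r)) = inj₂ (inj₂ (trans q (sym r)))
        pigeon false (there (here p)) (here q) (here r) = inj₂ (inj₂ (trans q (sym r)))
        pigeon false (there (here p)) (here q) (there (here r)) = inj₂ (inj₁ (trans p (sym r)))
        pigeon false (there (here p)) (there (here q)) _ = inj₁ (trans p (sym q))

      -- W is to be the fixed-point set of a 2-subgroup and t the next generator. By maximality the
      -- points of W fixed by t lie on one block, which is `small`.
      module Involution (W : Carrier → Set) (W? : ∀ x → Dec (W x)) (W-op : ∀ {x y} → W x → W y → W (x ∗ y))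
        (t : Carrier → Carrier) (at : Aut a b t) (tW : ∀ {x} → W x → W (t x)) (t² : ∀ {x} → W x → t (t x) ≡ x)
        (small : ∀ x y z → W x → W y → W z → t x ≡ x → t y ≡ y → t z ≡ z → ¬ x ≡ y → ¬ NC x y z) where

        opaque
          t∗ : ∀ x y → t (x ∗ y) ≡ t x ∗ t y
          t∗ = proj₂ at

          -- t exchanges y and t y, so it fixes the third point of their block, the axis of y.
          axis-fixed : ∀ {y} → W y → t (y ∗ t y) ≡ y ∗ t y
          axis-fixed {y} wy = trans (t∗ y (t y)) (trans (cong (t y ∗_) (t² wy)) (∗-comm (t y) y))

          t-by-axis : ∀ {y c} → y ∗ t y ≡ c → t y ≡ c ∗ y
          t-by-axis {y} e = trans (∗-move e) (∗-comm y _)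

        opaque
          -- With c as the only fixed point, c is the axis of every y, so t is the reflection y ↦ c
          -- ∗ y on W. As t is an automorphism, this is a mitre centred at c.
          isolated : ∀ {c} → W c → t c ≡ c → (∀ v → W v → t v ≡ v → v ≡ c) → ∀ {y z} → W y → W z → ¬ y ≡ c → NC c y z → ⊥
          isolated {c} wc tc only {y} {z} wy wz y≢c (nc , ny , ncy) = mitre (y≢c ∘ sym)
            ((λ q → nc (trans (∗-move q) (op-refl a b c))) , (λ q → ncy (∗-move q)) , (λ q → ny (∗-cancel c q)))
            (trans (cong (λ w → c ∗ (y ∗ w)) (∗-invol c z)) (trans (sym (reflect (W-op wy wz) (λ q → ncy (trans (∗-move q) (∗-comm y c)))))
              (trans (t∗ y z) (cong₂ _∗_ (reflect wy y≢c) (reflect wz nc)))))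
            where
            reflect : ∀ {y} → W y → ¬ y ≡ c → t y ≡ c ∗ y
            reflect wy ne = t-by-axis (only _ (W-op wy (tW wy)) (axis-fixed wy))

        module Axis {c v : Carrier} (wc : W c) (wv : W v) (tc : t c ≡ c) (tv : t v ≡ v) (Sd : S (v - c)) where
          opaque
            c≢v : ¬ c ≡ v
            c≢v e = S≢0 Sd (x≡y⇒x-y≡0 (sym e))

            fixed-line : ∀ {u} → W u → t u ≡ u → u ≡ c ⊎ u ≡ v ⊎ u ≡ c ∗ v
            fixed-line {u} wu tu with u ≟ c | u ≟ v | u ≟ c ∗ v
            ... | yes e | _ | _ = inj₁ e
            ... | no _ | yes e | _ = inj₂ (inj₁ e)
            ... | no _ | no _ | yes e = inj₂ (inj₂ e)
            ... | no n₁ | no n₂ | no n₃ = ⊥-elim (small c v u wc wv wu tc tv tu c≢v (n₁ , n₂ , n₃))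

          -- The moved points of W with axis c.
          Y : Carrier → Set
          Y y = W y × ¬ t y ≡ y × t y ≡ c ∗ y

          opaque
            Y-NC : ∀ {y v′} → t v′ ≡ v′ → Y y → NC c v′ y
            Y-NC tv′ (wy , ny , ty) = (λ { refl → ny tc }) , (λ { refl → ny tv′ }) , λ { refl → ny (trans (t∗ _ _) (cong₂ _∗_ tc tv′)) }

            -- The axis of v′ ∗ y is c, v′ or c ∗ v′. The second would give c = v′, and the third a
            -- mitre. So it is c, and the two expressions for t (v′ ∗ y) give the Pasch
            -- configuration.
            Y-step : ∀ {y v′} → W v′ → t v′ ≡ v′ → ¬ v′ ≡ c → (∀ {u} → W u → t u ≡ u → u ≡ c ⊎ u ≡ v′ ⊎ u ≡ c ∗ v′) → Y y →
              Y (v′ ∗ y) × c ∗ (v′ ∗ y) ≡ v′ ∗ (c ∗ y)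
            Y-step {y} {v′} wv′ tv′ v′≢c only yy@(wy , ny , ty) = go (only (W-op wy₁ (tW wy₁)) (axis-fixed wy₁))
              where
              y₁ : Carrier
              y₁ = v′ ∗ y
              wy₁ : W y₁
              wy₁ = W-op wv′ wy
              ty₁ : t y₁ ≡ v′ ∗ (c ∗ y)
              ty₁ = trans (t∗ v′ y) (cong₂ _∗_ tv′ ty)
              go : y₁ ∗ t y₁ ≡ c ⊎ y₁ ∗ t y₁ ≡ v′ ⊎ y₁ ∗ t y₁ ≡ c ∗ v′ → Y y₁ × c ∗ y₁ ≡ v′ ∗ (c ∗ y)
              go (inj₁ e) = (wy₁ , (λ q → ny (∗-cancel v′ (trans (cong (_∗ t y) (sym tv′)) (trans (sym (t∗ v′ y)) q)))) , t-by-axis e) , trans (sym (t-by-axis e)) ty₁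
              go (inj₂ (inj₁ e)) = ⊥-elim (v′≢c (sym (∗-cancel y (trans (∗-comm y c) (trans (∗-move (trans (sym ty₁)
                (trans (∗-move e) (trans (∗-comm y₁ v′) (∗-invol v′ y))))) (∗-comm v′ y))))))
              go (inj₂ (inj₂ e)) = ⊥-elim (mitre {v′} {c ∗ v′} {y} (λ q → x∗y≢x v′≢c (trans (∗-comm v′ c) (sym q)))
                  ((proj₁ (proj₂ (Y-NC tv′ yy))) , proj₂ (proj₂ (Y-NC tv′ yy)) , (λ q → proj₁ (Y-NC tv′ yy) (trans q thirdc)))
                  (trans (cong (v′ ∗_) (trans (cong (_∗ (v′ ∗ y)) (sym e)) (trans (∗-comm (y₁ ∗ t y₁) y₁) (trans (∗-invol y₁ (t y₁)) ty₁))))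
                    (trans (∗-invol v′ (c ∗ y)) (cong (_∗ y) (sym thirdc)))))
                where
                thirdc : v′ ∗ (c ∗ v′) ≡ c
                thirdc = trans (cong (v′ ∗_) (∗-comm c v′)) (∗-invol v′ c)

            Y-t : ∀ {y} → Y y → Y (c ∗ y)
            Y-t {y} (wy , ny , ty) = W-op wc wy , (λ q → ny (trans ty (trans (sym q) (trans tcy (∗-invol c y))))) , tcy
              where
              tcy : t (c ∗ y) ≡ c ∗ (c ∗ y)
              tcy = trans (t∗ c y) (cong₂ _∗_ tc ty)

            w : Carrier
            w = c ∗ v

            tw : t w ≡ w
            tw = trans (t∗ c v) (cong₂ _∗_ tc tv)

            w≢c : ¬ w ≡ c
            w≢c = x∗y≢x c≢v

            fixed-line-w : ∀ {u} → W u → t u ≡ u → u ≡ c ⊎ u ≡ w ⊎ u ≡ c ∗ w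
            fixed-line-w wu tu with fixed-line wu tu
            ... | inj₁ e = inj₁ e
            ... | inj₂ (inj₁ e) = inj₂ (inj₂ (trans e (sym (∗-invol c v))))
            ... | inj₂ (inj₂ e) = inj₂ (inj₁ e)

            Y-centre : ∀ {y} → Y y → num 3 * Coordinates.coord Sd y ∈ Iset ss
            Y-centre yy = centre Sd (Y-NC tv yy) (proj₂ (Y-step wv tv (c≢v ∘ sym) fixed-line yy)) (proj₂ (Y-step (W-op wc wv) tw w≢c fixed-line-w yy))

            -- y, c ∗ y and v ∗ y are distinct points of `Y`, each forming Pasch configurations with
            -- c, v and with c, c ∗ v; but only two positions are left for such points.
            Y-empty : ∀ {y} → Y y → ⊥
            Y-empty {y} yy with pigeon ss (Y-centre yy) (Y-centre (Y-t yy)) (Y-centre (proj₁ (Y-step wv tv (c≢v ∘ sym) fixed-line yy)))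
            ... | inj₁ e = proj₁ (proj₂ yy) (trans (proj₂ (proj₂ yy)) (sym (Coordinates.coord-injective Sd (*-cancelˡ nz3 e))))
            ... | inj₂ (inj₁ e) = x∗y≢x (proj₁ (proj₂ (Y-NC tv yy))) (trans (∗-comm y v) (sym (Coordinates.coord-injective Sd (*-cancelˡ nz3 e))))
            ... | inj₂ (inj₂ e) = c≢v (∗-cancel y (trans (∗-comm y c) (trans (Coordinates.coord-injective Sd (*-cancelˡ nz3 e)) (∗-comm v y))))

        opaque
          moved : ∀ {p} → W p → ¬ t p ≡ p → ∀ x y z → W x → W y → W z → ¬ x ≡ y → NC x y z → ⊥
          moved {p} wp np x y z wx wy wz x≢y (nx , ny , nxy) with any? (λ v → W? v ×-dec ((t v ≟ v) ×-dec ¬? (v ≟ (p ∗ t p)))) elems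
          ... | yes r with find r
          ...   | (v , _ , wv , tv , v≢c) with S⊎N (x≢y⇒x-y≢0 v≢c)
          ...     | inj₁ s′ = Axis.Y-empty (W-op wp (tW wp)) wv (axis-fixed wp) tv s′ (wp , np , t-by-axis refl)
          ...     | inj₂ n = Axis.Y-empty (W-op wp (tW wp)) (W-op (W-op wp (tW wp)) wv) (axis-fixed wp) (trans (t∗ _ v) (cong₂ _∗_ (axis-fixed wp) tv)) (out n) (wp , np , t-by-axis refl)
          moved {p} wp np x y z wx wy wz x≢y (nx , ny , nxy) | no none = go (x ≟ c) (y ≟ c) (y ≟ c ∗ x) (z ≟ c) (z ≟ c ∗ x)
            where
            c : Carrier
            c = p ∗ t p
            wc : W c
            wc = W-op wp (tW wp)
            only : ∀ v → W v → t v ≡ v → v ≡ c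
            only v wv tv with v ≟ c
            ... | yes e = e
            ... | no ne = ⊥-elim (none (lose (∈-elems v) (wv , tv , ne)))
            iso : ∀ {y z} → W y → W z → ¬ y ≡ c → NC c y z → ⊥
            iso = isolated wc (axis-fixed wp) only
            -- Of three noncollinear points, some two differ from c and do not lie on a block with
            -- it.
            go : Dec (x ≡ c) → Dec (y ≡ c) → Dec (y ≡ c ∗ x) → Dec (z ≡ c) → Dec (z ≡ c ∗ x) → ⊥
            go (yes e) _ _ _ _ = iso wy wz (λ q → x≢y (trans e (sym q))) ((λ q → nx (trans q (sym e))) , ny , (λ q → nxy (trans q (cong (_∗ y) (sym e)))))
            go (no n) (no n₁) (no n₂) _ _ = iso wx wy n (n₁ , x≢y ∘ sym , n₂)
            go (no n) _ _ (no n₁) (no n₂) = iso wx wz n (n₁ , nx , n₂)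
            go (no n) (yes e) _ (yes e′) _ = ny (trans e′ (sym e))
            go (no n) (yes e) _ (no _) (yes e′) = nxy (trans e′ (trans (cong (_∗ x) (sym e)) (∗-comm y x)))
            go (no n) (no _) (yes e) (yes e′) _ = nxy (trans e′ (sym (trans (cong (x ∗_) (trans e (∗-comm c x))) (∗-invol x c))))
            go (no n) (no _) (yes e) (no _) (yes e′) = ny (trans e′ (sym e))

          no-involution : ∀ x y z → W x → W y → W z → ¬ x ≡ y → NC x y z → ⊥
          no-involution x y z wx wy wz ne nc with t x ≟ x | t y ≟ y | t z ≟ z
          ... | no n | _ | _ = moved wx n x y z wx wy wz ne nc
          ... | yes _ | no n | _ = moved wy n x y z wx wy wz ne nc
          ... | yes _ | yes _ | no n = moved wz n x y z wx wy wz ne nc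
          ... | yes p | yes q | yes r = small x y z wx wy wz p q r ne nc

    module _ (tt₂ : TwoTransitive a b) (nz7 : ¬ num 7 ≡ 0#) where
      open Inverse enumeration using (to; from)

      opaque
        all-F? : ∀ {P : Carrier → Set} → (∀ x → Dec (P x)) → Dec (∀ x → P x)
        all-F? {P} P? = Dec.map′ (λ h x → subst P (from-to x) (h (to x))) (λ h i → h (from i)) (Finₚ.all? (λ i → P? (from i)))

        aut? : ∀ f → Dec (Aut a b f)
        aut? f with all-F? (λ x → all-F? (λ y → Dec.map′ (λ h e → h e) (λ h e → h e) (imp (f x ≟ f y) (x ≟ y)))) | all-F? (λ x → all-F? (λ y → f (x ∗ y) ≟ f x ∗ f y))
          where
          imp : ∀ {P Q : Set} → Dec P → Dec Q → Dec (P → Q)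
          imp _ (yes q) = yes (λ _ → q)
          imp (no np) (no _) = yes (λ p → ⊥-elim (np p))
          imp (yes p) (no nq) = no (λ h → nq (h p))
        ... | yes p | yes q = yes ((λ {x} {y} → p x y) , q)
        ... | no np | _ = no (λ h → np (λ x y → proj₁ h))
        ... | yes _ | no nq = no (λ h → nq (proj₂ h))

        aut-resp : ∀ {f g} → (∀ x → f x ≡ g x) → Aut a b f → Aut a b g
        aut-resp e (inj , hom) = (λ {x} {y} q → inj (trans (e x) (trans q (sym (e y))))) , λ x y → trans (sym (e _)) (trans (hom x y) (cong₂ _∗_ (e x) (e y)))

      open TwoSubgroups to from from-to to-from (Aut a b) aut? aut-resp id-aut ∘-aut
        (λ af → inverseOf af , inverse-aut af , inverse-right af , inverse-left af)
      open G renaming (inv to ginv)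

      Fix : List G → Carrier → Set
      Fix [] x = ⊤
      Fix (g ∷ gs) x = fn g x ≡ x × Fix gs x

      fix? : ∀ gs x → Dec (Fix gs x)
      fix? [] x = yes tt
      fix? (g ∷ gs) x = (fn g x ≟ x) ×-dec fix? gs x

      Big : List G → Set
      Big gs = Σ[ x ∈ Carrier ] Σ[ y ∈ Carrier ] Σ[ z ∈ Carrier ] (Fix gs x × Fix gs y × Fix gs z) × ¬ x ≡ y × NC x y z

      opaque
        any-F? : ∀ {P : Carrier → Set} → (∀ x → Dec (P x)) → Dec (Σ Carrier P)
        any-F? {P} P? = Dec.map′ (λ { (i , p) → from i , p }) (λ { (x , p) → to x , subst P (sym (from-to x)) p }) (Finₚ.any? (λ i → P? (from i)))

        big? : ∀ gs → Dec (Big gs)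
        big? gs = any-F? (λ x → any-F? (λ y → any-F? (λ z → (fix? gs x ×-dec (fix? gs y ×-dec fix? gs z)) ×-dec
          (¬? (x ≟ y) ×-dec (¬? (z ≟ x) ×-dec (¬? (z ≟ y) ×-dec ¬? (z ≟ (x ∗ y))))))))

        fix-mem : ∀ gs {x h} → Fix gs x → Mem gs h → h x ≡ x
        fix-mem [] fx m = m _
        fix-mem (g ∷ gs) (e , fx) (inj₁ m) = fix-mem gs fx m
        fix-mem (g ∷ gs) {x} (e , fx) (inj₂ m) = aut-injective (fn-A g) (trans (fix-mem gs fx m) (sym e))

        mem-fix : ∀ gs → Valid gs → ∀ {x} → (∀ h → Mem gs h → h x ≡ x) → Fix gs x
        mem-fix [] v h = tt
        mem-fix (g ∷ gs) (v , sq , nm) h = h (fn g) (inj₂ sq) , mem-fix gs v (λ k m → h k (inj₁ m))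

        fix-op : ∀ gs {x y} → Fix gs x → Fix gs y → Fix gs (x ∗ y)
        fix-op [] _ _ = tt
        fix-op (g ∷ gs) (e , fx) (e′ , fy) = trans (proj₂ (fn-A g) _ _) (cong₂ _∗_ e e′) , fix-op gs fx fy

        fix-normal : ∀ gs g → Valid gs → Normal gs g → ∀ {x} → Fix gs x → Fix gs (fn g x)
        fix-normal gs g v nm {x} fx = mem-fix gs v (λ h m → trans (sym (fn-inv g _)) (cong (fn g) (fix-mem gs fx (nm h m))))

      swap-by : ∀ u v → ¬ u ≡ v → G
      swap-by u v ne = fromA (proj₁ (tt₂ u v v u ne (ne ∘ sym))) (proj₁ (proj₂ (tt₂ u v v u ne (ne ∘ sym))))

      -- One swap is chosen for each unordered pair, so that `sw v u` is inverse to `sw u v`;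
      -- otherwise `Φ` would not be an involution.
      sw : Carrier → Carrier → G
      sw u v with Finₚ.<-cmp (to u) (to v)
      ... | tri< _ ne _ = swap-by u v (ne ∘ cong to)
      ... | tri≈ _ _ _ = ε
      ... | tri> _ ne _ = swap-by v u (ne ∘ cong to ∘ sym) ⁻¹

      opaque

        sw-l : ∀ u v → ¬ u ≡ v → fn (sw u v) u ≡ v
        sw-l u v ne with Finₚ.<-cmp (to u) (to v)
        ... | tri< _ n _ = proj₁ (proj₂ (proj₂ (tt₂ u v v u _ _)))
        ... | tri≈ _ e _ = ⊥-elim (ne (to-injective e))
        ... | tri> _ n _ = trans (cong (ginv (swap-by v u (n ∘ cong to ∘ sym))) (sym (proj₁ (proj₂ (proj₂ (tt₂ v u u v _ _)))))) (inv-fn (swap-by v u (n ∘ cong to ∘ sym)) v)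

        sw-r : ∀ u v → ¬ u ≡ v → fn (sw u v) v ≡ u
        sw-r u v ne with Finₚ.<-cmp (to u) (to v)
        ... | tri< _ n _ = proj₂ (proj₂ (proj₂ (tt₂ u v v u _ _)))
        ... | tri≈ _ e _ = ⊥-elim (ne (to-injective e))
        ... | tri> _ n _ = trans (cong (ginv (swap-by v u (n ∘ cong to ∘ sym))) (sym (proj₂ (proj₂ (proj₂ (tt₂ v u u v _ _)))))) (inv-fn (swap-by v u (n ∘ cong to ∘ sym)) u)

        sw-inv : ∀ u v → ¬ u ≡ v → ∀ z → fn (sw v u) (fn (sw u v) z) ≡ z
        sw-inv u v ne z with Finₚ.<-cmp (to u) (to v) | Finₚ.<-cmp (to v) (to u)
        ... | tri< l _ _ | tri< l′ _ _ = ⊥-elim (Finₚ.<-asym l l′)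
        ... | tri> _ _ g | tri> _ _ g′ = ⊥-elim (Finₚ.<-asym g g′)
        ... | tri≈ _ e _ | _ = ⊥-elim (ne (to-injective e))
        ... | tri< _ _ _ | tri≈ _ e _ = ⊥-elim (ne (to-injective (sym e)))
        ... | tri> _ _ _ | tri≈ _ e _ = ⊥-elim (ne (to-injective (sym e)))
        ... | tri< _ n _ | tri> _ n′ _ = inv-fn (swap-by u v (n ∘ cong to)) z
        ... | tri> _ n _ | tri< _ n′ _ = fn-inv (swap-by v u (n′ ∘ cong to)) z

        grow : ∀ gs → Valid gs → Big gs → Σ[ g ∈ G ] ¬ Mem gs (fn g) × Mem gs (fn g ∘ fn g) × Normal gs g
        grow gs v (x , y , z , (fx , fy , fz) , x≢y , nc) = Cosets.extension gs v x y x≢y (λ h m → fix-mem gs fx m , fix-mem gs fy m) sw sw-l sw-r sw-inv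

        big-[] : Big []
        big-[] = 0# , 1# , - 1# , (tt , tt , tt) , 0≢1 , (λ e → 1≢0 (-x≡0⇒x≡0 e)) , (1≢-1 ∘ sym) , (λ e → a≢b (trans (sym (trans e 0∗1)) (-1≡b (trans e 0∗1))))
          where
          -- a = -1 would give b = -1 as well
          -1≡b : - 1# ≡ a → - 1# ≡ b
          -1≡b e = *-cancelˡ (λ q → 1≢0 (-x≡0⇒x≡0 q)) (trans -1*-1 (trans (sym ab≡1) (cong (_* b) (sym e))))

        -- The chain stops at a group whose fixed points do not lie on one block, whereas those
        -- fixed also by the next generator do. That generator normalises the group and has its
        -- square in it, so it acts on the fixed points as an involution.
        not-twoTransitive : ⊥
        not-twoTransitive with last-with big? big-[] grow
        ... | (gs , g , v , (x , y , z , (fx , fy , fz) , x≢y , nc) , nb , sq , nm) = by-sign (S⊎N s≢0)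
          where
          run : ∀ ss → Sg ss s → ⊥
          run ss hs = NotSeven.Involution.no-involution nz7 ss hs (Fix gs) (fix? gs) (fix-op gs) (fn g) (fn-A g) (fix-normal gs g v nm) (λ fx → fix-mem gs fx sq)
            (λ x y z fx fy fz tx ty tz ne nc → nb (x , y , z , ((tx , fx) , (ty , fy) , (tz , fz)) , ne , nc)) x y z fx fy fz x≢y nc
          by-sign : S s ⊎ N s → ⊥
          by-sign (inj₁ p) = run true p
          by-sign (inj₂ n) = run false n

-- Netto systems in characteristic 7.

sgn₇ : F7 → Bool
sgn₇ 0F = true
sgn₇ 1F = true
sgn₇ 2F = true
sgn₇ 3F = false
sgn₇ 4F = true
sgn₇ 5F = false
sgn₇ 6F = false

if₇ : Bool → F7 → F7 → F7
if₇ true x y = x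
if₇ false x y = y

-- The operation of Q_{α,β} over ℤ/7.
T₇ : F7 → F7 → F7 → F7 → F7
T₇ α β i j = i ⊕ if₇ (sgn₇ (j ⊕ ⊖ i)) α β ⊗ (j ⊕ ⊖ i)

inv₇ : F7 → F7
inv₇ 0F = 0F
inv₇ 1F = 1F
inv₇ 2F = 4F
inv₇ 3F = 5F
inv₇ 4F = 2F
inv₇ 5F = 3F
inv₇ 6F = 6F

module Characteristic7 (F : FiniteField) (odd : FiniteField.size F % 2 ≡ 1) (seven : ι F 7 ≡ FiniteField.0# F) where
  open Signs F odd
  open Quasi F odd

  opaque
    k : F7 → Carrier
    k i = nat (toℕ i)

    k-def : ∀ i → k i ≡ nat (toℕ i)
    k-def i = refl

    nat-mod : ∀ n → nat (n % 7) ≡ nat n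
    nat-mod n = sym (trans (cong nat (m≡m%n+[m/n]*n n 7)) (trans (nat-+ (n % 7) (n / 7 ℕ.* 7)) (trans (cong (λ z → nat (n % 7) + z)
      (trans (nat-* (n / 7) 7) (trans (cong (nat (n / 7) *_) seven) (zeroʳ _)))) (+-identityʳ _))))

    k-mod : ∀ n → k (n mod 7) ≡ nat n
    k-mod n = trans (cong nat (Finₚ.toℕ-fromℕ< (m%n<n n 7))) (nat-mod n)

    k-⊕ : ∀ i j → k (i ⊕ j) ≡ k i + k j
    k-⊕ i j = trans (k-mod (toℕ i ℕ.+ toℕ j)) (nat-+ (toℕ i) (toℕ j))

    k-⊗ : ∀ i j → k (i ⊗ j) ≡ k i * k j
    k-⊗ i j = trans (k-mod (toℕ i ℕ.* toℕ j)) (nat-* (toℕ i) (toℕ j))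

    k-⊖ : ∀ i → k (⊖ i) ≡ - k i
    k-⊖ i = trans (k-mod (7 ∸ toℕ i)) (trans (solve 2 (λ u v → u := (u :+ v) :- v) refl (nat (7 ∸ toℕ i)) (k i))
      (trans (cong (λ z → z - k i) (trans (sym (nat-+ (7 ∸ toℕ i) (toℕ i))) (trans (cong nat (ℕₚ.m∸n+n≡m (ℕₚ.<⇒≤ (Finₚ.toℕ<n i)))) seven))) (+-identityˡ _)))

    k-0 : k 0F ≡ 0#
    k-0 = refl

    k0* : ∀ x → k 0F * x ≡ 0#
    k0* = zeroˡ

    k-1 : k 1F ≡ 1#
    k-1 = +-identityʳ 1#

    k-inv : ∀ i → ¬ i ≡ 0F → k i * k (inv₇ i) ≡ 1#
    k-inv i ni = trans (sym (k-⊗ i (inv₇ i))) (trans (cong k (lem i ni)) k-1)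
      where
      lem : ∀ i → ¬ i ≡ 0F → i ⊗ inv₇ i ≡ 1F
      lem 0F n = ⊥-elim (n refl)
      lem 1F _ = refl
      lem 2F _ = refl
      lem 3F _ = refl
      lem 4F _ = refl
      lem 5F _ = refl
      lem 6F _ = refl

    k≢0 : ∀ i → ¬ i ≡ 0F → ¬ k i ≡ 0#
    k≢0 i ni = xy≡1⇒x≢0 (k-inv i ni)

    k-injective : ∀ {i j} → k i ≡ k j → i ≡ j
    k-injective {i} {j} e with (i ⊕ ⊖ j) Fin.≟ 0F
    ... | yes z = sub0 i j z
      where
      sub0 : ∀ i j → i ⊕ ⊖ j ≡ 0F → i ≡ j
      sub0 = from-yes (Finₚ.all? (λ i → Finₚ.all? (λ j → imp ((i ⊕ ⊖ j) Fin.≟ 0F) (i Fin.≟ j))))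
        where
        imp : ∀ {P Q : Set} → Dec P → Dec Q → Dec (P → Q)
        imp _ (yes q) = yes (λ _ → q)
        imp (no np) (no _) = yes (λ p → ⊥-elim (np p))
        imp (yes p) (no nq) = no (λ h → nq (h p))
    ... | no nz = ⊥-elim (k≢0 _ nz (trans (k-⊕ i (⊖ j)) (trans (cong (λ z → k i + z) (k-⊖ j)) (x≡y⇒x-y≡0 e))))

  module _ (N-1 : N (- 1#)) where
    opaque
      -- 1, 2 = 3² and 4 = 2² stay squares in F, and their negatives 6, 5, 3 are nonsquares because
      -- -1 is one.
      sign₇ : ∀ d → ¬ d ≡ 0F → (sgn₇ d ≡ true × S (k d)) ⊎ (sgn₇ d ≡ false × N (k d))
      sign₇ 0F n = ⊥-elim (n refl)
      sign₇ 1F _ = inj₁ (refl , subst S (sym k-1) S-1)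
      sign₇ 2F _ = inj₁ (refl , subst S (sym (k-⊗ 3F 3F)) (S-sq (k≢0 3F (λ ()))))
      sign₇ 4F _ = inj₁ (refl , subst S (sym (k-⊗ 2F 2F)) (S-sq (k≢0 2F (λ ()))))
      sign₇ 3F _ = inj₂ (refl , subst N (trans (solve 1 (λ x → (:- con (+ 1)) :* x := :- x) refl (k 4F)) (sym (k-⊖ 4F))) (NS N-1 (subst S (sym (k-⊗ 2F 2F)) (S-sq (k≢0 2F (λ ()))))))
      sign₇ 5F _ = inj₂ (refl , subst N (trans (solve 1 (λ x → (:- con (+ 1)) :* x := :- x) refl (k 2F)) (sym (k-⊖ 2F))) (NS N-1 (subst S (sym (k-⊗ 3F 3F)) (S-sq (k≢0 3F (λ ()))))))
      sign₇ 6F _ = inj₂ (refl , subst N (trans (cong -_ (sym k-1)) (sym (k-⊖ 1F))) N-1)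

      op-k : ∀ α β i j → op (k α) (k β) (k i) (k j) ≡ k (T₇ α β i j)
      op-k α β i j = go (d Fin.≟ 0F)
        where
        d : F7
        d = j ⊕ ⊖ i
        kd : k j - k i ≡ k d
        kd = sym (trans (k-⊕ j (⊖ i)) (cong (λ z → k j + z) (k-⊖ i)))
        expand : ∀ c → k i + k c * (k j - k i) ≡ k (i ⊕ c ⊗ d)
        expand c = trans (cong (λ z → k i + k c * z) kd) (trans (cong (λ z → k i + z) (sym (k-⊗ c d))) (sym (k-⊕ i (c ⊗ d))))
        go : Dec (d ≡ 0F) → op (k α) (k β) (k i) (k j) ≡ k (T₇ α β i j)
        go (yes z) = trans (cong (op (k α) (k β) (k i)) (x-y≡0⇒x≡y (trans kd (trans (cong k z) k-0)))) (trans (op-refl _ _ _)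
          (trans (solve 2 (λ x c → x := x :+ c :* con (+ 0)) refl (k i) (k (if₇ (sgn₇ d) α β))) (trans (cong (λ w → k i + k (if₇ (sgn₇ d) α β) * w) (sym (trans kd (trans (cong k z) k-0)))) (expand (if₇ (sgn₇ d) α β)))))
        go (no nz) with sign₇ d nz
        ... | inj₁ (e , s) = trans (op-S _ _ (subst S (sym kd) s)) (trans (expand α) (cong (λ b → k (i ⊕ if₇ b α β ⊗ d)) (sym e)))
        ... | inj₂ (e , n) = trans (op-N _ _ (subst N (sym kd) n)) (trans (expand β) (cong (λ b → k (i ⊕ if₇ b α β ⊗ d)) (sym e)))

  -- The set {x, y, x∗y} together with the z satisfying x∗(y∗z) = y∗(x∗z) is the F₇-line through x and y.
  module Lines₇ (α β : F7) (αβ : (α ≡ 3F × β ≡ 5F) ⊎ (α ≡ 5F × β ≡ 3F)) (Na : N (k α)) (N-1 : N (- 1#)) where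
    open Netto F odd (k α) (k β)

    opaque
      ab≡1 : k α * k β ≡ 1#
      ab≡1 = trans (sym (k-⊗ α β)) (trans (cong k (lem αβ)) k-1)
        where
        lem : ∀ {α β : F7} → (α ≡ 3F × β ≡ 5F) ⊎ (α ≡ 5F × β ≡ 3F) → α ⊗ β ≡ 1F
        lem (inj₁ (refl , refl)) = refl
        lem (inj₂ (refl , refl)) = refl

      a+b≡1 : k α + k β ≡ 1#
      a+b≡1 = trans (sym (k-⊕ α β)) (trans (cong k (lem αβ)) k-1)
        where
        lem : ∀ {α β : F7} → (α ≡ 3F × β ≡ 5F) ⊎ (α ≡ 5F × β ≡ 3F) → α ⊕ β ≡ 1F
        lem (inj₁ (refl , refl)) = refl
        lem (inj₂ (refl , refl)) = refl

      a≢b : ¬ k α ≡ k β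
      a≢b e = lem αβ (k-injective e)
        where
        lem : ∀ {α β : F7} → (α ≡ 3F × β ≡ 5F) ⊎ (α ≡ 5F × β ≡ 3F) → ¬ α ≡ β
        lem (inj₁ (refl , refl)) ()
        lem (inj₂ (refl , refl)) ()

    open Steiner a≢b ab≡1 a+b≡1 Na N-1

    OnLine : Carrier → Carrier → Carrier → Set
    OnLine x y z = Σ[ i ∈ F7 ] z ≡ x + k i * (y - x)

    opaque
      -- A finite check: F₇ carries a Fano plane, in which every point off the block of 0 and 1
      -- completes a Pasch configuration with them.
      table : ∀ i → (i ≡ 0F ⊎ i ≡ 1F ⊎ i ≡ α) ⊎ T₇ α β 0F (T₇ α β 1F i) ≡ T₇ α β 1F (T₇ α β 0F i)
      table i = lem αβ i
        where
        dec : ∀ α β (i : F7) → Dec ((i ≡ 0F ⊎ i ≡ 1F ⊎ i ≡ α) ⊎ T₇ α β 0F (T₇ α β 1F i) ≡ T₇ α β 1F (T₇ α β 0F i))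
        dec α β i = ((i Fin.≟ 0F) ⊎-dec ((i Fin.≟ 1F) ⊎-dec (i Fin.≟ α))) ⊎-dec (T₇ α β 0F (T₇ α β 1F i) Fin.≟ T₇ α β 1F (T₇ α β 0F i))
        lem : ∀ {α β : F7} → (α ≡ 3F × β ≡ 5F) ⊎ (α ≡ 5F × β ≡ 3F) → ∀ (i : F7) → (i ≡ 0F ⊎ i ≡ 1F ⊎ i ≡ α) ⊎ T₇ α β 0F (T₇ α β 1F i) ≡ T₇ α β 1F (T₇ α β 0F i)
        lem (inj₁ (refl , refl)) = from-yes (Finₚ.all? (dec 3F 5F))
        lem (inj₂ (refl , refl)) = from-yes (Finₚ.all? (dec 5F 3F))

      line-block : ∀ x y → OnLine x y (x ∗ y)
      line-block x y with op-view (k α) (k β) x y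
      ... | inj₁ (e , _) = α , e
      ... | inj₂ (e , _) = β , e

      line-swap : ∀ {x y z} → OnLine x y z → OnLine y x z
      line-swap {x} {y} {z} (i , e) = 1F ⊕ ⊖ i , trans e (trans (solve 3 (λ x y c → x :+ c :* (y :- x) := y :+ (con (+ 1) :+ (:- c)) :* (x :- y)) refl x y (k i))
        (cong (λ c → y + c * (x - y)) (sym (trans (k-⊕ 1F (⊖ i)) (cong₂ _+_ k-1 (k-⊖ i))))))

      on-line⇒ : ∀ {x y z} → S (y - x) → OnLine x y z → (z ≡ x ⊎ z ≡ y ⊎ z ≡ x ∗ y) ⊎ x ∗ (y ∗ z) ≡ y ∗ (x ∗ z)
      on-line⇒ {x} {y} {z} Sd (i , e) = go (table i)
        where
        open Coordinates Sd
        hz : h (k i) ≡ z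
        hz = trans (trans (+-comm _ x) (cong (λ w → x + w) (*-comm _ _))) (sym e)
        hk0 : h (k 0F) ≡ x
        hk0 = trans (cong h k-0) h-0
        hk1 : h (k 1F) ≡ y
        hk1 = trans (cong h k-1) h-1
        go : (i ≡ 0F ⊎ i ≡ 1F ⊎ i ≡ α) ⊎ T₇ α β 0F (T₇ α β 1F i) ≡ T₇ α β 1F (T₇ α β 0F i) → (z ≡ x ⊎ z ≡ y ⊎ z ≡ x ∗ y) ⊎ x ∗ (y ∗ z) ≡ y ∗ (x ∗ z)
        go (inj₁ (inj₁ q)) = inj₁ (inj₁ (trans (sym hz) (trans (cong (h ∘ k) q) hk0)))
        go (inj₁ (inj₂ (inj₁ q))) = inj₁ (inj₂ (inj₁ (trans (sym hz) (trans (cong (h ∘ k) q) hk1))))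
        go (inj₁ (inj₂ (inj₂ q))) = inj₁ (inj₂ (inj₂ (trans (sym hz) (trans (cong (h ∘ k) q) h-a))))
        go (inj₂ q) = inj₂ (trans (sym (h∗ hk0 (h∗ hk1 hz))) (trans (cong h (trans (cong (k 0F ∗_) (op-k N-1 α β 1F i)) (trans (op-k N-1 α β 0F (T₇ α β 1F i)) (trans (cong k q)
          (sym (trans (cong (k 1F ∗_) (op-k N-1 α β 0F i)) (op-k N-1 α β 1F (T₇ α β 0F i)))))))) (h∗ hk1 (h∗ hk0 hz))))

      num-k : ∀ n → num n ≡ k (n mod 7)
      num-k n = trans (num≡nat n) (sym (k-mod n))

      -- 5 inverts 3 modulo 7, undoing the factor 3 carried by `Aset`.
      third : ∀ {z w i} → num 3 * z ≡ w → w ≡ k i → z ≡ k (5F ⊗ i)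
      third {z} {w} {i} e q = trans (sym (*-identityˡ z)) (trans (cong (_* z) (sym (trans (sym (k-⊗ 5F 3F)) k-1))) (trans (*-assoc _ _ _)
        (trans (cong (λ c → k 5F * (c * z)) (sym (num-k 3))) (trans (cong (k 5F *_) (trans e q)) (sym (k-⊗ 5F i))))))

      -lin : ∀ i j → k i - k j ≡ k (i ⊕ ⊖ j)
      -lin i j = sym (trans (k-⊕ i (⊖ j)) (cong (λ z → k i + z) (k-⊖ j)))

      -- As a is in F₇, the candidates of `pasch01` are too: Pasch configurations do not lead off
      -- the F₇-line.
      A-in-K : ∀ ss {w} → w ∈ Aset ss → Σ[ i ∈ F7 ] w ≡ k i
      A-in-K true (here e) = 2F ⊕ ⊖ α , trans e (trans (cong (λ z → z - k α) (num-k 2)) (-lin 2F α))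
      A-in-K true (there (here e)) = (2F ⊗ α) ⊕ ⊖ 1F , trans e (trans (cong₂ _-_ (trans (cong (_* k α) (num-k 2)) (sym (k-⊗ 2F α))) (sym k-1)) (-lin (2F ⊗ α) 1F))
      A-in-K true (there (there (here e))) = 1F ⊕ ⊖ (2F ⊗ α) , trans e (trans (cong₂ _-_ (sym k-1) (trans (cong (_* k α) (num-k 2)) (sym (k-⊗ 2F α)))) (-lin 1F (2F ⊗ α)))
      A-in-K true (there (there (there (here e)))) = 1F ⊕ α , trans e (trans (cong (_+ k α) (sym k-1)) (sym (k-⊕ 1F α)))
      A-in-K false (here e) = 2F ⊕ 2F ⊗ α , trans e (trans (cong₂ _+_ (num-k 2) (trans (cong (_* k α) (num-k 2)) (sym (k-⊗ 2F α)))) (sym (k-⊕ 2F (2F ⊗ α))))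
      A-in-K false (there (here e)) = 1F ⊕ α , trans e (trans (cong (_+ k α) (sym k-1)) (sym (k-⊕ 1F α)))
      A-in-K false (there (there (here e))) = 2F ⊕ ⊖ α , trans e (trans (cong (λ z → z - k α) (num-k 2)) (-lin 2F α))
      A-in-K false (there (there (there (here e)))) = 4F ⊕ ⊖ (2F ⊗ α) , trans e (trans (cong₂ _-_ (num-k 4) (trans (cong (_* k α) (num-k 2)) (sym (k-⊗ 2F α)))) (-lin 4F (2F ⊗ α)))

      sign-s : Σ[ ss ∈ Bool ] Sg ss s
      sign-s with S⊎N s≢0
      ... | inj₁ p = true , p
      ... | inj₂ n = false , n

      trivial-line : ∀ {x y z} → z ≡ x ⊎ z ≡ y ⊎ z ≡ x ∗ y → OnLine x y z
      trivial-line {x} {y} (inj₁ refl) = 0F , sym (trans (cong (λ w → x + w) (k0* (y - x))) (+-identityʳ x))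
      trivial-line {x} {y} (inj₂ (inj₁ refl)) = 1F , trans (solve 2 (λ x y → y := x :+ con (+ 1) :* (y :- x)) refl x y) (cong (λ c → x + c * (y - x)) (sym k-1))
      trivial-line {x} {y} (inj₂ (inj₂ refl)) = line-block x y

      ⇒on-line : ∀ {x y z} → S (y - x) → (z ≡ x ⊎ z ≡ y ⊎ z ≡ x ∗ y) ⊎ x ∗ (y ∗ z) ≡ y ∗ (x ∗ z) → OnLine x y z
      ⇒on-line Sd (inj₁ t) = trivial-line t
      ⇒on-line {x} {y} {z} Sd (inj₂ e) = go (z ≟ x) (z ≟ y) (z ≟ x ∗ y)
        where
        open Coordinates Sd
        in-K : Σ[ i ∈ F7 ] num 3 * coord z ≡ k i → OnLine x y z
        in-K (i , q) = 5F ⊗ i , trans (sym (h-coord z)) (trans (cong h (third refl q)) (trans (+-comm _ x) (cong (λ w → x + w) (*-comm _ _))))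
        go : Dec (z ≡ x) → Dec (z ≡ y) → Dec (z ≡ x ∗ y) → OnLine x y z
        go (yes q) _ _ = trivial-line (inj₁ q)
        go (no _) (yes q) _ = trivial-line (inj₂ (inj₁ q))
        go (no _) (no _) (yes q) = trivial-line (inj₂ (inj₂ q))
        go (no n₀) (no n₁) (no nₐ) = in-K (A-in-K (proj₁ sign-s) (pasch01 (proj₁ sign-s) (proj₂ sign-s) (coord z) (h≢ h-0 n₀) (h≢ h-1 n₁) (h≢ h-a nₐ)
              (h-inj (trans (h∗ h-0 (h∗ h-1 (h-coord z))) (trans e (sym (h∗ h-1 (h∗ h-0 (h-coord z)))))))))

    Special : Carrier → Carrier → Carrier → Set
    Special x y z = (z ≡ x ⊎ z ≡ y ⊎ z ≡ x ∗ y) ⊎ x ∗ (y ∗ z) ≡ y ∗ (x ∗ z)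

    opaque
      special-swap : ∀ {x y z} → Special x y z → Special y x z
      special-swap (inj₁ (inj₁ e)) = inj₁ (inj₂ (inj₁ e))
      special-swap (inj₁ (inj₂ (inj₁ e))) = inj₁ (inj₁ e)
      special-swap {x} {y} (inj₁ (inj₂ (inj₂ e))) = inj₁ (inj₂ (inj₂ (trans e (∗-comm x y))))
      special-swap (inj₂ e) = inj₂ (sym e)

      special-image : ∀ {g x y z} → Aut (k α) (k β) g → Special x y z → Special (g x) (g y) (g z)
      special-image {g} ag (inj₁ (inj₁ e)) = inj₁ (inj₁ (cong g e))
      special-image {g} ag (inj₁ (inj₂ (inj₁ e))) = inj₁ (inj₂ (inj₁ (cong g e)))
      special-image {g} ag (inj₁ (inj₂ (inj₂ e))) = inj₁ (inj₂ (inj₂ (trans (cong g e) (proj₂ ag _ _))))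
      special-image {g} {x} {y} {z} ag (inj₂ e) = inj₂ (trans (sym (hom x y)) (trans (cong g e) (hom y x)))
        where
        hom : ∀ x y → g (x ∗ (y ∗ z)) ≡ g x ∗ (g y ∗ g z)
        hom x y = trans (proj₂ ag _ _) (cong (g x ∗_) (proj₂ ag _ _))

      reverse-S : ∀ {x y} → N (y - x) → S (x - y)
      reverse-S {x} {y} n = subst S (solve 2 (λ x y → (:- con (+ 1)) :* (y :- x) := x :- y) refl x y) (NN N-1 n)

      line⇒special : ∀ {x y z} → ¬ x ≡ y → OnLine x y z → Special x y z
      line⇒special ne l with S⊎N (x≢y⇒x-y≢0 (ne ∘ sym))
      ... | inj₁ p = on-line⇒ p l
      ... | inj₂ n = special-swap (on-line⇒ (reverse-S n) (line-swap l))

      special⇒line : ∀ {x y z} → ¬ x ≡ y → Special x y z → OnLine x y z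
      special⇒line ne l with S⊎N (x≢y⇒x-y≢0 (ne ∘ sym))
      ... | inj₁ p = ⇒on-line p l
      ... | inj₂ n = line-swap (⇒on-line (reverse-S n) (special-swap l))

      line-preserved : ∀ {g x y z} → Aut (k α) (k β) g → ¬ x ≡ y → OnLine x y z → OnLine (g x) (g y) (g z)
      line-preserved ag ne l = special⇒line (ne ∘ aut-injective ag) (special-image ag (line⇒special ne l))

    -- An automorphism fixing 0 maps F₇-lines to F₇-lines, hence is additive once there are two independent directions.
    module Affine {g : Carrier → Carrier} (ag : Aut (k α) (k β) g) (g0 : g 0# ≡ 0#) where
      g⁻¹ : Carrier → Carrier
      g⁻¹ = inverseOf ag

      Multiple : Carrier → Carrier → Set
      Multiple y z = Σ[ i ∈ F7 ] z ≡ k i * y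

      opaque
        line-lift : ∀ {x y z} → ¬ x ≡ y → OnLine (g x) (g y) (g z) → OnLine x y z
        line-lift {x} {y} {z} ne l = subst₂ (λ p q → OnLine p q z) (inverse-left ag x) (inverse-left ag y) (subst (OnLine _ _) (inverse-left ag z)
          (line-preserved (inverse-aut ag) (ne ∘ aut-injective ag) l))

        multiple-image : ∀ {y z} → ¬ y ≡ 0# → Multiple y z → Multiple (g y) (g z)
        multiple-image {y} {z} ny (i , e) with line-preserved {x = 0#} {y = y} ag (ny ∘ sym) (i , trans e (solve 2 (λ c y → c :* y := con (+ 0) :+ c :* (y :- con (+ 0))) refl (k i) y))
        ... | (j , q) = j , trans q (trans (cong (λ w → w + k j * (g y - w)) g0) (solve 2 (λ c y → con (+ 0) :+ c :* (y :- con (+ 0)) := c :* y) refl (k j) (g y)))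

        multiple-lift : ∀ {y w} → ¬ y ≡ 0# → Multiple (g y) w → Σ[ z ∈ Carrier ] g z ≡ w × Multiple y z
        multiple-lift {y} {w} ny (i , e) = g⁻¹ w , inverse-right ag w , j (line-lift {x = 0#} {y = y} (ny ∘ sym)
            (i , trans (inverse-right ag w) (trans e (trans (solve 2 (λ c y → c :* y := con (+ 0) :+ c :* (y :- con (+ 0))) refl (k i) (g y)) (cong (λ w → w + k i * (g y - w)) (sym g0))))))
          where
          j : ∀ {z} → OnLine 0# y z → Multiple y z
          j (j , q) = j , trans q (solve 2 (λ c y → con (+ 0) :+ c :* (y :- con (+ 0)) := c :* y) refl (k j) y)

        multiple-sym : ∀ {y z} → ¬ z ≡ 0# → Multiple y z → Multiple z y
        multiple-sym {y} {z} nz (i , e) = inv₇ i , sym (trans (cong (k (inv₇ i) *_) e) (trans (sym (*-assoc _ _ _)) (trans (cong (_* y) (trans (*-comm _ _) (k-inv i (λ { refl → nz (trans e (k0* y)) })))) (*-identityˡ y))))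

        -- The sum y + z is the midpoint of 2y and 2z.
        mid : ∀ y z → y + z ≡ k 2F * y + k 4F * (k 2F * z - k 2F * y)
        mid y z = sym (trans (expand (k 2F) (k 4F))
            (cong₂ _+_ (trans (cong (_* y) c₁) (*-identityˡ y)) (trans (cong (_* z) c₂) (*-identityˡ z))))
          where
          expand : ∀ p q → p * y + q * (p * z - p * y) ≡ (p - q * p) * y + (q * p) * z
          expand p q = solve 4 (λ p q y z → p :* y :+ q :* (p :* z :- p :* y) := (p :- q :* p) :* y :+ (q :* p) :* z) refl p q y z
          c₂ : k 4F * k 2F ≡ 1#
          c₂ = trans (sym (k-⊗ 4F 2F)) k-1
          c₁ : k 2F - k 4F * k 2F ≡ 1#
          c₁ = trans (cong (λ c → k 2F - c) (trans c₂ (sym k-1))) (trans (-lin 2F 1F) k-1)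

        -- g preserves the lines through 0 in the directions y and z, and the line joining 2y to 2z,
        -- on which y + z lies.
        sum-in-plane : ∀ {y z} → ¬ y ≡ 0# → ¬ z ≡ 0# → ¬ Multiple y z → Σ[ A ∈ F7 ] Σ[ B ∈ F7 ] g (y + z) ≡ k A * g y + k B * g z
        sum-in-plane {y} {z} ny nz ind = go (multiple-image ny (2F , refl)) (multiple-image nz (2F , refl)) (line-preserved ag distinct (4F , mid y z))
          where
          distinct : ¬ k 2F * y ≡ k 2F * z
          distinct e = ind (1F , sym (trans (cong (_* y) k-1) (trans (*-identityˡ y) (*-cancelˡ (k≢0 2F (λ ())) e))))
          go : Multiple (g y) (g (k 2F * y)) → Multiple (g z) (g (k 2F * z)) → OnLine (g (k 2F * y)) (g (k 2F * z)) (g (y + z)) →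
            Σ[ A ∈ F7 ] Σ[ B ∈ F7 ] g (y + z) ≡ k A * g y + k B * g z
          go (r , er) (t , et) (l , el) = r ⊕ ⊖ (l ⊗ r) , l ⊗ t , trans el (trans (cong₂ (λ p q → p + k l * (q - p)) er et)
                (trans (solve 5 (λ r t l y z → r :* y :+ l :* (t :* z :- r :* y) := (r :+ (:- (l :* r))) :* y :+ (l :* t) :* z) refl (k r) (k t) (k l) (g y) (g z))
                (cong₂ (λ p q → p * g y + q * g z) (sym (trans (k-⊕ r (⊖ (l ⊗ r))) (cong (λ c → k r + c) (trans (k-⊖ (l ⊗ r)) (cong -_ (k-⊗ l r)))))) (sym (k-⊗ l t)))))

        -- Parallel lines have disjoint images.
        coefficient : ∀ {y z} → ¬ z ≡ 0# → ¬ Multiple z y → ∀ A B → g (y + z) ≡ k A * g y + k B * g z → A ≡ 1F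
        coefficient {y} {z} nz ind A B e = go ((A ⊕ ⊖ 1F) Fin.≟ 0F)
          where
          lem : ∀ A → A ⊕ ⊖ 1F ≡ 0F → A ≡ 1F
          lem 0F ()
          lem 1F _ = refl
          lem 2F ()
          lem 3F ()
          lem 4F ()
          lem 5F ()
          lem 6F ()
          -- Chosen with 1 + τ(A - 1) = 0. For A ≠ 1 the line through g y and g (y + z) then meets
          -- the multiples of g z, although the line through y and y + z misses the multiples of z.
          τ : F7
          τ = ⊖ inv₇ (A ⊕ ⊖ 1F)
          kA : k (A ⊕ ⊖ 1F) ≡ k A - 1#
          kA = trans (k-⊕ A (⊖ 1F)) (cong (λ c → k A + c) (trans (k-⊖ 1F) (cong -_ k-1)))
          τA : ¬ A ⊕ ⊖ 1F ≡ 0F → k τ * (k A - 1#) ≡ - 1#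
          τA nA = trans (cong₂ _*_ (k-⊖ (inv₇ (A ⊕ ⊖ 1F))) (sym kA)) (trans (solve 2 (λ i c → (:- i) :* c := :- (c :* i)) refl (k (inv₇ (A ⊕ ⊖ 1F))) (k (A ⊕ ⊖ 1F))) (cong -_ (k-inv (A ⊕ ⊖ 1F) nA)))
          expand : ∀ t A B y z → y + t * ((A * y + B * z) - y) ≡ (1# + t * (A - 1#)) * y + (t * B) * z
          expand = solve 5 (λ t A B y z → y :+ t :* ((A :* y :+ B :* z) :- y) := (con (+ 1) :+ t :* (A :- con (+ 1))) :* y :+ (t :* B) :* z) refl
          on : ¬ A ⊕ ⊖ 1F ≡ 0F → ∀ {z′} → g z′ ≡ k (τ ⊗ B) * g z → g z′ ≡ g y + k τ * (g (y + z) - g y)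
          on nA gz′ = trans gz′ (sym (trans (cong (λ w → g y + k τ * (w - g y)) e) (trans (expand (k τ) (k A) (k B) (g y) (g z))
            (trans (cong₂ (λ p q → (1# + p) * g y + q * g z) (τA nA) (sym (k-⊗ τ B))) (solve 2 (λ y w → (con (+ 1) :+ (:- con (+ 1))) :* y :+ w := w) refl (g y) (k (τ ⊗ B) * g z))))))
          clash : ∀ {z′} → Multiple z z′ → OnLine y (y + z) z′ → ⊥
          clash (j , ez′) (l , el) = ind (j ⊕ ⊖ l , trans (solve 3 (λ y z l → y := (y :+ l :* ((y :+ z) :- y)) :+ (:- (l :* z))) refl y z (k l)) (trans (cong (_+ - (k l * z)) (trans (sym el) ez′))
                (trans (solve 3 (λ j l z → j :* z :+ (:- (l :* z)) := (j :+ (:- l)) :* z) refl (k j) (k l) z) (cong (_* z) (-lin j l)))))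
          y≢y+z : ¬ y ≡ y + z
          y≢y+z q = nz (+-cancelˡ y z 0# (trans (sym q) (sym (+-identityʳ y))))
          lift : ¬ A ⊕ ⊖ 1F ≡ 0F → Σ[ z′ ∈ Carrier ] g z′ ≡ k (τ ⊗ B) * g z × Multiple z z′ → ⊥
          lift nA (z′ , gz′ , mz′) = clash mz′ (line-lift {x = y} {y = y + z} {z = z′} y≢y+z (τ , on nA gz′))
          go : Dec (A ⊕ ⊖ 1F ≡ 0F) → A ≡ 1F
          go (yes q) = lem A q
          go (no nA) = ⊥-elim (lift nA (multiple-lift {y = z} {w = k (τ ⊗ B) * g z} nz (τ ⊗ B , refl)))

        independent-add : ∀ {y z} → ¬ y ≡ 0# → ¬ z ≡ 0# → ¬ Multiple y z → g (y + z) ≡ g y + g z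
        independent-add {y} {z} ny nz ind = go (sum-in-plane ny nz ind)
          where
          one : ∀ A w → A ≡ 1F → k A * w ≡ w
          one A w e = trans (cong (λ c → k c * w) e) (trans (cong (_* w) k-1) (*-identityˡ w))
          ind′ : ¬ Multiple z y
          ind′ m = ind (multiple-sym {y = z} {z = y} ny m)
          go : Σ[ A ∈ F7 ] Σ[ B ∈ F7 ] g (y + z) ≡ k A * g y + k B * g z → g (y + z) ≡ g y + g z
          go (A , B , e) = trans e (cong₂ _+_ (one A (g y) (coefficient {y} {z} nz ind′ A B e)) (one B (g z)
              (coefficient {z} {y} ny ind B A (trans (cong g (+-comm z y)) (trans e (+-comm _ _))))))

        multiple? : ∀ y z → Dec (Multiple y z)
        multiple? y z = Finₚ.any? (λ i → z ≟ k i * y)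

        multiple-add : ∀ {y z w} → Multiple y z → Multiple y w → Multiple y (z + w)
        multiple-add {y} (i , e) (j , q) = i ⊕ j , trans (cong₂ _+_ e q) (trans (sym (distribʳ y _ _)) (cong (_* y) (sym (k-⊕ i j))))

        multiple-neg : ∀ {y z} → Multiple y z → Multiple y (- z)
        multiple-neg {y} (i , e) = ⊖ i , trans (cong -_ e) (trans (-‿distribˡ-* (k i) y) (cong (_* y) (sym (k-⊖ i))))

        multiple-trans : ∀ {x y z} → Multiple x y → Multiple y z → Multiple x z
        multiple-trans {x} (i , e) (j , q) = j ⊗ i , trans q (trans (cong (k j *_) e) (trans (sym (*-assoc _ _ _)) (cong (_* x) (sym (k-⊗ j i)))))

        only-multiples : ∀ {y} → (∀ w → Multiple y w) → size ≡ 7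
        only-multiples {y} coordinate = ℕₚ.≤-antisym (Finₚ.injective⇒≤ {f = λ i → proj₁ (coordinate (from i))} inj) (Finₚ.injective⇒≤ {f = λ i → to (k i)} (λ e → k-injective (to-injective e)))
          where
          open Inverse enumeration using (to; from)
          inj : ∀ {i j} → proj₁ (coordinate (from i)) ≡ proj₁ (coordinate (from j)) → i ≡ j
          inj {i} {j} e = trans (sym (to-from i)) (trans (cong to (trans (proj₂ (coordinate (from i))) (trans (cong (λ c → k c * y) e) (sym (proj₂ (coordinate (from j))))))) (to-from j))

        -- Expand g (y + z + w) in two ways, with w off the line of y and z: apart from y + z = 0,
        -- which is immediate, all sums that arise are of independent vectors.
        dependent-add : ∀ {y z w} → ¬ y ≡ 0# → ¬ z ≡ 0# → Multiple y z → ¬ Multiple y w → g (y + z) ≡ g y + g z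
        dependent-add {y} {z} {w} ny nz mz nw = +-cancelʳ (g w) _ _ (trans (sym (left (y + z ≟ 0#))) (trans (cong g (+-assoc y z w)) (trans right (sym (+-assoc _ _ _)))))
          where
          zero-multiple : ∀ {v} → v ≡ 0# → Multiple y v
          zero-multiple e = 0F , trans e (sym (k0* y))
          w≢0 : ¬ w ≡ 0#
          w≢0 e = nw (zero-multiple e)
          z+w : ¬ Multiple y (z + w)
          z+w m = nw (subst (Multiple y) (solve 2 (λ z w → (z :+ w) :+ (:- z) := w) refl z w) (multiple-add {y} {z + w} { - z} m (multiple-neg {y} {z} mz)))
          right : g (y + (z + w)) ≡ g y + (g z + g w)
          right = trans (independent-add ny (λ e → z+w (zero-multiple e)) z+w) (cong (λ c → g y + c) (independent-add nz w≢0 (λ m → nw (multiple-trans {y} {z} {w} mz m))))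
          my : Multiple y y
          my = 1F , sym (trans (cong (_* y) k-1) (*-identityˡ y))
          left : Dec (y + z ≡ 0#) → g ((y + z) + w) ≡ g (y + z) + g w
          left (yes e) = trans (cong (λ c → g (c + w)) e) (trans (cong g (+-identityˡ w)) (sym (trans (cong (λ c → g c + g w) e) (trans (cong (_+ g w) g0) (+-identityˡ _)))))
          left (no ne) = independent-add ne w≢0 (λ m → nw (multiple-trans {y} {y + z} {w} (multiple-add {y} {y} {z} my mz) m))

        additive₇ : ¬ size ≡ 7 → ∀ y z → g (y + z) ≡ g y + g z
        additive₇ ns y z = go (y ≟ 0#) (z ≟ 0#)
          where
          further : ¬ y ≡ 0# → ¬ z ≡ 0# → Multiple y z → Dec (Any (λ w → ¬ Multiple y w) elems) → g (y + z) ≡ g y + g z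
          further ny nz mz (yes r) = dependent-add ny nz mz (proj₂ (proj₂ (find r)))
          further ny nz mz (no none) = ⊥-elim (ns (only-multiples {y} (λ w → decidable-stable (multiple? y w) (λ nm → none (lose (∈-elems w) nm)))))
          split : ¬ y ≡ 0# → ¬ z ≡ 0# → Dec (Multiple y z) → g (y + z) ≡ g y + g z
          split ny nz (no ind) = independent-add ny nz ind
          split ny nz (yes mz) = further ny nz mz (any? (λ w → ¬? (multiple? y w)) elems)
          go : Dec (y ≡ 0#) → Dec (z ≡ 0#) → g (y + z) ≡ g y + g z
          go (yes e) _ = trans (cong (λ c → g (c + z)) e) (trans (cong g (+-identityˡ z)) (sym (trans (cong (λ c → g c + g z) e) (trans (cong (_+ g z) g0) (+-identityˡ _)))))
          go (no _) (yes e) = trans (cong (λ c → g (y + c)) e) (trans (cong g (+-identityʳ y)) (sym (trans (cong (λ c → g y + g c) e) (trans (cong (λ c → g y + c) g0) (+-identityʳ _)))))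
          go (no ny) (no nz) = split ny nz (multiple? y z)

    opaque
      aut-affine : ¬ size ≡ 7 → ∀ {f} → Aut (k α) (k β) f → ∀ x y → f (x + y) + f 0# ≡ f x + f y
      aut-affine ns {f} af x y = trans (solve 2 (λ p z → p :+ z := (con (+ 1) :* p :+ (:- z)) :+ z :+ z) refl (f (x + y)) (f 0#))
        (trans (cong (λ w → w + f 0# + f 0#) (Affine.additive₇ (∘-aut (affine-aut _ _ (- f 0#) S-1) af) (solve 1 (λ z → con (+ 1) :* z :+ (:- z) := con (+ 0)) refl (f 0#)) ns x y))
        (solve 3 (λ p q z → (con (+ 1) :* p :+ (:- z)) :+ (con (+ 1) :* q :+ (:- z)) :+ z :+ z := p :+ q) refl (f x) (f y) (f 0#)))

-- Additive power maps and orders of subfields.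

bin-1 : ∀ n → bin n 1 ≡ n
bin-1 zero = refl
bin-1 (suc n) = cong suc (bin-1 n)

module Powers (F : FiniteField) (odd : FiniteField.size F % 2 ≡ 1) where
  open Signs F odd
  open Carlitz F odd

  AdditivePower : ℕ → Set
  AdditivePower n = ∀ x y → (x + y) ^ n ≡ x ^ n + y ^ n

  opaque
    -- (1 + x)^(n+1) - 1 - x^(n+1) has degree at most n and n + 1 roots, so its coefficients vanish.
    vanishing-binomials : ∀ n rs → Unique rs → suc n ≤ length rs → (∀ r → r ∈ rs → (1# + r) ^ suc n ≡ 1# + r ^ suc n) →
      ∀ i j → suc i ℕ.+ suc j ≡ suc n → nbin (suc n) (suc i) ≡ 0#
    vanishing-binomials n rs u l h i j e = trans (sym (trans (cong₂ (λ p q → nbin (suc n) (suc i) * p + - 1# * q) (1^ (suc n ∸ suc i)) (δ-off 0 (suc i) (λ ())))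
        (solve 1 (λ x → x :* con (+ 1) :+ (:- con (+ 1)) :* con (+ 0) := x) refl (nbin (suc n) (suc i)))))
        (roots-bound rs u d (suc n) l root (suc i) (subst (suc i <_) e (ℕₚ.m<m+n (suc i) (s≤s z≤n))))
      where
      c d : ℕ → Carrier
      c i = nbin (suc n) i * 1# ^ (suc n ∸ i)
      d i = c i + - 1# * δ 0 i
      top : c (suc n) ≡ 1#
      top = trans (cong₂ (λ p q → nat p * q) (bin-diag (suc n)) (1^ (suc n ∸ suc n))) (solve 0 ((con (+ 1) :+ con (+ 0)) :* con (+ 1) := con (+ 1)) refl)
      value : ∀ r → r ∈ rs → poly c (suc n) r ≡ 1#
      value r r∈ = +-cancelʳ (r ^ suc n) _ _ (trans (cong (λ z → poly c (suc n) r + z) (trans (sym (*-identityˡ _)) (cong (_* r ^ suc n) (sym top))))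
        (trans (sym (poly-snoc c (suc n) r)) (trans (sym (binomial (suc n) 1# r)) (h r r∈))))
      root : ∀ r → r ∈ rs → poly d (suc n) r ≡ 0#
      root r r∈ = trans (poly-+ c (λ i → - 1# * δ 0 i) (suc n) r) (trans (cong₂ _+_ (value r r∈) (trans (poly-* (- 1#) (δ 0) (suc n) r) (cong (- 1# *_) (poly-δ 0 (suc n) r (s≤s z≤n)))))
        (solve 0 (con (+ 1) :+ (:- con (+ 1)) :* con (+ 1) := con (+ 0)) refl))

    additive-power : ∀ n → (∀ i j → suc i ℕ.+ suc j ≡ suc n → nbin (suc n) (suc i) ≡ 0#) → AdditivePower (suc n)
    additive-power n h x y = trans (sym (*-identityˡ _)) (trans (binomial-collapse 1# n (λ i j e → trans (*-identityˡ _) (h i j e)) x y) (*-identityˡ _))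

    additive-power-* : ∀ m n → AdditivePower m → AdditivePower n → AdditivePower (m ℕ.* n)
    additive-power-* m n hm hn x y = trans (^-* (x + y) m n) (trans (cong (_^ m) (hn x y)) (trans (hm _ _) (sym (cong₂ _+_ (^-* x m n) (^-* y m n)))))

    additive-power-injective : ∀ n → AdditivePower n → ∀ {x y} → x ^ n ≡ y ^ n → x ≡ y
    additive-power-injective n h {x} {y} e = x-y≡0⇒x≡y (x^n≡0⇒x≡0 n (+-cancelʳ (y ^ n) _ _ (trans (sym (h (x - y) y))
      (trans (cong (_^ n) (solve 2 (λ x y → (x :- y) :+ y := x) refl x y)) (trans e (sym (+-identityˡ _)))))))

    power-aut : ∀ n → AdditivePower n → IsFieldAut F (λ x → x ^ n)
    power-aut n h = injective⇒bijective (additive-power-injective n h) , h , (λ x y → *-^ x y n) , 1^ n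

    characteristic-search : ∀ n → (Σ[ p ∈ ℕ ] nat (suc p) ≡ 0# × (∀ i → i < p → ¬ nat (suc i) ≡ 0#)) ⊎ (∀ i → i < n → ¬ nat (suc i) ≡ 0#)
    characteristic-search zero = inj₂ (λ _ ())
    characteristic-search (suc n) with characteristic-search n
    ... | inj₁ r = inj₁ r
    ... | inj₂ h with nat (suc n) ≟ 0#
    ...   | yes e = inj₁ (n , e , h)
    ...   | no ne = inj₂ below
      where
      below : ∀ i → i < suc n → ¬ nat (suc i) ≡ 0#
      below i (s≤s l) with i ℕₚ.≟ n
      ... | yes refl = ne
      ... | no i≢n = h i (ℕₚ.≤∧≢⇒< l i≢n)

    characteristic : Σ[ p ∈ ℕ ] nat (suc p) ≡ 0# × (∀ i → i < p → ¬ nat (suc i) ≡ 0#)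
    characteristic with characteristic-search (suc (m ℕ.+ m))
    ... | inj₁ r = r
    ... | inj₂ h = ⊥-elim (h (m ℕ.+ m) ℕₚ.≤-refl (trans (cong nat (sym size≡1+2m)) nat-size))

    p-1 p : ℕ
    p-1 = proj₁ characteristic
    p = suc p-1

    nat-p : nat p ≡ 0#
    nat-p = proj₁ (proj₂ characteristic)

    below-p : ∀ i → i < p-1 → ¬ nat (suc i) ≡ 0#
    below-p = proj₂ (proj₂ characteristic)

    -- For 0 < i < p, i C(p,i) = p C(p-1,i-1) = 0 in F, while i ≠ 0 in F because p is the least
    -- positive integer that vanishes there.
    frobenius-additive : AdditivePower p
    frobenius-additive = additive-power p-1 coeff
      where
      coeff : ∀ i j → suc i ℕ.+ suc j ≡ p → nbin p (suc i) ≡ 0#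
      coeff i j e with xy≡0⇒x≡0⊎y≡0 (nbin p (suc i)) (nat (suc i)) (trans (cong (λ k → nbin p (suc i) * nat k) (sym (bin-1 (suc i))))
            (trans (sym (nat-* (bin p (suc i)) (bin (suc i) 1))) (trans (cong nat (bin-chain p 1 i)) (trans (nat-* (bin p 1) (bin (p ∸ 1) i))
            (trans (cong (λ z → nat z * nat (bin (p ∸ 1) i)) (bin-1 p)) (trans (cong (_* nat (bin (p ∸ 1) i)) nat-p) (zeroˡ _)))))))
      ... | inj₁ z = z
      ... | inj₂ z = ⊥-elim (below-p i (ℕₚ.≤-trans (ℕₚ.m<m+n i {suc j} (s≤s z≤n)) (ℕₚ.≤-reflexive (ℕₚ.suc-injective e))) z)

    2≤p : 2 ≤ p
    2≤p = lem p-1 nat-p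
      where
      lem : ∀ q → nat (suc q) ≡ 0# → 2 ≤ suc q
      lem zero e = ⊥-elim (1≢0 (trans (sym (+-identityʳ 1#)) e))
      lem (suc q) e = s≤s (s≤s z≤n)

    p-divides : ∀ r → nat r ≡ 0# → Σ[ r′ ∈ ℕ ] r ≡ r′ ℕ.* p
    p-divides r e = r / p , trans (m≡m%n+[m/n]*n r p) (cong (ℕ._+ r / p ℕ.* p) (remainder (r % p) (m%n<n r p) rem))
      where
      rem : nat (r % p) ≡ 0#
      rem = trans (sym (trans (cong nat (m≡m%n+[m/n]*n r p)) (trans (nat-+ (r % p) (r / p ℕ.* p)) (trans (cong (λ z → nat (r % p) + z)
        (trans (nat-* (r / p) p) (trans (cong (nat (r / p) *_) nat-p) (zeroʳ _)))) (+-identityʳ _))))) e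
      remainder : ∀ k → k < p → nat k ≡ 0# → k ≡ 0
      remainder zero _ _ = refl
      remainder (suc k) (s≤s l) z = ⊥-elim (below-p k l z)

    -- If γ = s r with x ↦ x^s additive and r > 1, then (1 + y)^(r²) = 1 + y^(r²) for the γ² values y = x^(s²), so that p divides r.
    square-root-additive : ∀ γ xs → ¬ γ ≡ 0 → Unique xs → length xs ≡ γ ℕ.* γ → (∀ x → x ∈ xs → x ^ (γ ℕ.* γ) ≡ x) →
      (∀ x → x ∈ xs → 1# + x ∈ xs) → AdditivePower γ
    square-root-additive γ xs γ≢0 u len fix suc-closed = go γ γ 1 ℕₚ.≤-refl (ℕₚ.*-identityˡ γ) (λ x y → distribute x y)
      where
      distribute : ∀ x y → (x + y) ^ 1 ≡ x ^ 1 + y ^ 1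
      distribute x y = distribʳ 1# x y
      go : ∀ fuel r s → r ≤ fuel → s ℕ.* r ≡ γ → AdditivePower s → AdditivePower γ
      go fuel zero s _ e hs = ⊥-elim (γ≢0 (trans (sym e) (ℕₚ.*-zeroʳ s)))
      go fuel (suc zero) s _ e hs = subst AdditivePower (trans (sym (ℕₚ.*-identityʳ s)) e) hs
      go (suc fuel) (suc (suc r₀)) s (s≤s l) e hs = next (p-divides r nat-r)
        where
        r : ℕ
        r = suc (suc r₀)
        h² : AdditivePower (s ℕ.* s)
        h² = additive-power-* s s hs hs
        s≢0 : ¬ s ≡ 0
        s≢0 z = γ≢0 (trans (sym e) (cong (ℕ._* r) z))
        r≤γ : r ≤ γ
        r≤γ = subst (r ≤_) e (ℕₚ.m≤n*m r s {{ℕ.≢-nonZero s≢0}})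
        rr : ∀ x → (x ^ (s ℕ.* s)) ^ (r ℕ.* r) ≡ x ^ (γ ℕ.* γ)
        rr x = trans (sym (^-* x (r ℕ.* r) (s ℕ.* s))) (cong (x ^_) (trans (ℕₚ.*-comm (r ℕ.* r) (s ℕ.* s)) (trans (ℕₚ.[m*n]*[o*p]≡[m*o]*[n*p] s s r r) (cong₂ ℕ._*_ e e))))
        ys : List Carrier
        ys = map (_^ (s ℕ.* s)) xs
        ys-len : r ℕ.* r ≤ length ys
        ys-len = subst (r ℕ.* r ≤_) (sym (trans (length-map (_^ (s ℕ.* s)) xs) len)) (ℕₚ.*-mono-≤ r≤γ r≤γ)
        on-xs : ∀ x → x ∈ xs → (1# + x ^ (s ℕ.* s)) ^ (r ℕ.* r) ≡ 1# + (x ^ (s ℕ.* s)) ^ (r ℕ.* r)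
        on-xs x x∈ = trans (cong (_^ (r ℕ.* r)) (sym (trans (h² 1# x) (cong (_+ x ^ (s ℕ.* s)) (1^ (s ℕ.* s))))))
          (trans (rr (1# + x)) (trans (fix (1# + x) (suc-closed x x∈)) (cong (λ z → 1# + z) (sym (trans (rr x) (fix x x∈))))))
        on-ys : ∀ y → y ∈ ys → (1# + y) ^ (r ℕ.* r) ≡ 1# + y ^ (r ℕ.* r)
        on-ys y y∈ with ∈-map⁻ (_^ (s ℕ.* s)) y∈
        ... | (x , x∈ , refl) = on-xs x x∈
        -- r² is the first inner binomial coefficient C(r², 1).
        nat-rr : nat (r ℕ.* r) ≡ 0#
        nat-rr = trans (cong nat (sym (bin-1 (r ℕ.* r)))) (vanishing-binomials (suc r₀ ℕ.+ suc r₀ ℕ.* r) ys (Uniqueₚ.map⁺ (additive-power-injective (s ℕ.* s) h²) u) ys-len on-ys 0 (r₀ ℕ.+ suc r₀ ℕ.* r) refl)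
        nat-r : nat r ≡ 0#
        nat-r with xy≡0⇒x≡0⊎y≡0 (nat r) (nat r) (trans (sym (nat-* r r)) nat-rr)
        ... | inj₁ z = z
        ... | inj₂ z = z
        next : Σ[ r′ ∈ ℕ ] r ≡ r′ ℕ.* p → AdditivePower γ
        next (zero , ())
        next (suc r₁ , q) = go fuel (suc r₁) (s ℕ.* p) (ℕₚ.≤-trans (ℕₚ.≤-pred (subst (suc (suc r₁) ≤_) (sym q) smaller)) l)
            (trans (ℕₚ.*-assoc s p (suc r₁)) (trans (cong (s ℕ.*_) (trans (ℕₚ.*-comm p (suc r₁)) (sym q))) e)) (additive-power-* s p hs frobenius-additive)
          where
          smaller : suc r₁ < suc r₁ ℕ.* p
          smaller = ℕₚ.m<m*n (suc r₁) p 2≤p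

  nonzero : List Carrier → List Carrier
  nonzero = filter (λ x → ¬? (x ≟ 0#))

  opaque
    ∈-nonzero⁺ : ∀ {xs x} → x ∈ xs → ¬ x ≡ 0# → x ∈ nonzero xs
    ∈-nonzero⁺ = ∈-filter⁺ (λ x → ¬? (x ≟ 0#))

    ∈-nonzero⁻ : ∀ {xs x} → x ∈ nonzero xs → x ∈ xs × ¬ x ≡ 0#
    ∈-nonzero⁻ = ∈-filter⁻ (λ x → ¬? (x ≟ 0#))

    nonzero-unique : ∀ {xs} → Unique xs → Unique (nonzero xs)
    nonzero-unique = Uniqueₚ.filter⁺ (λ x → ¬? (x ≟ 0#))

    length-nonzero : ∀ {xs} → Unique xs → 0# ∈ xs → length xs ≡ suc (length (nonzero xs))
    length-nonzero {xs} u 0∈ = ↭-length (unique-↭ u (All.tabulate (λ x∈ e → proj₂ (∈-nonzero⁻ {xs} x∈) (sym e)) ∷ nonzero-unique u) to from)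
      where
      to : ∀ {x} → x ∈ xs → x ∈ 0# ∷ nonzero xs
      to {x} x∈ with x ≟ 0#
      ... | yes e = here e
      ... | no ne = there (∈-nonzero⁺ x∈ ne)
      from : ∀ {x} → x ∈ 0# ∷ nonzero xs → x ∈ xs
      from (here refl) = 0∈
      from (there x∈) = proj₁ (∈-nonzero⁻ x∈)

    subfield-fermat : ∀ {xs} → Unique xs → IsSubfield F (_∈ xs) → ∀ {x} → x ∈ xs → x ^ length xs ≡ x
    subfield-fermat {xs} u (0∈ , 1∈ , +∈ , -∈ , *∈ , inv∈) {x} x∈ = trans (cong (x ^_) (length-nonzero u 0∈)) (lem (x ≟ 0#))
      where
      lem : Dec (x ≡ 0#) → x * x ^ length (nonzero xs) ≡ x
      lem (yes e) = trans (cong (_* x ^ length (nonzero xs)) e) (trans (zeroˡ _) (sym e))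
      lem (no nx) = trans (cong (x *_) (fermat-list (nonzero xs) (nonzero-unique u) (λ y y∈ → proj₂ (∈-nonzero⁻ {xs} y∈)) nx
        (λ y y∈ → ∈-nonzero⁺ (*∈ x y x∈ (proj₁ (∈-nonzero⁻ y∈))) (xy≢0 nx (proj₂ (∈-nonzero⁻ {xs} y∈))))
        (λ y y∈ → ∈-nonzero⁺ (*∈ (inv x) y (inv∈ x (inv x) x∈ (inv-right nx)) (proj₁ (∈-nonzero⁻ y∈))) (xy≢0 (inv≢0 nx) (proj₂ (∈-nonzero⁻ {xs} y∈))))))
        (*-identityʳ x)

    -- The nonzero solutions of xⁿ = x are roots of x^(n-1) = 1.
    few-fixed-points : ∀ {xs} → Unique xs → 0# ∈ xs → 1# ∈ xs → ∀ n → n < length xs → 2 ≤ n → ¬ (∀ x → x ∈ xs → x ^ n ≡ x)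
    few-fixed-points _ _ _ (suc zero) _ (s≤s ()) _
    few-fixed-points {xs} u 0∈ 1∈ (suc (suc n)) l _ h = few-roots-of-unity n (nonzero xs) (nonzero-unique u)
        (ℕₚ.≤-pred (subst (suc (suc n) <_) (length-nonzero u 0∈) l))
        (λ x x∈ → *-cancelˡ (proj₂ (∈-nonzero⁻ {xs} x∈)) (trans (h x (proj₁ (∈-nonzero⁻ x∈))) (sym (*-identityʳ x))))

    length≥2 : ∀ {xs : List Carrier} → 0# ∈ xs → 1# ∈ xs → 2 ≤ length xs
    length≥2 {x ∷ []} (here p) (here q) = ⊥-elim (1≢0 (trans q (sym p)))
    length≥2 {x ∷ y ∷ xs} _ _ = s≤s (s≤s z≤n)

-- Semilinear maps, the twist, and the case a = b.

length-cartesianProduct : ∀ {A B : Set} (xs : List A) (ys : List B) → length (cartesianProduct xs ys) ≡ length xs ℕ.* length ys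
length-cartesianProduct [] ys = refl
length-cartesianProduct (x ∷ xs) ys = trans (length-++ (map (x ,_) ys)) (cong₂ ℕ._+_ (length-map (x ,_) ys) (length-cartesianProduct xs ys))

-- Membership in K comes without a decision procedure. In deriving a contradiction it may still be
-- taken as decided on the finitely many elements of F.
¬¬-decide : ∀ {A : Set} (P : A → Set) xs → ¬ ¬ (∀ x → x ∈ xs → Dec (P x))
¬¬-decide P [] k = k (λ _ ())
¬¬-decide P (x ∷ xs) k = ¬¬-decide P xs (λ d → k′ d (λ p → k (λ { y (here refl) → yes p ; y (there y∈) → d y y∈ })))
  where
  k′ : (∀ y → y ∈ xs → Dec (P y)) → ¬ ¬ P x
  k′ d np = k (λ { y (here refl) → no np ; y (there y∈) → d y y∈ })

module Semilinear (F : FiniteField) (odd : FiniteField.size F % 2 ≡ 1) where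
  open Signs F odd
  open Carlitz F odd
  open Quasi F odd
  open Dichotomy F odd
  open Powers F odd

  module FieldAut {α : Carrier → Carrier} (isα : IsFieldAut F α) where
    opaque
      α-+ : ∀ x y → α (x + y) ≡ α x + α y
      α-+ = proj₁ (proj₂ isα)

      α-* : ∀ x y → α (x * y) ≡ α x * α y
      α-* = proj₁ (proj₂ (proj₂ isα))

      α-1 : α 1# ≡ 1#
      α-1 = proj₂ (proj₂ (proj₂ isα))

      α-injective : ∀ {x y} → α x ≡ α y → x ≡ y
      α-injective = proj₁ (proj₁ isα)

      α-0 : α 0# ≡ 0#
      α-0 = +-cancelʳ (α 0#) _ _ (trans (sym (α-+ 0# 0#)) (trans (cong α (+-identityˡ 0#)) (sym (+-identityˡ _))))

      α-neg : ∀ x → α (- x) ≡ - α x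
      α-neg x = +-cancelʳ (α x) _ _ (trans (sym (α-+ (- x) x)) (trans (cong α (-‿inverseˡ x)) (trans α-0 (sym (-‿inverseˡ _)))))

      α-minus : ∀ x y → α (x - y) ≡ α x - α y
      α-minus x y = trans (α-+ x (- y)) (cong (λ z → α x + z) (α-neg y))

      α-^ : ∀ x n → α (x ^ n) ≡ α x ^ n
      α-^ x zero = α-1
      α-^ x (suc n) = trans (α-* x (x ^ n)) (cong (α x *_) (α-^ x n))

      α≢0 : ∀ {x} → ¬ x ≡ 0# → ¬ α x ≡ 0#
      α≢0 nx e = nx (α-injective (trans e (sym α-0)))

      α-inv : ∀ {x} → ¬ x ≡ 0# → α (inv x) ≡ inv (α x)
      α-inv {x} nx = sym (inv-unique (trans (sym (α-* x (inv x))) (trans (cong α (inv-right nx)) α-1)))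

      α-S : ∀ {x} → S x → S (α x)
      α-S {x} s = trans (X-def (α x)) (trans (sym (α-^ x m)) (trans (cong α (trans (sym (X-def x)) s)) α-1))

      α-N : ∀ {x} → N x → N (α x)
      α-N {x} n = trans (X-def (α x)) (trans (sym (α-^ x m)) (trans (cong α (trans (sym (X-def x)) n)) (trans (α-neg 1#) (cong -_ α-1))))

      α-nat : ∀ n → α (nat n) ≡ nat n
      α-nat zero = α-0
      α-nat (suc n) = trans (α-+ 1# (nat n)) (cong₂ _+_ α-1 (α-nat n))

      α-op : ∀ a b x y → α (op a b x y) ≡ op (α a) (α b) (α x) (α y)
      α-op a b x y = go (op-view a b x y)
        where
        expand : ∀ c → α (x + c * (y - x)) ≡ α x + α c * (α y - α x)
        expand c = trans (α-+ x (c * (y - x))) (cong (λ z → α x + z) (trans (α-* c (y - x)) (cong (α c *_) (α-minus y x))))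
        go : (op a b x y ≡ x + a * (y - x) × (y ≡ x ⊎ S (y - x))) ⊎ (op a b x y ≡ x + b * (y - x) × N (y - x)) → α (op a b x y) ≡ op (α a) (α b) (α x) (α y)
        go (inj₁ (e , inj₁ refl)) = trans (cong α (op-refl a b x)) (sym (op-refl (α a) (α b) (α x)))
        go (inj₁ (e , inj₂ s)) = trans (cong α e) (trans (expand a) (sym (op-S (α a) (α b) (subst S (α-minus y x) (α-S s)))))
        go (inj₂ (e , n)) = trans (cong α e) (trans (expand b) (sym (op-N (α a) (α b) (subst N (α-minus y x) (α-N n)))))

      -- The points fixed by α form a subfield containing a and b, hence K.
      fixes⇒InGal : ∀ {a b} → α a ≡ a → α b ≡ b → InGal F a b α
      fixes⇒InGal αa αb = isα , λ x x∈ → x∈ (λ z → α z ≡ z)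
        (α-0 , α-1 , (λ x y p q → trans (α-+ x y) (cong₂ _+_ p q)) , (λ x p → trans (α-neg x) (cong -_ p)) , (λ x y p q → trans (α-* x y) (cong₂ _*_ p q)) ,
          (λ x y p e → *-cancelˡ (xy≡1⇒x≢0 e) (trans (cong (_* α y) (sym p)) (trans (sym (α-* x y)) (trans (cong α e) (trans α-1 (sym e))))))) αa αb

  opaque
    a∈K : ∀ {a b} → InK F a b a
    a∈K S isS Sa Sb = Sa

    b∈K : ∀ {a b} → InK F a b b
    b∈K S isS Sa Sb = Sb

    op-translate : ∀ a b μ x y → op a b (x + μ) (y + μ) ≡ op a b x y + μ
    op-translate a b μ x y = trans (cong₂ (λ p q → op a b (p + μ) (q + μ)) (sym (*-identityˡ x)) (sym (*-identityˡ y)))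
      (trans (op-affine a b μ x y S-1) (cong (_+ μ) (*-identityˡ _)))

    aut-cong : ∀ {a b f g} → (∀ x → f x ≡ g x) → Aut a b g → Aut a b f
    aut-cong {a} {b} {f} {g} eq ag = mkAut (λ {x} {y} e → aut-injective ag (trans (sym (eq x)) (trans e (eq y))))
      (λ x y → trans (eq _) (trans (proj₂ ag x y) (sym (cong₂ (op a b) (eq x) (eq y)))))

    fixing-aut : ∀ {a b α l} → IsFieldAut F α → α a ≡ a → α b ≡ b → S l → ∀ μ → Aut a b (λ x → l * α x + μ)
    fixing-aut {a} {b} {α} {l} isα αa αb Sl μ = mkAut (λ e → α-injective (affine-injective (S≢0 Sl) e))
        (λ x y → trans (cong (λ z → l * z + μ) (trans (α-op a b x y) (cong₂ (λ p q → op p q (α x) (α y)) αa αb))) (sym (op-affine a b μ (α x) (α y) Sl)))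
      where open FieldAut isα

    -- α is an isomorphism from Q_{a,b} to Q_{b,a}, and multiplication by a nonsquare leads back.
    swapping-aut : ∀ {a b α l} → IsFieldAut F α → α a ≡ b → α b ≡ a → N l → ∀ μ → Aut a b (λ x → l * α x + μ)
    swapping-aut {a} {b} {α} {l} isα αa αb Nl μ = mkAut (λ e → α-injective (affine-injective (N≢0 Nl) e))
        (λ x y → trans (cong (λ z → l * z + μ) (trans (α-op a b x y) (cong₂ (λ p q → op p q (α x) (α y)) αa αb)))
          (trans (cong (_+ μ) (sym (op-twist a b (α x) (α y) Nl))) (sym (op-translate a b μ (l * α x) (l * α y)))))
      where open FieldAut isα

  module Coefficients {a b f α l μ} (isα : IsFieldAut F α) (af : Aut a b f) (eq : ∀ x → f x ≡ l * α x + μ) (l≢0 : ¬ l ≡ 0#) where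
    open FieldAut isα
    opaque
      diff : ∀ w → f w - f 0# ≡ l * α w
      diff w = trans (cong₂ _-_ (eq w) (trans (eq 0#) (cong (λ z → l * z + μ) α-0))) (solve 3 (λ l w μ → (l :* w :+ μ) :- (l :* con (+ 0) :+ μ) := l :* w) refl l (α w) μ)

      -- Evaluating f at 0 ∗ w reads off the image of the coefficient used there: a for w = 1, b for
      -- w a nonsquare.
      coefficient : ∀ {w c d} → ¬ w ≡ 0# → op a b 0# w ≡ 0# + c * (w - 0#) → op a b (f 0#) (f w) ≡ f 0# + d * (f w - f 0#) → α c ≡ d
      coefficient {w} {c} {d} nw p q = *-cancelˡ (xy≢0 l≢0 (α≢0 nw)) (trans (sym lhs) (trans (cong (λ z → z - f 0#) (trans (proj₂ af 0# w) q)) rhs))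
        where
        lhs : f (op a b 0# w) - f 0# ≡ (l * α w) * α c
        lhs = trans (diff _) (trans (cong (λ z → l * α z) (trans p (solve 2 (λ c w → con (+ 0) :+ c :* (w :- con (+ 0)) := w :* c) refl c w)))
          (trans (cong (l *_) (α-* w c)) (sym (*-assoc _ _ _))))
        rhs : (f 0# + d * (f w - f 0#)) - f 0# ≡ (l * α w) * d
        rhs = trans (solve 2 (λ u v → (u :+ v) :- u := v) refl (f 0#) (d * (f w - f 0#))) (trans (cong (d *_) (diff w)) (*-comm _ _))

      w-0 : ∀ w → w - 0# ≡ w
      w-0 w = solve 1 (λ w → w :- con (+ 0) := w) refl w

      fixes : S l → α a ≡ a × α b ≡ b
      fixes Sl = coefficient 1≢0 (op-S a b (subst S (sym (w-0 1#)) S-1)) (op-S a b (subst S (sym (diff 1#)) (SS Sl (α-S S-1)))) ,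
        coefficient (N≢0 Nν) (op-N a b (subst N (sym (w-0 _)) Nν)) (op-N a b (subst N (sym (diff _)) (SN Sl (α-N Nν))))
        where
        Nν : N (proj₁ nonsquare)
        Nν = proj₂ nonsquare

      swaps : N l → α a ≡ b × α b ≡ a
      swaps Nl = coefficient 1≢0 (op-S a b (subst S (sym (w-0 1#)) S-1)) (op-N a b (subst N (sym (diff 1#)) (NS Nl (α-S S-1)))) ,
        coefficient (N≢0 Nν) (op-N a b (subst N (sym (w-0 _)) Nν)) (op-S a b (subst S (sym (diff _)) (NN Nl (α-N Nν))))
        where
        Nν : N (proj₁ nonsquare)
        Nν = proj₂ nonsquare

  opaque
    preserving⇒AΓ²L : ∀ {a b f} → Aut a b f → Preserves f → InAΓ²L F a b f
    preserving⇒AΓ²L {a} {b} {f} af pres = go (carlitz f pres)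
      where
      go : (Σ Carrier λ l → Σ Carrier λ μ → Σ (Carrier → Carrier) λ α → S l × IsFieldAut F α × (∀ x → f x ≡ l * α x + μ)) → InAΓ²L F a b f
      go (l , μ , α , Sl , isα , eq) = l , μ , α , χ-S Sl , FieldAut.fixes⇒InGal isα (proj₁ fx) (proj₂ fx) , eq
        where
        fx : α a ≡ a × α b ≡ b
        fx = Coefficients.fixes isα af eq (S≢0 Sl) Sl

    AΓ²L⇒aut : ∀ {a b f} → InAΓ²L F a b f → Aut a b f
    AΓ²L⇒aut (l , μ , α , χl , (isα , fx) , eq) = aut-cong eq (fixing-aut isα (fx _ a∈K) (fx _ b∈K) (χ⇒S χl) μ)

    reversing⇒swap : ∀ {a b f} → Aut a b f → Reverses f →
      Σ Carrier λ l → Σ Carrier λ μ → Σ (Carrier → Carrier) λ α → N l × IsFieldAut F α × (α a ≡ b × α b ≡ a) × (∀ x → f x ≡ l * α x + μ)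
    reversing⇒swap {a} {b} {f} af rev = go (carlitz (λ x → ν * f x) pres)
      where
      ν : Carrier
      ν = proj₁ nonsquare
      Nν : N ν
      Nν = proj₂ nonsquare
      pres : ∀ x y → X (ν * f x - ν * f y) ≡ X (x - y)
      pres x y = trans (cong X (solve 3 (λ n p q → n :* p :- n :* q := n :* (p :- q)) refl ν (f x) (f y))) (trans (X-* ν _) (trans (cong₂ _*_ Nν (rev x y))
        (solve 1 (λ z → (:- con (+ 1)) :* (:- z) := z) refl (X (x - y)))))
      go : (Σ Carrier λ l → Σ Carrier λ μ → Σ (Carrier → Carrier) λ α → S l × IsFieldAut F α × (∀ x → ν * f x ≡ l * α x + μ)) →
        Σ Carrier λ l → Σ Carrier λ μ → Σ (Carrier → Carrier) λ α → N l × IsFieldAut F α × (α a ≡ b × α b ≡ a) × (∀ x → f x ≡ l * α x + μ)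
      go (l , μ , α , Sl , isα , eq) = inv ν * l , inv ν * μ , α , Nl , isα , Coefficients.swaps isα af eq′ (N≢0 Nl) Nl , eq′
        where
        Nl : N (inv ν * l)
        Nl = NS (N-inv Nν) Sl
        eq′ : ∀ x → f x ≡ (inv ν * l) * α x + inv ν * μ
        eq′ x = trans (sym (ν-conj-cancel′ (N≢0 Nν) (f x))) (trans (cong (inv ν *_) (eq x)) (solve 4 (λ i l x μ → i :* (l :* x :+ μ) := (i :* l) :* x :+ i :* μ) refl (inv ν) l (α x) μ))

    InK-isSubfield : ∀ {a b n} (hc : HasCard F (InK F a b) n) → IsSubfield F (_∈ proj₁ hc)
    InK-isSubfield {a} {b} (xs , u , len , mem) =
        in-xs (λ S isS _ _ → proj₁ isS) ,
        in-xs (λ S isS _ _ → proj₁ (proj₂ isS)) ,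
        (λ x y p q → in-xs (λ S isS Sa Sb → proj₁ (proj₂ (proj₂ isS)) x y (in-K p S isS Sa Sb) (in-K q S isS Sa Sb))) ,
        (λ x p → in-xs (λ S isS Sa Sb → proj₁ (proj₂ (proj₂ (proj₂ isS))) x (in-K p S isS Sa Sb))) ,
        (λ x y p q → in-xs (λ S isS Sa Sb → proj₁ (proj₂ (proj₂ (proj₂ (proj₂ isS)))) x y (in-K p S isS Sa Sb) (in-K q S isS Sa Sb))) ,
        (λ x y p e → in-xs (λ S isS Sa Sb → proj₂ (proj₂ (proj₂ (proj₂ (proj₂ isS)))) x y (in-K p S isS Sa Sb) e))
      where
      in-xs : ∀ {x} → InK F a b x → x ∈ xs
      in-xs {x} = proj₁ (mem x)
      in-K : ∀ {x} → x ∈ xs → InK F a b x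
      in-K {x} = proj₂ (mem x)

    1<γ : ∀ γ → 2 ≤ γ ℕ.* γ → 2 ≤ γ
    1<γ (suc zero) (s≤s ())
    1<γ (suc (suc γ)) _ = s≤s (s≤s z≤n)

    -- Fermat's theorem in K gives b^γ = a^(γ²) = a. Were a = b, x ↦ x^γ would fix all γ² elements
    -- of K, but x^γ = x has at most γ solutions.
    twist-frobenius : ∀ {a b γ} → TwistExponent F a b γ → IsFieldAut F (λ x → x ^ γ) × (a ^ γ ≡ b × b ^ γ ≡ a) × ¬ a ≡ b
    twist-frobenius {a} {b} {γ} (n , hc , γγ≡n , b≡) = isφ , (sym b≡ , bγ) , a≢b
      where
      xs : List Carrier
      xs = proj₁ hc
      u : Unique xs
      u = proj₁ (proj₂ hc)
      len : length xs ≡ γ ℕ.* γ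
      len = trans (proj₁ (proj₂ (proj₂ hc))) (sym γγ≡n)
      sub : IsSubfield F (_∈ xs)
      sub = InK-isSubfield hc
      0∈ : 0# ∈ xs
      0∈ = proj₁ sub
      1∈ : 1# ∈ xs
      1∈ = proj₁ (proj₂ sub)
      2≤γ : 2 ≤ γ
      2≤γ = 1<γ γ (subst (2 ≤_) len (length≥2 0∈ 1∈))
      fix : ∀ x → x ∈ xs → x ^ (γ ℕ.* γ) ≡ x
      fix x x∈ = trans (cong (x ^_) (sym len)) (subfield-fermat u sub x∈)
      isφ : IsFieldAut F (λ x → x ^ γ)
      isφ = power-aut γ (square-root-additive γ xs (λ { refl → ℕₚ.<⇒≱ 2≤γ z≤n }) u len fix (λ x x∈ → proj₁ (proj₂ (proj₂ sub)) 1# x 1∈ x∈))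
      bγ : b ^ γ ≡ a
      bγ = trans (cong (_^ γ) b≡) (trans (sym (^-* a γ γ)) (fix a (proj₁ (proj₂ (proj₂ (proj₂ hc)) a) a∈K)))
      a≢b : ¬ a ≡ b
      a≢b e = few-fixed-points u 0∈ 1∈ γ (subst (γ <_) (sym len) (ℕₚ.m<m*n γ γ {{ℕ.>-nonZero (ℕₚ.<⇒≤ 2≤γ)}} 2≤γ)) 2≤γ
        (λ x x∈ → proj₂ gal x (proj₂ (proj₂ (proj₂ (proj₂ hc)) x) x∈))
        where
        gal : InGal F a b (λ x → x ^ γ)
        gal = FieldAut.fixes⇒InGal isφ (trans (sym b≡) (sym e)) (trans bγ e)

    twist⇒aut : ∀ {a b γ f} → TwistExponent F a b γ → InTwist F a b γ f → Aut a b f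
    twist⇒aut tw (inj₁ i) = AΓ²L⇒aut i
    twist⇒aut {a} {b} {γ} tw (inj₂ (l , μ , α , χl , (isα , fx) , eq)) = aut-cong eq (swapping-aut {α = λ x → α (x ^ γ)} isαφ (trans (cong α aγ) (fx _ b∈K)) (trans (cong α bγ) (fx _ a∈K)) (χ⇒N χl) μ)
      where
      isφ : IsFieldAut F (λ x → x ^ γ)
      isφ = proj₁ (twist-frobenius {a} {b} {γ} tw)
      aγ : a ^ γ ≡ b
      aγ = proj₁ (proj₁ (proj₂ (twist-frobenius {a} {b} {γ} tw)))
      bγ : b ^ γ ≡ a
      bγ = proj₂ (proj₁ (proj₂ (twist-frobenius {a} {b} {γ} tw)))
      module A = FieldAut isα
      module Φ = FieldAut isφ
      isαφ : IsFieldAut F (λ x → α (x ^ γ))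
      isαφ = injective⇒bijective (λ e → Φ.α-injective (A.α-injective e)) , (λ x y → trans (cong α (Φ.α-+ x y)) (A.α-+ _ _)) ,
        (λ x y → trans (cong α (Φ.α-* x y)) (A.α-* _ _)) , trans (cong α Φ.α-1) A.α-1

    -- Composing α with the inverse of x ↦ x^γ undoes the exchange of a and b, so the composite
    -- fixes K.
    swap⇒twist : ∀ {a b γ f} → TwistExponent F a b γ →
      (Σ Carrier λ l → Σ Carrier λ μ → Σ (Carrier → Carrier) λ α → N l × IsFieldAut F α × (α a ≡ b × α b ≡ a) × (∀ x → f x ≡ l * α x + μ)) → InTwist F a b γ f
    swap⇒twist {a} {b} {γ} {f} tw (l , μ , α , Nl , isα , (αa , αb) , eq) = inj₂ (l , μ , (λ x → α (ψ x)) , χ-N Nl ,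
        FieldAut.fixes⇒InGal isαψ (trans (cong α (trans (cong ψ (sym bγ)) (ψφ b))) αb) (trans (cong α (trans (cong ψ (sym aγ)) (ψφ a))) αa) ,
        (λ x → trans (eq x) (cong (λ z → l * α z + μ) (sym (ψφ x)))))
      where
      isφ : IsFieldAut F (λ x → x ^ γ)
      isφ = proj₁ (twist-frobenius {a} {b} {γ} tw)
      aγ : a ^ γ ≡ b
      aγ = proj₁ (proj₁ (proj₂ (twist-frobenius {a} {b} {γ} tw)))
      bγ : b ^ γ ≡ a
      bγ = proj₂ (proj₁ (proj₂ (twist-frobenius {a} {b} {γ} tw)))
      module A = FieldAut isα
      module Φ = FieldAut isφ
      surj : ∀ y → ∃[ x ] x ^ γ ≡ y
      surj = injective⇒surjective Φ.α-injective
      ψ : Carrier → Carrier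
      ψ y = proj₁ (surj y)
      φψ : ∀ y → ψ y ^ γ ≡ y
      φψ y = proj₂ (surj y)
      ψφ : ∀ x → ψ (x ^ γ) ≡ x
      ψφ x = Φ.α-injective (φψ (x ^ γ))
      ψ-injective : ∀ {x y} → ψ x ≡ ψ y → x ≡ y
      ψ-injective {x} {y} e = trans (sym (φψ x)) (trans (cong (_^ γ) e) (φψ y))
      ψ-hom : (_∙_ : Carrier → Carrier → Carrier) → (∀ x y → (x ∙ y) ^ γ ≡ (x ^ γ) ∙ (y ^ γ)) → ∀ x y → ψ (x ∙ y) ≡ ψ x ∙ ψ y
      ψ-hom _∙_ h x y = Φ.α-injective (trans (φψ _) (sym (trans (h (ψ x) (ψ y)) (cong₂ _∙_ (φψ x) (φψ y)))))
      isαψ : IsFieldAut F (λ x → α (ψ x))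
      isαψ = injective⇒bijective (λ e → ψ-injective (A.α-injective e)) , (λ x y → trans (cong α (ψ-hom _+_ Φ.α-+ x y)) (A.α-+ _ _)) ,
        (λ x y → trans (cong α (ψ-hom _*_ Φ.α-* x y)) (A.α-* _ _)) , trans (cong α (trans (cong ψ (sym Φ.α-1)) (ψφ 1#))) A.α-1

  -- K built from below, which permits induction over its elements. Inverses come in as powers, by
  -- `gen-inv`.
  data Generated (a b : Carrier) : Carrier → Set where
    gen-0 : Generated a b 0#
    gen-1 : Generated a b 1#
    gen-a : Generated a b a
    gen-b : Generated a b b
    gen-+ : ∀ {x y} → Generated a b x → Generated a b y → Generated a b (x + y)
    gen-neg : ∀ {x} → Generated a b x → Generated a b (- x)
    gen-* : ∀ {x y} → Generated a b x → Generated a b y → Generated a b (x * y)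

  opaque
    gen-^ : ∀ {a b x} → Generated a b x → ∀ n → Generated a b (x ^ n)
    gen-^ g zero = gen-1
    gen-^ g (suc n) = gen-* g (gen-^ g n)

    gen-inv : ∀ {a b x y} → Generated a b x → x * y ≡ 1# → Generated a b y
    gen-inv {a} {b} {x} {y} g e = subst (Generated a b) power (gen-^ g (proj₁ m≢0 ℕ.+ m))
      where
      power : x ^ (proj₁ m≢0 ℕ.+ m) ≡ y
      power = *-cancelˡ (xy≡1⇒x≢0 e) (trans (cong (λ k → x ^ (k ℕ.+ m)) (sym (proj₂ m≢0))) (trans (fermat (xy≡1⇒x≢0 e)) (sym e)))

    gen-isSubfield : ∀ {a b} → IsSubfield F (Generated a b)
    gen-isSubfield = gen-0 , gen-1 , (λ _ _ → gen-+) , (λ _ → gen-neg) , (λ _ _ → gen-*) , (λ _ _ → gen-inv)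

    InK⇒gen : ∀ {a b x} → InK F a b x → Generated a b x
    InK⇒gen x∈ = x∈ _ gen-isSubfield gen-a gen-b

    gen⇒InK : ∀ {a b x} → Generated a b x → InK F a b x
    gen⇒InK gen-0 S isS Sa Sb = proj₁ isS
    gen⇒InK gen-1 S isS Sa Sb = proj₁ (proj₂ isS)
    gen⇒InK gen-a S isS Sa Sb = Sa
    gen⇒InK gen-b S isS Sa Sb = Sb
    gen⇒InK (gen-+ p q) S isS Sa Sb = proj₁ (proj₂ (proj₂ isS)) _ _ (gen⇒InK p S isS Sa Sb) (gen⇒InK q S isS Sa Sb)
    gen⇒InK (gen-neg p) S isS Sa Sb = proj₁ (proj₂ (proj₂ (proj₂ isS))) _ (gen⇒InK p S isS Sa Sb)
    gen⇒InK (gen-* p q) S isS Sa Sb = proj₁ (proj₂ (proj₂ (proj₂ (proj₂ isS)))) _ _ (gen⇒InK p S isS Sa Sb) (gen⇒InK q S isS Sa Sb)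

  -- K is a quadratic extension of the subfield L fixed by the involution α, with x ↦ x^|L| acting as α on K.
  module Involution {a b α} (isα : IsFieldAut F α) (αa : α a ≡ b) (αb : α b ≡ a) (a≢b : ¬ a ≡ b) (gen? : ∀ x → Dec (Generated a b x)) where
    open FieldAut isα

    fixed? : ∀ x → Dec (Generated a b x × α x ≡ x)
    fixed? x = gen? x ×-dec (α x ≟ x)

    L K : List Carrier
    L = filter fixed? elems
    K = filter gen? elems

    γ : ℕ
    γ = length L

    t : Carrier
    t = a - b

    opaque
      ∈L⁺ : ∀ {x} → Generated a b x → α x ≡ x → x ∈ L
      ∈L⁺ {x} g e = ∈-filter⁺ fixed? (∈-elems x) (g , e)

      ∈L⁻ : ∀ {x} → x ∈ L → Generated a b x × α x ≡ x
      ∈L⁻ x∈ = proj₂ (∈-filter⁻ fixed? {xs = elems} x∈)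

      L-unique : Unique L
      L-unique = Uniqueₚ.filter⁺ fixed? elems-unique

      K-unique : Unique K
      K-unique = Uniqueₚ.filter⁺ gen? elems-unique

      ∈K⁺ : ∀ {x} → Generated a b x → x ∈ K
      ∈K⁺ {x} g = ∈-filter⁺ gen? (∈-elems x) g

      ∈K⁻ : ∀ {x} → x ∈ K → Generated a b x
      ∈K⁻ x∈ = proj₂ (∈-filter⁻ gen? {xs = elems} x∈)

      L-isSubfield : IsSubfield F (_∈ L)
      L-isSubfield = ∈L⁺ gen-0 α-0 , ∈L⁺ gen-1 α-1 ,
        (λ x y p q → ∈L⁺ (gen-+ (proj₁ (∈L⁻ p)) (proj₁ (∈L⁻ q))) (trans (α-+ x y) (cong₂ _+_ (proj₂ (∈L⁻ p)) (proj₂ (∈L⁻ q))))) ,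
        (λ x p → ∈L⁺ (gen-neg (proj₁ (∈L⁻ p))) (trans (α-neg x) (cong -_ (proj₂ (∈L⁻ p))))) ,
        (λ x y p q → ∈L⁺ (gen-* (proj₁ (∈L⁻ p)) (proj₁ (∈L⁻ q))) (trans (α-* x y) (cong₂ _*_ (proj₂ (∈L⁻ p)) (proj₂ (∈L⁻ q))))) ,
        (λ x y p e → ∈L⁺ (gen-inv (proj₁ (∈L⁻ p)) e) (*-cancelˡ (xy≡1⇒x≢0 e) (trans (cong (_* α y) (sym (proj₂ (∈L⁻ p)))) (trans (sym (α-* x y)) (trans (cong α e) (trans α-1 (sym e)))))))

      0∈L : 0# ∈ L
      0∈L = proj₁ L-isSubfield

      1∈L : 1# ∈ L
      1∈L = proj₁ (proj₂ L-isSubfield)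

      +∈L : ∀ {x y} → x ∈ L → y ∈ L → x + y ∈ L
      +∈L = proj₁ (proj₂ (proj₂ L-isSubfield)) _ _

      L-fermat : ∀ {x} → x ∈ L → x ^ γ ≡ x
      L-fermat = subfield-fermat L-unique L-isSubfield

      γ-suc : Σ[ n ∈ ℕ ] γ ≡ suc n
      γ-suc = length (nonzero L) , length-nonzero L-unique 0∈L

      -- Every x in L satisfies (1 + x)^γ = 1 + x^γ, both sides being 1 + x. These are γ points,
      -- enough to annihilate the inner binomial coefficients C(γ, i).
      γ-additive : AdditivePower γ
      γ-additive = go γ-suc
        where
        go : Σ[ n ∈ ℕ ] γ ≡ suc n → AdditivePower γ
        go (n , e) = subst AdditivePower (sym e) (additive-power n (vanishing-binomials n L L-unique (ℕₚ.≤-reflexive (sym e)) roots))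
          where
          roots : ∀ r → r ∈ L → (1# + r) ^ suc n ≡ 1# + r ^ suc n
          roots r r∈ = subst (λ k → (1# + r) ^ k ≡ 1# + r ^ k) e (trans (L-fermat (+∈L 1∈L r∈)) (cong (λ z → 1# + z) (sym (L-fermat r∈))))

      t≢0 : ¬ t ≡ 0#
      t≢0 = x≢y⇒x-y≢0 a≢b

      αt : α t ≡ - t
      αt = trans (α-minus a b) (trans (cong₂ _-_ αa αb) (solve 2 (λ a b → b :- a := :- (a :- b)) refl a b))

      gen-t : Generated a b t
      gen-t = gen-+ gen-a (gen-neg gen-b)

      t²∈L : t * t ∈ L
      t²∈L = ∈L⁺ (gen-* gen-t gen-t) (trans (α-* t t) (trans (cong₂ _*_ αt αt) (solve 1 (λ t → (:- t) :* (:- t) := t :* t) refl t)))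

      -- Otherwise t and the elements of L would be γ + 1 solutions of x^γ = x.
      t^γ≢t : ¬ t ^ γ ≡ t
      t^γ≢t e = few-fixed-points {t ∷ L} (All.tabulate (λ x∈ q → x≢-x t≢0 (trans (sym (proj₂ (∈L⁻ (subst (_∈ L) (sym q) x∈)))) αt)) ∷ L-unique)
        (there 0∈L) (there 1∈L) γ ℕₚ.≤-refl (length≥2 0∈L 1∈L) (λ { x (here refl) → e ; x (there x∈) → L-fermat x∈ })

      t^γ : t ^ γ ≡ - t
      t^γ with x²≡y²⇒x≡y⊎x≡-y (t ^ γ) t (trans (sym (*-^ t t γ)) (L-fermat t²∈L))
      ... | inj₁ e = ⊥-elim (t^γ≢t e)
      ... | inj₂ e = e

      -- Apply the additive map x ↦ x^γ to 2a = (a + b) + t: it fixes a + b, which is in L, and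
      -- negates t, so 2a^γ = 2b.
      b≡a^γ : b ≡ a ^ γ
      b≡a^γ = sym (two*-cancel (trans (sym (γ-additive a a)) (trans (cong (_^ γ) (solve 2 (λ a b → a :+ a := (a :+ b) :+ (a :- b)) refl a b))
        (trans (γ-additive (a + b) t) (trans (cong₂ _+_ (L-fermat (∈L⁺ (gen-+ gen-a gen-b) (trans (α-+ a b) (trans (cong₂ _+_ αa αb) (+-comm b a))))) t^γ)
        (solve 2 (λ a b → (a :+ b) :+ (:- (a :- b)) := b :+ b) refl a b))))))

      α-gen : ∀ {x} → Generated a b x → Generated a b (α x)
      α-gen gen-0 = subst (Generated a b) (sym α-0) gen-0
      α-gen gen-1 = subst (Generated a b) (sym α-1) gen-1
      α-gen gen-a = subst (Generated a b) (sym αa) gen-b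
      α-gen gen-b = subst (Generated a b) (sym αb) gen-a
      α-gen (gen-+ p q) = subst (Generated a b) (sym (α-+ _ _)) (gen-+ (α-gen p) (α-gen q))
      α-gen (gen-neg p) = subst (Generated a b) (sym (α-neg _)) (gen-neg (α-gen p))
      α-gen (gen-* p q) = subst (Generated a b) (sym (α-* _ _)) (gen-* (α-gen p) (α-gen q))

      αα : ∀ {x} → Generated a b x → α (α x) ≡ x
      αα gen-0 = trans (cong α α-0) α-0
      αα gen-1 = trans (cong α α-1) α-1
      αα gen-a = trans (cong α αa) αb
      αα gen-b = trans (cong α αb) αa
      αα (gen-+ p q) = trans (cong α (α-+ _ _)) (trans (α-+ _ _) (cong₂ _+_ (αα p) (αα q)))
      αα (gen-neg p) = trans (cong α (α-neg _)) (trans (α-neg _) (cong -_ (αα p)))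
      αα (gen-* p q) = trans (cong α (α-* _ _)) (trans (α-* _ _) (cong₂ _*_ (αα p) (αα q)))

    re im : Carrier → Carrier
    re x = ½ * (x + α x)
    im x = (½ * inv t) * (x - α x)

    opaque
      re+im : ∀ x → re x + im x * t ≡ x
      re+im x = trans (cong (λ z → re x + z) (trans (solve 4 (λ h i t d → (h :* i) :* d :* t := h :* (t :* i) :* d) refl ½ (inv t) t (x - α x)) (cong (λ z → ½ * z * (x - α x)) (inv-right t≢0))))
        (trans (solve 3 (λ h x y → h :* (x :+ y) :+ h :* con (+ 1) :* (x :- y) := h :* x :+ h :* x) refl ½ x (α x)) (½+½ x))

      gen-½ : Generated a b ½
      gen-½ = gen-inv (gen-+ gen-1 gen-1) two*½

      α-½ : α ½ ≡ ½
      α-½ = trans (α-inv two≢0) (cong inv (trans (α-+ 1# 1#) (cong₂ _+_ α-1 α-1)))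

      α-inv-t : α (inv t) ≡ - inv t
      α-inv-t = trans (α-inv t≢0) (trans (cong inv αt) (inv-unique (trans (solve 2 (λ t i → (:- t) :* (:- i) := t :* i) refl t (inv t)) (inv-right t≢0))))

      re∈L : ∀ {x} → Generated a b x → re x ∈ L
      re∈L {x} g = ∈L⁺ (gen-* gen-½ (gen-+ g (α-gen g))) (trans (α-* ½ _) (cong₂ _*_ α-½ (trans (α-+ x (α x)) (trans (cong (λ z → α x + z) (αα g)) (+-comm _ _)))))

      im∈L : ∀ {x} → Generated a b x → im x ∈ L
      im∈L {x} g = ∈L⁺ (gen-* (gen-* gen-½ (gen-inv gen-t (inv-right t≢0))) (gen-+ g (gen-neg (α-gen g))))
        (trans (α-* _ _) (trans (cong₂ _*_ (trans (α-* ½ (inv t)) (cong₂ _*_ α-½ α-inv-t)) (trans (α-minus x (α x)) (cong (λ z → α x - z) (αα g))))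
        (solve 4 (λ h i x y → (h :* (:- i)) :* (y :- x) := (h :* i) :* (x :- y)) refl ½ (inv t) x (α x))))

      α-combine : ∀ {u v} → u ∈ L → v ∈ L → α (u + v * t) ≡ u - v * t
      α-combine {u} {v} u∈ v∈ = trans (α-+ u (v * t)) (cong₂ _+_ (proj₂ (∈L⁻ u∈)) (trans (α-* v t) (trans (cong₂ _*_ (proj₂ (∈L⁻ v∈)) αt) (solve 2 (λ v t → v :* (:- t) := :- (v :* t)) refl v t))))

      re-combine : ∀ {u v} → u ∈ L → v ∈ L → re (u + v * t) ≡ u
      re-combine {u} {v} u∈ v∈ = trans (cong (λ z → ½ * ((u + v * t) + z)) (α-combine u∈ v∈)) (trans (solve 3 (λ h u w → h :* ((u :+ w) :+ (u :- w)) := h :* u :+ h :* u) refl ½ u (v * t)) (½+½ u))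

      im-combine : ∀ {u v} → u ∈ L → v ∈ L → im (u + v * t) ≡ v
      im-combine {u} {v} u∈ v∈ = trans (cong (λ z → (½ * inv t) * ((u + v * t) - z)) (α-combine u∈ v∈)) (trans (solve 5 (λ h i u v t → (h :* i) :* ((u :+ v :* t) :- (u :- v :* t)) := h :* ((t :* i) :* v) :+ h :* ((t :* i) :* v)) refl ½ (inv t) u v t)
        (trans (½+½ _) (trans (cong (_* v) (inv-right t≢0)) (*-identityˡ v))))

      -- 1 and t form a basis of K over L, with coordinates `re` and `im`.
      length-K : length K ≡ γ ℕ.* γ
      length-K = trans (sym (length-map (λ x → re x , im x) K)) (trans (↭-length (unique-↭ (Uniqueₚ.map⁺ inj K-unique) (Uniqueₚ.cartesianProduct⁺ L-unique L-unique) to from)) (length-cartesianProduct L L))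
        where
        inj : ∀ {x y} → (re x , im x) ≡ (re y , im y) → x ≡ y
        inj {x} {y} e = trans (sym (re+im x)) (trans (cong₂ (λ u v → u + v * t) (cong proj₁ e) (cong proj₂ e)) (re+im y))
        to : ∀ {z} → z ∈ map (λ x → re x , im x) K → z ∈ cartesianProduct L L
        to z∈ with ∈-map⁻ (λ x → re x , im x) z∈
        ... | (x , x∈ , refl) = ∈-cartesianProduct⁺ (re∈L (∈K⁻ x∈)) (im∈L (∈K⁻ x∈))
        from : ∀ {z} → z ∈ cartesianProduct L L → z ∈ map (λ x → re x , im x) K
        from {u , v} z∈ with ∈-cartesianProduct⁻ L L z∈
        ... | (u∈ , v∈) = subst (_∈ map (λ x → re x , im x) K) (cong₂ _,_ (re-combine u∈ v∈) (im-combine u∈ v∈))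
              (∈-map⁺ (λ x → re x , im x) (∈K⁺ (gen-+ (proj₁ (∈L⁻ u∈)) (gen-* (proj₁ (∈L⁻ v∈)) gen-t))))

      twistExponent : TwistExponent F a b γ
      twistExponent = length K , (K , K-unique , refl , λ x → (λ x∈ → ∈K⁺ (InK⇒gen x∈)) , (λ x∈ → gen⇒InK (∈K⁻ x∈))) , sym length-K , b≡a^γ

  opaque
    no-twist⇒no-swap : ∀ {a b α} → ¬ a ≡ b → ¬ (∃[ γ ] TwistExponent F a b γ) → IsFieldAut F α → α a ≡ b → α b ≡ a → ⊥
    no-twist⇒no-swap {a} {b} {α} a≢b none isα αa αb = ¬¬-decide (Generated a b) elems exponent
      where
      exponent : (∀ x → x ∈ elems → Dec (Generated a b x)) → ⊥
      exponent d = none (γ , twistExponent)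
        where open Involution {a} {b} {α} isα αa αb a≢b (λ x → d x (∈-elems x))

    affK⇒aut : ∀ {a f} → InAffK F a a f → Aut a a f
    affK⇒aut {a} {f} (σ , μ , (add , lin) , bij , eq) = aut-cong eq (mkAut (λ e → proj₁ bij (+-cancelʳ μ _ _ e))
        (λ x y → trans (cong (λ z → σ z + μ) (op-same x y)) (trans (trans (cong (_+ μ) (trans (add x (a * (y - x))) (cong (λ z → σ x + z) (trans (lin a (y - x) a∈K) (cong (a *_) (minus y x))))))
          (solve 4 (λ a p q μ → (p :+ a :* (q :- p)) :+ μ := (p :+ μ) :+ a :* ((q :+ μ) :- (p :+ μ))) refl a (σ x) (σ y) μ)) (sym (op-same (σ x + μ) (σ y + μ))))))
      where
      op-same : ∀ x y → op a a x y ≡ x + a * (y - x)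
      op-same x y with op-view a a x y
      ... | inj₁ (e , _) = e
      ... | inj₂ (e , _) = e
      minus : ∀ x y → σ (x - y) ≡ σ x - σ y
      minus x y = +-cancelʳ (σ y) _ _ (trans (sym (add (x - y) y)) (trans (cong σ (solve 2 (λ x y → (x :- y) :+ y := x) refl x y)) (solve 2 (λ x y → x := (x :- y) :+ y) refl (σ x) (σ y))))

    -- Fixing 0, σ commutes with multiplication by a and by 1 - a. The law at x/(1 - a) and y/a then
    -- reads as additivity, and K-linearity follows by induction over K.
    aut⇒affK : ∀ {a f} → ¬ a ≡ 0# → ¬ a ≡ 1# → Aut a a f → InAffK F a a f
    aut⇒affK {a} {f} a≢0 a≢1 af = σ , f 0# , (add , linear) , injective⇒bijective (λ {x} {y} e → aut-injective af (+-cancelʳ (- f 0#) _ _ e)) ,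
        (λ x → solve 2 (λ p z → p := (p :- z) :+ z) refl (f x) (f 0#))
      where
      σ : Carrier → Carrier
      σ x = f x - f 0#
      op-same : ∀ x y → op a a x y ≡ x + a * (y - x)
      op-same x y with op-view a a x y
      ... | inj₁ (e , _) = e
      ... | inj₂ (e , _) = e
      hom : ∀ x y → f (x + a * (y - x)) ≡ f x + a * (f y - f x)
      hom x y = trans (cong f (sym (op-same x y))) (trans (proj₂ af x y) (op-same (f x) (f y)))
      σ-0 : σ 0# ≡ 0#
      σ-0 = -‿inverseʳ (f 0#)
      σ-a : ∀ x → σ (a * x) ≡ a * σ x
      σ-a x = trans (cong (λ z → f z - f 0#) (solve 2 (λ a x → a :* x := con (+ 0) :+ a :* (x :- con (+ 0))) refl a x))
        (trans (cong (λ z → z - f 0#) (hom 0# x)) (solve 3 (λ a p z → (z :+ a :* (p :- z)) :- z := a :* (p :- z)) refl a (f x) (f 0#)))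
      σ-1-a : ∀ x → σ ((1# - a) * x) ≡ (1# - a) * σ x
      σ-1-a x = trans (cong (λ z → f z - f 0#) (solve 2 (λ a x → (con (+ 1) :- a) :* x := x :+ a :* (con (+ 0) :- x)) refl a x))
        (trans (cong (λ z → z - f 0#) (hom x 0#)) (solve 3 (λ a p z → (p :+ a :* (z :- p)) :- z := (con (+ 1) :- a) :* (p :- z)) refl a (f x) (f 0#)))
      1-a≢0 : ¬ 1# - a ≡ 0#
      1-a≢0 e = a≢1 (sym (x-y≡0⇒x≡y e))
      convex : ∀ u v → σ ((1# - a) * u + a * v) ≡ (1# - a) * σ u + a * σ v
      convex u v = trans (cong (λ z → f z - f 0#) (solve 3 (λ a u v → (con (+ 1) :- a) :* u :+ a :* v := u :+ a :* (v :- u)) refl a u v))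
        (trans (cong (λ z → z - f 0#) (hom u v)) (solve 4 (λ a p q z → (p :+ a :* (q :- p)) :- z := (con (+ 1) :- a) :* (p :- z) :+ a :* (q :- z)) refl a (f u) (f v) (f 0#)))
      add : ∀ x y → σ (x + y) ≡ σ x + σ y
      add x y = trans (cong σ (sym (cong₂ _+_ (ν-conj-cancel 1-a≢0 x) (ν-conj-cancel a≢0 y)))) (trans (convex (inv (1# - a) * x) (inv a * y))
        (cong₂ _+_ (trans (sym (σ-1-a _)) (cong σ (ν-conj-cancel 1-a≢0 x))) (trans (sym (σ-a _)) (cong σ (ν-conj-cancel a≢0 y)))))
      σ-neg : ∀ x → σ (- x) ≡ - σ x
      σ-neg x = +-cancelʳ (σ x) _ _ (trans (sym (add (- x) x)) (trans (cong σ (-‿inverseˡ x)) (trans σ-0 (sym (-‿inverseˡ _)))))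
      gen-linear : ∀ {c} → Generated a a c → ∀ x → σ (c * x) ≡ c * σ x
      gen-linear gen-0 x = trans (cong σ (zeroˡ x)) (trans σ-0 (sym (zeroˡ _)))
      gen-linear gen-1 x = trans (cong σ (*-identityˡ x)) (sym (*-identityˡ _))
      gen-linear gen-a x = σ-a x
      gen-linear gen-b x = σ-a x
      gen-linear (gen-+ {p} {q} g h) x = trans (cong σ (distribʳ x p q)) (trans (add _ _) (trans (cong₂ _+_ (gen-linear g x) (gen-linear h x)) (sym (distribʳ (σ x) p q))))
      gen-linear (gen-neg {p} g) x = trans (cong σ (solve 2 (λ p x → (:- p) :* x := :- (p :* x)) refl p x)) (trans (σ-neg _) (trans (cong -_ (gen-linear g x)) (solve 2 (λ p x → :- (p :* x) := (:- p) :* x) refl p (σ x))))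
      gen-linear (gen-* {p} {q} g h) x = trans (cong σ (*-assoc p q x)) (trans (gen-linear g (q * x)) (trans (cong (p *_) (gen-linear h x)) (sym (*-assoc p q (σ x)))))
      linear : ∀ c x → InK F a a c → σ (c * x) ≡ c * σ x
      linear c x c∈ = gen-linear (InK⇒gen c∈) x

-- SL₂(7) acting on the Fano plane.

eq₇ : F7 → F7 → Bool
eq₇ i j = toℕ i ℕ.≡ᵇ toℕ j

eqM : Mat2 → Mat2 → Bool
eqM (mat a b c d) (mat a′ b′ c′ d′) = (eq₇ a a′ ∧ eq₇ b b′) ∧ (eq₇ c c′ ∧ eq₇ d d′)

all₇ : (F7 → Bool) → Bool
all₇ p = p 0F ∧ (p 1F ∧ (p 2F ∧ (p 3F ∧ (p 4F ∧ (p 5F ∧ p 6F)))))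

all-SL : (Mat2 → Bool) → Bool
all-SL p = all₇ λ a → all₇ λ b → all₇ λ c → all₇ λ d → not (eq₇ (det (mat a b c d)) 1F) ∨ p (mat a b c d)

∧-split : ∀ p {q} → T (p ∧ q) → T p × T q
∧-split true t = tt , t

opaque
  eq₇-sound : ∀ i j → T (eq₇ i j) → i ≡ j
  eq₇-sound i j t = Finₚ.toℕ-injective (ℕₚ.≡ᵇ⇒≡ (toℕ i) (toℕ j) t)

  eqM-sound : ∀ A B → T (eqM A B) → A ≡ B
  eqM-sound (mat a b c d) (mat a′ b′ c′ d′) t = lem (eq₇-sound a a′ (proj₁ s₁)) (eq₇-sound b b′ (proj₂ s₁)) (eq₇-sound c c′ (proj₁ s₂)) (eq₇-sound d d′ (proj₂ s₂))
    where
    s : T (eq₇ a a′ ∧ eq₇ b b′) × T (eq₇ c c′ ∧ eq₇ d d′)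
    s = ∧-split (eq₇ a a′ ∧ eq₇ b b′) t
    s₁ : T (eq₇ a a′) × T (eq₇ b b′)
    s₁ = ∧-split (eq₇ a a′) (proj₁ s)
    s₂ : T (eq₇ c c′) × T (eq₇ d d′)
    s₂ = ∧-split (eq₇ c c′) (proj₂ s)
    lem : ∀ {a b c d a′ b′ c′ d′} → a ≡ a′ → b ≡ b′ → c ≡ c′ → d ≡ d′ → mat a b c d ≡ mat a′ b′ c′ d′
    lem refl refl refl refl = refl

  all₇-sound : ∀ (p : F7 → Bool) → T (all₇ p) → ∀ i → T (p i)
  all₇-sound p t 0F = proj₁ (∧-split (p 0F) t)
  all₇-sound p t 1F = proj₁ (∧-split (p 1F) (proj₂ (∧-split (p 0F) t)))
  all₇-sound p t 2F = proj₁ (∧-split (p 2F) (proj₂ (∧-split (p 1F) (proj₂ (∧-split (p 0F) t)))))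
  all₇-sound p t 3F = proj₁ (∧-split (p 3F) (proj₂ (∧-split (p 2F) (proj₂ (∧-split (p 1F) (proj₂ (∧-split (p 0F) t)))))))
  all₇-sound p t 4F = proj₁ (∧-split (p 4F) (proj₂ (∧-split (p 3F) (proj₂ (∧-split (p 2F) (proj₂ (∧-split (p 1F) (proj₂ (∧-split (p 0F) t)))))))))
  all₇-sound p t 5F = proj₁ (∧-split (p 5F) (proj₂ (∧-split (p 4F) (proj₂ (∧-split (p 3F) (proj₂ (∧-split (p 2F) (proj₂ (∧-split (p 1F) (proj₂ (∧-split (p 0F) t)))))))))))
  all₇-sound p t 6F = proj₂ (∧-split (p 5F) (proj₂ (∧-split (p 4F) (proj₂ (∧-split (p 3F) (proj₂ (∧-split (p 2F) (proj₂ (∧-split (p 1F) (proj₂ (∧-split (p 0F) t)))))))))))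

  all-SL-sound : ∀ (p : Mat2 → Bool) → T (all-SL p) → ∀ A → det A ≡ 1F → T (p A)
  all-SL-sound p t A@(mat a b c d) e = lem (det A) (p A) e (all₇-sound (λ d → test a b c d) (all₇-sound (λ c → all₇ (λ d → test a b c d))
      (all₇-sound (λ b → all₇ (λ c → all₇ (λ d → test a b c d))) (all₇-sound (λ a → all₇ (λ b → all₇ (λ c → all₇ (λ d → test a b c d)))) t a) b) c) d)
    where
    test : F7 → F7 → F7 → F7 → Bool
    test a b c d = not (eq₇ (det (mat a b c d)) 1F) ∨ p (mat a b c d)
    lem : ∀ x q → x ≡ 1F → T (not (eq₇ x 1F) ∨ q) → T q
    lem x q refl t = t

T₃₅ : F7 → F7 → F7
T₃₅ = T₇ 3F 5F

ω : F7 → F7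
ω 0F = 0F
ω 1F = 2F
ω 2F = 1F
ω 3F = 6F
ω 4F = 4F
ω 5F = 5F
ω 6F = 3F

-- The upper triangular matrices act as the squares of AGL₁(7), and ω is the image of (0 −1 ; 1 0); the second clause is the Bruhat decomposition.
ψ : Mat2 → F7 → F7
ψ (mat a b 0F d) i = a ⊗ a ⊗ i ⊕ a ⊗ b
ψ (mat a b c@(suc _) d) i = ω (c ⊗ c ⊗ i ⊕ c ⊗ d) ⊕ a ⊗ inv₇ c

borel : F7 → F7 → Mat2
borel x a = mat a (inv₇ a ⊗ x) 0F (inv₇ a)

-- The matrix with lower row c, d that sends 0 to x: a solves ω(cd) + a/c = x, and b = (ad - 1)/c,
-- where 6 stands for -1.
cell : F7 → F7 → F7 → Mat2
cell x c d = mat a ((a ⊗ d ⊕ 6F) ⊗ inv₇ c) c d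
  where
  a : F7
  a = c ⊗ (x ⊕ ⊖ ω (c ⊗ d))

-- Up to sign, all matrices sending 0 to x: 3 triangular ones and 21 with c ≠ 0, together 24 =
-- 168/7. The values 1, 2, 3 represent the units modulo ±1.
candidates : F7 → List Mat2
candidates x = map (borel x) (1F ∷ 2F ∷ 3F ∷ []) ++ row 1F ++ row 2F ++ row 3F
  where
  row : F7 → List Mat2
  row c = map (cell x c) (0F ∷ 1F ∷ 2F ∷ 3F ∷ 4F ∷ 5F ∷ 6F ∷ [])

choose : (Mat2 → Bool) → List Mat2 → Mat2
-- A default value, reached only for triples that are not images of 0, 1, 2.
choose p [] = mat 1F 0F 0F 1F
choose p (A ∷ As) = if p A then A else choose p As

-- A representative of the matrices sending 0, 1, 2 to x, y, z.
matrix : F7 → F7 → F7 → Mat2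
matrix x y z = choose (λ A → eq₇ (ψ A 1F) y ∧ eq₇ (ψ A 2F) z) (candidates x)

-- Multiplicativity of ψ for a fixed left factor. It is tested for three generators against all 336
-- matrices; `bruhat` supplies the other left factors.
mult-test : Mat2 → Mat2 → Bool
mult-test B A = eq₇ (det (B · A)) 1F ∧ all₇ (λ i → eq₇ (ψ (B · A) i) (ψ B (ψ A i)))

-- 3 generates the units of F₇ and has inverse 5, so the powers of `u₁` and `h₃` give all unipotent
-- and diagonal factors.
u₁ h₃ w : Mat2
u₁ = mat 1F 1F 0F 1F
h₃ = mat 3F 0F 0F 5F
w = mat 0F 6F 1F 0F

frame-test : F7 → F7 → F7 → Bool
frame-test x y z = ((eq₇ x y ∨ eq₇ z x) ∨ (eq₇ z y ∨ eq₇ z (T₃₅ x y))) ∨ ((eq₇ (det M) 1F ∧ eq₇ (ψ M 0F) x) ∧ (eq₇ (ψ M 1F) y ∧ eq₇ (ψ M 2F) z))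
  where
  M : Mat2
  M = matrix x y z

represents : Mat2 → Mat2
represents A = matrix (ψ A 0F) (ψ A 1F) (ψ A 2F)

u h : F7 → Mat2
u x = mat 1F x 0F 1F
-- A default value: a = c = 0 is excluded by determinant 1.
h 0F = mat 1F 0F 0F 1F
h t@(suc _) = mat t 0F 0F (inv₇ t)

bruhat : Mat2 → Mat2
bruhat (mat a b 0F d) = h a · u (inv₇ a ⊗ b)
bruhat (mat a b c@(suc _) d) = u (a ⊗ inv₇ c) · (w · (h c · u (inv₇ c ⊗ d)))

opaque
  w-test : T (all-SL (mult-test w))
  w-test = tt

  u-test : T (all-SL (mult-test u₁))
  u-test = tt

  h-test : T (all-SL (mult-test h₃))
  h-test = tt

  bruhat-test : T (all-SL (λ A → eqM (bruhat A) A))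
  bruhat-test = tt

  represents-test : T (all-SL (λ A → eqM (represents A) A ∨ eqM (represents A) (negM A)))
  represents-test = tt

  neg-test : T (all-SL (λ A → all₇ (λ i → eq₇ (ψ (negM A) i) (ψ A i))))
  neg-test = tt

  matrix-test : T (all₇ (λ x → all₇ (λ y → all₇ (λ z → frame-test x y z))))
  matrix-test = tt

all²-sound : (f g : F7 → F7 → F7) → T (all₇ (λ x → all₇ (λ y → eq₇ (f x y) (g x y)))) → ∀ x y → f x y ≡ g x y
all²-sound f g t x y = eq₇-sound _ _ (all₇-sound (λ y → eq₇ (f x y) (g x y)) (all₇-sound (λ x → all₇ (λ y → eq₇ (f x y) (g x y))) t x) y)

all³-sound : (f g : F7 → F7 → F7 → F7) → T (all₇ (λ x → all₇ (λ y → all₇ (λ z → eq₇ (f x y z) (g x y z))))) → ∀ x y z → f x y z ≡ g x y z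
all³-sound f g t x y z = all²-sound (f x) (g x) (all₇-sound (λ x → all₇ (λ y → all₇ (λ z → eq₇ (f x y z) (g x y z)))) t x) y z

opaque
  ⊕-comm : ∀ x y → x ⊕ y ≡ y ⊕ x
  ⊕-comm = all²-sound _⊕_ (λ x y → y ⊕ x) tt

  ⊕-assoc : ∀ x y z → (x ⊕ y) ⊕ z ≡ x ⊕ (y ⊕ z)
  ⊕-assoc = all³-sound (λ x y z → (x ⊕ y) ⊕ z) (λ x y z → x ⊕ (y ⊕ z)) tt

  ⊗-assoc : ∀ x y z → (x ⊗ y) ⊗ z ≡ x ⊗ (y ⊗ z)
  ⊗-assoc = all³-sound (λ x y z → (x ⊗ y) ⊗ z) (λ x y z → x ⊗ (y ⊗ z)) tt

  ⊗-distribˡ : ∀ x y z → x ⊗ (y ⊕ z) ≡ x ⊗ y ⊕ x ⊗ z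
  ⊗-distribˡ = all³-sound (λ x y z → x ⊗ (y ⊕ z)) (λ x y z → x ⊗ y ⊕ x ⊗ z) tt

  ⊗-distribʳ : ∀ x y z → (y ⊕ z) ⊗ x ≡ y ⊗ x ⊕ z ⊗ x
  ⊗-distribʳ = all³-sound (λ x y z → (y ⊕ z) ⊗ x) (λ x y z → y ⊗ x ⊕ z ⊗ x) tt

  ⊕-interchange : ∀ a b c d → (a ⊕ b) ⊕ (c ⊕ d) ≡ (a ⊕ c) ⊕ (b ⊕ d)
  ⊕-interchange a b c d = trans (⊕-assoc a b (c ⊕ d)) (trans (cong (λ z → a ⊕ z) (trans (sym (⊕-assoc b c d)) (trans (cong (λ z → z ⊕ d) (⊕-comm b c)) (⊕-assoc c b d)))) (sym (⊕-assoc a c (b ⊕ d))))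

  entry-assoc : ∀ p r q s x q′ s′ x′ → (p ⊗ q ⊕ r ⊗ s) ⊗ x ⊕ (p ⊗ q′ ⊕ r ⊗ s′) ⊗ x′ ≡ p ⊗ (q ⊗ x ⊕ q′ ⊗ x′) ⊕ r ⊗ (s ⊗ x ⊕ s′ ⊗ x′)
  entry-assoc p r q s x q′ s′ x′ = trans (cong₂ _⊕_ (⊗-distribʳ x (p ⊗ q) (r ⊗ s)) (⊗-distribʳ x′ (p ⊗ q′) (r ⊗ s′))) (trans (⊕-interchange ((p ⊗ q) ⊗ x) ((r ⊗ s) ⊗ x) ((p ⊗ q′) ⊗ x′) ((r ⊗ s′) ⊗ x′))
      (cong₂ _⊕_ (collect p q x q′ x′) (collect r s x s′ x′)))
    where
    collect : ∀ p q x q′ x′ → (p ⊗ q) ⊗ x ⊕ (p ⊗ q′) ⊗ x′ ≡ p ⊗ (q ⊗ x ⊕ q′ ⊗ x′)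
    collect p q x q′ x′ = trans (cong₂ _⊕_ (⊗-assoc p q x) (⊗-assoc p q′ x′)) (sym (⊗-distribˡ p (q ⊗ x) (q′ ⊗ x′)))

  mat-cong : ∀ {a b c d a′ b′ c′ d′} → a ≡ a′ → b ≡ b′ → c ≡ c′ → d ≡ d′ → mat a b c d ≡ mat a′ b′ c′ d′
  mat-cong refl refl refl refl = refl

  ·-assoc : ∀ A B C → (A · B) · C ≡ A · (B · C)
  ·-assoc (mat a b c d) (mat e f g i) (mat x y z v) = mat-cong (entry-assoc a b e g x f i z) (entry-assoc a b e g y f i v) (entry-assoc c d e g x f i z) (entry-assoc c d e g y f i v)

  ⊖-involutive : ∀ x → ⊖ (⊖ x) ≡ x
  ⊖-involutive x = eq₇-sound _ _ (all₇-sound (λ x → eq₇ (⊖ (⊖ x)) x) tt x)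

  negM-involutive : ∀ A → negM (negM A) ≡ A
  negM-involutive (mat a b c d) = mat-cong (⊖-involutive a) (⊖-involutive b) (⊖-involutive c) (⊖-involutive d)

Hom₇ : (F7 → F7) → Set
Hom₇ g = ∀ i j → g (T₃₅ i j) ≡ T₃₅ (g i) (g j)

-- The laws are stated for B as left factor with A arbitrary, and in this form they pass to products
-- of generators.
record Good (B : Mat2) : Set where
  field
    det-1 : det B ≡ 1F
    det-· : ∀ {A} → det A ≡ 1F → det (B · A) ≡ 1F
    ψ-· : ∀ {A} → det A ≡ 1F → ∀ i → ψ (B · A) i ≡ ψ B (ψ A i)
    hom : Hom₇ (ψ B)
open Good

opaque
  good-· : ∀ {B C} → Good B → Good C → Good (B · C)
  good-· {B} {C} gB gC = record
    { det-1 = det-· gB (det-1 gC)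
    ; det-· = λ {A} e → trans (cong det (·-assoc B C A)) (det-· gB (det-· gC e))
    ; ψ-· = λ {A} e i → trans (cong (λ M → ψ M i) (·-assoc B C A)) (trans (ψ-· gB (det-· gC e) i) (trans (cong (ψ B) (ψ-· gC e i)) (sym (ψ-· gB (det-1 gC) (ψ A i)))))
    ; hom = λ i j → trans (ψ-· gB (det-1 gC) (T₃₅ i j)) (trans (cong (ψ B) (hom gC i j)) (trans (hom gB _ _) (sym (cong₂ T₃₅ (ψ-· gB (det-1 gC) i) (ψ-· gB (det-1 gC) j)))))
    }

  good-generator : ∀ B → det B ≡ 1F → T (all-SL (mult-test B)) → Hom₇ (ψ B) → Good B
  good-generator B e t hm = record { det-1 = e ; det-· = λ {A} q → eq₇-sound _ _ (proj₁ (split A q)) ; ψ-· = λ {A} q i → eq₇-sound _ _ (all₇-sound (λ i → eq₇ (ψ (B · A) i) (ψ B (ψ A i))) (proj₂ (split A q)) i) ; hom = hm }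
    where
    split : ∀ A → det A ≡ 1F → T (eq₇ (det (B · A)) 1F) × T (all₇ (λ i → eq₇ (ψ (B · A) i) (ψ B (ψ A i))))
    split A q = ∧-split (eq₇ (det (B · A)) 1F) (all-SL-sound (mult-test B) t A q)

  good-u₁ : Good u₁
  good-u₁ = good-generator u₁ refl u-test (all²-sound (λ i j → ψ u₁ (T₃₅ i j)) (λ i j → T₃₅ (ψ u₁ i) (ψ u₁ j)) tt)

  good-h₃ : Good h₃
  good-h₃ = good-generator h₃ refl h-test (all²-sound (λ i j → ψ h₃ (T₃₅ i j)) (λ i j → T₃₅ (ψ h₃ i) (ψ h₃ j)) tt)

  good-w : Good w
  good-w = good-generator w refl w-test (all²-sound (λ i j → ψ w (T₃₅ i j)) (λ i j → T₃₅ (ψ w i) (ψ w j)) tt)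

  good-u : ∀ x → Good (u x)
  good-u 1F = good-u₁
  good-u 2F = good-· good-u₁ (good-u 1F)
  good-u 3F = good-· good-u₁ (good-· good-u₁ good-u₁)
  good-u 4F = good-· good-u₁ (good-· good-u₁ (good-· good-u₁ good-u₁))
  good-u 5F = good-· good-u₁ (good-· good-u₁ (good-· good-u₁ (good-· good-u₁ good-u₁)))
  good-u 6F = good-· good-u₁ (good-· good-u₁ (good-· good-u₁ (good-· good-u₁ (good-· good-u₁ good-u₁))))
  good-u 0F = good-· good-u₁ (good-· good-u₁ (good-· good-u₁ (good-· good-u₁ (good-· good-u₁ (good-· good-u₁ good-u₁)))))

  good-h : ∀ t → Good (h t)
  good-h 3F = good-h₃
  good-h 2F = good-· good-h₃ good-h₃
  good-h 6F = good-· good-h₃ (good-· good-h₃ good-h₃)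
  good-h 4F = good-· good-h₃ (good-· good-h₃ (good-· good-h₃ good-h₃))
  good-h 5F = good-· good-h₃ (good-· good-h₃ (good-· good-h₃ (good-· good-h₃ good-h₃)))
  good-h 1F = good-· good-h₃ (good-· good-h₃ (good-· good-h₃ (good-· good-h₃ (good-· good-h₃ good-h₃))))
  good-h 0F = good-· good-h₃ (good-· good-h₃ (good-· good-h₃ (good-· good-h₃ (good-· good-h₃ good-h₃))))

  good-bruhat : ∀ A → Good (bruhat A)
  good-bruhat (mat a b 0F d) = good-· {h a} {u (inv₇ a ⊗ b)} (good-h a) (good-u (inv₇ a ⊗ b))
  good-bruhat (mat a b c@(suc _) d) = good-· {u (a ⊗ inv₇ c)} {w · (h c · u (inv₇ c ⊗ d))} (good-u (a ⊗ inv₇ c))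
    (good-· {w} {h c · u (inv₇ c ⊗ d)} good-w (good-· {h c} {u (inv₇ c ⊗ d)} (good-h c) (good-u (inv₇ c ⊗ d))))

  good : ∀ A → det A ≡ 1F → Good A
  good A e = subst Good (eqM-sound _ _ (all-SL-sound (λ A → eqM (bruhat A) A) bruhat-test A e)) (good-bruhat A)

  ψ-neg : ∀ A → det A ≡ 1F → ∀ i → ψ (negM A) i ≡ ψ A i
  ψ-neg A e i = eq₇-sound _ _ (all₇-sound (λ i → eq₇ (ψ (negM A) i) (ψ A i)) (all-SL-sound (λ A → all₇ (λ i → eq₇ (ψ (negM A) i) (ψ A i))) neg-test A e) i)

  ψ-respects : ∀ {A B} → det B ≡ 1F → A ∼PSL B → ∀ i → ψ A i ≡ ψ B i
  ψ-respects e (inj₁ refl) i = refl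
  ψ-respects {B = B} e (inj₂ refl) i = ψ-neg B e i

  represents-sound : ∀ A → det A ≡ 1F → represents A ∼PSL A
  represents-sound A e = split (eqM (represents A) A) refl (all-SL-sound (λ A → eqM (represents A) A ∨ eqM (represents A) (negM A)) represents-test A e)
    where
    split : ∀ p → eqM (represents A) A ≡ p → T (p ∨ eqM (represents A) (negM A)) → represents A ∼PSL A
    split true q _ = inj₁ (eqM-sound _ _ (subst T (sym q) tt))
    split false _ t = inj₂ (eqM-sound _ _ t)

  negM-swap : ∀ A B → negM A ≡ B → A ≡ negM B
  negM-swap A B e = trans (sym (negM-involutive A)) (cong negM e)

  ∼PSL-join : ∀ M A B → M ∼PSL A → M ∼PSL B → A ∼PSL B
  ∼PSL-join M A B (inj₁ p) (inj₁ q) = inj₁ (trans (sym p) q)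
  ∼PSL-join M A B (inj₁ p) (inj₂ q) = inj₂ (trans (sym p) q)
  ∼PSL-join M A B (inj₂ p) (inj₁ q) = inj₂ (negM-swap A B (trans (sym p) q))
  ∼PSL-join M A B (inj₂ p) (inj₂ q) = inj₁ (trans (negM-swap A (negM B) (trans (sym p) q)) (negM-involutive B))

  -- `represents` recovers a matrix up to sign from the images of 0, 1, 2 under its action.
  ψ-faithful : ∀ A B → det A ≡ 1F → det B ≡ 1F → (∀ i → ψ A i ≡ ψ B i) → A ∼PSL B
  ψ-faithful A B eA eB q = ∼PSL-join (represents A) A B (represents-sound A eA) (subst (_∼PSL B) (sym eq) (represents-sound B eB))
    where
    eq : represents A ≡ represents B
    eq = trans (cong₂ (λ x y → matrix x y (ψ A 2F)) (q 0F) (q 1F)) (cong (matrix (ψ B 0F) (ψ B 1F)) (q 2F))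

  matrix-sound : ∀ x y z → ¬ x ≡ y → ¬ z ≡ x → ¬ z ≡ y → ¬ z ≡ T₃₅ x y → det (matrix x y z) ≡ 1F × ψ (matrix x y z) 0F ≡ x × ψ (matrix x y z) 1F ≡ y × ψ (matrix x y z) 2F ≡ z
  matrix-sound x y z n₁ n₂ n₃ n₄ = eq₇-sound _ _ (proj₁ s₁) , eq₇-sound _ _ (proj₂ s₁) , eq₇-sound _ _ (proj₁ s₂) , eq₇-sound _ _ (proj₂ s₂)
    where
    M : Mat2
    M = matrix x y z
    or : ∀ p {q} → ¬ T p → T (p ∨ q) → T q
    or true n t = ⊥-elim (n tt)
    or false n t = t
    either : ∀ p q → ¬ T p → ¬ T q → ¬ T (p ∨ q)
    either true q n n′ t = n t
    either false q n n′ t = n′ t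
    row : T (frame-test x y z)
    row = all₇-sound (λ z → frame-test x y z) (all₇-sound (λ y → all₇ (λ z → frame-test x y z)) (all₇-sound (λ x → all₇ (λ y → all₇ (λ z → frame-test x y z))) matrix-test x) y) z
    s : T (eq₇ (det M) 1F ∧ eq₇ (ψ M 0F) x) × T (eq₇ (ψ M 1F) y ∧ eq₇ (ψ M 2F) z)
    s = ∧-split (eq₇ (det M) 1F ∧ eq₇ (ψ M 0F) x) (or ((eq₇ x y ∨ eq₇ z x) ∨ (eq₇ z y ∨ eq₇ z (T₃₅ x y)))
      (either (eq₇ x y ∨ eq₇ z x) (eq₇ z y ∨ eq₇ z (T₃₅ x y)) (either (eq₇ x y) (eq₇ z x) (λ t → n₁ (eq₇-sound _ _ t)) (λ t → n₂ (eq₇-sound _ _ t))) (either (eq₇ z y) (eq₇ z (T₃₅ x y)) (λ t → n₃ (eq₇-sound _ _ t)) (λ t → n₄ (eq₇-sound _ _ t)))) row)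
    s₁ : T (eq₇ (det M) 1F) × T (eq₇ (ψ M 0F) x)
    s₁ = ∧-split (eq₇ (det M) 1F) (proj₁ s)
    s₂ : T (eq₇ (ψ M 1F) y) × T (eq₇ (ψ M 2F) z)
    s₂ = ∧-split (eq₇ (ψ M 1F) y) (proj₂ s)

  -- 0, 1, 2 generate: 3 = 0∗1, 4 = 1∗2, 6 = 0∗2, 5 = 0∗4.
  hom-determined : ∀ {g g′} → Hom₇ g → Hom₇ g′ → g 0F ≡ g′ 0F → g 1F ≡ g′ 1F → g 2F ≡ g′ 2F → ∀ i → g i ≡ g′ i
  hom-determined {g} {g′} hg hg′ e₀ e₁ e₂ = go
    where
    step : ∀ i j → g i ≡ g′ i → g j ≡ g′ j → g (T₃₅ i j) ≡ g′ (T₃₅ i j)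
    step i j p q = trans (hg i j) (trans (cong₂ T₃₅ p q) (sym (hg′ i j)))
    go : ∀ i → g i ≡ g′ i
    go 0F = e₀
    go 1F = e₁
    go 2F = e₂
    go 3F = step 0F 1F e₀ e₁
    go 4F = step 1F 2F e₁ e₂
    go 5F = step 0F 4F e₀ (step 1F 2F e₁ e₂)
    go 6F = step 0F 2F e₀ e₂

adjugate : Mat2 → Mat2
adjugate (mat a b c d) = mat d (⊖ b) (⊖ c) a

opaque
  adjugate-test : T (all-SL (λ A → eq₇ (det (adjugate A)) 1F ∧ eqM (adjugate A · A) (mat 1F 0F 0F 1F)))
  adjugate-test = tt

  adjugate-sound : ∀ A → det A ≡ 1F → det (adjugate A) ≡ 1F × (∀ i → ψ (adjugate A · A) i ≡ i)
  adjugate-sound A e = eq₇-sound _ _ (proj₁ s) , λ i → trans (cong (λ M → ψ M i) (eqM-sound (adjugate A · A) (mat 1F 0F 0F 1F) (proj₂ s))) (ψ-1 i)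
    where
    s : T (eq₇ (det (adjugate A)) 1F) × T (eqM (adjugate A · A) (mat 1F 0F 0F 1F))
    s = ∧-split (eq₇ (det (adjugate A)) 1F) (all-SL-sound (λ A → eq₇ (det (adjugate A)) 1F ∧ eqM (adjugate A · A) (mat 1F 0F 0F 1F)) adjugate-test A e)
    ψ-1 : ∀ i → ψ (mat 1F 0F 0F 1F) i ≡ i
    ψ-1 i = eq₇-sound _ _ (all₇-sound (λ i → eq₇ (ψ (mat 1F 0F 0F 1F) i) i) tt i)

-- The exceptional case of order 7.

module Fano (F : FiniteField) (odd : FiniteField.size F % 2 ≡ 1) where
  open Signs F odd
  open Quasi F odd

  module Coordinates {a b : Carrier} (κ : F7 → Carrier) (κ⁻¹ : Carrier → F7) (κκ⁻¹ : ∀ x → κ (κ⁻¹ x) ≡ x) (κ⁻¹κ : ∀ i → κ⁻¹ (κ i) ≡ i)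
    (κ-op : ∀ i j → op a b (κ i) (κ j) ≡ κ (T₃₅ i j)) where

    pull : (Carrier → Carrier) → F7 → F7
    pull f i = κ⁻¹ (f (κ i))

    push : (F7 → F7) → Carrier → Carrier
    push g x = κ (g (κ⁻¹ x))

    opaque
      κ-injective : ∀ {i j} → κ i ≡ κ j → i ≡ j
      κ-injective {i} {j} e = trans (sym (κ⁻¹κ i)) (trans (cong κ⁻¹ e) (κ⁻¹κ j))

      κ⁻¹-injective : ∀ {x y} → κ⁻¹ x ≡ κ⁻¹ y → x ≡ y
      κ⁻¹-injective {x} {y} e = trans (sym (κκ⁻¹ x)) (trans (cong κ e) (κκ⁻¹ y))

      pull-injective : ∀ {f} → Aut a b f → ∀ {i j} → pull f i ≡ pull f j → i ≡ j
      pull-injective af e = κ-injective (aut-injective af (κ⁻¹-injective e))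

      pull-hom : ∀ {f} → Aut a b f → Hom₇ (pull f)
      pull-hom {f} af i j = κ-injective (trans (κκ⁻¹ _) (trans (cong f (sym (κ-op i j))) (trans (proj₂ af (κ i) (κ j))
        (trans (cong₂ (op a b) (sym (κκ⁻¹ _)) (sym (κκ⁻¹ _))) (κ-op (pull f i) (pull f j))))))

      κ⁻¹-op : ∀ x y → κ⁻¹ (op a b x y) ≡ T₃₅ (κ⁻¹ x) (κ⁻¹ y)
      κ⁻¹-op x y = trans (cong κ⁻¹ (trans (cong₂ (op a b) (sym (κκ⁻¹ x)) (sym (κκ⁻¹ y))) (κ-op (κ⁻¹ x) (κ⁻¹ y)))) (κ⁻¹κ _)

      push-aut : ∀ {g} → (∀ {i j} → g i ≡ g j → i ≡ j) → Hom₇ g → Aut a b (push g)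
      push-aut {g} inj hg = mkAut (λ e → κ⁻¹-injective (inj (κ-injective e)))
        (λ x y → trans (cong (λ z → κ (g z)) (κ⁻¹-op x y)) (trans (cong κ (hg _ _)) (sym (κ-op _ _))))

    module _ {f : Carrier → Carrier} (af : Aut a b f) where
      M : Mat2
      M = matrix (pull f 0F) (pull f 1F) (pull f 2F)

      opaque
        M-spec : det M ≡ 1F × ψ M 0F ≡ pull f 0F × ψ M 1F ≡ pull f 1F × ψ M 2F ≡ pull f 2F
        M-spec = matrix-sound (pull f 0F) (pull f 1F) (pull f 2F) (λ e → ne (λ ()) (pull-injective af e)) (λ e → ne (λ ()) (pull-injective af e)) (λ e → ne (λ ()) (pull-injective af e))
            -- 0 ∗ 1 = 3 differs from 2, so the images of 0, 1, 2 are noncollinear, as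
            -- `matrix-sound` demands.
            (λ e → ne {2F} {3F} (λ ()) (pull-injective af (trans e (sym (pull-hom af 0F 1F)))))
          where
          ne : ∀ {i j : F7} → ¬ i ≡ j → i ≡ j → ⊥
          ne n e = n e

        det-M : det M ≡ 1F
        det-M = proj₁ M-spec

        ψ-M : ∀ i → ψ M i ≡ pull f i
        ψ-M = hom-determined (Good.hom (good M det-M)) (pull-hom af) (proj₁ (proj₂ M-spec)) (proj₁ (proj₂ (proj₂ M-spec))) (proj₂ (proj₂ (proj₂ M-spec)))

    opaque
      ψ-injective : ∀ A → det A ≡ 1F → ∀ {i j} → ψ A i ≡ ψ A j → i ≡ j
      ψ-injective A e {i} {j} q = trans (sym (left i)) (trans (cong (ψ B) q) (left j))
        where
        B : Mat2
        B = adjugate A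
        left : ∀ i → ψ B (ψ A i) ≡ i
        left i = trans (sym (Good.ψ-· (good B (proj₁ (adjugate-sound A e))) e i)) (proj₂ (adjugate-sound A e) i)

      pull-reflects : ∀ {f g} → (∀ i → pull f i ≡ pull g i) → ∀ x → f x ≡ g x
      pull-reflects {f} {g} e x = trans (cong f (sym (κκ⁻¹ x))) (trans (κ⁻¹-injective (e (κ⁻¹ x))) (cong g (κκ⁻¹ x)))

    φ : AutQ F a b → SL₂7
    φ (f , isf) = M (IsAut⇒Aut isf) , det-M (IsAut⇒Aut isf)

    opaque
      ψφ : ∀ f i → ψ (proj₁ (φ f)) i ≡ pull (proj₁ f) i
      ψφ (f , isf) = ψ-M (IsAut⇒Aut isf)

      autIso : AutIsoPSL₂7 F a b
      autIso = φ
        , (λ f g e → ψ-faithful _ _ (proj₂ (φ f)) (proj₂ (φ g)) (λ i → trans (ψφ f i) (trans (cong κ⁻¹ (e (κ i))) (sym (ψφ g i)))))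
        , (λ f g e → pull-reflects (λ i → trans (sym (ψφ f i)) (trans (ψ-respects (proj₂ (φ g)) e i) (ψφ g i))))
        , (λ { (B , eB) → preimage B eB , ψ-faithful _ _ (proj₂ (φ (preimage B eB))) eB (λ i → trans (ψφ (preimage B eB) i) (trans (κ⁻¹κ _) (cong (ψ B) (κ⁻¹κ i)))) })
        , (λ f g h e → ψ-faithful _ _ (proj₂ (φ h)) (Good.det-· (goodφ g) {proj₁ (φ f)} (proj₂ (φ f))) (λ i → trans (ψφ h i) (sym
            (trans (Good.ψ-· (goodφ g) {proj₁ (φ f)} (proj₂ (φ f)) i) (trans (cong (ψ (proj₁ (φ g))) (ψφ f i)) (trans (ψφ g (pull (proj₁ f) i))
              (cong κ⁻¹ (trans (cong (proj₁ g) (κκ⁻¹ _)) (sym (e (κ i)))))))))))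
        where
        goodφ : ∀ g → Good (proj₁ (φ g))
        goodφ g = good (proj₁ (φ g)) (proj₂ (φ g))
        preimage : ∀ B → det B ≡ 1F → AutQ F a b
        preimage B eB = push (ψ B) , Aut⇒IsAut (push-aut (ψ-injective B eB) (Good.hom (good B eB)))

  opaque
    seven : size ≡ 7 → ι F 7 ≡ 0#
    seven e = trans (cong nat (sym e)) nat-size

  module _ (size≡7 : size ≡ 7) where
    open Characteristic7 F odd (seven size≡7)
    open Inverse enumeration using (to; from)

    opaque
      k-surjective : ∀ x → Σ[ i ∈ F7 ] k i ≡ x
      k-surjective x = Fin.cast size≡7 (to (proj₁ pre)) , proj₂ pre
        where
        pre : ∃[ y ] k (Fin.cast size≡7 (to y)) ≡ x
        pre = injective⇒surjective (λ {x} {y} e → to-injective (Finₚ.toℕ-injective (trans (sym (Finₚ.toℕ-cast size≡7 (to x))) (trans (cong toℕ (k-injective e)) (Finₚ.toℕ-cast size≡7 (to y)))))) x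

      k-6 : k 6F ≡ - 1#
      k-6 = trans (k-⊖ 1F) (cong -_ k-1)

      -1-nonsquare : N (- 1#)
      -1-nonsquare with S⊎N { - 1#} (λ e → 1≢0 (-x≡0⇒x≡0 e))
      ... | inj₂ n = n
      ... | inj₁ s = ⊥-elim (root (S⇒IsSquare s))
        where
        no-root : ∀ i → ¬ i ⊗ i ≡ 6F
        no-root 0F ()
        no-root 1F ()
        no-root 2F ()
        no-root 3F ()
        no-root 4F ()
        no-root 5F ()
        no-root 6F ()
        root : ∃[ y ] y * y ≡ - 1# → ⊥
        root (y , e) = no-root (proj₁ (k-surjective y)) (k-injective (trans (k-⊗ _ _) (trans (cong₂ _*_ (proj₂ (k-surjective y)) (proj₂ (k-surjective y))) (trans e (sym k-6)))))

      iso₃₅ : AutIsoPSL₂7 F (ι F 3) (ι F 5)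
      iso₃₅ = Coordinates.autIso k (λ x → proj₁ (k-surjective x)) (λ x → proj₂ (k-surjective x)) (λ i → k-injective (proj₂ (k-surjective (k i))))
        (λ i j → trans (cong₂ (λ p q → op p q (k i) (k j)) (sym (k-def 3F)) (sym (k-def 5F))) (op-k -1-nonsquare 3F 5F i j))

      -- x ↦ −x is an isomorphism from Q_{3,5} to Q_{5,3}.
      iso₅₃ : AutIsoPSL₂7 F (ι F 5) (ι F 3)
      iso₅₃ = Coordinates.autIso κ (λ x → proj₁ (k-surjective (- 1# * x))) κκ⁻¹ (λ i → k-injective (trans (proj₂ (k-surjective _)) (minus-minus (k i))))
        (λ i j → trans (cong₂ (λ p q → op p q (κ i) (κ j)) (sym (k-def 5F)) (sym (k-def 3F))) (trans (op-twist (k 5F) (k 3F) (k i) (k j) -1-nonsquare) (cong (- 1# *_) (op-k -1-nonsquare 3F 5F i j))))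
        where
        κ : F7 → Carrier
        κ i = - 1# * k i
        minus-minus : ∀ x → - 1# * (- 1# * x) ≡ x
        minus-minus x = solve 1 (λ x → (:- con (+ 1)) :* ((:- con (+ 1)) :* x) := x) refl x
        κκ⁻¹ : ∀ x → κ (proj₁ (k-surjective (- 1# * x))) ≡ x
        κκ⁻¹ x = trans (cong (- 1# *_) (proj₂ (k-surjective (- 1# * x)))) (minus-minus x)

  opaque
    exceptional-iso : ∀ {a b} → Exceptional7 F a b → AutIsoPSL₂7 F a b
    exceptional-iso (e , inj₁ (refl , refl)) = iso₃₅ e
    exceptional-iso (e , inj₂ (refl , refl)) = iso₅₃ e

-- Combining the cases.

module Classification (F : FiniteField) (odd : FiniteField.size F % 2 ≡ 1) where
  open Signs F odd
  open Quasi F odd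
  open Dichotomy F odd

  opaque
    affine₇ : ∀ {a b f} (z : ι F 7 ≡ 0#) → ¬ size ≡ 7 → (let open Characteristic7 F odd z) → (α β : F7) → (α ≡ 3F × β ≡ 5F) ⊎ (α ≡ 5F × β ≡ 3F) →
      a ≡ k α → b ≡ k β → N a → N (- 1#) → Aut a b f → ∀ x y → f (x + y) + f 0# ≡ f x + f y
    affine₇ z ns α β αβ refl refl Na N-1 af = Characteristic7.Lines₇.aut-affine F odd z α β αβ Na N-1 ns af

    -- Outside characteristic 7 double transitivity is contradictory. For 7 = 0 the equation a² - a
    -- + 1 = 0 factors as (a - 3)(a - 5) = 0, so a and b are 3 and 5 in some order.
    netto-affine : ∀ {a b f} → ¬ a ≡ b → ¬ Exceptional7 F a b → TwoTransitive a b → a * b ≡ 1# → a + b ≡ 1# → N a → N (- 1#) → Aut a b f →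
      ∀ x y → f (x + y) + f 0# ≡ f x + f y
    netto-affine {a} {b} {f} a≢b ne tr ab≡1 a+b≡1 Na N-1 af = go (num 7 ≟ 0#)
      where
      go : Dec (num 7 ≡ 0#) → ∀ x y → f (x + y) + f 0# ≡ f x + f y
      go (no nz) = ⊥-elim (Netto.Steiner.not-twoTransitive F odd a b a≢b ab≡1 a+b≡1 Na N-1 tr nz)
      go (yes e) = split (xy≡0⇒x≡0⊎y≡0 (a - num 3) (a - num 5) factor)
        where
        z : ι F 7 ≡ 0#
        z = trans (sym (num≡nat 7)) e
        open Characteristic7 F odd z
        quadratic : a * a - a + 1# ≡ 0#
        quadratic = trans (cong (λ w → a * a - a + w) (sym ab≡1)) (trans (solve 2 (λ a b → a :* a :- a :+ a :* b := a :* ((a :+ b) :- con (+ 1))) refl a b) (trans (cong (a *_) (x≡y⇒x-y≡0 a+b≡1)) (zeroʳ a)))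
        factor : (a - num 3) * (a - num 5) ≡ 0#
        factor = trans (solve 1 (λ a → (a :- con (+ 3)) :* (a :- con (+ 5)) := (a :* a :- a :+ con (+ 1)) :+ con (+ 7) :* (con (+ 2) :- a)) refl a)
          (trans (cong₂ (λ p q → p + q * (num 2 - a)) quadratic e) (trans (+-identityˡ _) (zeroˡ _)))
        k-num : ∀ i → num (toℕ i) ≡ k i
        k-num i = trans (num≡nat (toℕ i)) (sym (k-def i))
        other : ∀ i j → i ⊕ j ≡ 1F → a ≡ k i → b ≡ k j
        other i j ij p = +-cancelˡ (k i) b (k j) (trans (trans (cong (_+ b) (sym p)) a+b≡1) (sym (trans (sym (k-⊕ i j)) (trans (cong k ij) k-1))))
        finish : ∀ α β → (α ≡ 3F × β ≡ 5F) ⊎ (α ≡ 5F × β ≡ 3F) → (size ≡ 7 → Exceptional7 F a b) → a ≡ k α → b ≡ k β → Dec (size ≡ 7) → ∀ x y → f (x + y) + f 0# ≡ f x + f y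
        finish α β αβ exc p q (yes s) = ⊥-elim (ne (exc s))
        finish α β αβ exc p q (no ns) = affine₇ z ns α β αβ p q Na N-1 af
        split : a - num 3 ≡ 0# ⊎ a - num 5 ≡ 0# → ∀ x y → f (x + y) + f 0# ≡ f x + f y
        split (inj₁ q) = finish 3F 5F (inj₁ (refl , refl)) (λ s → s , inj₁ (trans p (k-def 3F) , trans (other 3F 5F refl p) (k-def 5F))) p (other 3F 5F refl p) (size ℕₚ.≟ 7)
          where
          p : a ≡ k 3F
          p = trans (x-y≡0⇒x≡y q) (k-num 3F)
        split (inj₂ q) = finish 5F 3F (inj₂ (refl , refl)) (λ s → s , inj₂ (trans p (k-def 5F) , trans (other 5F 3F refl p) (k-def 3F))) p (other 5F 3F refl p) (size ℕₚ.≟ 7)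
          where
          p : a ≡ k 5F
          p = trans (x-y≡0⇒x≡y q) (k-num 5F)

    preserving⊎reversing : ∀ {a b f} → ¬ a ≡ b → ¬ a ≡ 0# → ¬ a ≡ 1# → ¬ b ≡ 0# → ¬ b ≡ 1# → X a ≡ X b → ¬ Exceptional7 F a b → Aut a b f → Preserves f ⊎ Reverses f
    preserving⊎reversing {a} {b} {f} a≢b a≢0 a≢1 b≢0 b≢1 Xab ne af = go (any? (λ x → any? (λ y → ¬? (X (f x - f y) ≟ X (x - y))) elems) elems)
      where
      affine : TwoTransitive a b → ∀ x y → f (x + y) + f 0# ≡ f x + f y
      affine tr = first (Lines.two⊎netto a b tr a≢0 a≢1 b≢0 b≢1 Xab)
        where
        -- Nonsquare directions are governed by Q_{b,a}, so 2 is looked for on its line through 0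
        -- and 1 as well. The Netto case is symmetric in a and b.
        second : Line a b 0# 1# two → Line b a 0# 1# two ⊎ (b * a ≡ 1# × b + a ≡ 1# × N b × N (- 1#)) → ∀ x y → f (x + y) + f 0# ≡ f x + f y
        second l (inj₁ l′) = aut-additive af (lines-closed l l′)
        second l (inj₂ (ba , b+a , Nb , N-1)) = netto-affine a≢b ne tr (trans (*-comm a b) ba) (trans (+-comm a b) b+a) (trans Xab Nb) N-1 af
        first : Line a b 0# 1# two ⊎ (a * b ≡ 1# × a + b ≡ 1# × N a × N (- 1#)) → ∀ x y → f (x + y) + f 0# ≡ f x + f y
        first (inj₁ l) = second l (Lines.two⊎netto b a (twist-twoTransitive tr) b≢0 b≢1 a≢0 a≢1 (sym Xab))
        first (inj₂ (ab , a+b , Na , N-1)) = netto-affine a≢b ne tr ab a+b Na N-1 af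
      go : Dec (Any (λ x → Any (λ y → ¬ X (f x - f y) ≡ X (x - y)) elems) elems) → Preserves f ⊎ Reverses f
      go (no none) = inj₁ (λ x y → decidable-stable (X (f x - f y) ≟ X (x - y)) (λ n → none (lose (∈-elems x) (lose (∈-elems y) n))))
      go (yes r) = preserves⊎reverses a≢b a≢0 a≢1 af (affine (flip⇒twoTransitive af y x flip))
        where
        x y : Carrier
        x = proj₁ (find r)
        y = proj₁ (find (proj₂ (proj₂ (find r))))
        flip : ¬ X (f x - f y) ≡ X (x - y)
        flip = proj₂ (proj₂ (find (proj₂ (proj₂ (find r)))))

theorem1p2 : (F : FiniteField) → FiniteField.size F % 2 ≡ 1 →
    (a b : FiniteField.Carrier F) → QuadraticParams F a b →
    ((¬ (a ≡ b) → ¬ (∃[ γ ] TwistExponent F a b γ) → ¬ Exceptional7 F a b →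
        ∀ f → IsAut F a b f ⇔ InAΓ²L F a b f)
    × (a ≡ b → ∀ f → IsAut F a b f ⇔ InAffK F a b f)
    × (∀ γ → TwistExponent F a b γ → ∀ f → IsAut F a b f ⇔ InTwist F a b γ f)
    × (Exceptional7 F a b → AutIsoPSL₂7 F a b))
theorem1p2 F odd a b (χab , χa , χ1ab , χ1a) = generic , affine , twisted , Fano.exceptional-iso F odd
  where
  open Signs F odd
  open Quasi F odd
  open Dichotomy F odd
  open Semilinear F odd
  open Classification F odd

  a≢0 : ¬ a ≡ 0#
  a≢0 = χ≢0⇒≢0 χa

  b≢0 : ¬ b ≡ 0#
  b≢0 = χ≢0⇒≢0 (λ e → χa (trans χab e))

  a≢1 : ¬ a ≡ 1#
  a≢1 e = χ≢0⇒≢0 χ1a (x≡y⇒x-y≡0 (sym e))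

  b≢1 : ¬ b ≡ 1#
  b≢1 e = χ≢0⇒≢0 (λ q → χ1a (trans χ1ab q)) (x≡y⇒x-y≡0 (sym e))

  dichotomy : ∀ {f} → ¬ a ≡ b → ¬ Exceptional7 F a b → Aut a b f → Preserves f ⊎ Reverses f
  dichotomy a≢b = preserving⊎reversing a≢b a≢0 a≢1 b≢0 b≢1 (χ≡⇒X≡ χab)

  generic : ¬ a ≡ b → ¬ (∃[ γ ] TwistExponent F a b γ) → ¬ Exceptional7 F a b → ∀ f → IsAut F a b f ⇔ InAΓ²L F a b f
  generic a≢b no-twist ne f = mk⇔ (λ isf → go (IsAut⇒Aut isf) (dichotomy a≢b ne (IsAut⇒Aut isf))) (λ i → Aut⇒IsAut (AΓ²L⇒aut i))
    where
    go : Aut a b f → Preserves f ⊎ Reverses f → InAΓ²L F a b f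
    go af (inj₁ p) = preserving⇒AΓ²L af p
    go af (inj₂ r) with reversing⇒swap af r
    ... | (_ , _ , α , _ , isα , (αa , αb) , _) = ⊥-elim (no-twist⇒no-swap a≢b no-twist isα αa αb)

  affine : a ≡ b → ∀ f → IsAut F a b f ⇔ InAffK F a b f
  affine refl f = mk⇔ (λ isf → aut⇒affK a≢0 a≢1 (IsAut⇒Aut isf)) (λ i → Aut⇒IsAut (affK⇒aut i))

  twisted : ∀ γ → TwistExponent F a b γ → ∀ f → IsAut F a b f ⇔ InTwist F a b γ f
  twisted γ tw f = mk⇔ (λ isf → go (IsAut⇒Aut isf) (dichotomy a≢b ne (IsAut⇒Aut isf))) (λ i → Aut⇒IsAut (twist⇒aut {γ = γ} tw i))
    where
    frobenius : IsFieldAut F (λ x → x ^ γ) × (a ^ γ ≡ b × b ^ γ ≡ a) × ¬ a ≡ b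
    frobenius = twist-frobenius {a} {b} {γ} tw
    a≢b : ¬ a ≡ b
    a≢b = proj₂ (proj₂ frobenius)
    -- x ↦ x^γ is a field automorphism that takes a to b ≠ a, whereas it fixes the multiples of 1;
    -- so a twist excludes the parameters 3 and 5.
    not-natural : ∀ n → ¬ a ≡ nat n
    not-natural n e = a≢b (trans e (trans (sym (FieldAut.α-nat (proj₁ frobenius) n)) (trans (cong (_^ γ) (sym e)) (proj₁ (proj₁ (proj₂ frobenius))))))
    ne : ¬ Exceptional7 F a b
    ne (_ , inj₁ (e , _)) = not-natural 3 e
    ne (_ , inj₂ (e , _)) = not-natural 5 e
    go : Aut a b f → Preserves f ⊎ Reverses f → InTwist F a b γ f
    go af (inj₁ p) = inj₁ (preserving⇒AΓ²L af p)
    go af (inj₂ r) = swap⇒twist {γ = γ} tw (reversing⇒swap af r)
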